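{- Let $m$ be a non-negative integer and let $s\colon \mathbb N\to\mathbb Q$ be a function, where $\mathbb N=\{0,1,2,\ldots\}$. Suppose that (i) the $m$th divided difference $\delta^m s$ of $s$ is integer-valued, and (ii) there are constants $C>0$ and $\theta>0$ with $|s(n)|\le C\theta^n$ for all $n\in\mathbb N$, where $$\theta < e^{1+\frac12+\cdots+\frac1m}-1.$$ Then there is a polynomial $f\in\mathbb Q[x]$ with $s(n)=f(n)$ for all $n\in\mathbb N$.
   Context: For a non-negative integer $m$, let $\mathbb N^{(m)}=\{(n_0,\ldots,n_m)\in\mathbb N^{m+1}: n_i \text{ pairwise distinct}\}$. The $m$th divided difference of $s\colon\mathbb N\to\mathbb Q$ is the function $\delta^m s\colon \mathbb N^{(m)}\to\mathbb Q$ given by $$\delta^m s(n_0,\ldots,n_m)=\sum_{i=0}^m\Big(\prod_{j\ne i}(n_i-n_j)^{ -1}\Big)s(n_i).$$ In particular $\delta^0 s=s$. -}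

module Defs where

open import Data.Nat as ℕ using (ℕ; zero; suc)
open import Data.Nat using (_!)
open import Data.Integer as ℤ using (ℤ; +_; +[1+_]; -[1+_])
open import Data.Rational using (ℚ; mkℚ; 0ℚ; 1ℚ; _+_; _*_; _-_; _/_; 1/_; _<_)
open import Data.Fin using (Fin; zero; suc)
open import Data.Fin.Properties using () renaming (_≟_ to _≟ᶠ_)
open import Data.List using (List; []; _∷_)
open import Data.Product using (∃)
open import Relation.Binary.PropositionalEquality using (_≡_)
open import Relation.Nullary using (yes; no)

ℤ→ℚ : ℤ → ℚ
ℤ→ℚ z = z / 1

ℕ→ℚ : ℕ → ℚ
ℕ→ℚ n = (+ n) / 1

-- total inverse on ℚ (inv 0 = 0); only ever applied to nonzero values below
inv : ℚ → ℚ
inv (mkℚ (+ zero) _ _) = 0ℚ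
inv p@(mkℚ +[1+ _ ] _ _) = 1/ p
inv p@(mkℚ -[1+ _ ] _ _) = 1/ p

_^_ : ℚ → ℕ → ℚ
x ^ zero = 1ℚ
x ^ suc n = x * (x ^ n)

ΣFin : (k : ℕ) → (Fin k → ℚ) → ℚ
ΣFin zero f = 0ℚ
ΣFin (suc k) f = f zero + ΣFin k (λ i → f (suc i))

ΠFin : (k : ℕ) → (Fin k → ℚ) → ℚ
ΠFin zero f = 1ℚ
ΠFin (suc k) f = f zero * ΠFin k (λ i → f (suc i))

divDiff : (m : ℕ) → (ℕ → ℚ) → (Fin (suc m) → ℕ) → ℚ
divDiff m s n =
  ΣFin (suc m) λ i →
    inv (ΠFin (suc m) (λ j → factor i j)) * s (n i)
  where
  factor : Fin (suc m) → Fin (suc m) → ℚ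
  factor i j with i ≟ᶠ j
  ... | yes _ = 1ℚ
  ... | no  _ = ℕ→ℚ (n i) - ℕ→ℚ (n j)

IsInteger : ℚ → Set
IsInteger q = ∃ λ (z : ℤ) → q ≡ ℤ→ℚ z

harmonic : ℕ → ℚ
harmonic zero = 0ℚ
harmonic (suc m) = harmonic m + ((+ 1) / suc m)

expPartial : ℚ → ℕ → ℚ
expPartial x zero = 1ℚ
expPartial x (suc N) = expPartial x N + (x ^ suc N) * inv (ℕ→ℚ (suc N !))

-- a < e^x  (e^x is the limit of the increasing partial sums for x ≥ 0)
_<exp_ : ℚ → ℚ → Set
a <exp x = ∃ λ (N : ℕ) → a < expPartial x N

eval : List ℚ → ℚ → ℚ
eval [] x = 0ℚ
eval (c ∷ cs) x = c + x * eval cs x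

{-# OPTIONS --safe #-}
-- Put a_k = Δ^k s(0) = k! δ^k s(0,…,k), so that |a_k| ≤ C (1+θ)^k. Passing from δ^(r-1) to δ^r divides by a
-- difference of nodes, and one may divide by the gcd g of all differences; r+1 nodes in [0,k] that agree modulo g
-- force g ≤ k/r. Hence a_k is an integer multiple of k! / ∏_{m<r≤k} lcm(1,…,⌊k/r⌋), whose logarithm is
-- ∑_{r≤m} ψ(k/r) because log k! = ∑_{r≤k} ψ(k/r). By the prime number theorem in the form ψ(x) ≥ (1-ε)x - K this
-- exceeds (1-2ε) k (1 + 1/2 + … + 1/m), so a_k = 0 for large k, and Newton's expansion of s is finite.
--
-- The prime number theorem is proved elementarily, through M(x) = ∑_{n≤x} μ(n) = o(x). Selberg's formula
-- ∑_{n≤x} Λ₂(n) = 2x log x + O(x) with Λ₂ = Λ log + Λ*Λ turns μ log² = μ*(Λ*Λ - Λ log) into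
-- |M(x)| log²x ≤ 2 ∑_{n≤x} log n |M(x/n)| + O(x log x), since M is Lipschitz. As ∑_{n≤N} M(x/n) = O(x), the function
-- M(x/n) is small or changes sign in every long enough multiplicative block of n, and near such an n it stays small;
-- so a bound |M(x)| ≤ αx + K improves to one with α replaced by α - η.
--
-- To stay within ℚ, the logarithm is replaced by an exactly additive L with values in (1/M)ℕ, built from
-- logarithms to the base 1 + 1/M of the primes, with M chosen large in terms of the range under consideration.

module Submission where

open import Data.Nat.Base as ℕ using (ℕ; zero; suc; z≤n; s≤s; _!)
import Data.Nat.Properties as ℕₚ
open import Data.List.Base using (List; []; _∷_)
open import Data.Vec.Base using ([]; _∷_)
open import Data.Product using (_,_; _×_; ∃; proj₁; proj₂)
open import Data.Sum using (_⊎_; inj₁; inj₂)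
open import Data.Empty using (⊥; ⊥-elim)
open import Relation.Nullary using (¬_; Dec; yes; no)
open import Relation.Binary.PropositionalEquality hiding (J)

-- No rational-valued function can be the logarithm of all integers, and the substitute `L` is
-- accurate only up to a bound `V` chosen beforehand. Its exact additivity cannot be given up, since
-- every identity for Λ rests on it; its accuracy can. This dictates the route to the prime number
-- theorem. What is carried from one improvement to the next must not mention `L`, because each `x`
-- calls for a new one: M(x) qualifies, ψ(x) does not. For the same reason every error term has an
-- explicit constant, fixed before `V` and `L`, and even Euler's constant is replaced by its
-- approximation at `V`. The same device finishes the proof. Exponents of the base 1 + 1/B are
-- integers, so k! and the denominator are compared through powers of one rational number, and the
-- truncated exponential that witnesses the hypothesis on θ is compared with such a power.
-- Strictness of that hypothesis gives a margin δ, half of which pays for the errors in the exponent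
-- and half for the constant C.

module SealedRationals where
  open import Data.Integer.Base as ℤ using (ℤ; +_; -[1+_])
  import Data.Integer.Properties as ℤₚ
  import Data.Integer.Solver as ℤS
  import Data.Nat.Coprimality as Cop
  open import Data.Rational as ℚ using (ℚ; mkℚ)
  import Data.Rational.Properties as ℚₚ
  import Data.Rational.Unnormalised as ℚᵘ
  import Data.Rational.Unnormalised.Properties as ℚᵘₚ

  infixl 6 _+_ _-_
  infixl 7 _*_
  infix  4 _≤_ _<_

  -- A sealed copy of ℚ: the operations never unfold, which keeps conversion checking cheap.
  opaque
    R : Set
    R = ℚ

    _+_ _*_ : R → R → R
    _+_ = ℚ._+_
    _*_ = ℚ._*_

    neg : R → R
    neg = ℚ.-_

    -- Given by the constructor and not by a division, so that numerator and denominator are visible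
    -- to the comparisons and homomorphism laws for integers.
    ιℤ : ℤ → R
    ιℤ z = mkℚ z 0 (Cop.sym (Cop.1-coprimeTo _))

    _≤_ : R → R → Set
    _≤_ = ℚ._≤_

    inv : R → R
    inv x with x ℚ.≟ ℚ.0ℚ
    ... | yes _ = ℚ.0ℚ
    ... | no x≢0 = ℚ.1/_ x {{ℚ.≢-nonZero x≢0}}

  _-_ : R → R → R
  x - y = x + neg y

  opaque
    ι : ℕ → R
    ι n = ιℤ (+ n)

  -- A negation: strict inequalities serve mainly to be contradicted, and the certificates deal with
  -- `_≤_` alone.
  _<_ : R → R → Set
  x < y = ¬ (y ≤ x)

  opaque
    unfolding R

    toℚ : R → ℚ
    toℚ x = x

    fromℚ : ℚ → R
    fromℚ x = x

    +-assoc : ∀ a b c → (a + b) + c ≡ a + (b + c)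
    +-assoc = ℚₚ.+-assoc

    +-comm : ∀ a b → a + b ≡ b + a
    +-comm = ℚₚ.+-comm

    *-assoc : ∀ a b c → (a * b) * c ≡ a * (b * c)
    *-assoc = ℚₚ.*-assoc

    *-comm : ∀ a b → a * b ≡ b * a
    *-comm = ℚₚ.*-comm

    *-distribˡ-+ : ∀ a b c → a * (b + c) ≡ a * b + a * c
    *-distribˡ-+ = ℚₚ.*-distribˡ-+

    ≤-refl : ∀ {a} → a ≤ a
    ≤-refl = ℚₚ.≤-refl

    ≤-trans : ∀ {a b c} → a ≤ b → b ≤ c → a ≤ c
    ≤-trans = ℚₚ.≤-trans

    ≤-antisym : ∀ {a b} → a ≤ b → b ≤ a → a ≡ b
    ≤-antisym = ℚₚ.≤-antisym

    ≤-total : ∀ a b → a ≤ b ⊎ b ≤ a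
    ≤-total = ℚₚ.≤-total

    _≤?_ : ∀ a b → Dec (a ≤ b)
    _≤?_ = ℚ._≤?_

    +-mono-≤ : ∀ {a b c d} → a ≤ b → c ≤ d → a + c ≤ b + d
    +-mono-≤ = ℚₚ.+-mono-≤

  opaque
    unfolding R ι

    +-identityˡ : ∀ a → ι 0 + a ≡ a
    +-identityˡ = ℚₚ.+-identityˡ

    *-identityˡ : ∀ a → ι 1 * a ≡ a
    *-identityˡ = ℚₚ.*-identityˡ

    *-zeroˡ : ∀ a → ι 0 * a ≡ ι 0
    *-zeroˡ = ℚₚ.*-zeroˡ

    +-inverseʳ : ∀ a → a - a ≡ ι 0
    +-inverseʳ = ℚₚ.+-inverseʳ

    *-nonneg : ∀ {a b} → ι 0 ≤ a → ι 0 ≤ b → ι 0 ≤ a * b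
    *-nonneg {a} {b} p q =
      ℚₚ.nonNegative⁻¹ (a ℚ.* b)
        {{ℚₚ.nonNeg*nonNeg⇒nonNeg a {{ℚ.nonNegative p}} b {{ℚ.nonNegative q}}}}

    ιℤ-+ : ∀ z w → ιℤ (z ℤ.+ w) ≡ ιℤ z + ιℤ w
    ιℤ-+ z w = ℚₚ.toℚᵘ-injective (ℚᵘₚ.≃-sym (ℚᵘₚ.≃-trans (ℚₚ.toℚᵘ-homo-+ (ιℤ z) (ιℤ w))
      (ℚᵘ.*≡* (solve 2 (λ z w → (z :* con ℤ.1ℤ :+ w :* con ℤ.1ℤ) :* con ℤ.1ℤ := (z :+ w) :* con ℤ.1ℤ) refl z w))))
      where open ℤS.+-*-Solver

    ιℤ-* : ∀ z w → ιℤ (z ℤ.* w) ≡ ιℤ z * ιℤ w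
    ιℤ-* z w = ℚₚ.toℚᵘ-injective (ℚᵘₚ.≃-sym (ℚᵘₚ.≃-trans (ℚₚ.toℚᵘ-homo-* (ιℤ z) (ιℤ w))
      (ℚᵘ.*≡* (solve 2 (λ z w → (z :* w) :* con ℤ.1ℤ := (z :* w) :* con ℤ.1ℤ) refl z w))))
      where open ℤS.+-*-Solver


    ιℤ-pos : ∀ n → ιℤ (+ n) ≡ ι n
    ιℤ-pos n = refl

    ι-+ : ∀ a b → ι (a ℕ.+ b) ≡ ι a + ι b
    ι-+ a b = ιℤ-+ (+ a) (+ b)

    ι-* : ∀ a b → ι (a ℕ.* b) ≡ ι a * ι b
    ι-* a b = trans (cong ιℤ (ℤₚ.pos-* a b)) (ιℤ-* (+ a) (+ b))

    ι-mono : ∀ {a b} → a ℕ.≤ b → ι a ≤ ι b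
    ι-mono {a} {b} p = ℚ.*≤* (ℤₚ.*-monoʳ-≤-nonNeg (+ 1) (ℤ.+≤+ p))

    ι-cancel-≤ : ∀ {a b} → ι a ≤ ι b → a ℕ.≤ b
    ι-cancel-≤ {a} {b} (ℚ.*≤* p) = ℤₚ.drop‿+≤+ (subst₂ ℤ._≤_ (ℤₚ.*-identityʳ (+ a)) (ℤₚ.*-identityʳ (+ b)) p)

    *-inverseʳ : ∀ {x} → x ≢ ι 0 → x * inv x ≡ ι 1
    *-inverseʳ {x} nz with x ℚ.≟ ℚ.0ℚ
    ... | yes e = ⊥-elim (nz e)
    ... | no x≢0 = ℚₚ.*-inverseʳ x {{ℚ.≢-nonZero x≢0}}

    archimedean : ∀ x → ∃ λ n → x ≤ ι n
    archimedean x = ℤ.∣ ℚ.numerator x ∣ , ℚ.*≤* (begin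
      ℚ.↥ x ℤ.* + 1                     ≡⟨ ℤₚ.*-identityʳ _ ⟩
      ℚ.↥ x                             ≤⟨ i≤∣i∣ (ℚ.↥ x) ⟩
      + ℤ.∣ ℚ.↥ x ∣                      ≡⟨ sym (ℤₚ.*-identityʳ _) ⟩
      + ℤ.∣ ℚ.↥ x ∣ ℤ.* + 1              ≤⟨ ℤₚ.*-monoˡ-≤-nonNeg (+ ℤ.∣ ℚ.↥ x ∣) (ℤ.+≤+ (ℕ.s≤s ℕ.z≤n)) ⟩
      + ℤ.∣ ℚ.↥ x ∣ ℤ.* ℚ.↧ x            ∎)
      where
      open ℤₚ.≤-Reasoning
      i≤∣i∣ : ∀ i → i ℤ.≤ + ℤ.∣ i ∣
      i≤∣i∣ (+ n) = ℤₚ.≤-refl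
      i≤∣i∣ (-[1+ n ]) = ℤ.-≤+

    1≰0 : ¬ (ι 1 ≤ ι 0)
    1≰0 p with ι-cancel-≤ p
    ... | ()

-- Checked certificates for polynomial identities and inequalities over an ordered field

module LinearArithmetic where
  open SealedRationals
  open import Data.Integer.Base as ℤ using (ℤ; -[1+_]) renaming (+_ to pos)
  open import Data.Bool.Base using (Bool; true; false; if_then_else_; _∧_; T)
  open import Data.Bool.Properties using (T-∧)
  import Data.List.Properties as Listₚ
  open import Data.Vec.Base using (Vec)
  open import Data.Vec.N-ary using (N-ary; _$ⁿ_)
  open import Data.Unit.Base using (⊤; tt)
  open import Function.Bundles using (Equivalence)
  open import Relation.Nullary using (yes; no)
  open ≡-Reasoning

  +-identityʳ : ∀ a → a + ι 0 ≡ a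
  +-identityʳ a = trans (+-comm a (ι 0)) (+-identityˡ a)

  *-identityʳ : ∀ a → a * ι 1 ≡ a
  *-identityʳ a = trans (*-comm a (ι 1)) (*-identityˡ a)

  *-zeroʳ : ∀ a → a * ι 0 ≡ ι 0
  *-zeroʳ a = trans (*-comm a (ι 0)) (*-zeroˡ a)

  *-distribʳ-+ : ∀ a b c → (b + c) * a ≡ b * a + c * a
  *-distribʳ-+ a b c = trans (*-comm (b + c) a) (trans (*-distribˡ-+ a b c) (cong₂ _+_ (*-comm a b) (*-comm a c)))

  +-interchange : ∀ a b c d → (a + b) + (c + d) ≡ (a + c) + (b + d)
  +-interchange a b c d = begin
    (a + b) + (c + d) ≡⟨ +-assoc a b (c + d) ⟩
    a + (b + (c + d)) ≡⟨ cong (a +_) (sym (+-assoc b c d)) ⟩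
    a + ((b + c) + d) ≡⟨ cong (λ t → a + (t + d)) (+-comm b c) ⟩
    a + ((c + b) + d) ≡⟨ cong (a +_) (+-assoc c b d) ⟩
    a + (c + (b + d)) ≡⟨ sym (+-assoc a c (b + d)) ⟩
    (a + c) + (b + d) ∎

  *-interchange : ∀ a b c d → (a * b) * (c * d) ≡ (a * c) * (b * d)
  *-interchange a b c d = begin
    (a * b) * (c * d) ≡⟨ *-assoc a b (c * d) ⟩
    a * (b * (c * d)) ≡⟨ cong (a *_) (sym (*-assoc b c d)) ⟩
    a * ((b * c) * d) ≡⟨ cong (λ t → a * (t * d)) (*-comm b c) ⟩
    a * ((c * b) * d) ≡⟨ cong (a *_) (*-assoc c b d) ⟩
    a * (c * (b * d)) ≡⟨ sym (*-assoc a c (b * d)) ⟩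
    (a * c) * (b * d) ∎

  ιℤ-0 : ιℤ (pos 0) ≡ ι 0
  ιℤ-0 = ιℤ-pos 0

  ιℤ-1 : ιℤ (pos 1) ≡ ι 1
  ιℤ-1 = ιℤ-pos 1

  neg-unique : ∀ {a b} → a + b ≡ ι 0 → b ≡ neg a
  neg-unique {a} {b} e = begin
    b                   ≡⟨ sym (+-identityˡ b) ⟩
    ι 0 + b             ≡⟨ cong (_+ b) (trans (sym (+-inverseʳ a)) (+-comm a (neg a))) ⟩
    (neg a + a) + b     ≡⟨ +-assoc (neg a) a b ⟩
    neg a + (a + b)     ≡⟨ cong (neg a +_) e ⟩
    neg a + ι 0         ≡⟨ +-identityʳ (neg a) ⟩
    neg a               ∎

  -1*a : ∀ a → ιℤ -[1+ 0 ] * a ≡ neg a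
  -1*a a = neg-unique (begin
    a + ιℤ -[1+ 0 ] * a              ≡⟨ cong (_+ ιℤ -[1+ 0 ] * a) (sym (*-identityˡ a)) ⟩
    ι 1 * a + ιℤ -[1+ 0 ] * a        ≡⟨ sym (*-distribʳ-+ a (ι 1) (ιℤ -[1+ 0 ])) ⟩
    (ι 1 + ιℤ -[1+ 0 ]) * a          ≡⟨ cong (λ t → (t + ιℤ -[1+ 0 ]) * a) (sym ιℤ-1) ⟩
    (ιℤ (pos 1) + ιℤ -[1+ 0 ]) * a     ≡⟨ cong (_* a) (sym (ιℤ-+ (pos 1) -[1+ 0 ])) ⟩
    ιℤ (pos 0) * a                     ≡⟨ cong (_* a) ιℤ-0 ⟩
    ι 0 * a                          ≡⟨ *-zeroˡ a ⟩
    ι 0                              ∎)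

  infixl 6 _:+_ _:-_
  infixl 7 _:*_
  infix  4 _≼_ _≈_

  data Expr : Set where
    con : ℕ → Expr
    var : ℕ → Expr
    _:+_ _:*_ _:-_ : Expr → Expr → Expr

  -- A monomial is meant to be the sorted list of its variables, a polynomial a sorted list of
  -- terms. Sortedness is never proved: the soundness lemmas hold for all lists, and the order only
  -- makes equal monomials meet so that cancellation is detected.
  Mon Poly Env : Set
  Mon = List ℕ
  Poly = List (ℤ × Mon)
  Env = ℕ → R

  ⟦_⟧ : Expr → Env → R
  ⟦ con n ⟧ ρ = ι n
  ⟦ var i ⟧ ρ = ρ i
  ⟦ a :+ b ⟧ ρ = ⟦ a ⟧ ρ + ⟦ b ⟧ ρ
  ⟦ a :* b ⟧ ρ = ⟦ a ⟧ ρ * ⟦ b ⟧ ρ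
  ⟦ a :- b ⟧ ρ = ⟦ a ⟧ ρ - ⟦ b ⟧ ρ

  ⟦_⟧ₘ : Mon → Env → R
  ⟦ [] ⟧ₘ ρ = ι 1
  ⟦ i ∷ m ⟧ₘ ρ = ρ i * ⟦ m ⟧ₘ ρ

  ⟦_⟧ₚ : Poly → Env → R
  ⟦ [] ⟧ₚ ρ = ι 0
  ⟦ (c , m) ∷ p ⟧ₚ ρ = ιℤ c * ⟦ m ⟧ₘ ρ + ⟦ p ⟧ₚ ρ

  merge : Mon → Mon → Mon
  merge [] n = n
  merge (i ∷ m) [] = i ∷ m
  merge (i ∷ m) (j ∷ n) = if i ℕ.≤ᵇ j then i ∷ merge m (j ∷ n) else j ∷ merge (i ∷ m) n

  merge-sound : ∀ m n ρ → ⟦ merge m n ⟧ₘ ρ ≡ ⟦ m ⟧ₘ ρ * ⟦ n ⟧ₘ ρ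
  merge-sound [] n ρ = sym (*-identityˡ _)
  merge-sound (i ∷ m) [] ρ = sym (*-identityʳ _)
  merge-sound (i ∷ m) (j ∷ n) ρ = if-elim (i ℕ.≤ᵇ j) (λ l → ⟦ l ⟧ₘ ρ ≡ ⟦ i ∷ m ⟧ₘ ρ * ⟦ j ∷ n ⟧ₘ ρ)
    (trans (cong (ρ i *_) (merge-sound m (j ∷ n) ρ)) (sym (*-assoc _ _ _)))
    (begin
    ρ j * ⟦ merge (i ∷ m) n ⟧ₘ ρ            ≡⟨ cong (ρ j *_) (merge-sound (i ∷ m) n ρ) ⟩
    ρ j * (⟦ i ∷ m ⟧ₘ ρ * ⟦ n ⟧ₘ ρ)         ≡⟨ sym (*-assoc _ _ _) ⟩
    (ρ j * ⟦ i ∷ m ⟧ₘ ρ) * ⟦ n ⟧ₘ ρ         ≡⟨ cong (_* ⟦ n ⟧ₘ ρ) (*-comm _ _) ⟩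
    (⟦ i ∷ m ⟧ₘ ρ * ρ j) * ⟦ n ⟧ₘ ρ         ≡⟨ *-assoc _ _ _ ⟩
    ⟦ i ∷ m ⟧ₘ ρ * (ρ j * ⟦ n ⟧ₘ ρ)         ∎)
    where
    if-elim : ∀ b (P : Mon → Set) {l l′} → P l → P l′ → P (if b then l else l′)
    if-elim true P p q = p
    if-elim false P p q = q

  _<ₘ_ : Mon → Mon → Bool
  [] <ₘ [] = false
  [] <ₘ (_ ∷ _) = true
  (_ ∷ _) <ₘ [] = false
  (i ∷ m) <ₘ (j ∷ n) = if i ℕ.<ᵇ j then true else if j ℕ.<ᵇ i then false else m <ₘ n

  insert : ℤ → Mon → Poly → Poly
  insert c m [] = (c , m) ∷ []
  insert c m ((d , n) ∷ p) with Listₚ.≡-dec ℕₚ._≟_ m n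
  ... | yes _ = (c ℤ.+ d , n) ∷ p
  ... | no _ = if m <ₘ n then (c , m) ∷ (d , n) ∷ p else (d , n) ∷ insert c m p

  insert-sound : ∀ c m p ρ → ⟦ insert c m p ⟧ₚ ρ ≡ ιℤ c * ⟦ m ⟧ₘ ρ + ⟦ p ⟧ₚ ρ
  insert-sound c m [] ρ = refl
  insert-sound c m ((d , n) ∷ p) ρ with Listₚ.≡-dec ℕₚ._≟_ m n
  ... | yes refl = begin
    ιℤ (c ℤ.+ d) * M + P            ≡⟨ cong (λ t → t * M + P) (ιℤ-+ c d) ⟩
    (ιℤ c + ιℤ d) * M + P           ≡⟨ cong (_+ P) (*-distribʳ-+ M _ _) ⟩
    (ιℤ c * M + ιℤ d * M) + P       ≡⟨ +-assoc _ _ _ ⟩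
    ιℤ c * M + (ιℤ d * M + P)       ∎
    where M = ⟦ m ⟧ₘ ρ ; P = ⟦ p ⟧ₚ ρ
  ... | no _ with m <ₘ n
  ... | true = refl
  ... | false = begin
    D + ⟦ insert c m p ⟧ₚ ρ          ≡⟨ cong (D +_) (insert-sound c m p ρ) ⟩
    D + (C + P)                     ≡⟨ sym (+-assoc _ _ _) ⟩
    (D + C) + P                     ≡⟨ cong (_+ P) (+-comm D C) ⟩
    (C + D) + P                     ≡⟨ +-assoc _ _ _ ⟩
    C + (D + P)                     ∎
    where C = ιℤ c * ⟦ m ⟧ₘ ρ ; D = ιℤ d * ⟦ n ⟧ₘ ρ ; P = ⟦ p ⟧ₚ ρ

  addP : Poly → Poly → Poly
  addP [] q = q
  addP ((c , m) ∷ p) q = insert c m (addP p q)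

  addP-sound : ∀ p q ρ → ⟦ addP p q ⟧ₚ ρ ≡ ⟦ p ⟧ₚ ρ + ⟦ q ⟧ₚ ρ
  addP-sound [] q ρ = sym (+-identityˡ _)
  addP-sound ((c , m) ∷ p) q ρ =
    trans (insert-sound c m (addP p q) ρ) (trans (cong (_ +_) (addP-sound p q ρ)) (sym (+-assoc _ _ _)))

  scale : ℤ → Mon → Poly → Poly
  scale c m [] = []
  scale c m ((d , n) ∷ p) = insert (c ℤ.* d) (merge m n) (scale c m p)

  scale-sound : ∀ c m p ρ → ⟦ scale c m p ⟧ₚ ρ ≡ (ιℤ c * ⟦ m ⟧ₘ ρ) * ⟦ p ⟧ₚ ρ
  scale-sound c m [] ρ = sym (*-zeroʳ _)
  scale-sound c m ((d , n) ∷ p) ρ = begin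
    ⟦ insert (c ℤ.* d) (merge m n) (scale c m p) ⟧ₚ ρ
      ≡⟨ insert-sound (c ℤ.* d) (merge m n) (scale c m p) ρ ⟩
    ιℤ (c ℤ.* d) * ⟦ merge m n ⟧ₘ ρ + ⟦ scale c m p ⟧ₚ ρ
      ≡⟨ cong₂ _+_ (cong₂ _*_ (ιℤ-* c d) (merge-sound m n ρ)) (scale-sound c m p ρ) ⟩
    (ιℤ c * ιℤ d) * (⟦ m ⟧ₘ ρ * ⟦ n ⟧ₘ ρ) + (ιℤ c * ⟦ m ⟧ₘ ρ) * ⟦ p ⟧ₚ ρ
      ≡⟨ cong (_+ _) (*-interchange _ _ _ _) ⟩
    (ιℤ c * ⟦ m ⟧ₘ ρ) * (ιℤ d * ⟦ n ⟧ₘ ρ) + (ιℤ c * ⟦ m ⟧ₘ ρ) * ⟦ p ⟧ₚ ρ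
      ≡⟨ sym (*-distribˡ-+ _ _ _) ⟩
    (ιℤ c * ⟦ m ⟧ₘ ρ) * (ιℤ d * ⟦ n ⟧ₘ ρ + ⟦ p ⟧ₚ ρ) ∎

  mulP : Poly → Poly → Poly
  mulP [] q = []
  mulP ((c , m) ∷ p) q = addP (scale c m q) (mulP p q)

  mulP-sound : ∀ p q ρ → ⟦ mulP p q ⟧ₚ ρ ≡ ⟦ p ⟧ₚ ρ * ⟦ q ⟧ₚ ρ
  mulP-sound [] q ρ = sym (*-zeroˡ _)
  mulP-sound ((c , m) ∷ p) q ρ =
    trans (addP-sound (scale c m q) (mulP p q) ρ)
      (trans (cong₂ _+_ (scale-sound c m q ρ) (mulP-sound p q ρ)) (sym (*-distribʳ-+ _ _ _)))

  norm : Expr → Poly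
  norm (con n) = (pos n , []) ∷ []
  norm (var i) = (pos 1 , i ∷ []) ∷ []
  norm (a :+ b) = addP (norm a) (norm b)
  norm (a :* b) = mulP (norm a) (norm b)
  norm (a :- b) = addP (norm a) (scale -[1+ 0 ] [] (norm b))

  norm-sound : ∀ e ρ → ⟦ norm e ⟧ₚ ρ ≡ ⟦ e ⟧ ρ
  norm-sound (con n) ρ = trans (+-identityʳ _) (trans (*-identityʳ _) (ιℤ-pos n))
  norm-sound (var i) ρ = trans (+-identityʳ _) (trans (cong₂ _*_ ιℤ-1 (*-identityʳ _)) (*-identityˡ _))
  norm-sound (a :+ b) ρ = trans (addP-sound (norm a) (norm b) ρ) (cong₂ _+_ (norm-sound a ρ) (norm-sound b ρ))
  norm-sound (a :* b) ρ = trans (mulP-sound (norm a) (norm b) ρ) (cong₂ _*_ (norm-sound a ρ) (norm-sound b ρ))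
  norm-sound (a :- b) ρ = trans (addP-sound (norm a) _ ρ) (cong₂ _+_ (norm-sound a ρ)
    (trans (scale-sound -[1+ 0 ] [] (norm b) ρ)
      (trans (cong₂ _*_ (*-identityʳ _) (norm-sound b ρ)) (-1*a _))))

  isZero : ℤ → Bool
  isZero (pos zero) = true
  isZero _ = false

  -- `insert` keeps terms whose coefficients have cancelled, so zero is recognised by its
  -- coefficients and not by emptiness.
  allZero : Poly → Bool
  allZero [] = true
  allZero ((c , _) ∷ p) = isZero c ∧ allZero p

  allZero-sound : ∀ p ρ → T (allZero p) → ⟦ p ⟧ₚ ρ ≡ ι 0
  allZero-sound [] ρ _ = refl
  allZero-sound ((pos zero , m) ∷ p) ρ t =
    trans (cong₂ _+_ (trans (cong (_* ⟦ m ⟧ₘ ρ) ιℤ-0) (*-zeroˡ _)) (allZero-sound p ρ t)) (+-identityˡ _)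

  x-y≡0⇒x≡y : ∀ {x y} → x - y ≡ ι 0 → x ≡ y
  x-y≡0⇒x≡y {x} {y} e = begin
    x                  ≡⟨ sym (+-identityʳ x) ⟩
    x + ι 0            ≡⟨ cong (x +_) (trans (sym (+-inverseʳ y)) (+-comm y (neg y))) ⟩
    x + (neg y + y)    ≡⟨ sym (+-assoc x (neg y) y) ⟩
    (x - y) + y        ≡⟨ cong (_+ y) e ⟩
    ι 0 + y            ≡⟨ +-identityˡ y ⟩
    y                  ∎

  ≤⇒0≤- : ∀ {x y} → x ≤ y → ι 0 ≤ y - x
  ≤⇒0≤- {x} {y} p = subst (_≤ y - x) (+-inverseʳ x) (+-mono-≤ p ≤-refl)

  0≤-⇒≤ : ∀ {x y} → ι 0 ≤ y - x → x ≤ y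
  0≤-⇒≤ {x} {y} p = subst₂ _≤_ (+-identityˡ x) eq (+-mono-≤ p ≤-refl)
    where
    eq : (y - x) + x ≡ y
    eq = trans (+-assoc y (neg x) x) (trans (cong (y +_) (trans (+-comm (neg x) x) (+-inverseʳ x))) (+-identityʳ y))

  data Ineq : Set where
    _≼_ : Expr → Expr → Ineq

  slack : Ineq → Expr
  slack (a ≼ b) = b :- a

  ⟦_⟧≤ : Ineq → Env → Set
  ⟦ a ≼ b ⟧≤ ρ = ⟦ a ⟧ ρ ≤ ⟦ b ⟧ ρ

  slack-nonneg : ∀ h ρ → ⟦ h ⟧≤ ρ → ι 0 ≤ ⟦ slack h ⟧ ρ
  slack-nonneg (a ≼ b) ρ p = ≤⇒0≤- p

  -- A certificate (k , Σ c · Π hᵢ) asserts (1 + k) · slack goal = Σ c · Π slack hᵢ, the indices i numbering the hypotheses.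
  Cert : Set
  Cert = ℕ × List (ℕ × List ℕ)

  record Problem : Set where
    constructor _⊢_by_
    field
      hyps : List Ineq
      goal : Ineq
      cert : Cert

  infix 2 _⊢_by_

  nth : List Ineq → ℕ → Ineq
  -- An index out of range stands for a true inequality, so that `nth-holds` is total.
  nth [] _ = con 0 ≼ con 0
  nth (h ∷ hs) zero = h
  nth (h ∷ hs) (suc i) = nth hs i

  prodE : List Ineq → List ℕ → Expr
  prodE hs [] = con 1
  prodE hs (i ∷ is) = slack (nth hs i) :* prodE hs is

  combE : List Ineq → List (ℕ × List ℕ) → Expr
  combE hs [] = con 0
  combE hs ((c , is) ∷ cs) = con c :* prodE hs is :+ combE hs cs

  Holds : List Ineq → Env → Set
  Holds [] ρ = ⊤
  Holds (h ∷ hs) ρ = ⟦ h ⟧≤ ρ × Holds hs ρ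

  nth-holds : ∀ hs ρ → Holds hs ρ → ∀ i → ⟦ nth hs i ⟧≤ ρ
  nth-holds [] ρ _ i = ≤-refl
  nth-holds (h ∷ hs) ρ (p , _) zero = p
  nth-holds (h ∷ hs) ρ (_ , ps) (suc i) = nth-holds hs ρ ps i

  0≤ι : ∀ n → ι 0 ≤ ι n
  0≤ι n = ι-mono ℕ.z≤n

  prodE-nonneg : ∀ hs ρ → Holds hs ρ → ∀ is → ι 0 ≤ ⟦ prodE hs is ⟧ ρ
  prodE-nonneg hs ρ ps [] = 0≤ι 1
  prodE-nonneg hs ρ ps (i ∷ is) = *-nonneg (slack-nonneg (nth hs i) ρ (nth-holds hs ρ ps i)) (prodE-nonneg hs ρ ps is)

  combE-nonneg : ∀ hs ρ → Holds hs ρ → ∀ cs → ι 0 ≤ ⟦ combE hs cs ⟧ ρ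
  combE-nonneg hs ρ ps [] = ≤-refl
  combE-nonneg hs ρ ps ((c , is) ∷ cs) = subst (_≤ ⟦ combE hs ((c , is) ∷ cs) ⟧ ρ) (+-identityˡ (ι 0))
    (+-mono-≤ (*-nonneg (0≤ι c) (prodE-nonneg hs ρ ps is)) (combE-nonneg hs ρ ps cs))

  claim : Problem → Expr
  claim (hs ⊢ g by (k , cs)) = con (suc k) :* slack g :- combE hs cs

  check : Problem → Bool
  check P = allZero (norm (claim P))

  -- In the case `x ≤ 0`, adding the nonnegative `k (0 - x)` to the hypothesis leaves `x` itself;
  -- this replaces a division by `k + 1`.
  cancel-suc : ∀ k x → ι 0 ≤ ι (suc k) * x → ι 0 ≤ x
  cancel-suc k x p with ≤-total (ι 0) x
  ... | inj₁ q = q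
  ... | inj₂ q = subst (ι 0 ≤_) (+-identityʳ x) (subst₂ _≤_ (+-identityˡ (ι 0)) e (+-mono-≤ p k[-x]≥0))
    where
    -x≥0 : ι 0 ≤ ι 0 - x
    -x≥0 = ≤⇒0≤- q
    k[-x]≥0 : ι 0 ≤ ι k * (ι 0 - x)
    k[-x]≥0 = *-nonneg (0≤ι k) -x≥0
    e : ι (suc k) * x + ι k * (ι 0 - x) ≡ x + ι 0
    e = x-y≡0⇒x≡y (trans (cong (λ t → (t * x + ι k * (ι 0 - x)) - (x + ι 0)) (ι-+ 1 k))
          (trans (sym (norm-sound claimE env)) (allZero-sound (norm claimE) env tt)))
      where
      env : Env
      env zero = ι k
      env (suc _) = x
      claimE : Expr
      claimE = ((con 1 :+ var 0) :* var 1 :+ var 0 :* (con 0 :- var 1)) :- (var 1 :+ con 0)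

  check-sound : ∀ P ρ → T (check P) → Holds (Problem.hyps P) ρ → ⟦ Problem.goal P ⟧≤ ρ
  check-sound P@(hs ⊢ (a ≼ b) by (k , cs)) ρ t ps =
    0≤-⇒≤ (cancel-suc k _ (subst (ι 0 ≤_) (sym e) (combE-nonneg hs ρ ps cs)))
    where
    e : ι (suc k) * ⟦ b :- a ⟧ ρ ≡ ⟦ combE hs cs ⟧ ρ
    e = x-y≡0⇒x≡y (trans (sym (norm-sound (claim P) ρ)) (allZero-sound (norm (claim P)) ρ t))

  ⟦_⟧v : ∀ {n} → Vec R n → Env
  ⟦ [] ⟧v _ = ι 0
  ⟦ x ∷ v ⟧v zero = x
  ⟦ x ∷ v ⟧v (suc i) = ⟦ v ⟧v i

  vars : ∀ n → ℕ → Vec Expr n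
  vars zero i = []
  vars (suc n) i = var i ∷ vars n (suc i)

  Implication : List Ineq → Ineq → Env → Set
  Implication [] g ρ = ⟦ g ⟧≤ ρ
  Implication (h ∷ hs) g ρ = ⟦ h ⟧≤ ρ → Implication hs g ρ

  curry-hyps : ∀ hs g ρ → (Holds hs ρ → ⟦ g ⟧≤ ρ) → Implication hs g ρ
  curry-hyps [] g ρ f = f tt
  curry-hyps (h ∷ hs) g ρ f = λ p → curry-hyps hs g ρ (λ ps → f (p , ps))

  -- The type `T (check P)` reduces to the unit type exactly when the certificate is correct, so
  -- type checking verifies the certificate and fills in the implicit argument.
  lin : ∀ {n} (v : Vec R n) (f : N-ary n Expr Problem) →
    let P = f $ⁿ vars n 0 in {T (check P)} → Implication (Problem.hyps P) (Problem.goal P) ⟦ v ⟧v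
  lin {n} v f {t} = curry-hyps _ _ _ (check-sound (f $ⁿ vars n 0) ⟦ v ⟧v t)

  data Equation : Set where
    _≈_ : Expr → Expr → Equation

  ⟦_⟧≡ : Equation → Env → Set
  ⟦ a ≈ b ⟧≡ ρ = ⟦ a ⟧ ρ ≡ ⟦ b ⟧ ρ

  checkE : Equation → Bool
  checkE (a ≈ b) = allZero (norm (a :- b))

  ring-sound : ∀ E ρ → T (checkE E) → ⟦ E ⟧≡ ρ
  ring-sound (a ≈ b) ρ t = x-y≡0⇒x≡y (trans (sym (norm-sound (a :- b) ρ)) (allZero-sound (norm (a :- b)) ρ t))

  ring : ∀ {n} (v : Vec R n) (f : N-ary n Expr Equation) →
    let E = f $ⁿ vars n 0 in {T (checkE E)} → ⟦ E ⟧≡ ⟦ v ⟧v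
  ring {n} v f {t} = ring-sound (f $ⁿ vars n 0) ⟦ v ⟧v t

  ⟦_⟧ℕ : Expr → (ℕ → ℕ) → ℕ
  ⟦ con n ⟧ℕ ρ = n
  ⟦ var i ⟧ℕ ρ = ρ i
  ⟦ a :+ b ⟧ℕ ρ = ⟦ a ⟧ℕ ρ ℕ.+ ⟦ b ⟧ℕ ρ
  ⟦ a :* b ⟧ℕ ρ = ⟦ a ⟧ℕ ρ ℕ.* ⟦ b ⟧ℕ ρ
  -- A dummy: truncated subtraction would not agree with `_-_`, and `positive` rejects such
  -- expressions.
  ⟦ a :- b ⟧ℕ ρ = 0

  positive : Expr → Bool
  positive (con _) = true
  positive (var _) = true
  positive (a :+ b) = positive a ∧ positive b
  positive (a :* b) = positive a ∧ positive b
  positive (a :- b) = false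

  ι-⟦⟧ : ∀ e ρ → T (positive e) → ι (⟦ e ⟧ℕ ρ) ≡ ⟦ e ⟧ (λ i → ι (ρ i))
  ι-⟦⟧ (con n) ρ t = refl
  ι-⟦⟧ (var i) ρ t = refl
  ι-⟦⟧ (a :+ b) ρ t with positive a in pa | positive b in pb
  ... | true | true = trans (ι-+ _ _) (cong₂ _+_ (ι-⟦⟧ a ρ (subst T (sym pa) tt)) (ι-⟦⟧ b ρ (subst T (sym pb) tt)))
  ι-⟦⟧ (a :* b) ρ t with positive a in pa | positive b in pb
  ... | true | true = trans (ι-* _ _) (cong₂ _*_ (ι-⟦⟧ a ρ (subst T (sym pa) tt)) (ι-⟦⟧ b ρ (subst T (sym pb) tt)))

  positive≤ : Ineq → Bool
  positive≤ (a ≼ b) = positive a ∧ positive b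

  allPositive : List Ineq → Bool
  allPositive [] = true
  allPositive (h ∷ hs) = positive≤ h ∧ allPositive hs

  ⟦_⟧≤ℕ : Ineq → (ℕ → ℕ) → Set
  ⟦ a ≼ b ⟧≤ℕ ρ = ⟦ a ⟧ℕ ρ ℕ.≤ ⟦ b ⟧ℕ ρ

  to-R : ∀ h ρ → T (positive≤ h) → ⟦ h ⟧≤ℕ ρ → ⟦ h ⟧≤ (λ i → ι (ρ i))
  to-R (a ≼ b) ρ t p with Equivalence.to (T-∧ {positive a}) t
  ... | ta , tb = subst₂ _≤_ (ι-⟦⟧ a ρ ta) (ι-⟦⟧ b ρ tb) (ι-mono p)

  from-R : ∀ h ρ → T (positive≤ h) → ⟦ h ⟧≤ (λ i → ι (ρ i)) → ⟦ h ⟧≤ℕ ρ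
  from-R (a ≼ b) ρ t p with Equivalence.to (T-∧ {positive a}) t
  ... | ta , tb = ι-cancel-≤ (subst₂ _≤_ (sym (ι-⟦⟧ a ρ ta)) (sym (ι-⟦⟧ b ρ tb)) p)

  Implicationℕ : List Ineq → Ineq → (ℕ → ℕ) → Set
  Implicationℕ [] g ρ = ⟦ g ⟧≤ℕ ρ
  Implicationℕ (h ∷ hs) g ρ = ⟦ h ⟧≤ℕ ρ → Implicationℕ hs g ρ

  to-ℕ : ∀ hs g ρ → T (allPositive hs) → T (positive≤ g) → Implication hs g (λ i → ι (ρ i)) → Implicationℕ hs g ρ
  to-ℕ [] g ρ _ t f = from-R g ρ t f
  to-ℕ (h ∷ hs) g ρ ts t f p with Equivalence.to (T-∧ {positive≤ h}) ts
  ... | th , ths = to-ℕ hs g ρ ths t (f (to-R h ρ th p))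

  ⟦_⟧vℕ : ∀ {n} → Vec ℕ n → ℕ → ℕ
  ⟦ [] ⟧vℕ _ = 0
  ⟦ x ∷ v ⟧vℕ zero = x
  ⟦ x ∷ v ⟧vℕ (suc i) = ⟦ v ⟧vℕ i

  -- The certificate is checked over the rationals, where nothing makes a variable nonnegative. This
  -- explains the hypotheses `con 0 ≼ a`, discharged by `ℕ.z≤n`, in many applications.
  linℕ : ∀ {n} (v : Vec ℕ n) (f : N-ary n Expr Problem) → let P = f $ⁿ vars n 0 in
    {T (check P)} → {T (allPositive (Problem.hyps P))} → {T (positive≤ (Problem.goal P))} →
    Implicationℕ (Problem.hyps P) (Problem.goal P) ⟦ v ⟧vℕ
  linℕ {n} v f {t} {hs} {g} = to-ℕ (Problem.hyps P) (Problem.goal P) ⟦ v ⟧vℕ hs g (curry-hyps (Problem.hyps P) (Problem.goal P) _ (check-sound P (λ i → ι (⟦ v ⟧vℕ i)) t))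
    where
    P : Problem
    P = f $ⁿ vars n 0

  ≤-reflexive : ∀ {a b : R} → a ≡ b → a ≤ b
  ≤-reflexive refl = ≤-refl

-- Reciprocals, absolute values, finite sums, floor division and the hyperbola method

module FiniteSums where
  open SealedRationals
  open LinearArithmetic
  import Data.Nat.DivMod as DM
  open import Data.Nat.Divisibility using (_∣_; _∣?_; divides)

  <⇒≤ : ∀ {x y} → x < y → x ≤ y
  <⇒≤ {x} {y} p with ≤-total x y
  ... | inj₁ q = q
  ... | inj₂ q = ⊥-elim (p q)

  *-mono-≤ : ∀ {a b c d} → ι 0 ≤ a → ι 0 ≤ c → a ≤ b → c ≤ d → a * c ≤ b * d
  *-mono-≤ {a} {b} {c} {d} p q r s =
    (lin (a ∷ c ∷ b ∷ d ∷ []) (λ a c b d → (con 0 ≼ a) ∷ (con 0 ≼ c) ∷ (a ≼ b) ∷ (c ≼ d) ∷ [] ⊢ (a :* c ≼ b :* d) by (0 , (1 , 0 ∷ 3 ∷ []) ∷ (1 , 1 ∷ 2 ∷ []) ∷ (1 , 2 ∷ 3 ∷ []) ∷ [])) p q r s)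

  *-monoʳ-≤ : ∀ {a c d} → ι 0 ≤ a → c ≤ d → a * c ≤ a * d
  *-monoʳ-≤ {a} {c} {d} p s = (lin (a ∷ c ∷ d ∷ []) (λ a c d → (con 0 ≼ a) ∷ (c ≼ d) ∷ [] ⊢ (a :* c ≼ a :* d) by (0 , (1 , 0 ∷ 1 ∷ []) ∷ [])) p s)

  -- If `y ≤ x`, then `(a - 1) (x - y)` is nonnegative, and adding it to `a y - a x` leaves `y - x`.
  *-cancel-≤ : ∀ {a x y} → ι 1 ≤ a → a * x ≤ a * y → x ≤ y
  *-cancel-≤ {a} {x} {y} p q with ≤-total x y
  ... | inj₁ r = r
  ... | inj₂ r = (lin (a ∷ x ∷ y ∷ []) (λ a x y → (con 1 ≼ a) ∷ (a :* x ≼ a :* y) ∷ (y ≼ x) ∷ [] ⊢ (x ≼ y) by (0 , (1 , 1 ∷ []) ∷ (1 , 0 ∷ 2 ∷ []) ∷ [])) p q r)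

  ι-suc : ∀ n → ι (suc n) ≡ ι 1 + ι n
  ι-suc n = ι-+ 1 n

  1≤ι : ∀ {n} → 1 ℕ.≤ n → ι 1 ≤ ι n
  1≤ι = ι-mono

  -- u n = 1/n, with u 0 = 0
  opaque
    u : ℕ → R
    u n = inv (ι n)

    ι*u : ∀ {n} → 1 ℕ.≤ n → ι n * u n ≡ ι 1
    ι*u {n} p = *-inverseʳ (λ e → 1≰0 (≤-trans (ι-mono p) (≤-reflexive e)))

  0≤u : ∀ {n} → 1 ℕ.≤ n → ι 0 ≤ u n
  0≤u {n} p with ≤-total (ι 0) (u n)
  ... | inj₁ q = q
  ... | inj₂ q = ⊥-elim (1≰0 (lin (ι n ∷ u n ∷ []) (λ a b → (con 1 ≼ a :* b) ∷ (b ≼ con 0) ∷ (con 0 ≼ a) ∷ [] ⊢ (con 1 ≼ con 0) by (0 , (1 , 0 ∷ []) ∷ (1 , 1 ∷ 2 ∷ []) ∷ [])) (≤-reflexive (sym (ι*u p))) q (0≤ι n)))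

  u≤1 : ∀ {n} → 1 ℕ.≤ n → u n ≤ ι 1
  u≤1 {n} p = *-cancel-≤ (ι-mono p) (lin (ι n ∷ u n ∷ []) (λ a b → (a :* b ≼ con 1) ∷ (con 1 ≼ a) ∷ [] ⊢ (a :* b ≼ a :* con 1) by (0 , (1 , 0 ∷ []) ∷ (1 , 1 ∷ []) ∷ [])) (≤-reflexive (ι*u p)) (ι-mono p))

  u-anti : ∀ {m n} → 1 ℕ.≤ m → m ℕ.≤ n → u n ≤ u m
  u-anti {m} {n} p q = *-cancel-≤ (ι-mono p) (*-cancel-≤ (ι-mono (ℕₚ.≤-trans p q))
    (lin (ι m ∷ u m ∷ ι n ∷ u n ∷ []) (λ a b c d → (a :* (c :* d) ≼ a) ∷ (c ≼ c :* (a :* b)) ∷ (a ≼ c) ∷ [] ⊢ (c :* (a :* d) ≼ c :* (a :* b)) by (0 , (1 , 0 ∷ []) ∷ (1 , 1 ∷ []) ∷ (1 , 2 ∷ []) ∷ [])) (≤-reflexive e) (≤-reflexive (sym e′)) (ι-mono q)))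
    where
    e : ι m * (ι n * u n) ≡ ι m
    e = trans (cong (ι m *_) (ι*u (ℕₚ.≤-trans p q))) (*-identityʳ _)
    e′ : ι n * (ι m * u m) ≡ ι n
    e′ = trans (cong (ι n *_) (ι*u p)) (*-identityʳ _)

  u-* : ∀ {m n} → 1 ℕ.≤ m → 1 ℕ.≤ n → u (m ℕ.* n) ≡ u m * u n
  u-* {m} {n} p q = begin
    w                                        ≡⟨ (ring (w ∷ []) (λ w → w ≈ w :* con 1 :* con 1)) ⟩
    w * ι 1 * ι 1                            ≡⟨ cong₂ (λ s t → w * s * t) (sym (ι*u p)) (sym (ι*u q)) ⟩
    w * (ι m * u m) * (ι n * u n)            ≡⟨ (ring (w ∷ ι m ∷ u m ∷ ι n ∷ u n ∷ []) (λ w a b c d → w :* (a :* b) :* (c :* d) ≈ a :* c :* w :* (b :* d))) ⟩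
    (ι m * ι n) * w * (u m * u n)            ≡⟨ cong (λ t → t * w * (u m * u n)) (sym (ι-* m n)) ⟩
    ι (m ℕ.* n) * w * (u m * u n)            ≡⟨ cong (_* (u m * u n)) (ι*u (ℕₚ.*-mono-≤ p q)) ⟩
    ι 1 * (u m * u n)                        ≡⟨ *-identityˡ _ ⟩
    u m * u n                                ∎
    where
    open ≡-Reasoning
    w : R
    w = u (m ℕ.* n)

  u-step : ∀ {n} → 1 ℕ.≤ n → u n - u (suc n) ≡ u n * u (suc n)
  u-step {n} p = begin
    u n - u (suc n)
      ≡⟨ (ring (u n ∷ u (suc n) ∷ []) (λ a b → a :- b ≈ a :* con 1 :- b :* con 1)) ⟩
    u n * ι 1 - u (suc n) * ι 1
      ≡⟨ cong₂ (λ s t → u n * s - u (suc n) * t) (sym (ι*u {suc n} (s≤s z≤n))) (sym (ι*u p)) ⟩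
    u n * (ι (suc n) * u (suc n)) - u (suc n) * (ι n * u n)
      ≡⟨ cong (λ s → u n * (s * u (suc n)) - u (suc n) * (ι n * u n)) (ι-suc n) ⟩
    u n * ((ι 1 + ι n) * u (suc n)) - u (suc n) * (ι n * u n)
      ≡⟨ (ring (u n ∷ ι n ∷ u (suc n) ∷ []) (λ a b c → a :* ((con 1 :+ b) :* c) :- c :* (b :* a) ≈ a :* c)) ⟩
    u n * u (suc n) ∎
    where open ≡-Reasoning

  opaque
    abs : R → R
    abs x with ≤-total (ι 0) x
    ... | inj₁ _ = x
    ... | inj₂ _ = ι 0 - x

    x≤abs : ∀ x → x ≤ abs x
    x≤abs x with ≤-total (ι 0) x
    ... | inj₁ _ = ≤-refl
    ... | inj₂ p = (lin (x ∷ []) (λ x → (x ≼ con 0) ∷ [] ⊢ (x ≼ con 0 :- x) by (0 , (2 , 0 ∷ []) ∷ [])) p)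

    -x≤abs : ∀ x → ι 0 - x ≤ abs x
    -x≤abs x with ≤-total (ι 0) x
    ... | inj₁ p = (lin (x ∷ []) (λ x → (con 0 ≼ x) ∷ [] ⊢ (con 0 :- x ≼ x) by (0 , (2 , 0 ∷ []) ∷ [])) p)
    ... | inj₂ _ = ≤-refl

    abs-lub : ∀ {x c} → x ≤ c → ι 0 - x ≤ c → abs x ≤ c
    abs-lub {x} p q with ≤-total (ι 0) x
    ... | inj₁ _ = p
    ... | inj₂ _ = q

    abs-cases : ∀ x → abs x ≡ x ⊎ abs x ≡ ι 0 - x
    abs-cases x with ≤-total (ι 0) x
    ... | inj₁ _ = inj₁ refl
    ... | inj₂ _ = inj₂ refl

  0≤abs : ∀ x → ι 0 ≤ abs x
  0≤abs x = (lin (x ∷ abs x ∷ []) (λ x a → (x ≼ a) ∷ (con 0 :- x ≼ a) ∷ [] ⊢ (con 0 ≼ a) by (1 , (1 , 0 ∷ []) ∷ (1 , 1 ∷ []) ∷ [])) (x≤abs x) (-x≤abs x))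

  abs-+ : ∀ x y → abs (x + y) ≤ abs x + abs y
  abs-+ x y = abs-lub (lin (x ∷ abs x ∷ y ∷ abs y ∷ []) (λ x a y b → (x ≼ a) ∷ (y ≼ b) ∷ [] ⊢ (x :+ y ≼ a :+ b) by (0 , (1 , 0 ∷ []) ∷ (1 , 1 ∷ []) ∷ [])) (x≤abs x) (x≤abs y))
    (lin (x ∷ abs x ∷ y ∷ abs y ∷ []) (λ x a y b → (con 0 :- x ≼ a) ∷ (con 0 :- y ≼ b) ∷ [] ⊢ (con 0 :- (x :+ y) ≼ a :+ b) by (0 , (1 , 0 ∷ []) ∷ (1 , 1 ∷ []) ∷ [])) (-x≤abs x) (-x≤abs y))

  abs-nonneg : ∀ {x} → ι 0 ≤ x → abs x ≡ x
  abs-nonneg {x} p = ≤-antisym (abs-lub ≤-refl (lin (x ∷ []) (λ x → (con 0 ≼ x) ∷ [] ⊢ (con 0 :- x ≼ x) by (0 , (2 , 0 ∷ []) ∷ [])) p)) (x≤abs x)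

  abs-* : ∀ x y → abs (x * y) ≤ abs x * abs y
  abs-* x y = abs-lub
    (lin (x ∷ abs x ∷ y ∷ abs y ∷ []) (λ x a y b → (x ≼ a) ∷ (con 0 :- x ≼ a) ∷ (y ≼ b) ∷ (con 0 :- y ≼ b) ∷ [] ⊢ (x :* y ≼ a :* b) by (1 , (1 , 0 ∷ 3 ∷ []) ∷ (1 , 1 ∷ 2 ∷ []) ∷ [])) (x≤abs x) (-x≤abs x) (x≤abs y) (-x≤abs y))
    (lin (x ∷ abs x ∷ y ∷ abs y ∷ []) (λ x a y b → (x ≼ a) ∷ (con 0 :- x ≼ a) ∷ (y ≼ b) ∷ (con 0 :- y ≼ b) ∷ [] ⊢ (con 0 :- x :* y ≼ a :* b) by (1 , (1 , 0 ∷ 2 ∷ []) ∷ (1 , 1 ∷ 3 ∷ []) ∷ [])) (x≤abs x) (-x≤abs x) (x≤abs y) (-x≤abs y))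

  ∑ : ℕ → (ℕ → R) → R
  ∑ zero f = ι 0
  ∑ (suc n) f = ∑ n f + f (suc n)

  ∑-mono : ∀ n {f g} → (∀ i → 1 ℕ.≤ i → i ℕ.≤ n → f i ≤ g i) → ∑ n f ≤ ∑ n g
  ∑-mono zero h = ≤-refl
  ∑-mono (suc n) h = +-mono-≤ (∑-mono n (λ i p q → h i p (ℕₚ.m≤n⇒m≤1+n q))) (h (suc n) (s≤s z≤n) ℕₚ.≤-refl)

  ∑-cong : ∀ n {f g} → (∀ i → 1 ℕ.≤ i → i ℕ.≤ n → f i ≡ g i) → ∑ n f ≡ ∑ n g
  ∑-cong zero h = refl
  ∑-cong (suc n) h = cong₂ _+_ (∑-cong n (λ i p q → h i p (ℕₚ.m≤n⇒m≤1+n q))) (h (suc n) (s≤s z≤n) ℕₚ.≤-refl)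

  ∑-zero : ∀ n {f} → (∀ i → 1 ℕ.≤ i → i ℕ.≤ n → f i ≡ ι 0) → ∑ n f ≡ ι 0
  ∑-zero zero h = refl
  ∑-zero (suc n) {f} h = trans (cong₂ _+_ (∑-zero n (λ i p q → h i p (ℕₚ.m≤n⇒m≤1+n q))) (h (suc n) (s≤s z≤n) ℕₚ.≤-refl))
    (+-identityˡ _)

  ∑-+ : ∀ n f g → ∑ n (λ i → f i + g i) ≡ ∑ n f + ∑ n g
  ∑-+ zero f g = sym (+-identityˡ _)
  ∑-+ (suc n) f g = trans (cong (_+ (f (suc n) + g (suc n))) (∑-+ n f g)) (+-interchange _ _ _ _)

  ∑-*ˡ : ∀ n c f → ∑ n (λ i → c * f i) ≡ c * ∑ n f
  ∑-*ˡ zero c f = sym (*-zeroʳ c)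
  ∑-*ˡ (suc n) c f = trans (cong (_+ c * f (suc n)) (∑-*ˡ n c f)) (sym (*-distribˡ-+ c _ _))

  ∑-*ʳ : ∀ n c f → ∑ n (λ i → f i * c) ≡ ∑ n f * c
  ∑-*ʳ n c f = trans (∑-cong n (λ i _ _ → *-comm (f i) c)) (trans (∑-*ˡ n c f) (*-comm c _))

  ∑-- : ∀ n f g → ∑ n (λ i → f i - g i) ≡ ∑ n f - ∑ n g
  ∑-- zero f g = (ring ([]) (con 0 ≈ con 0 :- con 0))
  ∑-- (suc n) f g = trans (cong (_+ (f (suc n) - g (suc n))) (∑-- n f g))
    (ring (∑ n f ∷ ∑ n g ∷ f (suc n) ∷ g (suc n) ∷ []) (λ a b c d → a :- b :+ (c :- d) ≈ a :+ c :- (b :+ d)))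

  ∑-const : ∀ n c → ∑ n (λ _ → c) ≡ ι n * c
  ∑-const zero c = sym (*-zeroˡ c)
  ∑-const (suc n) c = trans (cong (_+ c) (∑-const n c)) (trans (ring (ι n ∷ c ∷ []) (λ a c → a :* c :+ c ≈ (con 1 :+ a) :* c)) (cong (_* c) (sym (ι-suc n))))

  ∑-nonneg : ∀ n {f} → (∀ i → 1 ℕ.≤ i → i ℕ.≤ n → ι 0 ≤ f i) → ι 0 ≤ ∑ n f
  ∑-nonneg n {f} h = ≤-trans (≤-reflexive (sym (∑-zero n (λ _ _ _ → refl)))) (∑-mono n h)

  ∑-abs : ∀ n f → abs (∑ n f) ≤ ∑ n (λ i → abs (f i))
  ∑-abs zero f = ≤-reflexive (abs-nonneg ≤-refl)
  ∑-abs (suc n) f = ≤-trans (abs-+ _ _) (+-mono-≤ (∑-abs n f) ≤-refl)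

  ∑-swap : ∀ m n (φ : ℕ → ℕ → R) → ∑ m (λ a → ∑ n (φ a)) ≡ ∑ n (λ b → ∑ m (λ a → φ a b))
  ∑-swap zero n φ = sym (∑-zero n (λ _ _ _ → refl))
  ∑-swap (suc m) n φ = trans (cong (_+ ∑ n (φ (suc m))) (∑-swap m n φ)) (sym (∑-+ n _ _))

  ∑-upper : ∀ {m n} f → m ℕ.≤ n → (∀ i → 1 ℕ.≤ i → i ℕ.≤ n → ι 0 ≤ f i) → ∑ m f ≤ ∑ n f
  ∑-upper {m} {zero} f z≤n h = ≤-refl
  ∑-upper {m} {suc n} f p h with ℕₚ.m≤n⇒m<n∨m≡n p
  ... | inj₂ refl = ≤-refl
  ... | inj₁ (s≤s q) = (lin (∑ m f ∷ ∑ n f ∷ f (suc n) ∷ []) (λ a b c → (a ≼ b) ∷ (con 0 ≼ c) ∷ [] ⊢ (a ≼ b :+ c) by (0 , (1 , 0 ∷ []) ∷ (1 , 1 ∷ []) ∷ [])) (∑-upper {m} {n} f q (λ i a b → h i a (ℕₚ.m≤n⇒m≤1+n b))) (h (suc n) (s≤s z≤n) ℕₚ.≤-refl))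

  -- The boundary term is taken at `n + 1` and not at `n`: in the applications `n` is `x` and the
  -- weight depends on `x ÷ i`, which vanishes at `x + 1`.
  ∑-abel : ∀ n (b w : ℕ → R) →
    ∑ n (λ i → b i * w i) ≡ ∑ n b * w (suc n) + ∑ n (λ i → ∑ i b * (w i - w (suc i)))
  ∑-abel zero b w = (ring (w (suc zero) ∷ []) (λ a → con 0 ≈ con 0 :* a :+ con 0))
  ∑-abel (suc n) b w = trans (cong (_+ b (suc n) * w (suc n)) (∑-abel n b w))
    (ring (∑ n b ∷ w (suc n) ∷ ∑ n (λ i → ∑ i b * (w i - w (suc i))) ∷ b (suc n) ∷ w (suc (suc n)) ∷ []) (λ a b c d e → a :* b :+ c :+ d :* b ≈ (a :+ d) :* e :+ (c :+ (a :+ d) :* (b :- e))))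

  when : ∀ {P : Set} → Dec P → R → R
  when (yes _) x = x
  when (no _) x = ι 0

  when-yes : ∀ {P : Set} (d : Dec P) {x} → P → when d x ≡ x
  when-yes (yes _) p = refl
  when-yes (no ¬p) p = ⊥-elim (¬p p)

  when-no : ∀ {P : Set} (d : Dec P) {x} → ¬ P → when d x ≡ ι 0
  when-no (yes p) ¬p = ⊥-elim (¬p p)
  when-no (no _) ¬p = refl

  when-cong : ∀ {P : Set} (d : Dec P) {x y} → (P → x ≡ y) → when d x ≡ when d y
  when-cong (yes p) e = e p
  when-cong (no _) e = refl

  when-iff : ∀ {P Q : Set} (d : Dec P) (d′ : Dec Q) {x} → (P → Q) → (Q → P) → when d x ≡ when d′ x
  when-iff (yes p) d′ f g = sym (when-yes d′ (f p))
  when-iff (no ¬p) d′ f g = sym (when-no d′ (λ q → ¬p (g q)))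

  ∑-extend : ∀ {m n} f → m ℕ.≤ n → (∀ i → m ℕ.< i → i ℕ.≤ n → f i ≡ ι 0) → ∑ m f ≡ ∑ n f
  ∑-extend {m} {zero} f z≤n h = refl
  ∑-extend {m} {suc n} f p h with ℕₚ.m≤n⇒m<n∨m≡n p
  ... | inj₂ refl = refl
  ... | inj₁ (s≤s q) = trans (∑-extend {m} {n} f q (λ i a b → h i a (ℕₚ.m≤n⇒m≤1+n b)))
    (trans (sym (+-identityʳ _)) (cong (∑ n f +_) (sym (h (suc n) (s≤s q) ℕₚ.≤-refl))))

  ∑-when : ∀ {m n} {P : ℕ → Set} (d : ∀ i → Dec (P i)) f → m ℕ.≤ n →
    (∀ i → 1 ℕ.≤ i → i ℕ.≤ m → P i) → (∀ i → P i → i ℕ.≤ m) →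
    ∑ m f ≡ ∑ n (λ i → when (d i) (f i))
  ∑-when {m} {n} d f p h h′ = trans
    (∑-cong m (λ i a b → sym (when-yes (d i) (h i a b))))
    (∑-extend _ p (λ i a _ → when-no (d i) (λ q → ℕₚ.<⇒≱ a (h′ i q))))

  ∑-single : ∀ {n} k f → 1 ℕ.≤ k → k ℕ.≤ n → (∀ i → 1 ℕ.≤ i → i ℕ.≤ n → i ≢ k → f i ≡ ι 0) → ∑ n f ≡ f k
  ∑-single {suc n} k f p q h with ℕₚ.m≤n⇒m<n∨m≡n q
  ... | inj₂ refl = trans (cong (_+ f (suc n)) (∑-zero n (λ i a b → h i a (ℕₚ.m≤n⇒m≤1+n b) (ℕₚ.<⇒≢ (s≤s b))))) (+-identityˡ _)
  ... | inj₁ (s≤s r) = trans (cong₂ _+_ (∑-single {n} k f p r (λ i a b → h i a (ℕₚ.m≤n⇒m≤1+n b)))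
     (h (suc n) (s≤s z≤n) ℕₚ.≤-refl (λ e → ℕₚ.<⇒≢ (s≤s r) (sym e)))) (+-identityʳ _)
  ∑-single {zero} zero f () q h
  ∑-single {zero} (suc k) f p () h

  infixl 7 _÷_

  _÷_ : ℕ → ℕ → ℕ
  x ÷ zero = 0
  x ÷ suc a = x DM./ suc a

  ÷-lower : ∀ x a → a ℕ.* (x ÷ a) ℕ.≤ x
  ÷-lower x zero = z≤n
  ÷-lower x (suc a) = ℕₚ.≤-trans (ℕₚ.≤-reflexive (ℕₚ.*-comm (suc a) _)) (DM.m/n*n≤m x (suc a))

  ÷-upper : ∀ x {a} → 1 ℕ.≤ a → x ℕ.< a ℕ.* suc (x ÷ a)
  ÷-upper x {suc a} _ = ℕₚ.≤-<-trans (ℕₚ.≤-reflexive (DM.m≡m%n+[m/n]*n x (suc a)))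
    (linℕ (r ∷ a ∷ q ∷ []) (λ r a q → (con 1 :+ r ≼ con 1 :+ a) ∷ [] ⊢ (con 1 :+ (r :+ q :* (con 1 :+ a)) ≼ (con 1 :+ a) :* (con 1 :+ q)) by (0 , (1 , 0 ∷ []) ∷ [])) (DM.m%n<n x (suc a)))
    where
    r q : ℕ
    r = x DM.% suc a
    q = x DM./ suc a

  ÷-least : ∀ {x a b} → 1 ℕ.≤ a → a ℕ.* b ℕ.≤ x → b ℕ.≤ x ÷ a
  ÷-least {x} {a} {b} p q = ℕₚ.≤-pred (ℕₚ.*-cancelˡ-< a b (suc (x ÷ a)) (ℕₚ.≤-<-trans q (÷-upper x p)))

  ÷-most : ∀ {x a b} → b ℕ.≤ x ÷ a → a ℕ.* b ℕ.≤ x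
  ÷-most {x} {a} p = ℕₚ.≤-trans (ℕₚ.*-monoʳ-≤ a p) (÷-lower x a)

  ÷-unique : ∀ {x a b} → 1 ℕ.≤ a → a ℕ.* b ℕ.≤ x → x ℕ.< a ℕ.* suc b → x ÷ a ≡ b
  ÷-unique {x} {a} {b} p q r = ℕₚ.≤-antisym (ℕₚ.≤-pred (ℕₚ.*-cancelˡ-< a _ _ (ℕₚ.≤-<-trans (÷-lower x a) r))) (÷-least p q)

  ÷÷ : ∀ x {a b} → 1 ℕ.≤ a → 1 ℕ.≤ b → (x ÷ a) ÷ b ≡ x ÷ (a ℕ.* b)
  ÷÷ x {a} {b} p q = ℕₚ.≤-antisym
    (÷-least (ℕₚ.*-mono-≤ p q) (ℕₚ.≤-trans (ℕₚ.≤-reflexive (ℕₚ.*-assoc a b _)) (÷-most {x} {a} (÷-lower (x ÷ a) b))))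
    (÷-least q (÷-least p (ℕₚ.≤-trans (ℕₚ.≤-reflexive (sym (ℕₚ.*-assoc a b _))) (÷-lower x (a ℕ.* b)))))

  ÷-≤ : ∀ x a → x ÷ a ℕ.≤ x
  ÷-≤ x zero = z≤n
  ÷-≤ x (suc a) = DM.m/n≤m x (suc a)

  ÷-one : ∀ x → x ÷ 1 ≡ x
  ÷-one x = DM.n/1≡n x

  ÷-small : ∀ {x a} → x ℕ.< a → x ÷ a ≡ 0
  ÷-small {x} {suc a} p = DM.m<n⇒m/n≡0 p

  ÷-anti : ∀ x {a b} → 1 ℕ.≤ a → a ℕ.≤ b → x ÷ b ℕ.≤ x ÷ a
  ÷-anti x {a} {b} p q = ÷-least p (ℕₚ.≤-trans (ℕₚ.*-monoˡ-≤ (x ÷ b) q) (÷-lower x b))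

  1≤÷ : ∀ {x a} → 1 ℕ.≤ a → a ℕ.≤ x → 1 ℕ.≤ x ÷ a
  1≤÷ {x} {a} p q = ÷-least p (ℕₚ.≤-trans (ℕₚ.≤-reflexive (ℕₚ.*-identityʳ a)) q)

  *÷ : ∀ {a} b → 1 ℕ.≤ a → (a ℕ.* b) ÷ a ≡ b
  *÷ {a} b p = ÷-unique p ℕₚ.≤-refl (ℕₚ.*-monoʳ-< a {{ℕ.>-nonZero p}} (ℕₚ.n<1+n b))

  ∣⇒*÷ : ∀ {a n} → 1 ℕ.≤ a → a ∣ n → a ℕ.* (n ÷ a) ≡ n
  ∣⇒*÷ {a} {n} p (divides q refl) = trans (cong (λ t → a ℕ.* (t ÷ a)) (ℕₚ.*-comm q a))
    (trans (cong (a ℕ.*_) (*÷ q p)) (ℕₚ.*-comm a q))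

  ÷-suc-∣ : ∀ {x a} → 1 ℕ.≤ a → a ∣ suc x → suc x ÷ a ≡ suc (x ÷ a)
  ÷-suc-∣ {x} {a} p d = ÷-unique p
    (ℕₚ.≤-trans (ℕₚ.≤-reflexive (cong (a ℕ.*_) (sym e))) (ℕₚ.≤-reflexive (∣⇒*÷ p d)))
    (linℕ (a ∷ q ∷ x ∷ x ÷ a ∷ []) (λ a q x b → (con 1 :+ x ≼ a :* q) ∷ (q ≼ con 1 :+ b) ∷ (con 1 ≼ a) ∷ [] ⊢ (con 1 :+ (con 1 :+ x) ≼ a :* (con 1 :+ (con 1 :+ b))) by (0 , (1 , 0 ∷ []) ∷ (1 , 1 ∷ []) ∷ (1 , 2 ∷ []) ∷ (1 , 1 ∷ 2 ∷ []) ∷ [])) (ℕₚ.≤-reflexive (sym (∣⇒*÷ p d))) (ℕₚ.≤-reflexive e) p)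
    where
    q : ℕ
    q = suc x ÷ a
    pred-eq : ∀ {q} → a ℕ.* q ≡ suc x → q ≡ suc (x ÷ a)
    pred-eq {zero} e = ⊥-elim (ℕₚ.0≢1+n (trans (sym (ℕₚ.*-zeroʳ a)) e))
    pred-eq {suc q} e = cong suc (sym (÷-unique p (linℕ (a ∷ q ∷ x ∷ []) (λ a q x → (a :* (con 1 :+ q) ≼ con 1 :+ x) ∷ (con 1 ≼ a) ∷ [] ⊢ (a :* q ≼ x) by (0 , (1 , 0 ∷ []) ∷ (1 , 1 ∷ []) ∷ [])) (ℕₚ.≤-reflexive e) p) (linℕ (a ∷ q ∷ x ∷ []) (λ a q x → (con 1 :+ x ≼ a :* (con 1 :+ q)) ∷ [] ⊢ (con 1 :+ x ≼ a :* (con 1 :+ q)) by (0 , (1 , 0 ∷ []) ∷ [])) (ℕₚ.≤-reflexive (sym e)))))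
    e : q ≡ suc (x ÷ a)
    e = pred-eq (∣⇒*÷ p d)

  ÷-suc-∤ : ∀ {x a} → 1 ℕ.≤ a → ¬ (a ∣ suc x) → suc x ÷ a ≡ x ÷ a
  ÷-suc-∤ {x} {a} p nd = ÷-unique p (ℕₚ.m≤n⇒m≤1+n (÷-lower x a))
    (ℕₚ.≤∧≢⇒< (÷-upper x p) (λ e → nd (divides (suc (x ÷ a)) (trans e (ℕₚ.*-comm a _)))))

  ι-÷-≤ : ∀ x {a} → 1 ℕ.≤ a → ι (x ÷ a) ≤ ι x * u a
  ι-÷-≤ x {a} p = *-cancel-≤ (ι-mono p) (≤-trans (≤-trans (≤-reflexive (sym (ι-* a (x ÷ a)))) (ι-mono (÷-lower x a)))
    (≤-reflexive (trans (sym (trans (cong (ι x *_) (ι*u p)) (*-identityʳ _))) (ring (ι x ∷ ι a ∷ u a ∷ []) (λ a b c → a :* (b :* c) ≈ b :* (a :* c))))))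

  ι-÷-> : ∀ x {a} → 1 ℕ.≤ a → ι x * u a ≤ ι (x ÷ a) + ι 1
  ι-÷-> x {a} p = *-cancel-≤ (ι-mono p) (≤-trans (≤-reflexive e) (≤-trans (ι-mono (ℕₚ.<⇒≤ (÷-upper x p)))
    (≤-reflexive (trans (ι-* a _) (cong (ι a *_) (trans (ι-suc _) (+-comm _ _)))))))
    where
    e : ι a * (ι x * u a) ≡ ι x
    e = trans (ring (ι a ∷ ι x ∷ u a ∷ []) (λ a b c → a :* (b :* c) ≈ b :* (a :* c))) (trans (cong (ι x *_) (ι*u p)) (*-identityʳ _))

  -- Both sides run over the lattice points a b ≤ x, on the right grouped by the product n = a b.
  hyperbola : ∀ x (φ : ℕ → ℕ → R) →
    ∑ x (λ a → ∑ (x ÷ a) (φ a)) ≡ ∑ x (λ n → ∑ n (λ a → when (a ∣? n) (φ a (n ÷ a))))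
  hyperbola zero φ = refl
  hyperbola (suc x) φ = begin
    ∑ (suc x) (λ a → ∑ (suc x ÷ a) (φ a))
      ≡⟨ ∑-cong (suc x) (λ a p _ → grow a p) ⟩
    ∑ (suc x) (λ a → ∑ (x ÷ a) (φ a) + when (a ∣? suc x) (φ a (suc x ÷ a)))
      ≡⟨ ∑-+ (suc x) _ _ ⟩
    (∑ x (λ a → ∑ (x ÷ a) (φ a)) + ∑ (x ÷ suc x) (φ (suc x))) + last
      ≡⟨ cong (λ k → (∑ x (λ a → ∑ (x ÷ a) (φ a)) + ∑ k (φ (suc x))) + last) (÷-small (ℕₚ.n<1+n x)) ⟩
    (∑ x (λ a → ∑ (x ÷ a) (φ a)) + ι 0) + last
      ≡⟨ cong (_+ last) (trans (+-identityʳ _) (hyperbola x φ)) ⟩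
    ∑ x (λ n → ∑ n (λ a → when (a ∣? n) (φ a (n ÷ a)))) + last ∎
    where
    open ≡-Reasoning
    last : R
    last = ∑ (suc x) (λ a → when (a ∣? suc x) (φ a (suc x ÷ a)))
    grow : ∀ a → 1 ℕ.≤ a → ∑ (suc x ÷ a) (φ a) ≡ ∑ (x ÷ a) (φ a) + when (a ∣? suc x) (φ a (suc x ÷ a))
    grow a p with a ∣? suc x
    ... | yes d = trans (cong (λ k → ∑ k (φ a)) (÷-suc-∣ p d)) (cong (λ k → ∑ (x ÷ a) (φ a) + φ a k) (sym (÷-suc-∣ p d)))
    ... | no nd = trans (cong (λ k → ∑ k (φ a)) (÷-suc-∤ p nd)) (sym (+-identityʳ _))

  -- Both inner ranges are cut out of [1, x] by the symmetric condition a b ≤ x, after which the two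
  -- sums over [1, x] commute.
  hyperbola-swap : ∀ x (φ : ℕ → ℕ → R) →
    ∑ x (λ a → ∑ (x ÷ a) (φ a)) ≡ ∑ x (λ b → ∑ (x ÷ b) (λ a → φ a b))
  hyperbola-swap x φ = begin
    ∑ x (λ a → ∑ (x ÷ a) (φ a))
      ≡⟨ ∑-cong x (λ a p _ → box a p (φ a)) ⟩
    ∑ x (λ a → ∑ x (λ b → when (a ℕ.* b ℕₚ.≤? x) (φ a b)))
      ≡⟨ ∑-swap x x _ ⟩
    ∑ x (λ b → ∑ x (λ a → when (a ℕ.* b ℕₚ.≤? x) (φ a b)))
      ≡⟨ ∑-cong x (λ b _ _ → ∑-cong x (λ a _ _ → when-iff (a ℕ.* b ℕₚ.≤? x) (b ℕ.* a ℕₚ.≤? x)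
           (ℕₚ.≤-trans (ℕₚ.≤-reflexive (ℕₚ.*-comm b a))) (ℕₚ.≤-trans (ℕₚ.≤-reflexive (ℕₚ.*-comm a b))))) ⟩
    ∑ x (λ b → ∑ x (λ a → when (b ℕ.* a ℕₚ.≤? x) (φ a b)))
      ≡⟨ ∑-cong x (λ b p _ → sym (box b p (λ a → φ a b))) ⟩
    ∑ x (λ b → ∑ (x ÷ b) (λ a → φ a b)) ∎
    where
    open ≡-Reasoning
    box : ∀ a → 1 ℕ.≤ a → ∀ f → ∑ (x ÷ a) f ≡ ∑ x (λ b → when (a ℕ.* b ℕₚ.≤? x) (f b))
    box a p f = ∑-when (λ b → a ℕ.* b ℕₚ.≤? x) f (÷-≤ x a) (λ b _ q → ÷-most {x} {a} q) (λ b q → ÷-least p q)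

-- Lattice of divisors, von Mangoldt function and Möbius function

module ArithmeticFunctions where
  open SealedRationals
  open LinearArithmetic
  open FiniteSums
  open import Data.Nat.Divisibility
  open import Data.Nat.GCD
  open import Data.Nat.LCM
  open import Data.Nat.Coprimality using (gcd≡1⇒coprime; coprime-divisor)
  open import Data.Nat.Primality
  open import Data.Nat.Primality.Factorisation
  open import Data.Nat.ListAction using (product)
  open import Data.Nat.ListAction.Properties using (product-++; ∈⇒∣product)
  open import Data.List.Base using (_++_)
  open import Data.List.Relation.Unary.All using (All; []; _∷_)
  import Data.List.Relation.Unary.All.Properties as Allₚ
  open import Data.List.Relation.Unary.Any using (here; there)
  open import Data.List.Membership.Propositional using (_∈_; _∉_)
  open import Data.List.Membership.DecPropositional ℕₚ._≟_ using (_∈?_)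
  open import Data.List.Relation.Binary.Permutation.Propositional as Perm using (_↭_; ↭-sym)
  open import Data.List.Relation.Binary.Permutation.Propositional.Properties using (∈-resp-↭)

  1≤-∣ : ∀ {d n} → 1 ℕ.≤ n → d ∣ n → 1 ℕ.≤ d
  1≤-∣ {zero} {suc n} p (divides q e) = ⊥-elim (ℕₚ.1+n≢0 (trans e (ℕₚ.*-zeroʳ q)))
  1≤-∣ {suc d} p _ = s≤s z≤n

  ∣⇒≤′ : ∀ {d n} → 1 ℕ.≤ n → d ∣ n → d ℕ.≤ n
  ∣⇒≤′ p = ∣⇒≤ {{ℕ.>-nonZero p}}

  1≤-* : ∀ {a b} → 1 ℕ.≤ a → 1 ℕ.≤ b → 1 ℕ.≤ a ℕ.* b
  1≤-* = ℕₚ.*-mono-≤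

  1≤gcd : ∀ {m n} → 1 ℕ.≤ n → 1 ℕ.≤ gcd m n
  1≤gcd {m} {n} p = 1≤-∣ p (gcd[m,n]∣n m n)

  1≤lcm : ∀ {m n} → 1 ℕ.≤ m → 1 ℕ.≤ n → 1 ℕ.≤ lcm m n
  1≤lcm {m} {n} p q with lcm m n in e
  ... | suc _ = s≤s z≤n
  ... | zero = ⊥-elim (ℕₚ.<⇒≢ (1≤-* p q) (sym (trans (sym (gcd*lcm m n)) (trans (cong (gcd m n ℕ.*_) e) (ℕₚ.*-zeroʳ (gcd m n))))))

  lcm-mono : ∀ {a b c d} → a ∣ c → b ∣ d → lcm a b ∣ lcm c d
  lcm-mono {a} {b} {c} {d} p q = lcm-least (∣-trans p (m∣lcm[m,n] c d)) (∣-trans q (n∣lcm[m,n] c d))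

  -- With α = gcd a t and β = gcd b t, the product t · gcd α β divides a b, a t and t β, hence also α β.
  ∣lcm-gcd : ∀ {a b t} → 1 ℕ.≤ t → t ∣ lcm a b → t ∣ lcm (gcd a t) (gcd b t)
  ∣lcm-gcd {a} {b} {t} pos t∣l = *-cancelʳ-∣ g {{ℕ.>-nonZero (1≤gcd {α} (1≤gcd {b} pos))}}
    (subst (t ℕ.* g ∣_) (trans (sym (gcd*lcm α β)) (ℕₚ.*-comm g _)) tg∣uv)
    where
    α β g : ℕ
    α = gcd a t
    β = gcd b t
    g = gcd α β
    g∣u : g ∣ α
    g∣u = gcd[m,n]∣m α β
    g∣v : g ∣ β
    g∣v = gcd[m,n]∣n α β
    g∣gcd : g ∣ gcd a b
    g∣gcd = gcd-greatest (∣-trans g∣u (gcd[m,n]∣m a t)) (∣-trans g∣v (gcd[m,n]∣m b t))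
    tg∣ab : t ℕ.* g ∣ a ℕ.* b
    tg∣ab = subst (t ℕ.* g ∣_) (trans (ℕₚ.*-comm (lcm a b) _) (gcd*lcm a b)) (*-pres-∣ t∣l g∣gcd)
    tg∣at : t ℕ.* g ∣ a ℕ.* t
    tg∣at = subst (t ℕ.* g ∣_) (ℕₚ.*-comm t a) (*-pres-∣ (∣-refl {t}) (∣-trans g∣u (gcd[m,n]∣m a t)))
    tg∣av : t ℕ.* g ∣ β ℕ.* a
    tg∣av = subst (t ℕ.* g ∣_) (trans (sym (c*gcd[m,n]≡gcd[cm,cn] a b t)) (ℕₚ.*-comm a β)) (gcd-greatest tg∣ab tg∣at)
    tg∣vt : t ℕ.* g ∣ β ℕ.* t
    tg∣vt = subst (t ℕ.* g ∣_) (ℕₚ.*-comm t β) (*-pres-∣ (∣-refl {t}) g∣v)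
    tg∣uv : t ℕ.* g ∣ α ℕ.* β
    tg∣uv = subst (t ℕ.* g ∣_) (trans (sym (c*gcd[m,n]≡gcd[cm,cn] β a t)) (ℕₚ.*-comm β α)) (gcd-greatest tg∣av tg∣vt)

  -- Distributivity of the divisor lattice, obtained by applying `∣lcm-gcd` to the left side itself.
  -- It is what relates the lcm of all numbers up to `j` to the lcm of the divisors of a given
  -- number.
  gcd-lcm-distrib : ∀ {a b d} → 1 ℕ.≤ d → gcd (lcm a b) d ∣ lcm (gcd a d) (gcd b d)
  gcd-lcm-distrib {a} {b} {d} p = ∣-trans (∣lcm-gcd {a} {b} (1≤gcd {lcm a b} p) (gcd[m,n]∣m (lcm a b) d))
    (lcm-mono {c = gcd a d} {gcd b d} (shrink a) (shrink b))
    where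
    t : ℕ
    t = gcd (lcm a b) d
    shrink : ∀ c → gcd c t ∣ gcd c d
    shrink c = gcd-greatest (gcd[m,n]∣m c t) (∣-trans (gcd[m,n]∣n c t) (gcd[m,n]∣n (lcm a b) d))

  lcmTo : ℕ → ℕ
  lcmTo zero = 1
  lcmTo (suc n) = lcm (lcmTo n) (suc n)

  1≤lcmTo : ∀ n → 1 ℕ.≤ lcmTo n
  1≤lcmTo zero = s≤s z≤n
  1≤lcmTo (suc n) = 1≤lcm (1≤lcmTo n) (s≤s z≤n)

  ∣lcmTo : ∀ {n d} → 1 ℕ.≤ d → d ℕ.≤ n → d ∣ lcmTo n
  ∣lcmTo {zero} {suc d} p ()
  ∣lcmTo {suc n} {d} p q with ℕₚ.m≤n⇒m<n∨m≡n q
  ... | inj₂ refl = n∣lcm[m,n] (lcmTo n) (suc n)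
  ... | inj₁ (s≤s r) = ∣-trans (∣lcmTo {n} p r) (m∣lcm[m,n] (lcmTo n) (suc n))

  -- The lcm of those divisors of `n` that are at most `j`. It rises from 1 to `n` as `j` does, so
  -- the divisor sum of `Λ` telescopes along it.
  lcmDiv : ℕ → ℕ → ℕ
  lcmDiv n zero = 1
  lcmDiv n (suc j) with suc j ∣? n
  ... | yes _ = lcm (lcmDiv n j) (suc j)
  ... | no _ = lcmDiv n j

  lcmDiv-∣ : ∀ n j → lcmDiv n j ∣ n
  lcmDiv-∣ n zero = 1∣ n
  lcmDiv-∣ n (suc j) with suc j ∣? n
  ... | yes d = lcm-least (lcmDiv-∣ n j) d
  ... | no _ = lcmDiv-∣ n j

  lcmDiv-∣lcmTo : ∀ n j → lcmDiv n j ∣ lcmTo j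
  lcmDiv-∣lcmTo n zero = ∣-refl
  lcmDiv-∣lcmTo n (suc j) with suc j ∣? n
  ... | yes d = lcm-mono (lcmDiv-∣lcmTo n j) ∣-refl
  ... | no _ = ∣-trans (lcmDiv-∣lcmTo n j) (m∣lcm[m,n] (lcmTo j) (suc j))

  ∣lcmDiv : ∀ {n d} j → 1 ℕ.≤ d → d ∣ n → d ℕ.≤ j → d ∣ lcmDiv n j
  ∣lcmDiv {n} {suc d} zero p q ()
  ∣lcmDiv {n} {d} (suc j) p q r with ℕₚ.m≤n⇒m<n∨m≡n r | suc j ∣? n
  ... | inj₂ refl | yes _ = n∣lcm[m,n] (lcmDiv n j) (suc j)
  ... | inj₂ refl | no nd = ⊥-elim (nd q)
  ... | inj₁ (s≤s s) | yes _ = ∣-trans (∣lcmDiv j p q s) (m∣lcm[m,n] (lcmDiv n j) (suc j))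
  ... | inj₁ (s≤s s) | no _ = ∣lcmDiv j p q s

  gcd-lcmTo : ∀ {n d} j i → 1 ℕ.≤ d → d ∣ n → i ℕ.≤ j → gcd (lcmTo i) d ∣ lcmDiv n j
  gcd-lcmTo {n} {d} j zero p q r = ∣-trans (gcd[m,n]∣m 1 d) (1∣ lcmDiv n j)
  gcd-lcmTo {n} {d} j (suc i) p q r = ∣-trans (gcd-lcm-distrib {lcmTo i} {suc i} {d} p)
    (lcm-least (gcd-lcmTo j i p q (ℕₚ.<⇒≤ r))
      (∣lcmDiv j (1≤gcd {suc i} p) (∣-trans (gcd[m,n]∣n (suc i) d) q) (ℕₚ.≤-trans (∣⇒≤ (gcd[m,n]∣m (suc i) d)) r)))

  -- Adjoining a divisor d of n multiplies `lcmDiv` by d / gcd, whereas `Λ` is defined with the gcd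
  -- of d and the full `lcmTo`. The two gcds agree, so the increments of `L (lcmDiv n j)` are values
  -- of `Λ`.
  gcd-lcmDiv : ∀ {n d} j → 1 ℕ.≤ d → d ∣ n → gcd (lcmDiv n j) d ≡ gcd (lcmTo j) d
  gcd-lcmDiv {n} {d} j p q = ∣-antisym
    (gcd-greatest (∣-trans (gcd[m,n]∣m (lcmDiv n j) d) (lcmDiv-∣lcmTo n j)) (gcd[m,n]∣n (lcmDiv n j) d))
    (gcd-greatest (gcd-lcmTo j j p q ℕₚ.≤-refl) (gcd[m,n]∣n (lcmTo j) d))

  -- Nothing about size is demanded here: the identities for Λ are purely algebraic, and the
  -- comparison with the logarithm is added later by `LogSys`.
  record Additive (L : ℕ → R) : Set where
    field
      L-* : ∀ {a b} → 1 ℕ.≤ a → 1 ℕ.≤ b → L (a ℕ.* b) ≡ L a + L b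
      0≤L : ∀ {a} → 1 ℕ.≤ a → ι 0 ≤ L a

    L-1 : L 1 ≡ ι 0
    L-1 = (≤-antisym (lin (L 1 ∷ []) (λ a → (a :+ a ≼ a) ∷ [] ⊢ (a ≼ con 0) by (0 , (1 , 0 ∷ []) ∷ [])) (≤-reflexive (sym (L-* {1} {1} (s≤s z≤n) (s≤s z≤n))))) (lin (L 1 ∷ []) (λ a → (a ≼ a :+ a) ∷ [] ⊢ (con 0 ≼ a) by (0 , (1 , 0 ∷ []) ∷ [])) (≤-reflexive (L-* {1} {1} (s≤s z≤n) (s≤s z≤n)))))

    L-∣ : ∀ {d n} → 1 ℕ.≤ n → d ∣ n → L d ≤ L n
    L-∣ {d} {n} p d∣n = (lin (L n ∷ L (n ÷ d) ∷ L d ∷ []) (λ a b c → (b :+ c ≼ a) ∷ (con 0 ≼ b) ∷ [] ⊢ (c ≼ a) by (0 , (1 , 0 ∷ []) ∷ (1 , 1 ∷ []) ∷ [])) (≤-reflexive (sym e)) (0≤L 1≤q))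
      where
      1≤d : 1 ℕ.≤ d
      1≤d = 1≤-∣ p d∣n
      1≤q : 1 ℕ.≤ n ÷ d
      1≤q = 1≤÷ 1≤d (∣⇒≤′ p d∣n)
      e : L n ≡ L (n ÷ d) + L d
      e = trans (cong L (trans (sym (∣⇒*÷ 1≤d d∣n)) (ℕₚ.*-comm d _))) (L-* 1≤q 1≤d)

    L-lcm : ∀ {a b} → 1 ℕ.≤ a → 1 ℕ.≤ b → L (lcm a b) ≡ L a + (L b - L (gcd a b))
    L-lcm {a} {b} p q = (≤-antisym (lin (L (gcd a b) ∷ L (lcm a b) ∷ L a ∷ L b ∷ []) (λ a b c d → (a :+ b ≼ c :+ d) ∷ [] ⊢ (b ≼ c :+ (d :- a)) by (0 , (1 , 0 ∷ []) ∷ [])) (≤-reflexive e)) (lin (L (gcd a b) ∷ L (lcm a b) ∷ L a ∷ L b ∷ []) (λ a b c d → (c :+ d ≼ a :+ b) ∷ [] ⊢ (c :+ (d :- a) ≼ b) by (0 , (1 , 0 ∷ []) ∷ [])) (≤-reflexive (sym e))))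
      where
      e : L (gcd a b) + L (lcm a b) ≡ L a + L b
      e = trans (sym (L-* (1≤gcd {a} q) (1≤lcm p q))) (trans (cong L (gcd*lcm a b)) (L-* p q))

    -- The von Mangoldt function: n / gcd (lcm (1 … n−1)) n is p when n is a power of the prime p, and 1 otherwise.
    Λ : ℕ → R
    Λ n = L n - L (gcd (lcmTo (ℕ.pred n)) n)

    0≤Λ : ∀ {n} → 1 ℕ.≤ n → ι 0 ≤ Λ n
    0≤Λ {n} p = (lin (L (gcd (lcmTo (ℕ.pred n)) n) ∷ L n ∷ []) (λ a b → (a ≼ b) ∷ [] ⊢ (con 0 ≼ b :- a) by (0 , (1 , 0 ∷ []) ∷ [])) (L-∣ p (gcd[m,n]∣n (lcmTo (ℕ.pred n)) n)))

    ψ : ℕ → R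
    ψ n = ∑ n Λ

    ψ≡L-lcmTo : ∀ n → ψ n ≡ L (lcmTo n)
    ψ≡L-lcmTo zero = sym L-1
    ψ≡L-lcmTo (suc n) = trans (cong (_+ Λ (suc n)) (ψ≡L-lcmTo n)) (sym (L-lcm (1≤lcmTo n) (s≤s z≤n)))

    ∑Λ-lcmDiv : ∀ {n} → 1 ℕ.≤ n → ∀ j → ∑ j (λ d → when (d ∣? n) (Λ d)) ≡ L (lcmDiv n j)
    ∑Λ-lcmDiv {n} p zero = sym L-1
    ∑Λ-lcmDiv {n} p (suc j) with suc j ∣? n
    ... | no _ = trans (+-identityʳ _) (∑Λ-lcmDiv p j)
    ... | yes d = trans (cong (_+ Λ (suc j)) (∑Λ-lcmDiv p j))
      (trans (cong (λ t → L (lcmDiv n j) + (L (suc j) - L t)) (sym (gcd-lcmDiv j (s≤s z≤n) d)))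
        (sym (L-lcm (1≤-∣ p (lcmDiv-∣ n j)) (s≤s z≤n))))

    ∑Λ : ∀ {n} → 1 ℕ.≤ n → ∑ n (λ d → when (d ∣? n) (Λ d)) ≡ L n
    ∑Λ {n} p = trans (∑Λ-lcmDiv p n) (cong L (∣-antisym (lcmDiv-∣ n n) (∣lcmDiv n p ∣-refl ℕₚ.≤-refl)))

  facs : ℕ → List ℕ
  facs zero = []
  facs n@(suc _) = factors (factorise n)

  facs-prime : ∀ n → All Prime (facs n)
  facs-prime zero = []
  facs-prime n@(suc _) = PrimeFactorisation.factorsPrime (factorise n)

  facs-product : ∀ {n} → 1 ℕ.≤ n → product (facs n) ≡ n
  facs-product {n@(suc _)} _ = sym (PrimeFactorisation.isFactorisation (factorise n))

  facs-unique : ∀ {n ps} → 1 ℕ.≤ n → n ≡ product ps → All Prime ps → facs n ↭ ps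
  facs-unique {n@(suc _)} {ps} p e h = factorisationUnique (factorise n) record { factors = ps ; isFactorisation = e ; factorsPrime = h }

  facs-* : ∀ {a b} → 1 ℕ.≤ a → 1 ℕ.≤ b → facs (a ℕ.* b) ↭ facs a ++ facs b
  facs-* {a} {b} p q = facs-unique (1≤-* p q)
    (sym (trans (product-++ (facs a) (facs b)) (cong₂ ℕ._*_ (facs-product p) (facs-product q))))
    (Allₚ.++⁺ (facs-prime a) (facs-prime b))

  1≤prime : ∀ {p} → Prime p → 1 ℕ.≤ p
  1≤prime {suc _} h = s≤s z≤n
  1≤prime {zero} h = ⊥-elim (¬prime[0] h)

  facs-prime* : ∀ {p n} → Prime p → 1 ℕ.≤ n → facs (p ℕ.* n) ↭ p ∷ facs n
  facs-prime* {p} {n} h q = facs-unique (1≤-* (1≤prime h) q) (cong (p ℕ.*_) (sym (facs-product q))) (h ∷ facs-prime n)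

  prime∣⇒∈facs : ∀ {p n} → Prime p → 1 ℕ.≤ n → p ∣ n → p ∈ facs n
  prime∣⇒∈facs {p} {n} h q d = factorisationHasAllPrimeFactors h (subst (p ∣_) (sym (facs-product q)) d) (facs-prime n)

  ∈facs⇒∣ : ∀ {p n} → 1 ℕ.≤ n → p ∈ facs n → p ∣ n
  ∈facs⇒∣ {p} {n} q h = subst (p ∣_) (facs-product q) (∈⇒∣product h)

  primeDivisor : ∀ {n} → 2 ℕ.≤ n → ∃ λ p → Prime p × p ∣ n
  primeDivisor {n} q with facs n in e | facs-prime n | facs-product (ℕₚ.<⇒≤ q)
  ... | [] | _ | e₁ = ⊥-elim (ℕₚ.<⇒≢ q e₁)
  ... | p ∷ ps | h ∷ _ | _ = p , h , ∈facs⇒∣ (ℕₚ.<⇒≤ q) (subst (p ∈_) (sym e) (here refl))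

  signList : List ℕ → R
  signList [] = ι 1
  signList (p ∷ ps) with p ∈? ps
  ... | yes _ = ι 0
  ... | no _ = ι 0 - signList ps

  signList-∈ : ∀ p ps → p ∈ ps → signList (p ∷ ps) ≡ ι 0
  signList-∈ p ps h with p ∈? ps
  ... | yes _ = refl
  ... | no n = ⊥-elim (n h)

  signList-∉ : ∀ p ps → p ∉ ps → signList (p ∷ ps) ≡ ι 0 - signList ps
  signList-∉ p ps h with p ∈? ps
  ... | yes y = ⊥-elim (h y)
  ... | no n = refl

  signList-cons : ∀ {p ps qs} → ps ↭ qs → signList ps ≡ signList qs → signList (p ∷ ps) ≡ signList (p ∷ qs)
  signList-cons {p} {ps} {qs} σ e with p ∈? ps
  ... | yes y = sym (signList-∈ p qs (∈-resp-↭ σ y))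
  ... | no n = trans (cong (ι 0 -_) e) (sym (signList-∉ p qs (λ y → n (∈-resp-↭ (↭-sym σ) y))))

  -- The factors of a product are known only up to permutation; invariance is what allows `μ` to be
  -- computed at `p * n`.
  signList-↭ : ∀ {ps qs} → ps ↭ qs → signList ps ≡ signList qs
  signList-↭ Perm.refl = refl
  signList-↭ (Perm.prep p σ) = signList-cons {p} σ (signList-↭ σ)
  signList-↭ (Perm.trans σ τ) = trans (signList-↭ σ) (signList-↭ τ)
  signList-↭ {ps} {qs} (Perm.swap {xs} {ys} p q σ) = trans (swapped (p ℕₚ.≟ q) (p ∈? xs) (q ∈? xs))
    (signList-cons {q} (Perm.prep p σ) (signList-cons {p} σ (signList-↭ σ)))
    where
    swapped : Dec (p ≡ q) → Dec (p ∈ xs) → Dec (q ∈ xs) → signList (p ∷ q ∷ xs) ≡ signList (q ∷ p ∷ xs)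
    swapped (yes refl) _ _ = refl
    swapped (no p≢q) (yes a) (yes b) = trans (signList-∈ p (q ∷ xs) (there a)) (sym (signList-∈ q (p ∷ xs) (there b)))
    swapped (no p≢q) (yes a) (no b) = trans (signList-∈ p (q ∷ xs) (there a))
      (sym (trans (signList-∉ q (p ∷ xs) (λ { (here e) → p≢q (sym e) ; (there b′) → b b′ }))
        (trans (cong (ι 0 -_) (signList-∈ p xs a)) (ring ([]) (con 0 :- con 0 ≈ con 0)))))
    swapped (no p≢q) (no a) (yes b) = trans (trans (signList-∉ p (q ∷ xs) (λ { (here e) → p≢q e ; (there a′) → a a′ }))
        (trans (cong (ι 0 -_) (signList-∈ q xs b)) (ring ([]) (con 0 :- con 0 ≈ con 0)))) (sym (signList-∈ q (p ∷ xs) (there b)))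
    swapped (no p≢q) (no a) (no b) = trans
      (trans (signList-∉ p (q ∷ xs) (λ { (here e) → p≢q e ; (there a′) → a a′ })) (cong (ι 0 -_) (signList-∉ q xs b)))
      (sym (trans (signList-∉ q (p ∷ xs) (λ { (here e) → p≢q (sym e) ; (there b′) → b b′ })) (cong (ι 0 -_) (signList-∉ p xs a))))

  signList-abs : ∀ ps → abs (signList ps) ≤ ι 1
  signList-abs [] = abs-lub ≤-refl (lin ([]) ([] ⊢ (con 0 :- con 1 ≼ con 1) by (0 , (2 , []) ∷ [])))
  signList-abs (p ∷ ps) with p ∈? ps
  ... | yes _ = abs-lub (lin ([]) ([] ⊢ (con 0 ≼ con 1) by (0 , (1 , []) ∷ []))) (lin ([]) ([] ⊢ (con 0 :- con 0 ≼ con 1) by (0 , (1 , []) ∷ [])))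
  ... | no _ = abs-lub (lin (s ∷ abs s ∷ []) (λ s a → (con 0 :- s ≼ a) ∷ (a ≼ con 1) ∷ [] ⊢ (con 0 :- s ≼ con 1) by (0 , (1 , 0 ∷ []) ∷ (1 , 1 ∷ []) ∷ [])) (-x≤abs s) (signList-abs ps))
                       (lin (s ∷ abs s ∷ []) (λ s a → (s ≼ a) ∷ (a ≼ con 1) ∷ [] ⊢ (con 0 :- (con 0 :- s) ≼ con 1) by (0 , (1 , 0 ∷ []) ∷ (1 , 1 ∷ []) ∷ [])) (x≤abs s) (signList-abs ps))
    where
    s : R
    s = signList ps

  μ : ℕ → R
  μ n = signList (facs n)

  μ-abs : ∀ n → abs (μ n) ≤ ι 1
  μ-abs n = signList-abs (facs n)

  μ-1 : μ 1 ≡ ι 1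
  μ-1 = signList-↭ (facs-unique {1} {[]} (s≤s z≤n) refl [])

  μ-prime-∣ : ∀ {p n} → Prime p → 1 ℕ.≤ n → p ∣ n → μ (p ℕ.* n) ≡ ι 0
  μ-prime-∣ {p} {n} h q d = trans (signList-↭ (facs-prime* h q)) (signList-∈ p (facs n) (prime∣⇒∈facs h q d))

  μ-prime-∤ : ∀ {p n} → Prime p → 1 ℕ.≤ n → ¬ (p ∣ n) → μ (p ℕ.* n) ≡ ι 0 - μ n
  μ-prime-∤ {p} {n} h q nd = trans (signList-↭ (facs-prime* h q)) (signList-∉ p (facs n) (λ y → nd (∈facs⇒∣ q y)))

  unless : ∀ {P : Set} → Dec P → R → R
  unless (yes _) x = ι 0
  unless (no _) x = x

  unless-when : ∀ {P : Set} (d : Dec P) x → x ≡ unless d x + when d x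
  unless-when (yes _) x = sym (+-identityˡ x)
  unless-when (no _) x = sym (+-identityʳ x)

  ∑-multiples : ∀ p → 1 ℕ.≤ p → ∀ n (f : ℕ → R) → ∑ n (λ d → when (p ∣? d) (f d)) ≡ ∑ (n ÷ p) (λ e → f (p ℕ.* e))
  ∑-multiples (suc p) _ zero f = refl
  ∑-multiples p@(suc _) h (suc n) f with p ∣? suc n
  ... | no nd = trans (+-identityʳ _) (trans (∑-multiples p h n f) (cong (λ k → ∑ k (λ e → f (p ℕ.* e))) (sym (÷-suc-∤ h nd))))
  ... | yes d = trans (cong₂ _+_ (∑-multiples p h n f) (cong f (trans (sym (∣⇒*÷ h d)) (cong (p ℕ.*_) (÷-suc-∣ h d)))))
     (cong (λ k → ∑ k (λ e → f (p ℕ.* e))) (sym (÷-suc-∣ h d)))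

  prime∤⇒∣ : ∀ {p d m} → Prime p → ¬ (p ∣ d) → d ∣ p ℕ.* m → d ∣ m
  prime∤⇒∣ {p} {d} h nd d∣ = coprime-divisor (gcd≡1⇒coprime g≡1) d∣
    where
    g≡1 : gcd d p ≡ 1
    g≡1 with prime⇒irreducible h (gcd[m,n]∣n d p)
    ... | inj₁ e = e
    ... | inj₂ e = ⊥-elim (nd (subst (_∣ d) e (gcd[m,n]∣m d p)))

  ∑μ-1 : ∑ 1 (λ d → when (d ∣? 1) (μ d)) ≡ ι 1
  ∑μ-1 = trans (+-identityˡ _) (trans (when-yes (1 ∣? 1) ∣-refl) μ-1)

  -- The divisors d of n prime to p cancel against the p d; those divisible by p² do not count.
  ∑μ-prime : ∀ {p n} → Prime p → 1 ℕ.≤ n → p ∣ n → ∑ n (λ d → when (d ∣? n) (μ d)) ≡ ι 0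
  ∑μ-prime {p} {n} h q p∣n = begin
    ∑ n (λ d → when (d ∣? n) (μ d))
      ≡⟨ ∑-cong n (λ d _ _ → unless-when (p ∣? d) _) ⟩
    ∑ n (λ d → unless (p ∣? d) (when (d ∣? n) (μ d)) + when (p ∣? d) (when (d ∣? n) (μ d)))
      ≡⟨ ∑-+ n _ _ ⟩
    ∑ n (λ d → unless (p ∣? d) (when (d ∣? n) (μ d))) + ∑ n (λ d → when (p ∣? d) (when (d ∣? n) (μ d)))
      ≡⟨ cong₂ _+_ (trans (∑-cong n (λ d a _ → coprimePart d a)) (sym (∑-extend _ (÷-≤ n p) beyond)))
                   (trans (∑-multiples p 1≤p n _) (∑-cong (n ÷ p) (λ e a _ → multiplePart e a))) ⟩
    ∑ (n ÷ p) F + ∑ (n ÷ p) (λ e → ι 0 - F e)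
      ≡⟨ sym (∑-+ (n ÷ p) _ _) ⟩
    ∑ (n ÷ p) (λ e → F e + (ι 0 - F e))
      ≡⟨ ∑-zero (n ÷ p) (λ e _ _ → (ring (F e ∷ []) (λ a → a :+ (con 0 :- a) ≈ con 0))) ⟩
    ι 0 ∎
    where
    open ≡-Reasoning
    1≤p : 1 ℕ.≤ p
    1≤p = 1≤prime h
    F : ℕ → R
    F e = unless (p ∣? e) (when (p ℕ.* e ∣? n) (μ e))
    coprimePart : ∀ d → 1 ℕ.≤ d → unless (p ∣? d) (when (d ∣? n) (μ d)) ≡ F d
    coprimePart d a with p ∣? d
    ... | yes _ = refl
    ... | no nd = when-iff (d ∣? n) (p ℕ.* d ∣? n)
      (λ d∣n → subst (p ℕ.* d ∣_) (∣⇒*÷ 1≤p p∣n) (*-monoʳ-∣ p (prime∤⇒∣ {m = n ÷ p} h nd (subst (d ∣_) (sym (∣⇒*÷ 1≤p p∣n)) d∣n))))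
      (λ pd∣n → m*n∣⇒n∣ p d pd∣n)
    multiplePart : ∀ e → 1 ℕ.≤ e → when (p ℕ.* e ∣? n) (μ (p ℕ.* e)) ≡ ι 0 - F e
    multiplePart e a with p ∣? e | p ℕ.* e ∣? n
    ... | yes d | yes _ = trans (μ-prime-∣ h a d) (ring ([]) (con 0 ≈ con 0 :- con 0))
    ... | yes d | no _ = (ring ([]) (con 0 ≈ con 0 :- con 0))
    ... | no nd | yes _ = μ-prime-∤ h a nd
    ... | no nd | no _ = (ring ([]) (con 0 ≈ con 0 :- con 0))
    beyond : ∀ i → n ÷ p ℕ.< i → i ℕ.≤ n → F i ≡ ι 0
    beyond i a _ with p ∣? i
    ... | yes _ = refl
    ... | no _ = when-no (p ℕ.* i ∣? n) (λ d → ℕₚ.<⇒≱ a (÷-least 1≤p (∣⇒≤′ q d)))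

  ∑μ : ∀ {n} → 2 ℕ.≤ n → ∑ n (λ d → when (d ∣? n) (μ d)) ≡ ι 0
  ∑μ {n} q with primeDivisor q
  ... | p , h , d = ∑μ-prime h (ℕₚ.<⇒≤ q) d

  -- The summand depends on b only through the product a b, so grouping by n = a b leaves the
  -- divisor sum of `f`. The free kernel lets one lemma serve both Λ and μ.
  hyperbola-one : ∀ (f g : ℕ → R) → (∀ {n} → 1 ℕ.≤ n → ∑ n (λ d → when (d ∣? n) (f d)) ≡ g n) →
    ∀ x (κ : ℕ → R) → ∑ x (λ a → ∑ (x ÷ a) (λ b → f a * κ (a ℕ.* b))) ≡ ∑ x (λ n → g n * κ n)
  hyperbola-one f g h x κ = trans (hyperbola x _) (∑-cong x (λ n p _ → begin
    ∑ n (λ a → when (a ∣? n) (f a * κ (a ℕ.* (n ÷ a))))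
      ≡⟨ ∑-cong n (λ a q _ → when-cong (a ∣? n) (λ d → cong (λ t → f a * κ t) (∣⇒*÷ q d))) ⟩
    ∑ n (λ a → when (a ∣? n) (f a * κ n))
      ≡⟨ ∑-cong n (λ a _ _ → pull (a ∣? n) (f a) (κ n)) ⟩
    ∑ n (λ a → when (a ∣? n) (f a) * κ n)
      ≡⟨ ∑-*ʳ n (κ n) _ ⟩
    ∑ n (λ a → when (a ∣? n) (f a)) * κ n
      ≡⟨ cong (_* κ n) (h p) ⟩
    g n * κ n ∎))
    where
    open ≡-Reasoning
    pull : ∀ {P : Set} (d : Dec P) x c → when d (x * c) ≡ when d x * c
    pull (yes _) x c = refl
    pull (no _) x c = sym (*-zeroˡ c)

  δ₁ : ℕ → R
  δ₁ 1 = ι 1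
  δ₁ _ = ι 0

  ∑μ-δ : ∀ {n} → 1 ℕ.≤ n → ∑ n (λ d → when (d ∣? n) (μ d)) ≡ δ₁ n
  ∑μ-δ {1} _ = ∑μ-1
  ∑μ-δ {suc (suc n)} _ = ∑μ {suc (suc n)} (s≤s (s≤s z≤n))

  möbius : ∀ {x} (κ : ℕ → R) → 1 ℕ.≤ x → ∑ x (λ a → ∑ (x ÷ a) (λ b → μ a * κ (a ℕ.* b))) ≡ κ 1
  möbius {x} κ p = trans (hyperbola-one μ δ₁ ∑μ-δ x κ)
    (trans (∑-single 1 _ (s≤s z≤n) p (λ i a _ i≢1 → off i a i≢1)) (*-identityˡ _))
    where
    off : ∀ i → 1 ℕ.≤ i → i ≢ 1 → δ₁ i * κ i ≡ ι 0
    off 1 _ n = ⊥-elim (n refl)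
    off (suc (suc i)) _ _ = *-zeroˡ _

-- Möbius inversion and the convolution identities for Λ, Λ₂, μ log and μ log²

module MangoldtIdentities where
  open SealedRationals
  open LinearArithmetic
  open FiniteSums
  open ArithmeticFunctions
  open import Data.Nat.Divisibility using (_∣_; _∣?_)
  open ≡-Reasoning

  ÷-comm : ∀ x {a b} → 1 ℕ.≤ a → 1 ℕ.≤ b → (x ÷ a) ÷ b ≡ (x ÷ b) ÷ a
  ÷-comm x {a} {b} p q = trans (÷÷ x p q) (trans (cong (x ÷_) (ℕₚ.*-comm a b)) (sym (÷÷ x q p)))

  ∑-one : ∀ n (c : R) → ∑ n (λ _ → c * ι 1) ≡ c * ι n
  ∑-one n c = trans (∑-const n _) (ring (ι n ∷ c ∷ []) (λ a c → a :* (c :* con 1) ≈ c :* a))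

  ∑μ-÷ : ∀ {z} → 1 ℕ.≤ z → ∑ z (λ d → μ d * ι (z ÷ d)) ≡ ι 1
  ∑μ-÷ {z} p = trans (∑-cong z (λ d _ _ → sym (∑-one (z ÷ d) (μ d)))) (möbius (λ _ → ι 1) p)

  -- After interchanging the sums, the coefficient of `f n` is the sum of μ(d) ⌊z/d⌋ over d ≤ z with
  -- z = `x ÷ n`, which is 1.
  möbius-inversion : ∀ (f G : ℕ → R) → (∀ y → G y ≡ ∑ y (λ n → f n * ι (y ÷ n))) →
    ∀ x → ∑ x (λ d → μ d * G (x ÷ d)) ≡ ∑ x f
  möbius-inversion f G h x = begin
    ∑ x (λ d → μ d * G (x ÷ d))
      ≡⟨ ∑-cong x (λ d _ _ → trans (cong (μ d *_) (h (x ÷ d))) (sym (∑-*ˡ (x ÷ d) (μ d) _))) ⟩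
    ∑ x (λ d → ∑ (x ÷ d) (λ n → μ d * (f n * ι ((x ÷ d) ÷ n))))
      ≡⟨ hyperbola-swap x _ ⟩
    ∑ x (λ n → ∑ (x ÷ n) (λ d → μ d * (f n * ι ((x ÷ d) ÷ n))))
      ≡⟨ ∑-cong x (λ n p _ → ∑-cong (x ÷ n) (λ d q _ → trans (cong (λ t → μ d * (f n * ι t)) (÷-comm x q p))
           (ring (μ d ∷ f n ∷ ι ((x ÷ n) ÷ d) ∷ []) (λ a b c → a :* (b :* c) ≈ b :* (a :* c))))) ⟩
    ∑ x (λ n → ∑ (x ÷ n) (λ d → f n * (μ d * ι ((x ÷ n) ÷ d))))
      ≡⟨ ∑-cong x (λ n p q → trans (∑-*ˡ (x ÷ n) (f n) _) (trans (cong (f n *_) (∑μ-÷ (1≤÷ p q))) (*-identityʳ _))) ⟩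
    ∑ x f ∎

  M : ℕ → R
  M n = ∑ n μ

  module Mangoldt {L : ℕ → R} (A : Additive L) where
    open Additive A

    T G : ℕ → R
    T n = ∑ n L
    G n = ∑ n (λ i → L i * L i)

    T≡∑Λ : ∀ y → T y ≡ ∑ y (λ n → Λ n * ι (y ÷ n))
    T≡∑Λ y = sym (trans (∑-cong y (λ n _ _ → sym (∑-one (y ÷ n) (Λ n))))
      (trans (hyperbola-one Λ L ∑Λ y (λ _ → ι 1)) (∑-cong y (λ n _ _ → *-identityʳ _))))

    Λ*Λ Λ₂ : ℕ → R
    Λ*Λ n = ∑ n (λ a → when (a ∣? n) (Λ a * Λ (n ÷ a)))
    Λ₂ n = Λ n * L n + Λ*Λ n

    0≤Λ*Λ : ∀ {n} → 1 ℕ.≤ n → ι 0 ≤ Λ*Λ n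
    0≤Λ*Λ {n} p = ∑-nonneg n (λ a q r → lem a q r (a ∣? n))
      where
      lem : ∀ a → 1 ℕ.≤ a → a ℕ.≤ n → (d : Dec (a ∣ n)) → ι 0 ≤ when d (Λ a * Λ (n ÷ a))
      lem a q r (yes d) = *-nonneg (0≤Λ q) (0≤Λ (1≤÷ q r))
      lem a q r (no _) = ≤-refl

    ∑Λ*Λ : ∀ x (w : ℕ → R) → ∑ x (λ a → ∑ (x ÷ a) (λ b → Λ a * Λ b * w (a ℕ.* b))) ≡ ∑ x (λ n → Λ*Λ n * w n)
    ∑Λ*Λ x w = trans (hyperbola x _) (∑-cong x (λ n p _ → trans (∑-cong n (λ a q _ → lem a n q (a ∣? n))) (∑-*ʳ n (w n) _)))
      where
      lem : ∀ a n → 1 ℕ.≤ a → (d : Dec (a ∣ n)) →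
        when d (Λ a * Λ (n ÷ a) * w (a ℕ.* (n ÷ a))) ≡ when d (Λ a * Λ (n ÷ a)) * w n
      lem a n q (yes d) = cong (λ t → Λ a * Λ (n ÷ a) * w t) (∣⇒*÷ q d)
      lem a n q (no _) = sym (*-zeroˡ _)

    -- One factor `L` is written as a divisor sum of `Λ`; in the other, `L (a * b)` splits into
    -- `L a + L b`. The first part gives Λ L, and in the second the sum of `L b` is again a sum of
    -- `Λ`, which gives the convolution square.
    G≡∑Λ₂ : ∀ y → G y ≡ ∑ y (λ n → Λ₂ n * ι (y ÷ n))
    G≡∑Λ₂ y = begin
      G y
        ≡⟨ sym (hyperbola-one Λ L ∑Λ y L) ⟩
      ∑ y (λ a → ∑ (y ÷ a) (λ b → Λ a * L (a ℕ.* b)))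
        ≡⟨ ∑-cong y (λ a p _ → trans (∑-cong (y ÷ a) (λ b q _ → trans (cong (Λ a *_) (L-* p q)) (*-distribˡ-+ _ _ _))) (∑-+ (y ÷ a) _ _)) ⟩
      ∑ y (λ a → ∑ (y ÷ a) (λ b → Λ a * L a) + ∑ (y ÷ a) (λ b → Λ a * L b))
        ≡⟨ ∑-+ y _ _ ⟩
      ∑ y (λ a → ∑ (y ÷ a) (λ b → Λ a * L a)) + ∑ y (λ a → ∑ (y ÷ a) (λ b → Λ a * L b))
        ≡⟨ cong₂ _+_ (∑-cong y (λ a _ _ → trans (∑-const (y ÷ a) _) (*-comm _ _))) (∑-cong y (λ a p _ → second a p)) ⟩
      ∑ y (λ a → Λ a * L a * ι (y ÷ a)) + ∑ y (λ a → ∑ (y ÷ a) (λ c → Λ a * Λ c * ι (y ÷ (a ℕ.* c))))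
        ≡⟨ cong (∑ y (λ a → Λ a * L a * ι (y ÷ a)) +_) (∑Λ*Λ y (λ n → ι (y ÷ n))) ⟩
      ∑ y (λ a → Λ a * L a * ι (y ÷ a)) + ∑ y (λ n → Λ*Λ n * ι (y ÷ n))
        ≡⟨ sym (∑-+ y _ _) ⟩
      ∑ y (λ n → Λ n * L n * ι (y ÷ n) + Λ*Λ n * ι (y ÷ n))
        ≡⟨ ∑-cong y (λ n _ _ → sym (*-distribʳ-+ _ _ _)) ⟩
      ∑ y (λ n → Λ₂ n * ι (y ÷ n)) ∎
      where
      second : ∀ a → 1 ℕ.≤ a → ∑ (y ÷ a) (λ b → Λ a * L b) ≡ ∑ (y ÷ a) (λ c → Λ a * Λ c * ι (y ÷ (a ℕ.* c)))
      second a p = trans (∑-*ˡ (y ÷ a) (Λ a) L) (trans (cong (Λ a *_) (T≡∑Λ (y ÷ a)))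
        (trans (sym (∑-*ˡ (y ÷ a) (Λ a) _)) (∑-cong (y ÷ a) (λ c q _ →
          trans (sym (*-assoc _ _ _)) (cong (λ t → Λ a * Λ c * ι t) (÷÷ y p q))))))

    ψ-möbius : ∀ x → ∑ x (λ d → μ d * T (x ÷ d)) ≡ ψ x
    ψ-möbius = möbius-inversion Λ T T≡∑Λ

    Λ₂-möbius : ∀ x → ∑ x (λ d → μ d * G (x ÷ d)) ≡ ∑ x Λ₂
    Λ₂-möbius = möbius-inversion Λ₂ G G≡∑Λ₂

    -- The kernel κ′ is the Möbius inverse of κ along multiples, so that ∑ b≤x/a κ′(a b) = κ(a);
    -- expanding ∑ μ(a) L(a b) κ′(a b) = L(1) κ′(1) = 0 with L(a b) = L(a) + L(b) gives the identity μ L = − μ * Λ.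
    ∑μL : ∀ x (κ : ℕ → R) →
      ∑ x (λ n → μ n * L n * κ n) ≡ ι 0 - ∑ x (λ a → ∑ (x ÷ a) (λ c → μ a * (Λ c * κ (a ℕ.* c))))
    ∑μL zero κ = (ring ([]) (con 0 ≈ con 0 :- con 0))
    ∑μL x@(suc _) κ = (≤-antisym (lin (S₁ ∷ S₂ ∷ []) (λ a b → (a :+ b ≼ con 0) ∷ [] ⊢ (a ≼ con 0 :- b) by (0 , (1 , 0 ∷ []) ∷ [])) (≤-reflexive total)) (lin (S₁ ∷ S₂ ∷ []) (λ a b → (con 0 ≼ a :+ b) ∷ [] ⊢ (con 0 :- b ≼ a) by (0 , (1 , 0 ∷ []) ∷ [])) (≤-reflexive (sym total))))
      where
      S₁ S₂ : R
      S₁ = ∑ x (λ n → μ n * L n * κ n)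
      S₂ = ∑ x (λ a → ∑ (x ÷ a) (λ c → μ a * (Λ c * κ (a ℕ.* c))))
      κ′ : ℕ → R
      κ′ n = ∑ (x ÷ n) (λ j → μ j * κ (n ℕ.* j))
      κ′-sum : ∀ n → 1 ℕ.≤ n → n ℕ.≤ x → ∑ (x ÷ n) (λ b → κ′ (n ℕ.* b)) ≡ κ n
      κ′-sum n p q = begin
        ∑ (x ÷ n) (λ b → κ′ (n ℕ.* b))
          ≡⟨ ∑-cong (x ÷ n) (λ b r _ → trans (cong (λ t → ∑ t (λ j → μ j * κ (n ℕ.* b ℕ.* j))) (sym (÷÷ x p r)))
               (∑-cong ((x ÷ n) ÷ b) (λ j _ _ → cong (λ t → μ j * κ t) (trans (ℕₚ.*-assoc n b j) (cong (n ℕ.*_) (ℕₚ.*-comm b j)))))) ⟩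
        ∑ (x ÷ n) (λ b → ∑ ((x ÷ n) ÷ b) (λ j → μ j * κ (n ℕ.* (j ℕ.* b))))
          ≡⟨ hyperbola-swap (x ÷ n) _ ⟩
        ∑ (x ÷ n) (λ j → ∑ ((x ÷ n) ÷ j) (λ b → μ j * κ (n ℕ.* (j ℕ.* b))))
          ≡⟨ möbius (λ t → κ (n ℕ.* t)) (1≤÷ p q) ⟩
        κ (n ℕ.* 1)
          ≡⟨ cong κ (ℕₚ.*-identityʳ n) ⟩
        κ n ∎
      first : ∑ x (λ a → ∑ (x ÷ a) (λ b → μ a * L a * κ′ (a ℕ.* b))) ≡ S₁
      first = ∑-cong x (λ a p q → trans (∑-*ˡ (x ÷ a) (μ a * L a) _) (cong (μ a * L a *_) (κ′-sum a p q)))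
      second : ∑ x (λ a → ∑ (x ÷ a) (λ b → μ a * (L b * κ′ (a ℕ.* b)))) ≡ S₂
      second = ∑-cong x λ a p q → begin
        ∑ (x ÷ a) (λ b → μ a * (L b * κ′ (a ℕ.* b)))
          ≡⟨ ∑-*ˡ (x ÷ a) (μ a) _ ⟩
        μ a * ∑ (x ÷ a) (λ b → L b * κ′ (a ℕ.* b))
          ≡⟨ cong (μ a *_) (sym (hyperbola-one Λ L ∑Λ (x ÷ a) (λ b → κ′ (a ℕ.* b)))) ⟩
        μ a * ∑ (x ÷ a) (λ c → ∑ ((x ÷ a) ÷ c) (λ e → Λ c * κ′ (a ℕ.* (c ℕ.* e))))
          ≡⟨ cong (μ a *_) (∑-cong (x ÷ a) (λ c r s → inner a c p r s)) ⟩
        μ a * ∑ (x ÷ a) (λ c → Λ c * κ (a ℕ.* c))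
          ≡⟨ sym (∑-*ˡ (x ÷ a) (μ a) _) ⟩
        ∑ (x ÷ a) (λ c → μ a * (Λ c * κ (a ℕ.* c))) ∎
        where
        inner : ∀ a c → 1 ℕ.≤ a → 1 ℕ.≤ c → c ℕ.≤ x ÷ a →
          ∑ ((x ÷ a) ÷ c) (λ e → Λ c * κ′ (a ℕ.* (c ℕ.* e))) ≡ Λ c * κ (a ℕ.* c)
        inner a c p r s = trans (∑-*ˡ ((x ÷ a) ÷ c) (Λ c) _) (cong (Λ c *_) (trans
          (trans (cong (λ t → ∑ t (λ e → κ′ (a ℕ.* (c ℕ.* e)))) (÷÷ x p r))
            (∑-cong (x ÷ (a ℕ.* c)) (λ e _ _ → cong κ′ (sym (ℕₚ.*-assoc a c e)))))
          (κ′-sum (a ℕ.* c) (1≤-* p r) (÷-most {x} {a} s))))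
      total : S₁ + S₂ ≡ ι 0
      total = begin
        S₁ + S₂
          ≡⟨ cong₂ _+_ (sym first) (sym second) ⟩
        ∑ x (λ a → ∑ (x ÷ a) (λ b → μ a * L a * κ′ (a ℕ.* b))) + ∑ x (λ a → ∑ (x ÷ a) (λ b → μ a * (L b * κ′ (a ℕ.* b))))
          ≡⟨ sym (∑-+ x _ _) ⟩
        ∑ x (λ a → ∑ (x ÷ a) (λ b → μ a * L a * κ′ (a ℕ.* b)) + ∑ (x ÷ a) (λ b → μ a * (L b * κ′ (a ℕ.* b))))
          ≡⟨ ∑-cong x (λ a p _ → trans (sym (∑-+ (x ÷ a) _ _)) (∑-cong (x ÷ a) (λ b q _ → trans
               (ring (μ a ∷ L a ∷ κ′ (a ℕ.* b) ∷ L b ∷ []) (λ a b c d → a :* b :* c :+ a :* (d :* c) ≈ a :* ((b :+ d) :* c)))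
               (cong (λ t → μ a * (t * κ′ (a ℕ.* b))) (sym (L-* p q)))))) ⟩
        ∑ x (λ a → ∑ (x ÷ a) (λ b → μ a * (L (a ℕ.* b) * κ′ (a ℕ.* b))))
          ≡⟨ möbius {x} (λ n → L n * κ′ n) (s≤s z≤n) ⟩
        L 1 * κ′ 1
          ≡⟨ trans (cong (_* κ′ 1) L-1) (*-zeroˡ _) ⟩
        ι 0 ∎

    ∑μL≡-∑ΛM : ∀ x → ∑ x (λ n → μ n * L n) ≡ ι 0 - ∑ x (λ c → Λ c * M (x ÷ c))
    ∑μL≡-∑ΛM x = begin
      ∑ x (λ n → μ n * L n)
        ≡⟨ ∑-cong x (λ n _ _ → sym (*-identityʳ _)) ⟩
      ∑ x (λ n → μ n * L n * ι 1)
        ≡⟨ ∑μL x (λ _ → ι 1) ⟩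
      ι 0 - ∑ x (λ a → ∑ (x ÷ a) (λ c → μ a * (Λ c * ι 1)))
        ≡⟨ cong (ι 0 -_) (trans (hyperbola-swap x _) (∑-cong x (λ c _ _ →
             trans (∑-*ʳ (x ÷ c) (Λ c * ι 1) μ) (trans (cong (M (x ÷ c) *_) (*-identityʳ _)) (*-comm _ _))))) ⟩
      ι 0 - ∑ x (λ c → Λ c * M (x ÷ c)) ∎

    -- `∑μL` with kernel `L` produces `L (a * c)`, which splits into `L a + L c`. The part with
    -- `L c` is -Λ L; in the part with `L a` the identity applies a second time, and the two minus
    -- signs turn the convolution square of Λ positive.
    ∑μL² : ∀ x → ∑ x (λ n → μ n * (L n * L n)) ≡ ∑ x (λ n → (Λ*Λ n - Λ n * L n) * M (x ÷ n))
    ∑μL² x = begin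
      ∑ x (λ n → μ n * (L n * L n))
        ≡⟨ ∑-cong x (λ n _ _ → sym (*-assoc _ _ _)) ⟩
      ∑ x (λ n → μ n * L n * L n)
        ≡⟨ ∑μL x L ⟩
      ι 0 - ∑ x (λ a → ∑ (x ÷ a) (λ c → μ a * (Λ c * L (a ℕ.* c))))
        ≡⟨ cong (ι 0 -_) (hyperbola-swap x _) ⟩
      ι 0 - ∑ x (λ c → ∑ (x ÷ c) (λ a → μ a * (Λ c * L (a ℕ.* c))))
        ≡⟨ cong (ι 0 -_) (trans (∑-cong x (λ c p _ → inner c p)) (∑-- x _ _)) ⟩
      ι 0 - (∑ x (λ c → Λ c * L c * M (x ÷ c)) - ∑ x (λ c → ∑ (x ÷ c) (λ e → Λ c * Λ e * M (x ÷ (c ℕ.* e)))))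
        ≡⟨ cong (λ t → ι 0 - (P - t)) (∑Λ*Λ x (λ n → M (x ÷ n))) ⟩
      ι 0 - (P - Q)
        ≡⟨ (ring (P ∷ Q ∷ []) (λ P Q → con 0 :- (P :- Q) ≈ Q :- P)) ⟩
      Q - P
        ≡⟨ trans (sym (∑-- x _ _)) (∑-cong x (λ n _ _ → (ring (Λ*Λ n ∷ M (x ÷ n) ∷ Λ n ∷ L n ∷ []) (λ a b c d → a :* b :- c :* d :* b ≈ (a :- c :* d) :* b)))) ⟩
      ∑ x (λ n → (Λ*Λ n - Λ n * L n) * M (x ÷ n)) ∎
      where
      P Q : R
      P = ∑ x (λ c → Λ c * L c * M (x ÷ c))
      Q = ∑ x (λ n → Λ*Λ n * M (x ÷ n))
      inner : ∀ c → 1 ℕ.≤ c → ∑ (x ÷ c) (λ a → μ a * (Λ c * L (a ℕ.* c)))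
        ≡ Λ c * L c * M (x ÷ c) - ∑ (x ÷ c) (λ e → Λ c * Λ e * M (x ÷ (c ℕ.* e)))
      inner c p = begin
        ∑ (x ÷ c) (λ a → μ a * (Λ c * L (a ℕ.* c)))
          ≡⟨ trans (∑-cong (x ÷ c) (λ a q _ → trans (cong (λ t → μ a * (Λ c * t)) (L-* q p))
               (ring (μ a ∷ Λ c ∷ L a ∷ L c ∷ []) (λ a b c d → a :* (b :* (c :+ d)) ≈ a :* (b :* d) :+ b :* (a :* c))))) (∑-+ (x ÷ c) _ _) ⟩
        ∑ (x ÷ c) (λ a → μ a * (Λ c * L c)) + ∑ (x ÷ c) (λ a → Λ c * (μ a * L a))
          ≡⟨ cong₂ _+_ (trans (∑-*ʳ (x ÷ c) _ μ) (*-comm _ _)) (trans (∑-*ˡ (x ÷ c) (Λ c) _) (cong (Λ c *_) (∑μL≡-∑ΛM (x ÷ c)))) ⟩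
        Λ c * L c * M (x ÷ c) + Λ c * (ι 0 - S)
          ≡⟨ (ring (Λ c ∷ L c ∷ M (x ÷ c) ∷ S ∷ []) (λ a b c S → a :* b :* c :+ a :* (con 0 :- S) ≈ a :* b :* c :- a :* S)) ⟩
        Λ c * L c * M (x ÷ c) - Λ c * S
          ≡⟨ cong (Λ c * L c * M (x ÷ c) -_) (trans (sym (∑-*ˡ (x ÷ c) (Λ c) _)) (∑-cong (x ÷ c) (λ e q _ →
               trans (sym (*-assoc _ _ _)) (cong (λ t → Λ c * Λ e * M t) (÷÷ x p q))))) ⟩
        Λ c * L c * M (x ÷ c) - ∑ (x ÷ c) (λ e → Λ c * Λ e * M (x ÷ (c ℕ.* e))) ∎
        where
        S : R
        S = ∑ (x ÷ c) (λ e → Λ e * M ((x ÷ c) ÷ e))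

-- Sums of 1/n, log n / n, log n and log² n with explicit error terms

module LogarithmicSums where
  open SealedRationals
  open LinearArithmetic
  open FiniteSums
  open ArithmeticFunctions
  open MangoldtIdentities

  -- Explicit intervals take the place of O-terms: the constants have to be known before `V` and `L`
  -- are chosen.
  Within : R → R → Set
  Within c x = (ι 0 - c ≤ x) × (x ≤ c)

  within-+ : ∀ {a b x y} → Within a x → Within b y → Within (a + b) (x + y)
  within-+ {a} {b} {x} {y} (p , q) (r , s) =
    (lin (a ∷ x ∷ b ∷ y ∷ []) (λ a x b y → (con 0 :- a ≼ x) ∷ (con 0 :- b ≼ y) ∷ [] ⊢ (con 0 :- (a :+ b) ≼ x :+ y) by (0 , (1 , 0 ∷ []) ∷ (1 , 1 ∷ []) ∷ [])) p r) , +-mono-≤ q s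

  within-neg : ∀ {a x} → Within a x → Within a (ι 0 - x)
  within-neg {a} {x} (p , q) = (lin (x ∷ a ∷ []) (λ x a → (x ≼ a) ∷ [] ⊢ (con 0 :- a ≼ con 0 :- x) by (0 , (1 , 0 ∷ []) ∷ [])) q) , (lin (a ∷ x ∷ []) (λ a x → (con 0 :- a ≼ x) ∷ [] ⊢ (con 0 :- x ≼ a) by (0 , (1 , 0 ∷ []) ∷ [])) p)

  within-* : ∀ {a b x y} → Within a x → Within b y → Within (a * b) (x * y)
  within-* {a} {b} {x} {y} (p , q) (r , s) =
    (lin (a ∷ x ∷ b ∷ y ∷ []) (λ a x b y → (con 0 :- a ≼ x) ∷ (x ≼ a) ∷ (con 0 :- b ≼ y) ∷ (y ≼ b) ∷ [] ⊢ (con 0 :- a :* b ≼ x :* y) by (1 , (1 , 0 ∷ 2 ∷ []) ∷ (1 , 1 ∷ 3 ∷ []) ∷ [])) p q r s) ,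
    (lin (a ∷ x ∷ b ∷ y ∷ []) (λ a x b y → (con 0 :- a ≼ x) ∷ (x ≼ a) ∷ (con 0 :- b ≼ y) ∷ (y ≼ b) ∷ [] ⊢ (x :* y ≼ a :* b) by (1 , (1 , 0 ∷ 3 ∷ []) ∷ (1 , 1 ∷ 2 ∷ []) ∷ [])) p q r s)

  within-mono : ∀ {a b x} → a ≤ b → Within a x → Within b x
  within-mono {a} {b} {x} h (p , q) = (lin (a ∷ b ∷ x ∷ []) (λ a b x → (a ≼ b) ∷ (con 0 :- a ≼ x) ∷ [] ⊢ (con 0 :- b ≼ x) by (0 , (1 , 0 ∷ []) ∷ (1 , 1 ∷ []) ∷ [])) h p) , ≤-trans q h

  within-0≤ : ∀ {a x} → ι 0 ≤ x → x ≤ a → Within a x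
  within-0≤ {a} {x} p q = (lin (x ∷ a ∷ []) (λ x a → (con 0 ≼ x) ∷ (x ≼ a) ∷ [] ⊢ (con 0 :- a ≼ x) by (0 , (2 , 0 ∷ []) ∷ (1 , 1 ∷ []) ∷ [])) p q) , q

  within-abs : ∀ {a x} → Within a x → abs x ≤ a
  within-abs {a} {x} (p , q) = abs-lub q (lin (a ∷ x ∷ []) (λ a x → (con 0 :- a ≼ x) ∷ [] ⊢ (con 0 :- x ≼ a) by (0 , (1 , 0 ∷ []) ∷ [])) p)

  abs-within : ∀ {a x} → abs x ≤ a → Within a x
  abs-within {a} {x} p = (lin (abs x ∷ a ∷ x ∷ []) (λ b a x → (b ≼ a) ∷ (con 0 :- x ≼ b) ∷ [] ⊢ (con 0 :- a ≼ x) by (0 , (1 , 0 ∷ []) ∷ (1 , 1 ∷ []) ∷ [])) p (-x≤abs x)) , ≤-trans (x≤abs x) p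

  -- L approximates the natural logarithm on {1, …, V}; it is exactly additive, and its increments are those of log up to O(1/n²).
  record LogSys (V : ℕ) (L : ℕ → R) : Set where
    field
      additive : Additive L
      lower : ∀ {n} → 1 ℕ.≤ n → n ℕ.< V → u (suc n) - (u n - u (suc n)) ≤ L (suc n) - L n
      upper : ∀ {n} → 1 ℕ.≤ n → n ℕ.< V → L (suc n) - L n ≤ u (suc n) + ι 2 * (u n - u (suc n))

    open Additive additive public
    open MangoldtIdentities.Mangoldt additive public

  H : ℕ → R
  H n = ∑ n u

  u-1 : u 1 ≡ ι 1
  u-1 = trans (sym (*-identityˡ _)) (ι*u (s≤s z≤n))

  H-1 : H 1 ≡ ι 1
  H-1 = trans (+-identityˡ _) u-1

  module Estimates {V : ℕ} {L : ℕ → R} (ls : LogSys V L) where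
    open LogSys ls

    -- The method behind every estimate of this part. The quantity to be approximated, once with a
    -- correction added and once with its sign reversed, is made monotone in `n`; comparison with
    -- `n = 1` or with the end `V` of the range then bounds it on both sides.
    monotone-upto : ∀ (F : ℕ → R) → (∀ n → 1 ℕ.≤ n → n ℕ.< V → F n ≤ F (suc n)) → ∀ {m n} → 1 ℕ.≤ m → m ℕ.≤ n → n ℕ.≤ V → F m ≤ F n
    monotone-upto F h {suc m} {zero} p () r
    monotone-upto F h {m} {suc n} p q r with ℕₚ.m≤n⇒m<n∨m≡n q
    ... | inj₂ refl = ≤-refl
    ... | inj₁ (s≤s q′) = ≤-trans (monotone-upto F h p q′ (ℕₚ.<⇒≤ r)) (h n (ℕₚ.≤-trans p q′) r)

    module Step (n : ℕ) (p : 1 ℕ.≤ n) (q : n ℕ.< V) where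
      N a b D : R
      N = ι n
      a = u n
      b = u (suc n)
      D = L (suc n) - L n
      0≤b : ι 0 ≤ b
      0≤b = 0≤u (s≤s z≤n)
      0≤a : ι 0 ≤ a
      0≤a = 0≤u p
      a≤1 : a ≤ ι 1
      a≤1 = u≤1 p
      b≤1 : b ≤ ι 1
      b≤1 = u≤1 (s≤s z≤n)
      1≤N : ι 1 ≤ N
      1≤N = ι-mono p
      a-b : a - b ≡ a * b
      a-b = u-step p
      Na : N * a ≡ ι 1
      Na = ι*u p
      Nb : N * b ≡ ι 1 - b
      Nb = (≤-antisym (lin (N ∷ b ∷ []) (λ N b → ((con 1 :+ N) :* b ≼ con 1) ∷ [] ⊢ (N :* b ≼ con 1 :- b) by (0 , (1 , 0 ∷ []) ∷ [])) (≤-reflexive (trans (cong (_* b) (sym (ι-suc n))) (ι*u (s≤s z≤n))))) (lin (N ∷ b ∷ []) (λ N b → (con 1 ≼ (con 1 :+ N) :* b) ∷ [] ⊢ (con 1 :- b ≼ N :* b) by (0 , (1 , 0 ∷ []) ∷ [])) (≤-reflexive (sym (trans (cong (_* b) (sym (ι-suc n))) (ι*u (s≤s z≤n)))))))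
      ab≤b : a * b ≤ b
      ab≤b = (lin (b ∷ a ∷ []) (λ b a → (con 0 ≼ b) ∷ (a ≼ con 1) ∷ [] ⊢ (a :* b ≼ b) by (0 , (1 , 0 ∷ 1 ∷ []) ∷ [])) 0≤b a≤1)
      0≤ab : ι 0 ≤ a * b
      0≤ab = *-nonneg 0≤a 0≤b
      lo : b - (a - b) ≤ D
      lo = lower p q
      hi : D ≤ b + ι 2 * (a - b)
      hi = upper p q
      0≤D : ι 0 ≤ D
      0≤D = (lin (b ∷ a ∷ D ∷ []) (λ b a D → (b :- (a :- b) ≼ D) ∷ (a :- b ≼ a :* b) ∷ (a :* b ≼ b) ∷ [] ⊢ (con 0 ≼ D) by (0 , (1 , 0 ∷ []) ∷ (1 , 1 ∷ []) ∷ (1 , 2 ∷ []) ∷ [])) lo (≤-reflexive a-b) ab≤b)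
      D≤3b : D ≤ ι 3 * b
      D≤3b = (lin (D ∷ b ∷ a ∷ []) (λ D b a → (D ≼ b :+ con 2 :* (a :- b)) ∷ (a :- b ≼ a :* b) ∷ (a :* b ≼ b) ∷ [] ⊢ (D ≼ con 3 :* b) by (0 , (1 , 0 ∷ []) ∷ (2 , 1 ∷ []) ∷ (2 , 2 ∷ []) ∷ [])) hi (≤-reflexive a-b) ab≤b)
      ND-hi : N * D ≤ ι 1 + b
      ND-hi = ≤-trans (*-monoʳ-≤ (≤-trans (0≤ι 1) 1≤N) hi)
        (lin (N ∷ a ∷ b ∷ []) (λ N a b → (N :* a ≼ con 1) ∷ (con 1 :- b ≼ N :* b) ∷ [] ⊢ (N :* (b :+ con 2 :* (a :- b)) ≼ con 1 :+ b) by (0 , (2 , 0 ∷ []) ∷ (1 , 1 ∷ []) ∷ [])) (≤-reflexive Na) (≤-reflexive (sym Nb)))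
      ND-lo : ι 1 - ι 2 * b ≤ N * D
      ND-lo = ≤-trans (lin (N ∷ a ∷ b ∷ []) (λ N a b → (N :* a ≼ con 1) ∷ (con 1 :- b ≼ N :* b) ∷ [] ⊢ (con 1 :- con 2 :* b ≼ N :* (b :- (a :- b))) by (0 , (1 , 0 ∷ []) ∷ (2 , 1 ∷ []) ∷ [])) (≤-reflexive Na) (≤-reflexive (sym Nb))) (*-monoʳ-≤ (≤-trans (0≤ι 1) 1≤N) lo)
      L′ : L n ≡ L (suc n) - D
      L′ = (ring (L n ∷ L (suc n) ∷ []) (λ a b → a ≈ b :- (b :- a)))
      0≤Ln : ι 0 ≤ L n
      0≤Ln = 0≤L p
      0≤Ls : ι 0 ≤ L (suc n)
      0≤Ls = 0≤L (s≤s z≤n)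
      ιs : ι (suc n) ≡ ι 1 + N
      ιs = ι-suc n

    L-mono : ∀ {m n} → 1 ℕ.≤ m → m ℕ.≤ n → n ℕ.≤ V → L m ≤ L n
    L-mono = monotone-upto L (λ n p q → (lin (L (suc n) ∷ L n ∷ []) (λ a b → (con 0 ≼ a :- b) ∷ [] ⊢ (b ≼ a) by (0 , (1 , 0 ∷ []) ∷ [])) (Step.0≤D n p q)))

    -- Stands in for Euler's constant. There is no limit to take, as `L` is accurate only up to `V`;
    -- the value at `V` approximates all earlier ones equally well.
    γ : R
    γ = H V - L V

    H-L-lower : ∀ {m n} → 1 ℕ.≤ m → m ℕ.≤ n → n ℕ.≤ V → H m - L m - ι 2 * u m ≤ H n - L n - ι 2 * u n
    H-L-lower = monotone-upto (λ n → H n - L n - ι 2 * u n) λ n p q → let open Step n p q in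
      (lin (L (suc n) ∷ L n ∷ u (suc n) ∷ u n ∷ H n ∷ []) (λ a b c d e → (a :- b ≼ c :+ con 2 :* (d :- c)) ∷ [] ⊢ (e :- b :- con 2 :* d ≼ e :+ c :- a :- con 2 :* c) by (0 , (1 , 0 ∷ []) ∷ [])) hi)

    H-L-upper : ∀ {m n} → 1 ℕ.≤ m → m ℕ.≤ n → n ℕ.≤ V → ι 0 - (H m - L m + u m) ≤ ι 0 - (H n - L n + u n)
    H-L-upper = monotone-upto (λ n → ι 0 - (H n - L n + u n)) λ n p q → let open Step n p q in
      (lin (u (suc n) ∷ u n ∷ L (suc n) ∷ L n ∷ H n ∷ []) (λ a b c d e → (a :- (b :- a) ≼ c :- d) ∷ [] ⊢ (con 0 :- (e :- d :+ b) ≼ con 0 :- (e :+ a :- c :+ a)) by (0 , (1 , 0 ∷ []) ∷ [])) lo)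

    H≤L+2 : ∀ {n} → 1 ℕ.≤ n → n ℕ.≤ V → H n ≤ L n + ι 2
    H≤L+2 {n} p q = (lin (H 1 ∷ L 1 ∷ u 1 ∷ H n ∷ L n ∷ u n ∷ []) (λ a b c d e f → (con 0 :- (a :- b :+ c) ≼ con 0 :- (d :- e :+ f)) ∷ (a ≼ con 1) ∷ (c ≼ con 1) ∷ (con 0 ≼ b) ∷ (con 0 ≼ f) ∷ [] ⊢ (d ≼ e :+ con 2) by (0 , (1 , 0 ∷ []) ∷ (1 , 1 ∷ []) ∷ (1 , 2 ∷ []) ∷ (1 , 3 ∷ []) ∷ (1 , 4 ∷ []) ∷ [])) (H-L-upper (s≤s z≤n) p q) (≤-reflexive H-1) (≤-reflexive u-1) (≤-reflexive (sym L-1)) (0≤u p))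

    L≤H+1 : ∀ {n} → 1 ℕ.≤ n → n ℕ.≤ V → L n ≤ H n + ι 1
    L≤H+1 {n} p q = (lin (H 1 ∷ L 1 ∷ u 1 ∷ H n ∷ L n ∷ u n ∷ []) (λ a b c d e f → (a :- b :- con 2 :* c ≼ d :- e :- con 2 :* f) ∷ (con 1 ≼ a) ∷ (c ≼ con 1) ∷ (b ≼ con 0) ∷ (con 0 ≼ f) ∷ [] ⊢ (e ≼ d :+ con 1) by (0 , (1 , 0 ∷ []) ∷ (1 , 1 ∷ []) ∷ (2 , 2 ∷ []) ∷ (1 , 3 ∷ []) ∷ (2 , 4 ∷ []) ∷ [])) (H-L-lower (s≤s z≤n) p q) (≤-reflexive (sym H-1)) (≤-reflexive u-1) (≤-reflexive L-1) (0≤u p))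

    0≤H : ∀ n → ι 0 ≤ H n
    0≤H n = ∑-nonneg n (λ i p _ → 0≤u p)

    H-approx : ∀ {n} → 1 ℕ.≤ n → n ℕ.≤ V → (γ - u n ≤ H n - L n) × (H n - L n ≤ γ + ι 2 * u n)
    H-approx {n} p q =
      (lin (H n ∷ L n ∷ u n ∷ H V ∷ L V ∷ u V ∷ []) (λ a b c d e f → (con 0 :- (a :- b :+ c) ≼ con 0 :- (d :- e :+ f)) ∷ (con 0 ≼ f) ∷ [] ⊢ (d :- e :- c ≼ a :- b) by (0 , (1 , 0 ∷ []) ∷ (1 , 1 ∷ []) ∷ [])) (H-L-upper p q ℕₚ.≤-refl) 0≤uV) ,
      (lin (H n ∷ L n ∷ u n ∷ H V ∷ L V ∷ u V ∷ []) (λ a b c d e f → (a :- b :- con 2 :* c ≼ d :- e :- con 2 :* f) ∷ (con 0 ≼ f) ∷ [] ⊢ (a :- b ≼ d :- e :+ con 2 :* c) by (0 , (1 , 0 ∷ []) ∷ (2 , 1 ∷ []) ∷ [])) (H-L-lower p q ℕₚ.≤-refl) 0≤uV)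
      where
      0≤uV : ι 0 ≤ u V
      0≤uV = 0≤u (ℕₚ.≤-trans p q)

    γ-bounds : 1 ℕ.≤ V → (ι 0 - ι 1 ≤ γ) × (γ ≤ ι 2)
    γ-bounds v = (lin (H 1 ∷ L 1 ∷ γ ∷ u 1 ∷ []) (λ a b c d → (a :- b ≼ c :+ con 2 :* d) ∷ (con 1 ≼ a) ∷ (d ≼ con 1) ∷ (b ≼ con 0) ∷ [] ⊢ (con 0 :- con 1 ≼ c) by (0 , (1 , 0 ∷ []) ∷ (1 , 1 ∷ []) ∷ (2 , 2 ∷ []) ∷ (1 , 3 ∷ []) ∷ [])) (proj₂ approx) (≤-reflexive (sym H-1)) (≤-reflexive u-1) (≤-reflexive L-1)) ,
                 (lin (γ ∷ u 1 ∷ H 1 ∷ L 1 ∷ []) (λ a b c d → (a :- b ≼ c :- d) ∷ (c ≼ con 1) ∷ (b ≼ con 1) ∷ (con 0 ≼ d) ∷ [] ⊢ (a ≼ con 2) by (0 , (1 , 0 ∷ []) ∷ (1 , 1 ∷ []) ∷ (1 , 2 ∷ []) ∷ (1 , 3 ∷ []) ∷ [])) (proj₁ approx) (≤-reflexive H-1) (≤-reflexive u-1) (≤-reflexive (sym L-1)))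
      where
      approx : (γ - u 1 ≤ H 1 - L 1) × (H 1 - L 1 ≤ γ + ι 2 * u 1)
      approx = H-approx (s≤s z≤n) v

    H₁ : ℕ → R
    H₁ n = ∑ n (λ i → L i * u i)

    -- Stands in for twice the first Stieltjes constant.
    γ₁ : R
    γ₁ = ι 2 * H₁ V - L V * L V

    module _ {m : ℕ} (m≥1 : 1 ℕ.≤ m) (m≤V : m ℕ.≤ V) where
      private
        lowerF upperF Φ : ℕ → R
        -- One step changes the main difference by at most `(4 L + 9) a b`, with `L` taken at
        -- `n + 1`. The fall of `u` lowers `Φ` by `(4 L + 21) a b`, of which the growth of `L` takes
        -- back at most `12 a b`, because `D ≤ 3 b`.
        Φ n = (ι 4 * L n + ι 21) * u n
        lowerF n = (ι 2 * H₁ n - L n * L n) - Φ n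
        upperF n = ι 0 - ((ι 2 * H₁ n - L n * L n) + Φ n)
        module S (n : ℕ) (p : 1 ℕ.≤ n) (q : n ℕ.< V) where
          open Step n p q
          drop : (ι 4 * L (suc n) + ι 9) * (a * b) ≤ (ι 4 * L n + ι 21) * a - (ι 4 * L (suc n) + ι 21) * b
          drop = (lin (a ∷ D ∷ b ∷ L n ∷ L (suc n) ∷ []) (λ a D b c d → (a :* D ≼ con 3 :* (a :* b)) ∷ ((con 4 :* d :+ con 21) :* (a :* b) ≼ (con 4 :* d :+ con 21) :* (a :- b)) ∷ (d :* a :- a :* D ≼ c :* a) ∷ [] ⊢ ((con 4 :* d :+ con 9) :* (a :* b) ≼ (con 4 :* c :+ con 21) :* a :- (con 4 :* d :+ con 21) :* b) by (0 , (4 , 0 ∷ []) ∷ (1 , 1 ∷ []) ∷ (4 , 2 ∷ []) ∷ [])) aD (≤-reflexive (sym e)) (≤-reflexive (sym e₂)))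
            where
            aD : a * D ≤ ι 3 * (a * b)
            aD = (lin (D ∷ b ∷ a ∷ []) (λ D b a → (D ≼ con 3 :* b) ∷ (con 0 ≼ a) ∷ [] ⊢ (a :* D ≼ con 3 :* (a :* b)) by (0 , (1 , 0 ∷ 1 ∷ []) ∷ [])) D≤3b 0≤a)
            e : (ι 4 * L (suc n) + ι 21) * (a - b) ≡ (ι 4 * L (suc n) + ι 21) * (a * b)
            e = cong ((ι 4 * L (suc n) + ι 21) *_) a-b
            e₂ : L n * a ≡ L (suc n) * a - a * D
            e₂ = trans (cong (_* a) L′) (ring (L (suc n) ∷ D ∷ a ∷ []) (λ b D a → (b :- D) :* a ≈ b :* a :- a :* D))
          change : R
          change = ι 2 * (L (suc n) * b) - (L (suc n) * L (suc n) - L n * L n)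
          change≡ : change ≡ ι 2 * (L (suc n) * (b - D)) + D * D
          change≡ = trans (cong (λ t → ι 2 * (L (suc n) * b) - (L (suc n) * L (suc n) - t * t)) L′)
            (ring (L (suc n) ∷ b ∷ D ∷ []) (λ a b D → con 2 :* (a :* b) :- (a :* a :- (a :- D) :* (a :- D)) ≈ con 2 :* (a :* (b :- D)) :+ D :* D))
          b-D-hi : b - D ≤ a * b
          b-D-hi = (lin (b ∷ a ∷ D ∷ []) (λ b a D → (b :- (a :- b) ≼ D) ∷ (a :- b ≼ a :* b) ∷ [] ⊢ (b :- D ≼ a :* b) by (0 , (1 , 0 ∷ []) ∷ (1 , 1 ∷ []) ∷ [])) lo (≤-reflexive a-b))
          b-D-lo : ι 0 - ι 2 * (a * b) ≤ b - D
          b-D-lo = (lin (D ∷ b ∷ a ∷ []) (λ D b a → (D ≼ b :+ con 2 :* (a :- b)) ∷ (a :- b ≼ a :* b) ∷ [] ⊢ (con 0 :- con 2 :* (a :* b) ≼ b :- D) by (0 , (1 , 0 ∷ []) ∷ (2 , 1 ∷ []) ∷ [])) hi (≤-reflexive a-b))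
          DD : D * D ≤ ι 9 * (a * b)
          DD = ≤-trans (*-mono-≤ 0≤D 0≤D D≤3b D≤3b) (lin (b ∷ a ∷ []) (λ b a → (b ≼ a) ∷ (con 0 ≼ b) ∷ [] ⊢ (con 3 :* b :* (con 3 :* b) ≼ con 9 :* (a :* b)) by (0 , (9 , 0 ∷ 1 ∷ []) ∷ [])) b≤a 0≤b)
            where
            b≤a : b ≤ a
            b≤a = u-anti p (ℕₚ.n≤1+n n)
          change-hi : change ≤ (ι 4 * L (suc n) + ι 9) * (a * b)
          change-hi = ≤-trans (≤-reflexive change≡)
            (lin (D ∷ a ∷ b ∷ L (suc n) ∷ []) (λ D a b c → (D :* D ≼ con 9 :* (a :* b)) ∷ (c :* (b :- D) ≼ c :* (a :* b)) ∷ (con 0 ≼ c :* (a :* b)) ∷ [] ⊢ (con 2 :* (c :* (b :- D)) :+ D :* D ≼ (con 4 :* c :+ con 9) :* (a :* b)) by (0 , (1 , 0 ∷ []) ∷ (2 , 1 ∷ []) ∷ (2 , 2 ∷ []) ∷ [])) DD (*-monoʳ-≤ 0≤Ls b-D-hi) (*-nonneg 0≤Ls 0≤ab))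
          change-lo : ι 0 - (ι 4 * L (suc n) + ι 9) * (a * b) ≤ change
          change-lo = ≤-trans
            (lin (L (suc n) ∷ a ∷ b ∷ D ∷ []) (λ c a b D → (c :* (con 0 :- con 2 :* (a :* b)) ≼ c :* (b :- D)) ∷ (con 0 ≼ a :* b) ∷ (con 0 ≼ D :* D) ∷ [] ⊢ (con 0 :- (con 4 :* c :+ con 9) :* (a :* b) ≼ con 2 :* (c :* (b :- D)) :+ D :* D) by (0 , (2 , 0 ∷ []) ∷ (9 , 1 ∷ []) ∷ (1 , 2 ∷ []) ∷ [])) (*-monoʳ-≤ 0≤Ls b-D-lo) 0≤ab (*-nonneg 0≤D 0≤D))
            (≤-reflexive (sym change≡))
          up : lowerF n ≤ lowerF (suc n)
          up = (lin (E ∷ L (suc n) ∷ b ∷ L n ∷ a ∷ H₁ n ∷ []) (λ E c b d a e → (con 0 :- E ≼ con 2 :* (c :* b) :- (c :* c :- d :* d)) ∷ (E ≼ (con 4 :* d :+ con 21) :* a :- (con 4 :* c :+ con 21) :* b) ∷ [] ⊢ (con 2 :* e :- d :* d :- (con 4 :* d :+ con 21) :* a ≼ con 2 :* (e :+ c :* b) :- c :* c :- (con 4 :* c :+ con 21) :* b) by (0 , (1 , 0 ∷ []) ∷ (1 , 1 ∷ []) ∷ [])) change-lo drop)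
            where
            E : R
            E = (ι 4 * L (suc n) + ι 9) * (a * b)
          down : upperF n ≤ upperF (suc n)
          down = (lin (L (suc n) ∷ b ∷ L n ∷ E ∷ a ∷ H₁ n ∷ []) (λ c b d E a e → (con 2 :* (c :* b) :- (c :* c :- d :* d) ≼ E) ∷ (E ≼ (con 4 :* d :+ con 21) :* a :- (con 4 :* c :+ con 21) :* b) ∷ [] ⊢ (con 0 :- (con 2 :* e :- d :* d :+ (con 4 :* d :+ con 21) :* a) ≼ con 0 :- (con 2 :* (e :+ c :* b) :- c :* c :+ (con 4 :* c :+ con 21) :* b)) by (0 , (1 , 0 ∷ []) ∷ (1 , 1 ∷ []) ∷ [])) change-hi drop)
            where
            E : R
            E = (ι 4 * L (suc n) + ι 9) * (a * b)
        0≤ΦV : ι 0 ≤ Φ V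
        0≤ΦV = *-nonneg (lin (L V ∷ []) (λ a → (con 0 ≼ a) ∷ [] ⊢ (con 0 ≼ con 4 :* a :+ con 21) by (0 , (21 , []) ∷ (4 , 0 ∷ []) ∷ [])) (0≤L v)) (0≤u v)
          where
          v : 1 ℕ.≤ V
          v = ℕₚ.≤-trans m≥1 m≤V

      H₁-approx : Within ((ι 4 * L m + ι 21) * u m) (ι 2 * H₁ m - L m * L m - γ₁)
      H₁-approx =
        (lin (H₁ m ∷ L m ∷ u m ∷ H₁ V ∷ L V ∷ Φ V ∷ []) (λ a b c d e f → (con 0 :- (con 2 :* a :- b :* b :+ (con 4 :* b :+ con 21) :* c) ≼ con 0 :- (con 2 :* d :- e :* e :+ f)) ∷ (con 0 ≼ f) ∷ [] ⊢ (con 0 :- (con 4 :* b :+ con 21) :* c ≼ con 2 :* a :- b :* b :- (con 2 :* d :- e :* e)) by (0 , (1 , 0 ∷ []) ∷ (1 , 1 ∷ []) ∷ [])) (monotone-upto upperF S.down m≥1 m≤V ℕₚ.≤-refl) 0≤ΦV) ,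
        (lin (H₁ m ∷ L m ∷ u m ∷ H₁ V ∷ L V ∷ Φ V ∷ []) (λ a b c d e f → (con 2 :* a :- b :* b :- (con 4 :* b :+ con 21) :* c ≼ con 2 :* d :- e :* e :- f) ∷ (con 0 ≼ f) ∷ [] ⊢ (con 2 :* a :- b :* b :- (con 2 :* d :- e :* e) ≼ (con 4 :* b :+ con 21) :* c) by (0 , (1 , 0 ∷ []) ∷ (1 , 1 ∷ []) ∷ [])) (monotone-upto lowerF S.up m≥1 m≤V ℕₚ.≤-refl) 0≤ΦV)

    γ₁-bounds : 1 ℕ.≤ V → Within (ι 21) γ₁
    γ₁-bounds v = (lin (γ₁ ∷ []) (λ a → (con 0 :- a ≼ con 21) ∷ [] ⊢ (con 0 :- con 21 ≼ a) by (0 , (1 , 0 ∷ []) ∷ [])) q′) , (lin (γ₁ ∷ []) (λ a → (con 0 :- con 21 ≼ con 0 :- a) ∷ [] ⊢ (a ≼ con 21) by (0 , (1 , 0 ∷ []) ∷ [])) p′)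
      where
      e : ι 2 * H₁ 1 - L 1 * L 1 - γ₁ ≡ ι 0 - γ₁
      e = trans (cong (λ t → ι 2 * (ι 0 + t * u 1) - t * t - γ₁) L-1) (ring (u 1 ∷ γ₁ ∷ []) (λ a b → con 2 :* (con 0 :+ con 0 :* a) :- con 0 :* con 0 :- b ≈ con 0 :- b))
      e′ : (ι 4 * L 1 + ι 21) * u 1 ≡ ι 21
      e′ = trans (cong₂ (λ s t → (ι 4 * s + ι 21) * t) L-1 u-1) (ring ([]) ((con 4 :* con 0 :+ con 21) :* con 1 ≈ con 21))
      q′ : ι 0 - γ₁ ≤ ι 21
      q′ = subst₂ _≤_ e e′ (proj₂ (H₁-approx (s≤s z≤n) v))
      p′ : ι 0 - ι 21 ≤ ι 0 - γ₁
      p′ = subst₂ _≤_ (cong (ι 0 -_) e′) e (proj₁ (H₁-approx (s≤s z≤n) v))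

    -- From `n` to `n + 1` the difference changes by `1 - n D`, which lies between `-b` and `2 b`.
    -- Adding `H`, or subtracting the difference from `2 H`, therefore gives increasing functions.
    T-approx : ∀ {n} → 1 ℕ.≤ n → n ℕ.≤ V → Within (ι 2 * L n + ι 3) (T n - (ι n * L n - ι n))
    T-approx {n} p q =
      (lin (T 1 ∷ L 1 ∷ H 1 ∷ T n ∷ ι n ∷ L n ∷ H n ∷ []) (λ a b c d e f g → (a :- (con 1 :* b :- con 1) :+ c ≼ d :- (e :* f :- e) :+ g) ∷ (con 1 ≼ c) ∷ (con 0 ≼ a) ∷ (b ≼ con 0) ∷ (g ≼ f :+ con 2) ∷ (con 0 ≼ f) ∷ [] ⊢ (con 0 :- (con 2 :* f :+ con 3) ≼ d :- (e :* f :- e)) by (0 , (3 , []) ∷ (1 , 0 ∷ []) ∷ (1 , 1 ∷ []) ∷ (1 , 2 ∷ []) ∷ (1 , 3 ∷ []) ∷ (1 , 4 ∷ []) ∷ (1 , 5 ∷ []) ∷ [])) (monotone-upto F₁ up₁ (s≤s z≤n) p q) (≤-reflexive (sym H-1)) (≤-reflexive (sym T-1)) (≤-reflexive L-1) (H≤L+2 p q) (0≤L p)) ,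
      (lin (H 1 ∷ T 1 ∷ L 1 ∷ H n ∷ T n ∷ ι n ∷ L n ∷ []) (λ a b c d e f g → (con 2 :* a :- (b :- (con 1 :* c :- con 1)) ≼ con 2 :* d :- (e :- (f :* g :- f))) ∷ (con 1 ≼ a) ∷ (b ≼ con 0) ∷ (con 0 ≼ c) ∷ (d ≼ g :+ con 2) ∷ [] ⊢ (e :- (f :* g :- f) ≼ con 2 :* g :+ con 3) by (0 , (1 , 0 ∷ []) ∷ (2 , 1 ∷ []) ∷ (1 , 2 ∷ []) ∷ (1 , 3 ∷ []) ∷ (2 , 4 ∷ []) ∷ [])) (monotone-upto F₂ up₂ (s≤s z≤n) p q) (≤-reflexive (sym H-1)) (≤-reflexive T-1) (≤-reflexive (sym L-1)) (H≤L+2 p q))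
      where
      T-1 : T 1 ≡ ι 0
      T-1 = trans (+-identityˡ _) L-1
      F₁ F₂ : ℕ → R
      F₁ n = T n - (ι n * L n - ι n) + H n
      F₂ n = ι 2 * H n - (T n - (ι n * L n - ι n))
      up₁ : ∀ n → 1 ℕ.≤ n → n ℕ.< V → F₁ n ≤ F₁ (suc n)
      up₁ n p q = let open Step n p q in (lin (N ∷ L (suc n) ∷ L n ∷ b ∷ ι (suc n) ∷ T n ∷ H n ∷ []) (λ N a c b d e f → (N :* (a :- c) ≼ con 1 :+ b) ∷ (d :* a ≼ (con 1 :+ N) :* a) ∷ (con 1 :+ N ≼ d) ∷ [] ⊢ (e :- (N :* c :- N) :+ f ≼ e :+ a :- (d :* a :- d) :+ (f :+ b)) by (0 , (1 , 0 ∷ []) ∷ (1 , 1 ∷ []) ∷ (1 , 2 ∷ []) ∷ [])) ND-hi (≤-reflexive (cong (_* L (suc n)) ιs)) (≤-reflexive (sym ιs)))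
      up₂ : ∀ n → 1 ℕ.≤ n → n ℕ.< V → F₂ n ≤ F₂ (suc n)
      up₂ n p q = let open Step n p q in (lin (b ∷ N ∷ L (suc n) ∷ L n ∷ ι (suc n) ∷ H n ∷ T n ∷ []) (λ b N a c d e f → (con 1 :- con 2 :* b ≼ N :* (a :- c)) ∷ ((con 1 :+ N) :* a ≼ d :* a) ∷ (d ≼ con 1 :+ N) ∷ [] ⊢ (con 2 :* e :- (f :- (N :* c :- N)) ≼ con 2 :* (e :+ b) :- (f :+ a :- (d :* a :- d))) by (0 , (1 , 0 ∷ []) ∷ (1 , 1 ∷ []) ∷ (1 , 2 ∷ []) ∷ [])) ND-lo (≤-reflexive (sym (cong (_* L (suc n)) ιs))) (≤-reflexive ιs))

    G-main : ℕ → R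
    G-main n = ι n * (L n * L n) - ι 2 * (ι n * L n) + ι 2 * ι n

    -- The main term is the integral of log². With `w = 1 - n D` one step changes the difference by
    -- `2 ℓ w + n D² - 2 w`, at most `(4 ℓ + 10) b` in absolute value, and `Ψ` grows by at least as
    -- much.
    G-approx : ∀ {n} → 1 ℕ.≤ n → n ℕ.≤ V → Within (ι 5 * ((L n + ι 2) * (L n + ι 2))) (G n - G-main n)
    G-approx {n} p q = within-mono final
      ((lin (F₁ 1 ∷ G n ∷ G-main n ∷ Ψ n ∷ []) (λ a b c d → (a ≼ b :- c :+ d) ∷ (con 0 ≼ a) ∷ [] ⊢ (con 0 :- d ≼ b :- c) by (0 , (1 , 0 ∷ []) ∷ (1 , 1 ∷ []) ∷ [])) (monotone-upto F₁ up₁ (s≤s z≤n) p q) base₁) ,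
       (lin (F₂ 1 ∷ Ψ n ∷ G n ∷ G-main n ∷ []) (λ a b c d → (a ≼ b :- (c :- d)) ∷ (con 0 ≼ a) ∷ [] ⊢ (c :- d ≼ b) by (0 , (1 , 0 ∷ []) ∷ (1 , 1 ∷ []) ∷ [])) (monotone-upto F₂ up₂ (s≤s z≤n) p q) base₂))
      where
      Ψ F₁ F₂ : ℕ → R
      Ψ n = (ι 4 * L n + ι 10) * H n
      F₁ n = (G n - G-main n) + Ψ n
      F₂ n = Ψ n - (G n - G-main n)
      0≤Ln : ι 0 ≤ L n
      0≤Ln = 0≤L p
      final : Ψ n ≤ ι 5 * ((L n + ι 2) * (L n + ι 2))
      final = (lin (H n ∷ L n ∷ []) (λ a b → (a ≼ b :+ con 2) ∷ (con 0 ≼ b) ∷ [] ⊢ ((con 4 :* b :+ con 10) :* a ≼ con 5 :* ((b :+ con 2) :* (b :+ con 2))) by (0 , (10 , 0 ∷ []) ∷ (2 , 1 ∷ []) ∷ (4 , 0 ∷ 1 ∷ []) ∷ (1 , 1 ∷ 1 ∷ []) ∷ [])) (H≤L+2 p q) 0≤Ln)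
      main1 : G-main 1 ≡ ι 2
      main1 = trans (cong (λ t → ι 1 * (t * t) - ι 2 * (ι 1 * t) + ι 2 * ι 1) L-1) (ring ([]) (con 1 :* (con 0 :* con 0) :- con 2 :* (con 1 :* con 0) :+ con 2 :* con 1 ≈ con 2))
      G1 : G 1 ≡ ι 0
      G1 = trans (cong (λ t → ι 0 + t * t) L-1) (ring ([]) (con 0 :+ con 0 :* con 0 ≈ con 0))
      Ψ1 : Ψ 1 ≡ ι 10
      Ψ1 = trans (cong₂ (λ s t → (ι 4 * s + ι 10) * t) L-1 H-1) (ring ([]) ((con 4 :* con 0 :+ con 10) :* con 1 ≈ con 10))
      base₁ : ι 0 ≤ F₁ 1
      base₁ = (lin (G-main 1 ∷ G 1 ∷ Ψ 1 ∷ []) (λ a b c → (a ≼ con 2) ∷ (con 0 ≼ b) ∷ (con 10 ≼ c) ∷ [] ⊢ (con 0 ≼ b :- a :+ c) by (0 , (8 , []) ∷ (1 , 0 ∷ []) ∷ (1 , 1 ∷ []) ∷ (1 , 2 ∷ []) ∷ [])) (≤-reflexive main1) (≤-reflexive (sym G1)) (≤-reflexive (sym Ψ1)))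
      base₂ : ι 0 ≤ F₂ 1
      base₂ = (lin (G-main 1 ∷ G 1 ∷ Ψ 1 ∷ []) (λ a b c → (con 2 ≼ a) ∷ (b ≼ con 0) ∷ (con 10 ≼ c) ∷ [] ⊢ (con 0 ≼ c :- (b :- a)) by (0 , (12 , []) ∷ (1 , 0 ∷ []) ∷ (1 , 1 ∷ []) ∷ (1 , 2 ∷ []) ∷ [])) (≤-reflexive (sym main1)) (≤-reflexive G1) (≤-reflexive (sym Ψ1)))
      module S (n : ℕ) (p : 1 ℕ.≤ n) (q : n ℕ.< V) where
        open Step n p q hiding (0≤Ln) public
        ℓ w : R
        ℓ = L (suc n)
        w = ι 1 - N * D
        change : R
        change = ℓ * ℓ - (G-main (suc n) - G-main n)
        change≡ : change ≡ ι 2 * (ℓ * w) + N * D * D - ι 2 * w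
        change≡ = begin
          change
            ≡⟨ cong (λ t → ℓ * ℓ - ((t * (ℓ * ℓ) - ι 2 * (t * ℓ) + ι 2 * t) - G-main n)) ιs ⟩
          ℓ * ℓ - (((ι 1 + N) * (ℓ * ℓ) - ι 2 * ((ι 1 + N) * ℓ) + ι 2 * (ι 1 + N)) - G-main n)
            ≡⟨ cong (λ t → ℓ * ℓ - (((ι 1 + N) * (ℓ * ℓ) - ι 2 * ((ι 1 + N) * ℓ) + ι 2 * (ι 1 + N)) - (N * (t * t) - ι 2 * (N * t) + ι 2 * N))) L′ ⟩
          ℓ * ℓ - (((ι 1 + N) * (ℓ * ℓ) - ι 2 * ((ι 1 + N) * ℓ) + ι 2 * (ι 1 + N)) - (N * ((ℓ - D) * (ℓ - D)) - ι 2 * (N * (ℓ - D)) + ι 2 * N))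
            ≡⟨ (ring (ℓ ∷ N ∷ D ∷ []) (λ a N D → a :* a :- ((con 1 :+ N) :* (a :* a) :- con 2 :* ((con 1 :+ N) :* a) :+ con 2 :* (con 1 :+ N) :- (N :* ((a :- D) :* (a :- D)) :- con 2 :* (N :* (a :- D)) :+ con 2 :* N)) ≈ con 2 :* (a :* (con 1 :- N :* D)) :+ N :* D :* D :- con 2 :* (con 1 :- N :* D))) ⟩
          ι 2 * (ℓ * w) + N * D * D - ι 2 * w ∎
          where open ≡-Reasoning
        w-within : Within (ι 2 * b) w
        w-within = (lin (N ∷ D ∷ b ∷ []) (λ N D b → (N :* D ≼ con 1 :+ b) ∷ (con 0 ≼ b) ∷ [] ⊢ (con 0 :- con 2 :* b ≼ con 1 :- N :* D) by (0 , (1 , 0 ∷ []) ∷ (1 , 1 ∷ []) ∷ [])) ND-hi 0≤b) , (lin (b ∷ N ∷ D ∷ []) (λ b N D → (con 1 :- con 2 :* b ≼ N :* D) ∷ [] ⊢ (con 1 :- N :* D ≼ con 2 :* b) by (0 , (1 , 0 ∷ []) ∷ [])) ND-lo)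
        0≤ND : ι 0 ≤ N * D
        0≤ND = *-nonneg (≤-trans (0≤ι 1) 1≤N) 0≤D
        NDD≤ : N * D * D ≤ ι 6 * b
        NDD≤ = ≤-trans (*-mono-≤ 0≤ND 0≤D ND-hi D≤3b) (lin (b ∷ []) (λ b → (con 0 ≼ b) ∷ (b ≼ con 1) ∷ [] ⊢ ((con 1 :+ b) :* (con 3 :* b) ≼ con 6 :* b) by (0 , (3 , 0 ∷ 1 ∷ []) ∷ [])) 0≤b b≤1)
        change-within : Within ((ι 4 * ℓ + ι 10) * b) change
        change-within = subst (Within _) (sym change≡) (within-mono
          (lin (ℓ ∷ b ∷ []) (λ a b → [] ⊢ (con 2 :* a :* (con 2 :* b) :+ con 6 :* b :+ con 2 :* (con 2 :* b) ≼ (con 4 :* a :+ con 10) :* b) by (0 , [])))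
          (subst (Within _) (ring (ℓ ∷ w ∷ N ∷ D ∷ []) (λ a w N D → con 2 :* a :* w :+ N :* D :* D :+ (con 0 :- con 2 :* w) ≈ con 2 :* (a :* w) :+ N :* D :* D :- con 2 :* w))
            (within-+ (within-+ (within-* (within-0≤ (lin (ℓ ∷ []) (λ a → (con 0 ≼ a) ∷ [] ⊢ (con 0 ≼ con 2 :* a) by (0 , (2 , 0 ∷ []) ∷ [])) 0≤Ls) ≤-refl) w-within)
                                (within-0≤ (*-nonneg 0≤ND 0≤D) NDD≤))
                      (within-neg (within-* (within-0≤ (0≤ι 2) ≤-refl) w-within)))))
        0≤Hn : ι 0 ≤ H n
        0≤Hn = 0≤H n
        grow : (ι 4 * ℓ + ι 10) * b ≤ (ι 4 * ℓ + ι 10) * (H n + b) - (ι 4 * L n + ι 10) * H n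
        grow = (lin (ℓ ∷ L n ∷ H n ∷ b ∷ []) (λ a c d b → (con 0 ≼ a :- c) ∷ (con 0 ≼ d) ∷ [] ⊢ ((con 4 :* a :+ con 10) :* b ≼ (con 4 :* a :+ con 10) :* (d :+ b) :- (con 4 :* c :+ con 10) :* d) by (0 , (4 , 0 ∷ 1 ∷ []) ∷ [])) 0≤D 0≤Hn)
      up₁ : ∀ n → 1 ℕ.≤ n → n ℕ.< V → F₁ n ≤ F₁ (suc n)
      up₁ n p q = let open S n p q in
        (lin (ℓ ∷ b ∷ G-main (suc n) ∷ G-main n ∷ H n ∷ L n ∷ G n ∷ []) (λ a b c d e f g → (con 0 :- (con 4 :* a :+ con 10) :* b ≼ a :* a :- (c :- d)) ∷ ((con 4 :* a :+ con 10) :* b ≼ (con 4 :* a :+ con 10) :* (e :+ b) :- (con 4 :* f :+ con 10) :* e) ∷ [] ⊢ (g :- d :+ (con 4 :* f :+ con 10) :* e ≼ g :+ a :* a :- c :+ (con 4 :* a :+ con 10) :* (e :+ b)) by (0 , (1 , 0 ∷ []) ∷ (1 , 1 ∷ []) ∷ [])) (proj₁ change-within) grow)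
      up₂ : ∀ n → 1 ℕ.≤ n → n ℕ.< V → F₂ n ≤ F₂ (suc n)
      up₂ n p q = let open S n p q in
        (lin (ℓ ∷ G-main (suc n) ∷ G-main n ∷ b ∷ H n ∷ L n ∷ G n ∷ []) (λ a c d b e f g → (a :* a :- (c :- d) ≼ (con 4 :* a :+ con 10) :* b) ∷ ((con 4 :* a :+ con 10) :* b ≼ (con 4 :* a :+ con 10) :* (e :+ b) :- (con 4 :* f :+ con 10) :* e) ∷ [] ⊢ ((con 4 :* f :+ con 10) :* e :- (g :- d) ≼ (con 4 :* a :+ con 10) :* (e :+ b) :- (g :+ a :* a :- c)) by (0 , (1 , 0 ∷ []) ∷ (1 , 1 ∷ []) ∷ [])) (proj₂ change-within) grow)

-- Selberg's formula and the recursive inequality for M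

module SelbergFormula where
  open SealedRationals
  open LinearArithmetic
  open FiniteSums
  open ArithmeticFunctions
  open MangoldtIdentities
  open LogarithmicSums

  M-lipschitz : ∀ {m n} → m ℕ.≤ n → abs (M n - M m) ≤ ι n - ι m
  M-lipschitz {m} {n} p with ℕₚ.≤⇒≤′ p
  ... | ℕ.≤′-reflexive refl = ≤-trans (≤-reflexive (trans (cong abs (+-inverseʳ (M m))) (abs-nonneg ≤-refl))) (≤-reflexive (sym (+-inverseʳ (ι m))))
  M-lipschitz {m} {suc n} p | ℕ.≤′-step q = abs-lub
    (lin (M n ∷ M m ∷ abs (M n - M m) ∷ ι n ∷ ι m ∷ μ (suc n) ∷ abs (μ (suc n)) ∷ ι (suc n) ∷ []) (λ a b c d e f g h → (a :- b ≼ c) ∷ (c ≼ d :- e) ∷ (f ≼ g) ∷ (g ≼ con 1) ∷ (con 1 :+ d ≼ h) ∷ [] ⊢ (a :+ f :- b ≼ h :- e) by (0 , (1 , 0 ∷ []) ∷ (1 , 1 ∷ []) ∷ (1 , 2 ∷ []) ∷ (1 , 3 ∷ []) ∷ (1 , 4 ∷ []) ∷ [])) (x≤abs (M n - M m)) ih (x≤abs (μ (suc n))) (μ-abs (suc n)) (≤-reflexive (sym (ι-suc n))))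
    (lin (M n ∷ M m ∷ abs (M n - M m) ∷ ι n ∷ ι m ∷ μ (suc n) ∷ abs (μ (suc n)) ∷ ι (suc n) ∷ []) (λ a b c d e f g h → (con 0 :- (a :- b) ≼ c) ∷ (c ≼ d :- e) ∷ (con 0 :- f ≼ g) ∷ (g ≼ con 1) ∷ (con 1 :+ d ≼ h) ∷ [] ⊢ (con 0 :- (a :+ f :- b) ≼ h :- e) by (0 , (1 , 0 ∷ []) ∷ (1 , 1 ∷ []) ∷ (1 , 2 ∷ []) ∷ (1 , 3 ∷ []) ∷ (1 , 4 ∷ []) ∷ [])) (-x≤abs (M n - M m)) ih (-x≤abs (μ (suc n))) (μ-abs (suc n)) (≤-reflexive (sym (ι-suc n))))
    where
    ih : abs (M n - M m) ≤ ι n - ι m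
    ih = M-lipschitz (ℕₚ.≤′⇒≤ q)

  ∣M∣≤ : ∀ n → abs (M n) ≤ ι n
  ∣M∣≤ n = ≤-trans (≤-reflexive (cong abs (ring (M n ∷ []) (λ a → a ≈ a :- con 0)))) (≤-trans (M-lipschitz {0} {n} z≤n) (lin (ι n ∷ []) (λ a → [] ⊢ (a :- con 0 ≼ a) by (0 , []))))

  abs-abs-diff : ∀ x y → Within (abs (x - y)) (abs x - abs y)
  abs-abs-diff x y =
    (lin (abs (x + (ι 0 - (x - y))) ∷ abs x ∷ abs (ι 0 - (x - y)) ∷ abs y ∷ abs (x - y) ∷ []) (λ a b c d e → (a ≼ b :+ c) ∷ (d ≼ a) ∷ (c ≼ e) ∷ [] ⊢ (con 0 :- e ≼ b :- d) by (0 , (1 , 0 ∷ []) ∷ (1 , 1 ∷ []) ∷ (1 , 2 ∷ []) ∷ [])) (abs-+ x (ι 0 - (x - y))) (≤-reflexive (sym (cong abs (ring (x ∷ y ∷ []) (λ x y → x :+ (con 0 :- (x :- y)) ≈ y))))) (abs-lub (-x≤abs (x - y)) (≤-trans (≤-reflexive (ring (x ∷ y ∷ []) (λ x y → con 0 :- (con 0 :- (x :- y)) ≈ x :- y))) (x≤abs (x - y))))) ,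
    (lin (abs (x - y + y) ∷ abs (x - y) ∷ abs y ∷ abs x ∷ []) (λ a b c d → (a ≼ b :+ c) ∷ (d ≼ a) ∷ [] ⊢ (d :- c ≼ b) by (0 , (1 , 0 ∷ []) ∷ (1 , 1 ∷ []) ∷ [])) (abs-+ (x - y) y) (≤-reflexive (sym (cong abs (ring (x ∷ y ∷ []) (λ x y → x :- y :+ y ≈ x))))))

  module Selberg {V : ℕ} {L : ℕ → R} (ls : LogSys V L) where
    open LogSys ls public
    open LogarithmicSums.Estimates ls public

    2x≤⇒x≤ : ∀ {x} → 2 ℕ.* x ℕ.≤ V → x ℕ.≤ V
    2x≤⇒x≤ {x} p = (linℕ (x ∷ V ∷ []) (λ x V → (con 2 :* x ≼ V) ∷ (con 0 ≼ V) ∷ [] ⊢ (x ≼ V) by (1 , (1 , 0 ∷ []) ∷ (1 , 1 ∷ []) ∷ [])) p ℕ.z≤n)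

    -- With y = x/d and ℓ = log y, the sum of `κ x (d * k)` over k ≤ y is close to y times ℓ² + (2 γ
    -- + c₁) ℓ + c₁ γ - γ₁ + c₀. The two constants turn this into y (ℓ² - 2 ℓ + 2), the main term of
    -- `G`.
    c₁ c₀ : R
    c₁ = ι 0 - ι 2 - ι 2 * γ
    c₀ = ι 2 + γ₁ - c₁ * γ

    module Quotient {x d : ℕ} (1≤d : 1 ℕ.≤ d) (d≤x : d ℕ.≤ x) (2x≤V : 2 ℕ.* x ℕ.≤ V) where
      N : ℕ
      N = x ÷ d
      n y ℓ φ a β c : R
      n = ι N
      y = ι x * u d
      ℓ = L x - L d
      φ = y - n
      a = ℓ - L N
      β = H N - L N - γ
      c = ι 2 * H₁ N - L N * L N - γ₁
      1≤x : 1 ℕ.≤ x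
      1≤x = ℕₚ.≤-trans 1≤d d≤x
      1≤N : 1 ℕ.≤ N
      1≤N = 1≤÷ 1≤d d≤x
      x≤V : x ℕ.≤ V
      x≤V = 2x≤⇒x≤ 2x≤V
      1≤V : 1 ℕ.≤ V
      1≤V = ℕₚ.≤-trans 1≤x x≤V
      N≤V : N ℕ.≤ V
      N≤V = ℕₚ.≤-trans (÷-≤ x d) x≤V
      N<V : N ℕ.< V
      N<V = (linℕ (N ∷ x ∷ V ∷ []) (λ N x V → (N ≼ x) ∷ (con 1 ≼ x) ∷ (con 2 :* x ≼ V) ∷ [] ⊢ (con 1 :+ N ≼ V) by (0 , (1 , 0 ∷ []) ∷ (1 , 1 ∷ []) ∷ (1 , 2 ∷ []) ∷ [])) (÷-≤ x d) 1≤x 2x≤V)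
      0≤LN : ι 0 ≤ L N
      0≤LN = 0≤L 1≤N
      0≤uN : ι 0 ≤ u N
      0≤uN = 0≤u 1≤N
      uN≤1 : u N ≤ ι 1
      uN≤1 = u≤1 1≤N
      nu : n * u N ≡ ι 1
      nu = ι*u 1≤N
      φ-within : Within (ι 1) φ
      φ-within = within-0≤ (lin (ι N ∷ ι x ∷ u d ∷ []) (λ a b c → (a ≼ b :* c) ∷ [] ⊢ (con 0 ≼ b :* c :- a) by (0 , (1 , 0 ∷ []) ∷ [])) (ι-÷-≤ x 1≤d)) (lin (ι x ∷ u d ∷ ι N ∷ []) (λ a b c → (a :* b ≼ c :+ con 1) ∷ [] ⊢ (a :* b :- c ≼ con 1) by (0 , (1 , 0 ∷ []) ∷ [])) (ι-÷-> x 1≤d))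
      a-lo : L N ≤ ℓ
      a-lo = (lin (L (d ℕ.* N) ∷ L x ∷ L d ∷ L N ∷ []) (λ a b c d → (a ≼ b) ∷ (c :+ d ≼ a) ∷ [] ⊢ (d ≼ b :- c) by (0 , (1 , 0 ∷ []) ∷ (1 , 1 ∷ []) ∷ [])) (L-mono (1≤-* 1≤d 1≤N) (÷-lower x d) x≤V) (≤-reflexive (sym (L-* 1≤d 1≤N))))
      a-hi : ℓ ≤ L N + ι 3 * u N
      a-hi = (lin (L x ∷ L (d ℕ.* suc N) ∷ L d ∷ L (suc N) ∷ L N ∷ u (suc N) ∷ u N ∷ []) (λ a b c d e f g → (a ≼ b) ∷ (b ≼ c :+ d) ∷ (d :- e ≼ con 3 :* f) ∷ (f ≼ g) ∷ [] ⊢ (a :- c ≼ e :+ con 3 :* g) by (0 , (1 , 0 ∷ []) ∷ (1 , 1 ∷ []) ∷ (1 , 2 ∷ []) ∷ (3 , 3 ∷ []) ∷ [])) (L-mono 1≤x (ℕₚ.<⇒≤ (÷-upper x 1≤d)) top) (≤-reflexive (L-* 1≤d (s≤s z≤n))) (Step.D≤3b N 1≤N N<V) (u-anti 1≤N (ℕₚ.n≤1+n N)))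
        where
        -- The multiple `d (N + 1)` exceeds `x` but not `2 x`; hence the standing assumption
        -- `2 x ≤ V`.
        top : d ℕ.* suc N ℕ.≤ V
        top = (linℕ (d ∷ N ∷ x ∷ V ∷ []) (λ d N x V → (d :* N ≼ x) ∷ (d ≼ x) ∷ (con 2 :* x ≼ V) ∷ [] ⊢ (d :* (con 1 :+ N) ≼ V) by (0 , (1 , 0 ∷ []) ∷ (1 , 1 ∷ []) ∷ (1 , 2 ∷ []) ∷ [])) (÷-lower x d) d≤x 2x≤V)
      a-within : Within (ι 3 * u N) a
      a-within = within-0≤ (lin (L N ∷ ℓ ∷ []) (λ a b → (a ≼ b) ∷ [] ⊢ (con 0 ≼ b :- a) by (0 , (1 , 0 ∷ []) ∷ [])) a-lo) (lin (ℓ ∷ L N ∷ u N ∷ []) (λ a b c → (a ≼ b :+ con 3 :* c) ∷ [] ⊢ (a :- b ≼ con 3 :* c) by (0 , (1 , 0 ∷ []) ∷ [])) a-hi)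
      β-within : Within (ι 2 * u N) β
      β-within = (lin (γ ∷ u N ∷ H N ∷ L N ∷ []) (λ a b c d → (a :- b ≼ c :- d) ∷ (con 0 ≼ b) ∷ [] ⊢ (con 0 :- con 2 :* b ≼ c :- d :- a) by (0 , (1 , 0 ∷ []) ∷ (1 , 1 ∷ []) ∷ [])) (proj₁ (H-approx 1≤N N≤V)) 0≤uN) ,
                 (lin (H N ∷ L N ∷ γ ∷ u N ∷ []) (λ a b c d → (a :- b ≼ c :+ con 2 :* d) ∷ [] ⊢ (a :- b :- c ≼ con 2 :* d) by (0 , (1 , 0 ∷ []) ∷ [])) (proj₂ (H-approx 1≤N N≤V)))
      c-within : Within ((ι 4 * L N + ι 21) * u N) c
      c-within = H₁-approx 1≤N N≤V
      H-within : Within (L N + ι 2) (H N)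
      H-within = within-0≤ (0≤H N) (H≤L+2 1≤N N≤V)
      LN-within : Within (L N) (L N)
      LN-within = within-0≤ 0≤LN ≤-refl
      y-within : Within (n + ι 1) y
      y-within = within-0≤ (*-nonneg (0≤ι x) (0≤u 1≤d)) (lin (y ∷ n ∷ []) (λ y n → (y :- n ≼ con 1) ∷ [] ⊢ (y ≼ n :+ con 1) by (0 , (1 , 0 ∷ []) ∷ [])) (proj₂ φ-within))
      γ-within : Within (ι 2) γ
      γ-within = (lin (γ ∷ []) (λ a → (con 0 :- con 1 ≼ a) ∷ [] ⊢ (con 0 :- con 2 ≼ a) by (0 , (1 , []) ∷ (1 , 0 ∷ []) ∷ [])) (proj₁ (γ-bounds 1≤V))) , proj₂ (γ-bounds 1≤V)
      -- Since `y ≤ n + 1`, an error of size K/n that is multiplied by `y` costs at most `2 K`.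
      y-small : ∀ {K e} → ι 0 ≤ K → Within (K * u N) e → Within (ι 2 * K) (y * e)
      y-small {K} {e} 0≤K h = within-mono
        (lin (K ∷ u N ∷ n ∷ []) (λ K a n → (K :* a ≼ K :* con 1) ∷ (K :* (n :* a) ≼ K :* con 1) ∷ [] ⊢ ((n :+ con 1) :* (K :* a) ≼ con 2 :* K) by (0 , (1 , 0 ∷ []) ∷ (1 , 1 ∷ []) ∷ [])) (*-monoʳ-≤ 0≤K uN≤1) (≤-reflexive (cong (K *_) nu)))
        (within-* y-within h)

    c₁-within : 1 ℕ.≤ V → Within (ι 6) c₁
    c₁-within v = (lin (γ ∷ []) (λ a → (a ≼ con 2) ∷ [] ⊢ (con 0 :- con 6 ≼ con 0 :- con 2 :- con 2 :* a) by (0 , (2 , 0 ∷ []) ∷ [])) (proj₂ (γ-bounds v))) , (lin (γ ∷ []) (λ a → (con 0 :- con 1 ≼ a) ∷ [] ⊢ (con 0 :- con 2 :- con 2 :* a ≼ con 6) by (0 , (6 , []) ∷ (2 , 0 ∷ []) ∷ [])) (proj₁ (γ-bounds v)))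

    c₀-within : 1 ℕ.≤ V → Within (ι 35) c₀
    c₀-within v = within-mono (lin ([]) ([] ⊢ (con 2 :+ con 21 :+ con 6 :* con 2 ≼ con 35) by (0 , []))) (subst (Within _) (ring (γ₁ ∷ c₁ ∷ γ ∷ []) (λ a b c → con 2 :+ a :+ (con 0 :- b) :* c ≈ con 2 :+ a :- b :* c))
      (within-+ (within-+ (within-0≤ (0≤ι 2) ≤-refl) (γ₁-bounds v))
        (within-* (within-neg (c₁-within v)) ((lin (γ ∷ []) (λ a → (con 0 :- con 1 ≼ a) ∷ [] ⊢ (con 0 :- con 2 ≼ a) by (0 , (1 , []) ∷ (1 , 0 ∷ []) ∷ [])) (proj₁ (γ-bounds v))) , proj₂ (γ-bounds v)))))

    -- chosen so that ∑ κ(d n) over n ≤ x/d matches ∑ L(n)² over n ≤ x/d up to O((1 + log (x/d))²)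
    κ : ℕ → ℕ → R
    κ x e = ι 2 * (ι x * u e * (L x - L e)) + c₁ * (ι x * u e) + c₀

    module Error {x d : ℕ} (1≤d : 1 ℕ.≤ d) (d≤x : d ℕ.≤ x) (2x≤V : 2 ℕ.* x ℕ.≤ V) where
      open Quotient {x} {d} 1≤d d≤x 2x≤V

      κ-sum : ∑ N (λ k → κ x (d ℕ.* k)) ≡ (ι 2 * (y * ℓ) + c₁ * y) * H N - y * (ι 2 * H₁ N) + c₀ * n
      κ-sum = begin
        ∑ N (λ k → κ x (d ℕ.* k))
          ≡⟨ ∑-cong N (λ k p _ → trans (cong₂ (λ s t → ι 2 * (ι x * s * (L x - t)) + c₁ * (ι x * s) + c₀) (u-* 1≤d p) (L-* 1≤d p))
              (ring (ι x ∷ u d ∷ u k ∷ L x ∷ L d ∷ L k ∷ c₁ ∷ c₀ ∷ []) (λ a b c d e f g h → con 2 :* (a :* (b :* c) :* (d :- (e :+ f))) :+ g :* (a :* (b :* c)) :+ h ≈ (con 2 :* (a :* b :* (d :- e)) :+ g :* (a :* b)) :* c :+ (con 0 :- a :* b :* con 2) :* (f :* c) :+ h))) ⟩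
        ∑ N (λ k → K₁ * u k + K₂ * (L k * u k) + c₀)
          ≡⟨ trans (∑-+ N _ _) (cong₂ _+_ (trans (∑-+ N _ _) (cong₂ _+_ (∑-*ˡ N K₁ u) (∑-*ˡ N K₂ _))) (∑-const N c₀)) ⟩
        K₁ * H N + K₂ * H₁ N + n * c₀
          ≡⟨ (ring (K₁ ∷ H N ∷ y ∷ H₁ N ∷ n ∷ c₀ ∷ []) (λ a b y c n d → a :* b :+ (con 0 :- y :* con 2) :* c :+ n :* d ≈ a :* b :- y :* (con 2 :* c) :+ d :* n)) ⟩
        K₁ * H N - y * (ι 2 * H₁ N) + c₀ * n ∎
        where
        open ≡-Reasoning
        K₁ K₂ : R
        K₁ = ι 2 * (y * ℓ) + c₁ * y
        K₂ = ι 0 - y * ι 2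

      E e₁ e₂ g : R
      E = G N - ∑ N (λ k → κ x (d ℕ.* k))
      -- `e₁` is the factor of the rounding error `φ = y - n`; `e₂` collects the errors of size (log
      -- n)/n, which are multiplied by `y`.
      e₁ = L N * L N - ι 2 * L N - γ₁ - ι 2 * γ - ι 2 * (γ * γ)
      e₂ = ι 2 * (L N * β) + ι 2 * (a * H N) - c + c₁ * β
      g = G N - G-main N

      E≡ : E ≡ g + (ι 0 - φ * e₁) + (ι 0 - y * e₂)
      E≡ = trans (cong (λ t → G N - t) κ-sum) (expand (G N) y ℓ (H N) (H₁ N) n (L N) γ γ₁)
        where
        expand : ∀ G y ℓ H H₁ n L γ γ₁ →
          G - ((ι 2 * (y * ℓ) + (ι 0 - ι 2 - ι 2 * γ) * y) * H - y * (ι 2 * H₁) + (ι 2 + γ₁ - (ι 0 - ι 2 - ι 2 * γ) * γ) * n)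
          ≡ (G - (n * (L * L) - ι 2 * (n * L) + ι 2 * n)) + (ι 0 - (y - n) * (L * L - ι 2 * L - γ₁ - ι 2 * γ - ι 2 * (γ * γ)))
          + (ι 0 - y * (ι 2 * (L * (H - L - γ)) + ι 2 * ((ℓ - L) * H) - (ι 2 * H₁ - L * L - γ₁) + (ι 0 - ι 2 - ι 2 * γ) * (H - L - γ)))
        expand G y ℓ H H₁ n L γ γ₁ = (ring (G ∷ y ∷ ℓ ∷ γ ∷ H ∷ H₁ ∷ γ₁ ∷ n ∷ L ∷ []) (λ G y a b H c d n L → G :- ((con 2 :* (y :* a) :+ (con 0 :- con 2 :- con 2 :* b) :* y) :* H :- y :* (con 2 :* c) :+ (con 2 :+ d :- (con 0 :- con 2 :- con 2 :* b) :* b) :* n) ≈ G :- (n :* (L :* L) :- con 2 :* (n :* L) :+ con 2 :* n) :+ (con 0 :- (y :- n) :* (L :* L :- con 2 :* L :- d :- con 2 :* b :- con 2 :* (b :* b))) :+ (con 0 :- y :* (con 2 :* (L :* (H :- L :- b)) :+ con 2 :* ((a :- L) :* H) :- (con 2 :* c :- L :* L :- d) :+ (con 0 :- con 2 :- con 2 :* b) :* (H :- L :- b)))))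

      e₁-within : Within (L N * L N + ι 2 * L N + ι 33) e₁
      e₁-within = within-mono (lin (L N ∷ []) (λ a → [] ⊢ (a :* a :+ con 2 :* a :+ con 21 :+ con 2 :* con 2 :+ con 2 :* (con 2 :* con 2) ≼ a :* a :+ con 2 :* a :+ con 33) by (0 , [])))
        (subst (Within _) (ring (L N ∷ γ₁ ∷ γ ∷ []) (λ a b c → a :* a :+ (con 0 :- con 2 :* a) :+ (con 0 :- b) :+ (con 0 :- con 2 :* c) :+ (con 0 :- con 2 :* (c :* c)) ≈ a :* a :- con 2 :* a :- b :- con 2 :* c :- con 2 :* (c :* c)))
          (within-+ (within-+ (within-+ (within-+ (within-* LN-within LN-within) (within-neg (within-* two LN-within)))
            (within-neg (γ₁-bounds 1≤V))) (within-neg (within-* two γ-within))) (within-neg (within-* two (within-* γ-within γ-within)))))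
        where
        two : Within (ι 2) (ι 2)
        two = within-0≤ (0≤ι 2) ≤-refl

      e₂-within : Within ((ι 14 * L N + ι 45) * u N) e₂
      e₂-within = within-mono
        (lin (L N ∷ u N ∷ []) (λ a b → [] ⊢ (con 2 :* (a :* (con 2 :* b)) :+ con 2 :* (con 3 :* b :* (a :+ con 2)) :+ (con 4 :* a :+ con 21) :* b :+ con 6 :* (con 2 :* b) ≼ (con 14 :* a :+ con 45) :* b) by (0 , [])))
        (subst (Within _) (ring (L N ∷ β ∷ a ∷ H N ∷ c ∷ c₁ ∷ []) (λ b d a e c f → con 2 :* (b :* d) :+ con 2 :* (a :* e) :+ (con 0 :- c) :+ f :* d ≈ con 2 :* (b :* d) :+ con 2 :* (a :* e) :- c :+ f :* d))
          (within-+ (within-+ (within-+ (within-* two (within-* LN-within β-within)) (within-* two (within-* a-within H-within)))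
            (within-neg c-within)) (within-* (c₁-within 1≤V) β-within)))
        where
        two : Within (ι 2) (ι 2)
        two = within-0≤ (0≤ι 2) ≤-refl

      bound : R
      -- At `L N = 0` the three contributions add up to 20 + 33 + 90 = 143, rounded up to 150.
      bound = ι 150 * ((ι 1 + ℓ) * (ι 1 + ℓ))

      E-within : Within bound E
      E-within = subst (Within bound) (sym E≡) (within-mono total
        (within-+ (within-+ (G-approx 1≤N N≤V) (within-neg (within-* φ-within e₁-within)))
          (within-neg (y-small (lin (L N ∷ []) (λ a → (con 0 ≼ a) ∷ [] ⊢ (con 0 ≼ con 14 :* a :+ con 45) by (0 , (45 , []) ∷ (14 , 0 ∷ []) ∷ [])) 0≤LN) e₂-within))))
        where
        total : ι 5 * ((L N + ι 2) * (L N + ι 2)) + ι 1 * (L N * L N + ι 2 * L N + ι 33) + ι 2 * (ι 14 * L N + ι 45) ≤ bound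
        total = (lin (L N ∷ ℓ ∷ []) (λ a b → (a ≼ b) ∷ (con 0 ≼ a) ∷ [] ⊢ (con 5 :* ((a :+ con 2) :* (a :+ con 2)) :+ con 1 :* (a :* a :+ con 2 :* a :+ con 33) :+ con 2 :* (con 14 :* a :+ con 45) ≼ con 150 :* ((con 1 :+ b) :* (con 1 :+ b))) by (0 , (7 , []) ∷ (300 , 0 ∷ []) ∷ (250 , 1 ∷ []) ∷ (150 , 0 ∷ 0 ∷ []) ∷ (300 , 0 ∷ 1 ∷ []) ∷ (144 , 1 ∷ 1 ∷ []) ∷ [])) a-lo 0≤LN)

    module Fixed {x : ℕ} (1≤x : 1 ℕ.≤ x) (2x≤V : 2 ℕ.* x ℕ.≤ V) where
      x≤V : x ℕ.≤ V
      x≤V = 2x≤⇒x≤ 2x≤V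
      1≤V : 1 ℕ.≤ V
      1≤V = ℕₚ.≤-trans 1≤x x≤V

      q : ℕ → R
      q d = ι 1 + (L x - L d)

      1≤q : ∀ {d} → 1 ℕ.≤ d → d ℕ.≤ x → ι 1 ≤ q d
      1≤q {d} p r = (lin (L d ∷ L x ∷ []) (λ a b → (a ≼ b) ∷ [] ⊢ (con 1 ≼ con 1 :+ (b :- a)) by (0 , (1 , 0 ∷ []) ∷ [])) (L-mono p r x≤V))

      -- The right side acts as an antiderivative of (1 + log(x/t))². Replacing `q n = Q + D` by `Q`
      -- loses at most `4 Q + 18`, because `n D ≤ 2` and `D ≤ 3`, and the new factor `n + 1`
      -- supplies a further `6 Q + 24`.
      ∑q² : ∀ n → 1 ℕ.≤ n → n ℕ.≤ x → ∑ n (λ d → q d * q d) ≤ ι n * (q n * q n + ι 6 * q n + ι 24)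
      ∑q² (suc zero) p r = (lin (q 1 ∷ []) (λ a → (con 1 ≼ a) ∷ [] ⊢ (con 0 :+ a :* a ≼ con 1 :* (a :* a :+ con 6 :* a :+ con 24)) by (0 , (30 , []) ∷ (6 , 0 ∷ []) ∷ [])) (1≤q p r))
      ∑q² (suc n@(suc _)) p r = ≤-trans (+-mono-≤ (∑q² n (s≤s z≤n) (ℕₚ.<⇒≤ r)) ≤-refl) (≤-trans (≤-reflexive (cong (λ t → ι n * (t * t + ι 6 * t + ι 24) + Q * Q) qn)) (≤-trans
        (lin (N ∷ D ∷ Q ∷ []) (λ N D Q → (N :* D :* Q ≼ con 2 :* Q) ∷ (N :* D :* D ≼ con 2 :* D) ∷ (N :* D ≼ con 2) ∷ (D ≼ con 3) ∷ (con 1 ≼ Q) ∷ [] ⊢ (N :* ((Q :+ D) :* (Q :+ D) :+ con 6 :* (Q :+ D) :+ con 24) :+ Q :* Q ≼ (con 1 :+ N) :* (Q :* Q :+ con 6 :* Q :+ con 24)) by (0 , (8 , []) ∷ (2 , 0 ∷ []) ∷ (1 , 1 ∷ []) ∷ (6 , 2 ∷ []) ∷ (2 , 3 ∷ []) ∷ (2 , 4 ∷ []) ∷ [])) f₁ f₂ ND2 D3 1≤Q)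
        (≤-reflexive (cong (_* (Q * Q + ι 6 * Q + ι 24)) (sym ιs)))))
        where
        open Step n (s≤s z≤n) (ℕₚ.≤-trans r x≤V)
        Q : R
        Q = q (suc n)
        1≤Q : ι 1 ≤ Q
        1≤Q = 1≤q p r
        qn : q n ≡ Q + D
        qn = (ring (L x ∷ L n ∷ L (suc n) ∷ []) (λ a b c → con 1 :+ (a :- b) ≈ con 1 :+ (a :- c) :+ (c :- b)))
        ND2 : N * D ≤ ι 2
        ND2 = (lin (N ∷ D ∷ b ∷ []) (λ N D b → (N :* D ≼ con 1 :+ b) ∷ (b ≼ con 1) ∷ [] ⊢ (N :* D ≼ con 2) by (0 , (1 , 0 ∷ []) ∷ (1 , 1 ∷ []) ∷ [])) ND-hi b≤1)
        D3 : D ≤ ι 3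
        D3 = (lin (D ∷ b ∷ []) (λ D b → (D ≼ con 3 :* b) ∷ (b ≼ con 1) ∷ [] ⊢ (D ≼ con 3) by (0 , (1 , 0 ∷ []) ∷ (3 , 1 ∷ []) ∷ [])) D≤3b b≤1)
        f₁ : N * D * Q ≤ ι 2 * Q
        f₁ = (lin (N ∷ D ∷ Q ∷ []) (λ N D Q → (N :* D ≼ con 2) ∷ (con 1 ≼ Q) ∷ [] ⊢ (N :* D :* Q ≼ con 2 :* Q) by (0 , (1 , 0 ∷ []) ∷ (1 , 0 ∷ 1 ∷ []) ∷ [])) ND2 1≤Q)
        f₂ : N * D * D ≤ ι 2 * D
        f₂ = (lin (N ∷ D ∷ []) (λ N D → (N :* D ≼ con 2) ∷ (con 0 ≼ D) ∷ [] ⊢ (N :* D :* D ≼ con 2 :* D) by (0 , (1 , 0 ∷ 1 ∷ []) ∷ [])) ND2 0≤D)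

      q-x : q x ≡ ι 1
      q-x = (ring (L x ∷ []) (λ a → con 1 :+ (a :- a) ≈ con 1))

      ∑q²≤31x : ∑ x (λ d → q d * q d) ≤ ι 31 * ι x
      ∑q²≤31x = ≤-trans (∑q² x 1≤x ℕₚ.≤-refl) (≤-reflexive (trans (cong (λ t → ι x * (t * t + ι 6 * t + ι 24)) q-x)
        (ring (ι x ∷ []) (λ a → a :* (con 1 :* con 1 :+ con 6 :* con 1 :+ con 24) ≈ con 31 :* a))))

      L≤x+1 : L x ≤ ι x + ι 1
      L≤x+1 = (lin (L x ∷ H x ∷ ι x ∷ []) (λ a b c → (a ≼ b :+ con 1) ∷ (b ≼ c :* con 1) ∷ [] ⊢ (a ≼ c :+ con 1) by (0 , (1 , 0 ∷ []) ∷ (1 , 1 ∷ []) ∷ [])) (L≤H+1 1≤x x≤V) h)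
        where
        h : H x ≤ ι x * ι 1
        h = ≤-trans (∑-mono x (λ i p _ → u≤1 p)) (≤-reflexive (∑-const x (ι 1)))

      -- Möbius inversion recovers the sum of Λ₂ from `G` and the value `κ x 1` from the sums of
      -- `κ`, so the difference is the sum of μ(d) times the errors `Er d`. The constant is 150 ·
      -- 31.
      ∑Λ₂-κ : Within (ι 4650 * ι x) (∑ x Λ₂ - κ x 1)
      ∑Λ₂-κ = abs-within (≤-trans (≤-reflexive (cong abs eq)) (≤-trans (∑-abs x _) (≤-trans (∑-mono x each)
        (≤-trans (≤-reflexive (∑-*ˡ x (ι 150) _)) (lin (∑ x (λ d → q d * q d) ∷ ι x ∷ []) (λ a b → (a ≼ con 31 :* b) ∷ [] ⊢ (con 150 :* a ≼ con 4650 :* b) by (0 , (150 , 0 ∷ []) ∷ [])) ∑q²≤31x)))))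
        where
        Er : ℕ → R
        Er d = G (x ÷ d) - ∑ (x ÷ d) (λ k → κ x (d ℕ.* k))
        eq : ∑ x Λ₂ - κ x 1 ≡ ∑ x (λ d → μ d * Er d)
        eq = trans (cong₂ _-_ (sym (Λ₂-möbius x)) (sym (möbius (κ x) 1≤x))) (trans (sym (∑-- x _ _))
          (∑-cong x (λ d _ _ → trans (cong (μ d * G (x ÷ d) -_) (∑-*ˡ (x ÷ d) (μ d) _))
            (ring (μ d ∷ G (x ÷ d) ∷ ∑ (x ÷ d) (λ k → κ x (d ℕ.* k)) ∷ []) (λ a b c → a :* b :- a :* c ≈ a :* (b :- c))))))
        each : ∀ d → 1 ℕ.≤ d → d ℕ.≤ x → abs (μ d * Er d) ≤ ι 150 * (q d * q d)
        each d p r = ≤-trans (abs-* (μ d) (Er d)) (lin (abs (μ d) ∷ abs (Er d) ∷ q d ∷ []) (λ a b c → (a ≼ con 1) ∷ (con 0 ≼ b) ∷ (b ≼ con 150 :* (c :* c)) ∷ [] ⊢ (a :* b ≼ con 150 :* (c :* c)) by (0 , (1 , 2 ∷ []) ∷ (1 , 0 ∷ 1 ∷ []) ∷ [])) (μ-abs d) (0≤abs (Er d)) (within-abs (Error.E-within p r 2x≤V)))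

      -- The terms `2 x L x` in `κ x 1` and in `2 T x` cancel. Subtracting `2 L n` inside the sum,
      -- and not 2 x log x outside, gives the form required for summation by parts.
      selberg : Within (ι 4800 * ι x) (∑ x (λ n → Λ₂ n - ι 2 * L n))
      selberg = subst (Within _) (sym eq) (within-mono size
        (within-+ (within-+ (within-+ ∑Λ₂-κ (within-* (c₁-within 1≤V) (within-0≤ (0≤ι x) ≤-refl))) (c₀-within 1≤V))
          (within-+ (within-0≤ 0≤2x ≤-refl) (within-* (within-neg (within-0≤ (0≤ι 2) ≤-refl)) (T-approx 1≤x x≤V)))))
        where
        X : R
        X = ι x
        0≤2x : ι 0 ≤ ι 2 * X
        0≤2x = *-nonneg (0≤ι 2) (0≤ι x)
        κ1 : κ x 1 ≡ ι 2 * (X * L x) + c₁ * X + c₀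
        κ1 = trans (cong₂ (λ s t → ι 2 * (X * s * (L x - t)) + c₁ * (X * s) + c₀) u-1 L-1)
          (ring (X ∷ L x ∷ c₁ ∷ c₀ ∷ []) (λ X a b c → con 2 :* (X :* con 1 :* (a :- con 0)) :+ b :* (X :* con 1) :+ c ≈ con 2 :* (X :* a) :+ b :* X :+ c))
        S S₂ : R
        S = ∑ x Λ₂
        S₂ = S - κ x 1
        eq : ∑ x (λ n → Λ₂ n - ι 2 * L n) ≡ (S₂ + c₁ * X + c₀) + (ι 2 * X + (ι 0 - ι 2) * (T x - (X * L x - X)))
        eq = trans (∑-- x _ _) (trans (cong (S -_) (∑-*ˡ x (ι 2) L)) (trans
          (ring (S ∷ T x ∷ X ∷ L x ∷ c₁ ∷ c₀ ∷ []) (λ S a X b c d → S :- con 2 :* a ≈ S :- (con 2 :* (X :* b) :+ c :* X :+ d) :+ c :* X :+ d :+ (con 2 :* X :+ (con 0 :- con 2) :* (a :- (X :* b :- X)))))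
          (cong (λ t → (S - t + c₁ * X + c₀) + (ι 2 * X + (ι 0 - ι 2) * (T x - (X * L x - X)))) (sym κ1))))
        size : ι 4650 * X + ι 6 * X + ι 35 + (ι 2 * X + ι 2 * (ι 2 * L x + ι 3)) ≤ ι 4800 * X
        size = (lin (L x ∷ X ∷ []) (λ a X → (a ≼ X :+ con 1) ∷ (con 1 ≼ X) ∷ [] ⊢ (con 4650 :* X :+ con 6 :* X :+ con 35 :+ (con 2 :* X :+ con 2 :* (con 2 :* a :+ con 3)) ≼ con 4800 :* X) by (0 , (93 , []) ∷ (4 , 0 ∷ []) ∷ (138 , 1 ∷ []) ∷ [])) L≤x+1 (1≤ι 1≤x))

      ∑q≤31x : ∑ x (λ d → L x - L d) ≤ ι 31 * ι x
      ∑q≤31x = ≤-trans (∑-mono x (λ d p r → (lin (L x ∷ L d ∷ []) (λ a b → (con 1 ≼ con 1 :+ (a :- b)) ∷ [] ⊢ (a :- b ≼ (con 1 :+ (a :- b)) :* (con 1 :+ (a :- b))) by (0 , (1 , []) ∷ (1 , 0 ∷ []) ∷ (1 , 0 ∷ 0 ∷ []) ∷ [])) (1≤q p r)))) ∑q²≤31x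

      ∑÷ : ∑ x (λ i → ι (x ÷ i)) ≤ ι x * (L x + ι 2)
      ∑÷ = ≤-trans (∑-mono x (λ i p _ → ι-÷-≤ x p)) (≤-trans (≤-reflexive (∑-*ˡ x (ι x) u)) (*-monoʳ-≤ (0≤ι x) (H≤L+2 1≤x x≤V)))

      w : ℕ → R
      w n = abs (M (x ÷ n))

      w-beyond : w (suc x) ≡ ι 0
      w-beyond = trans (cong (λ t → abs (M t)) (÷-small (ℕₚ.n<1+n x))) (abs-nonneg ≤-refl)

      w-step : ∀ i → 1 ℕ.≤ i → Within (ι (x ÷ i) - ι (x ÷ suc i)) (w i - w (suc i))
      w-step i p = within-mono (M-lipschitz (÷-anti x p (ℕₚ.n≤1+n i))) (abs-abs-diff (M (x ÷ i)) (M (x ÷ suc i)))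

      ∑i-step : ∑ x (λ i → ι i * (ι (x ÷ i) - ι (x ÷ suc i))) ≡ ∑ x (λ i → ι (x ÷ i))
      ∑i-step = sym (trans (∑-cong x (λ i _ _ → sym (*-identityˡ _))) (trans (∑-abel x (λ _ → ι 1) (λ i → ι (x ÷ i)))
        (trans (cong₂ _+_ (trans (cong (λ t → ∑ x (λ _ → ι 1) * ι t) (÷-small (ℕₚ.n<1+n x))) (*-zeroʳ _))
          (∑-cong x (λ i _ _ → cong (_* (ι (x ÷ i) - ι (x ÷ suc i))) (trans (∑-const i (ι 1)) (*-identityʳ _)))))
          (+-identityˡ _))))

      -- Summation by parts against B(n) = ∑ (Λ₂ − 2 L) = O(n), the weights w being Lipschitz in x/n.
      ∑Λ₂w : (∀ i → 1 ℕ.≤ i → i ℕ.≤ x → Within (ι 4800 * ι i) (∑ i (λ n → Λ₂ n - ι 2 * L n))) →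
        ∑ x (λ n → Λ₂ n * w n) ≤ ι 2 * ∑ x (λ n → L n * w n) + ι 4800 * (ι x * (L x + ι 2))
      ∑Λ₂w h = (lin (∑ x (λ n → Λ₂ n * w n) ∷ ∑ x (λ n → (Λ₂ n - ι 2 * L n) * w n) ∷ ∑ x (λ n → L n * w n) ∷ ι x ∷ L x ∷ []) (λ a b c d e → (a ≼ b :+ con 2 :* c) ∷ (b ≼ con 4800 :* (d :* (e :+ con 2))) ∷ [] ⊢ (a ≼ con 2 :* c :+ con 4800 :* (d :* (e :+ con 2))) by (0 , (1 , 0 ∷ []) ∷ (1 , 1 ∷ []) ∷ [])) (≤-reflexive eq) main)
        where
        b : ℕ → R
        b n = Λ₂ n - ι 2 * L n
        eq : ∑ x (λ n → Λ₂ n * w n) ≡ ∑ x (λ n → b n * w n) + ι 2 * ∑ x (λ n → L n * w n)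
        eq = trans (∑-cong x (λ n _ _ → (ring (Λ₂ n ∷ w n ∷ L n ∷ []) (λ a b c → a :* b ≈ (a :- con 2 :* c) :* b :+ con 2 :* (c :* b)))))
          (trans (∑-+ x _ _) (cong (∑ x (λ n → b n * w n) +_) (∑-*ˡ x (ι 2) _)))
        each : ∀ i → 1 ℕ.≤ i → i ℕ.≤ x → ∑ i b * (w i - w (suc i)) ≤ ι 4800 * (ι i * (ι (x ÷ i) - ι (x ÷ suc i)))
        each i p r = ≤-trans (proj₂ (within-* (h i p r) (w-step i p))) (≤-reflexive (*-assoc _ _ _))
        main : ∑ x (λ n → b n * w n) ≤ ι 4800 * (ι x * (L x + ι 2))
        main = ≤-trans (≤-reflexive (trans (∑-abel x b w) (trans (cong (_+ ∑ x (λ i → ∑ i b * (w i - w (suc i)))) (trans (cong (∑ x b *_) w-beyond) (*-zeroʳ _))) (+-identityˡ _))))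
          (≤-trans (∑-mono x each) (≤-trans (≤-reflexive (trans (∑-*ˡ x (ι 4800) _) (cong (ι 4800 *_) ∑i-step))) (*-monoʳ-≤ (0≤ι 4800) ∑÷)))

      -- Under the sum of μ, `L x * L x` is split as `L n * L n` plus the rest. The first part is
      -- `∑μL²`, whose coefficients are at most `Λ₂` in absolute value; the rest is at most `2 L x`
      -- times the sum of `L x - L n`, which is of order x log x.
      M-recursion : (∀ i → 1 ℕ.≤ i → i ℕ.≤ x → Within (ι 4800 * ι i) (∑ i (λ n → Λ₂ n - ι 2 * L n))) →
        abs (M x) * (L x * L x) ≤ ι 2 * ∑ x (λ n → L n * w n) + ι 9600 * (ι x * (L x + ι 1))
      M-recursion h = ≤-trans step₁ (lin (abs (∑ x (λ n → μ n * (L n * L n))) ∷ ∑ x (λ n → Λ₂ n * w n) ∷ ∑ x (λ n → L n * w n) ∷ ι x ∷ L x ∷ abs (∑ x (λ n → μ n * (L x * L x - L n * L n))) ∷ []) (λ a b c d e f → (a ≼ b) ∷ (b ≼ con 2 :* c :+ con 4800 :* (d :* (e :+ con 2))) ∷ (f ≼ con 62 :* (d :* e)) ∷ (con 0 ≼ d :* e) ∷ [] ⊢ (a :+ f ≼ con 2 :* c :+ con 9600 :* (d :* (e :+ con 1))) by (0 , (1 , 0 ∷ []) ∷ (1 , 1 ∷ []) ∷ (1 , 2 ∷ []) ∷ (4738 , 3 ∷ []) ∷ [])) step₂ (∑Λ₂w h) step₃ (*-nonneg (0≤ι x) 0≤Lx))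
        where
        0≤Lx : ι 0 ≤ L x
        0≤Lx = 0≤L 1≤x
        split : M x * (L x * L x) ≡ ∑ x (λ n → μ n * (L n * L n)) + ∑ x (λ n → μ n * (L x * L x - L n * L n))
        split = trans (sym (∑-*ʳ x (L x * L x) μ)) (trans (∑-cong x (λ n _ _ →
          (ring (μ n ∷ L x ∷ L n ∷ []) (λ a b c → a :* (b :* b) ≈ a :* (c :* c) :+ a :* (b :* b :- c :* c))))) (∑-+ x _ _))
        step₁ : abs (M x) * (L x * L x) ≤ abs (∑ x (λ n → μ n * (L n * L n))) + abs (∑ x (λ n → μ n * (L x * L x - L n * L n)))
        step₁ = ≤-trans (≤-trans pull (≤-reflexive (cong abs split))) (abs-+ _ _)
          where
          pull : abs (M x) * (L x * L x) ≤ abs (M x * (L x * L x))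
          pull with abs-cases (M x)
          ... | inj₁ e = ≤-trans (≤-reflexive (cong (_* (L x * L x)) e)) (x≤abs _)
          ... | inj₂ e = ≤-trans (≤-reflexive (trans (cong (_* (L x * L x)) e) (ring (M x ∷ L x ∷ []) (λ a b → (con 0 :- a) :* (b :* b) ≈ con 0 :- a :* (b :* b))))) (-x≤abs _)
        step₂ : abs (∑ x (λ n → μ n * (L n * L n))) ≤ ∑ x (λ n → Λ₂ n * w n)
        step₂ = ≤-trans (≤-reflexive (cong abs (∑μL² x))) (≤-trans (∑-abs x _) (∑-mono x (λ n p _ →
          ≤-trans (abs-* _ _) (*-mono-≤ (0≤abs _) (0≤abs _) (abs-lub
            (lin (Λ n ∷ L n ∷ Λ*Λ n ∷ []) (λ a b c → (con 0 ≼ a :* b) ∷ [] ⊢ (c :- a :* b ≼ a :* b :+ c) by (0 , (2 , 0 ∷ []) ∷ [])) (*-nonneg (0≤Λ p) (0≤L p)))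
            (lin (Λ*Λ n ∷ Λ n ∷ L n ∷ []) (λ a b c → (con 0 ≼ a) ∷ [] ⊢ (con 0 :- (a :- b :* c) ≼ b :* c :+ a) by (0 , (2 , 0 ∷ []) ∷ [])) (0≤Λ*Λ p))) ≤-refl))))
        step₃ : abs (∑ x (λ n → μ n * (L x * L x - L n * L n))) ≤ ι 62 * (ι x * L x)
        step₃ = ≤-trans (∑-abs x _) (≤-trans (∑-mono x each) (≤-trans (≤-reflexive (∑-*ˡ x (ι 2 * L x) _))
          (lin (L x ∷ ∑ x (λ d → L x - L d) ∷ ι x ∷ []) (λ a b c → (a :* b ≼ a :* (con 31 :* c)) ∷ [] ⊢ (con 2 :* a :* b ≼ con 62 :* (c :* a)) by (0 , (2 , 0 ∷ []) ∷ [])) (*-monoʳ-≤ 0≤Lx ∑q≤31x))))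
          where
          each : ∀ n → 1 ℕ.≤ n → n ℕ.≤ x → abs (μ n * (L x * L x - L n * L n)) ≤ ι 2 * L x * (L x - L n)
          each n p r = ≤-trans (abs-* _ _) (≤-trans (*-mono-≤ (0≤abs _) (0≤abs _) (μ-abs n) (≤-reflexive (abs-nonneg 0≤d))) (
            (lin (L n ∷ L x ∷ []) (λ a b → (a ≼ b) ∷ [] ⊢ (con 1 :* (b :* b :- a :* a) ≼ con 2 :* b :* (b :- a)) by (0 , (1 , 0 ∷ 0 ∷ []) ∷ [])) L≤)))
            where
            L≤ : L n ≤ L x
            L≤ = L-mono p r x≤V
            0≤d : ι 0 ≤ L x * L x - L n * L n
            0≤d = (lin (L n ∷ L x ∷ []) (λ a b → (a ≼ b) ∷ (con 0 ≼ a) ∷ [] ⊢ (con 0 ≼ b :* b :- a :* a) by (0 , (1 , 0 ∷ 0 ∷ []) ∷ (2 , 0 ∷ 1 ∷ []) ∷ [])) L≤ (0≤L p))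

    selberg : ∀ {x} → 1 ℕ.≤ x → 2 ℕ.* x ℕ.≤ V → Within (ι 4800 * ι x) (∑ x (λ n → Λ₂ n - ι 2 * L n))
    selberg p q = Fixed.selberg p q

    M-recursion : ∀ {x} → 1 ℕ.≤ x → 2 ℕ.* x ℕ.≤ V →
      abs (M x) * (L x * L x) ≤ ι 2 * ∑ x (λ n → L n * abs (M (x ÷ n))) + ι 9600 * (ι x * (L x + ι 1))
    M-recursion p q = Fixed.M-recursion p q (λ i r s → Fixed.selberg r (ℕₚ.≤-trans (ℕₚ.*-monoʳ-≤ 2 s) q))

-- Bounded partial sums of M(x/n) and the existence of small values

module MertensPartialSums where
  open SealedRationals
  open LinearArithmetic
  open FiniteSums
  open ArithmeticFunctions
  open MangoldtIdentities
  open LogarithmicSums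
  open SelbergFormula using (M-lipschitz; ∣M∣≤)

  ∑-proportional : ∀ {m n} (f g : ℕ → R) c → m ℕ.≤ n → (∀ i → m ℕ.< i → i ℕ.≤ n → f i ≡ g i * c) →
    ∑ n f - ∑ m f ≡ (∑ n g - ∑ m g) * c
  ∑-proportional {m} {n} f g c p h = (≤-antisym (lin (∑ m f ∷ ∑ m g ∷ c ∷ ∑ n f ∷ ∑ n g ∷ []) (λ a b c d e → (d :- e :* c ≼ a :- b :* c) ∷ [] ⊢ (d :- a ≼ (e :- b) :* c) by (0 , (1 , 0 ∷ []) ∷ [])) (≤-reflexive (sym e))) (lin (∑ m f ∷ ∑ m g ∷ c ∷ ∑ n f ∷ ∑ n g ∷ []) (λ a b c d e → (a :- b :* c ≼ d :- e :* c) ∷ [] ⊢ ((e :- b) :* c ≼ d :- a) by (0 , (1 , 0 ∷ []) ∷ [])) (≤-reflexive e)))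
    where
    e : ∑ m f - ∑ m g * c ≡ ∑ n f - ∑ n g * c
    e = trans (trans (cong (∑ m f -_) (sym (∑-*ʳ m c g))) (sym (∑-- m _ _)))
      (trans (∑-extend (λ i → f i - g i * c) p (λ i a b → trans (cong (_- g i * c) (h i a b)) (+-inverseʳ _)))
        (trans (∑-- n _ _) (cong (∑ n f -_) (∑-*ʳ n c g))))

  -- Multiplied by `z`, the sum differs from the sum of μ(d) ⌊z/d⌋, which is 1, by at most one for
  -- each of the `z` roundings.
  ∑μu-bound : ∀ {z} → 1 ℕ.≤ z → Within (ι 2) (∑ z (λ d → μ d * u d))
  ∑μu-bound {z} p = *-cancel-≤ (ι-mono p) (lo) , *-cancel-≤ (ι-mono p) hi
    where
    s err : R
    s = ∑ z (λ d → μ d * u d)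
    err = ∑ z (λ d → μ d * (ι z * u d - ι (z ÷ d)))
    err-bound : Within (ι z * ι 1) err
    err-bound = abs-within (≤-trans (∑-abs z _) (≤-trans (∑-mono z (λ d q _ → ≤-trans (abs-* _ _)
      (≤-trans (*-mono-≤ (0≤abs _) (0≤abs _) (μ-abs d) (within-abs (within-0≤
        (lin (ι (z ÷ d) ∷ ι z ∷ u d ∷ []) (λ a b c → (a ≼ b :* c) ∷ [] ⊢ (con 0 ≼ b :* c :- a) by (0 , (1 , 0 ∷ []) ∷ [])) (ι-÷-≤ z q))
        (lin (ι z ∷ u d ∷ ι (z ÷ d) ∷ []) (λ a b c → (a :* b ≼ c :+ con 1) ∷ [] ⊢ (a :* b :- c ≼ con 1) by (0 , (1 , 0 ∷ []) ∷ [])) (ι-÷-> z q))))) (lin ([]) ([] ⊢ (con 1 :* con 1 ≼ con 1) by (0 , []))))))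
      (≤-reflexive (∑-const z (ι 1)))))
    eq : ι z * s ≡ err + ι 1
    eq = trans (trans (sym (∑-*ˡ z (ι z) _)) (trans (∑-cong z (λ d _ _ →
        (ring (ι z ∷ μ d ∷ u d ∷ ι (z ÷ d) ∷ []) (λ a b c d → a :* (b :* c) ≈ b :* (a :* c :- d) :+ b :* d)))) (∑-+ z _ _))) (cong (err +_) (∑μ-÷ p))
    lo : ι z * (ι 0 - ι 2) ≤ ι z * s
    lo = (lin (ι z ∷ s ∷ err ∷ []) (λ a s err → (err :+ con 1 ≼ a :* s) ∷ (con 0 :- a :* con 1 ≼ err) ∷ (con 1 ≼ a) ∷ [] ⊢ (a :* (con 0 :- con 2) ≼ a :* s) by (0 , (2 , []) ∷ (1 , 0 ∷ []) ∷ (1 , 1 ∷ []) ∷ (1 , 2 ∷ []) ∷ [])) (≤-reflexive (sym eq)) (proj₁ err-bound) (1≤ι p))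
    hi : ι z * s ≤ ι z * ι 2
    hi = (lin (ι z ∷ s ∷ err ∷ []) (λ a s err → (a :* s ≼ err :+ con 1) ∷ (err ≼ a :* con 1) ∷ (con 1 ≼ a) ∷ [] ⊢ (a :* s ≼ a :* con 2) by (0 , (1 , 0 ∷ []) ∷ (1 , 1 ∷ []) ∷ (1 , 2 ∷ []) ∷ [])) (≤-reflexive eq) (proj₂ err-bound) (1≤ι p))

  module Partial (x : ℕ) (1≤x : 1 ℕ.≤ x) where
    S : ℕ → R
    S z = ∑ z (λ d → μ d * ι (x ÷ d))

    F : ℕ → R
    F N = ∑ N (λ n → M (x ÷ n))

    -- For d between `x ÷ suc N` and `x ÷ N` the quotient `x ÷ d` is constantly `N`, so there the
    -- increment of `S` is `N` times that of M. The induction starts from S(x) = 1.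
    F≡ : ∀ N → 1 ℕ.≤ N → F N ≡ ι N * M (x ÷ N) + (ι 1 - S (x ÷ N))
    F≡ (suc zero) _ = trans (+-identityˡ _) (trans (ring (M (x ÷ 1) ∷ []) (λ a → a ≈ con 1 :* a :+ (con 1 :- con 1)))
      (cong (λ t → ι 1 * M (x ÷ 1) + (ι 1 - t)) (sym (trans (cong S (÷-one x)) (∑μ-÷ 1≤x)))))
    F≡ (suc N@(suc _)) _ = (≤-antisym (lin (F N ∷ ι N ∷ m ∷ S z ∷ S z′ ∷ m′ ∷ ι (suc N) ∷ []) (λ a b m c d m′ e → (a ≼ b :* m :+ (con 1 :- c)) ∷ ((m :- m′) :* b ≼ c :- d) ∷ ((con 1 :+ b) :* m′ ≼ e :* m′) ∷ [] ⊢ (a :+ m′ ≼ e :* m′ :+ (con 1 :- d)) by (0 , (1 , 0 ∷ []) ∷ (1 , 1 ∷ []) ∷ (1 , 2 ∷ []) ∷ [])) (≤-reflexive (F≡ N (s≤s z≤n))) (≤-reflexive (sym e)) (≤-reflexive (sym (cong (_* m′) (ι-suc N))))) (lin (F N ∷ ι N ∷ m ∷ S z ∷ S z′ ∷ m′ ∷ ι (suc N) ∷ []) (λ a b m c d m′ e → (b :* m :+ (con 1 :- c) ≼ a) ∷ (c :- d ≼ (m :- m′) :* b) ∷ (e :* m′ ≼ (con 1 :+ b) :* m′) ∷ [] ⊢ (e :* m′ :+ (con 1 :- d) ≼ a :+ m′) by (0 , (1 , 0 ∷ []) ∷ (1 , 1 ∷ []) ∷ (1 , 2 ∷ []) ∷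 [])) (≤-reflexive (sym (F≡ N (s≤s z≤n)))) (≤-reflexive e) (≤-reflexive (cong (_* m′) (ι-suc N)))))
      where
      z z′ : ℕ
      z = x ÷ N
      z′ = x ÷ suc N
      m m′ : R
      m = M z
      m′ = M z′
      e : S z - S z′ ≡ (m - m′) * ι N
      e = ∑-proportional _ μ (ι N) (÷-anti x (s≤s z≤n) (ℕₚ.n≤1+n N)) λ d p q → cong (λ t → μ d * ι t) (exact d p q)
        where
        exact : ∀ d → z′ ℕ.< d → d ℕ.≤ z → x ÷ d ≡ N
        exact d p q = ℕₚ.≤-antisym
          (ℕₚ.≤-pred (ℕₚ.≰⇒> (λ h → ℕₚ.<⇒≱ p (÷-least (s≤s z≤n) (ℕₚ.≤-trans (ℕₚ.≤-reflexive (ℕₚ.*-comm (suc N) d)) (÷-most {x} {d} h))))))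
          (÷-least (ℕₚ.≤-trans (s≤s z≤n) p) (ℕₚ.≤-trans (ℕₚ.≤-reflexive (ℕₚ.*-comm d N)) (÷-most {x} {N} q)))

    -- In `F≡` the product `N M(x/N)` is at most `x`. In `S`, the sum of μ(d)/d contributes `2 x`
    -- and the roundings at most `x`; the summand 1 is also at most `x`.
    F-bound : ∀ N → 1 ℕ.≤ N → N ℕ.≤ x → Within (ι 5 * ι x) (F N)
    F-bound N p q = subst (Within _) (sym eq) (within-mono size
      (within-+ (within-* (within-0≤ (0≤ι N) ≤-refl) (abs-within (∣M∣≤ z)))
        (within-+ (within-0≤ (0≤ι 1) ≤-refl) (within-neg (within-+ (within-* (within-0≤ (0≤ι x) ≤-refl) (∑μu-bound 1≤z)) err-bound)))))
      where
      z : ℕ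
      z = x ÷ N
      1≤z : 1 ℕ.≤ z
      1≤z = 1≤÷ p q
      err : R
      err = ∑ z (λ d → μ d * (ι (x ÷ d) - ι x * u d))
      err-bound : Within (ι z * ι 1) err
      err-bound = abs-within (≤-trans (∑-abs z _) (≤-trans (∑-mono z (λ d r _ → ≤-trans (abs-* _ _)
        (≤-trans (*-mono-≤ (0≤abs _) (0≤abs _) (μ-abs d) (within-abs (
          (lin (ι x ∷ u d ∷ ι (x ÷ d) ∷ []) (λ a b c → (a :* b ≼ c :+ con 1) ∷ [] ⊢ (con 0 :- con 1 ≼ c :- a :* b) by (0 , (1 , 0 ∷ []) ∷ [])) (ι-÷-> x r)) ,
          (lin (ι (x ÷ d) ∷ ι x ∷ u d ∷ []) (λ a b c → (a ≼ b :* c) ∷ [] ⊢ (a :- b :* c ≼ con 1) by (0 , (1 , []) ∷ (1 , 0 ∷ []) ∷ [])) (ι-÷-≤ x r))))) (lin ([]) ([] ⊢ (con 1 :* con 1 ≼ con 1) by (0 , []))))))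
        (≤-reflexive (∑-const z (ι 1)))))
      S≡ : S z ≡ ι x * ∑ z (λ d → μ d * u d) + err
      S≡ = trans (∑-cong z (λ d _ _ → (ring (μ d ∷ ι (x ÷ d) ∷ ι x ∷ u d ∷ []) (λ a b c d → a :* b ≈ c :* (a :* d) :+ a :* (b :- c :* d)))))
        (trans (∑-+ z _ _) (cong (_+ err) (∑-*ˡ z (ι x) _)))
      eq : F N ≡ ι N * M z + (ι 1 + (ι 0 - (ι x * ∑ z (λ d → μ d * u d) + err)))
      eq = trans (F≡ N p) (trans (cong (λ t → ι N * M z + (ι 1 - t)) S≡)
        (ring (ι N ∷ M z ∷ ι x ∷ ∑ z (λ d → μ d * u d) ∷ err ∷ []) (λ a b c d err → a :* b :+ (con 1 :- (c :* d :+ err)) ≈ a :* b :+ (con 1 :+ (con 0 :- (c :* d :+ err))))))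
      size : ι N * ι z + (ι 1 + (ι x * ι 2 + ι z * ι 1)) ≤ ι 5 * ι x
      size = (lin (ι N ∷ ι z ∷ ι x ∷ []) (λ a b c → (a :* b ≼ c) ∷ (b ≼ c) ∷ (con 1 ≼ c) ∷ [] ⊢ (a :* b :+ (con 1 :+ (c :* con 2 :+ b :* con 1)) ≼ con 5 :* c) by (0 , (1 , 0 ∷ []) ∷ (1 , 1 ∷ []) ∷ (1 , 2 ∷ []) ∷ [])) (≤-trans (≤-reflexive (sym (ι-* N z))) (ι-mono (÷-lower x N))) (ι-mono (÷-≤ x N)) (1≤ι 1≤x))

    -- While |M(x/n)| stays above β x/n it cannot change sign, as it moves by less than that in one step.
    module NoSignChange (β : R) (0≤β : ι 0 ≤ β) (m : ℕ → R)
      (m-step : ∀ n → 1 ℕ.≤ n → m n - m (suc n) ≤ ι (x ÷ n) - ι (x ÷ suc n))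
      (a b : ℕ) (2≤βa : ι 2 ≤ β * ι a) (1≤a : 1 ℕ.≤ a) (2≤βx : ∀ n → 1 ℕ.≤ n → n ℕ.≤ b → ι 2 ≤ β * (ι x * u n))
      (large : ∀ n → a ℕ.< n → n ℕ.≤ b → β * (ι x * u n) ≤ m n ⊎ β * (ι x * u n) ≤ ι 0 - m n)
      (start : β * (ι x * u (suc a)) ≤ m (suc a)) where

      stay : ∀ n → a ℕ.< n → n ℕ.< b → β * (ι x * u n) ≤ m n → β * (ι x * u (suc n)) ≤ m (suc n)
      stay n p q h with large (suc n) (ℕₚ.m≤n⇒m≤1+n p) q
      ... | inj₁ r = r
      ... | inj₂ r = ⊥-elim (1≰0 contra)
        where
        1≤n : 1 ℕ.≤ n
        1≤n = ℕₚ.≤-trans 1≤a (ℕₚ.<⇒≤ p)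
        X a′ b′ : R
        X = ι x
        a′ = u n
        b′ = u (suc n)
        e₁ : X * a′ - X * b′ ≡ X * (a′ * b′)
        e₁ = trans (ring (X ∷ a′ ∷ b′ ∷ []) (λ X a′ b′ → X :* a′ :- X :* b′ ≈ X :* (a′ :- b′))) (cong (X *_) (u-step 1≤n))
        2≤βn : ι 2 ≤ β * ι n
        2≤βn = ≤-trans 2≤βa (*-monoʳ-≤ 0≤β (ι-mono (ℕₚ.<⇒≤ p)))
        0≤b′ : ι 0 ≤ b′
        0≤b′ = 0≤u (s≤s z≤n)
        0≤Xab : ι 0 ≤ X * (a′ * b′)
        0≤Xab = *-nonneg (0≤ι x) (*-nonneg (0≤u 1≤n) 0≤b′)
        e₂ : β * ι n * (X * (a′ * b′)) ≡ β * (X * b′)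
        e₂ = trans (ring (β ∷ ι n ∷ X ∷ a′ ∷ b′ ∷ []) (λ a b X a′ b′ → a :* b :* (X :* (a′ :* b′)) ≈ a :* (X :* b′) :* (b :* a′))) (trans (cong (β * (X * b′) *_) (ι*u 1≤n)) (*-identityʳ _))
        f : ι 2 * (X * (a′ * b′)) ≤ β * (X * b′)
        f = ≤-trans (lin (β ∷ ι n ∷ X ∷ a′ ∷ b′ ∷ []) (λ a b X a′ b′ → (con 2 ≼ a :* b) ∷ (con 0 ≼ X :* (a′ :* b′)) ∷ [] ⊢ (con 2 :* (X :* (a′ :* b′)) ≼ a :* b :* (X :* (a′ :* b′))) by (0 , (1 , 0 ∷ 1 ∷ []) ∷ [])) 2≤βn 0≤Xab) (≤-reflexive e₂)
        -- A change of sign would need a fall of at least β x/n + β x/(n+1). The actual fall is at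
        -- most x/(n(n+1)) + 1, and the hypotheses 2 ≤ β n and 2 ≤ β x/n bound this by half of the
        -- same sum.
        contra : ι 1 ≤ ι 0
        contra = (lin (β ∷ X ∷ a′ ∷ m n ∷ b′ ∷ m (suc n) ∷ ι (x ÷ n) ∷ ι (x ÷ suc n) ∷ []) (λ a X a′ b b′ c d e → (a :* (X :* a′) ≼ b) ∷ (a :* (X :* b′) ≼ con 0 :- c) ∷ (b :- c ≼ d :- e) ∷ (d ≼ X :* a′) ∷ (X :* b′ ≼ e :+ con 1) ∷ (X :* a′ :- X :* b′ ≼ X :* (a′ :* b′)) ∷ (con 2 :* (X :* (a′ :* b′)) ≼ a :* (X :* b′)) ∷ (con 2 ≼ a :* (X :* a′)) ∷ (con 0 ≼ a :* (X :* b′)) ∷ [] ⊢ (con 1 ≼ con 0) by (1 , (2 , 0 ∷ []) ∷ (2 , 1 ∷ []) ∷ (2 , 2 ∷ []) ∷ (2 , 3 ∷ []) ∷ (2 , 4 ∷ []) ∷ (2 , 5 ∷ []) ∷ (1 , 6 ∷ []) ∷ (2 , 7 ∷ []) ∷ (1 , 8 ∷ []) ∷ [])) h r (m-step n 1≤n) (ι-÷-≤ x 1≤n) (ι-÷-> x {suc n} (s≤s z≤n)) (≤-reflexive e₁) f (2≤βx n 1≤n (ℕₚ.<⇒≤ q)) (*-nonneg 0≤β (*-nonneg (0≤ι x) 0≤b′)))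

      positive-on : ∀ j → a ℕ.+ suc j ℕ.≤ b → β * (ι x * u (a ℕ.+ suc j)) ≤ m (a ℕ.+ suc j)
      positive-on zero p = subst (λ t → β * (ι x * u t) ≤ m t) (sym (ℕₚ.+-comm a 1)) start
      positive-on (suc j) p = subst (λ t → β * (ι x * u t) ≤ m t) (sym (ℕₚ.+-suc a (suc j)))
        (stay (a ℕ.+ suc j) (ℕₚ.m<m+n a (s≤s z≤n)) p′ (positive-on j (ℕₚ.<⇒≤ p′)))
        where
        p′ : a ℕ.+ suc j ℕ.< b
        p′ = ℕₚ.≤-trans (ℕₚ.≤-reflexive (sym (ℕₚ.+-suc a (suc j)))) p

      sum-large : ∀ j → a ℕ.+ j ℕ.≤ b → β * ι x * (H (a ℕ.+ j) - H a) ≤ ∑ (a ℕ.+ j) m - ∑ a m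
      sum-large zero p = ≤-reflexive (trans (cong (λ t → β * ι x * (H t - H a)) (ℕₚ.+-identityʳ a))
        (trans (ring (β ∷ ι x ∷ H a ∷ ∑ a m ∷ []) (λ a b c d → a :* b :* (c :- c) ≈ d :- d)) (cong (λ t → ∑ t m - ∑ a m) (sym (ℕₚ.+-identityʳ a)))))
      sum-large (suc j) p = subst (λ t → β * ι x * (H t - H a) ≤ ∑ t m - ∑ a m) (sym (ℕₚ.+-suc a j))
        (lin (β ∷ ι x ∷ H (a ℕ.+ j) ∷ H a ∷ ∑ (a ℕ.+ j) m ∷ ∑ a m ∷ u (suc (a ℕ.+ j)) ∷ m (suc (a ℕ.+ j)) ∷ []) (λ a b c d e f g h → (a :* b :* (c :- d) ≼ e :- f) ∷ (a :* (b :* g) ≼ h) ∷ [] ⊢ (a :* b :* (c :+ g :- d) ≼ e :+ h :- f) by (0 , (1 , 0 ∷ []) ∷ (1 , 1 ∷ []) ∷ [])) (sum-large j (ℕₚ.<⇒≤ p′)) pos)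
        where
        p′ : suc (a ℕ.+ j) ℕ.≤ b
        p′ = ℕₚ.≤-trans (ℕₚ.≤-reflexive (sym (ℕₚ.+-suc a j))) p
        pos : β * (ι x * u (suc (a ℕ.+ j))) ≤ m (suc (a ℕ.+ j))
        pos = subst (λ t → β * (ι x * u t) ≤ m t) (ℕₚ.+-suc a j) (positive-on j p)

    search : ∀ {P : ℕ → Set} → (∀ n → Dec (P n)) → ∀ a j → (∃ λ n → a ℕ.< n × n ℕ.≤ a ℕ.+ j × P n) ⊎ (∀ n → a ℕ.< n → n ℕ.≤ a ℕ.+ j → ¬ P n)
    search P? a zero = inj₂ (λ n p q _ → ℕₚ.<⇒≱ p (ℕₚ.≤-trans q (ℕₚ.≤-reflexive (ℕₚ.+-identityʳ a))))
    search P? a (suc j) with search P? a j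
    ... | inj₁ (n , p , q , h) = inj₁ (n , p , ℕₚ.≤-trans q (ℕₚ.+-monoʳ-≤ a (ℕₚ.n≤1+n j)) , h)
    ... | inj₂ none with P? (a ℕ.+ suc j)
    ... | yes h = inj₁ (a ℕ.+ suc j , ℕₚ.m<m+n a (s≤s z≤n) , ℕₚ.≤-refl , h)
    ... | no ¬h = inj₂ λ n p q h → lem n p q h
      where
      lem : ∀ n → a ℕ.< n → n ℕ.≤ a ℕ.+ suc j → ¬ _
      lem n p q h with ℕₚ.m≤n⇒m<n∨m≡n q
      ... | inj₂ refl = ¬h h
      ... | inj₁ r = none n p (ℕₚ.≤-pred (ℕₚ.≤-trans r (ℕₚ.≤-reflexive (ℕₚ.+-suc a j)))) h

    -- Otherwise the partial sums of M(x/n), which are O(x), would grow by β x log (b/a).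
    small-value : ∀ (β : R) → ι 0 ≤ β → ∀ a j → 1 ℕ.≤ a → 1 ℕ.≤ j → a ℕ.+ j ℕ.≤ x → ι 2 ≤ β * ι a →
      (∀ n → 1 ℕ.≤ n → n ℕ.≤ a ℕ.+ j → ι 2 ≤ β * (ι x * u n)) → ι 11 ≤ β * (H (a ℕ.+ j) - H a) →
      ∃ λ n → a ℕ.< n × n ℕ.≤ a ℕ.+ j × abs (M (x ÷ n)) ≤ β * (ι x * u n)
    small-value β 0≤β a j 1≤a 1≤j b≤x 2≤βa 2≤βx 11≤ with search (λ n → abs (M (x ÷ n)) ≤? (β * (ι x * u n))) a j
    ... | inj₁ r = r
    ... | inj₂ none = ⊥-elim (by-sign (large (suc a) ℕₚ.≤-refl (ℕₚ.≤-trans (ℕₚ.≤-reflexive (ℕₚ.+-comm 1 a)) (ℕₚ.+-monoʳ-≤ a 1≤j))))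
      where
      b : ℕ
      b = a ℕ.+ j
      m : ℕ → R
      m n = M (x ÷ n)
      large : ∀ n → a ℕ.< n → n ℕ.≤ b → β * (ι x * u n) ≤ m n ⊎ β * (ι x * u n) ≤ ι 0 - m n
      large n p q with abs-cases (m n)
      ... | inj₁ e = inj₁ (≤-trans (<⇒≤ (none n p q)) (≤-reflexive e))
      ... | inj₂ e = inj₂ (≤-trans (<⇒≤ (none n p q)) (≤-reflexive e))
      step : ∀ n → 1 ℕ.≤ n → Within (ι (x ÷ n) - ι (x ÷ suc n)) (m n - m (suc n))
      step n p = abs-within (M-lipschitz (÷-anti x p (ℕₚ.n≤1+n n)))
      Fa Fb : Within (ι 5 * ι x) _
      Fa = F-bound a 1≤a (ℕₚ.≤-trans (ℕₚ.m≤m+n a j) b≤x)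
      Fb = F-bound b (ℕₚ.≤-trans 1≤a (ℕₚ.m≤m+n a j)) b≤x
      -- `F-bound` at both ends allows a growth of `10 x`; the hypothesis with 11 is the least
      -- integer above it.
      too-large : β * ι x * (H b - H a) ≤ ι 10 * ι x → ⊥
      too-large h = 1≰0 (lin (β ∷ ι x ∷ H b ∷ H a ∷ []) (λ a b c d → (a :* b :* (c :- d) ≼ con 10 :* b) ∷ (b :* con 11 ≼ b :* (a :* (c :- d))) ∷ (con 1 ≼ b) ∷ [] ⊢ (con 1 ≼ con 0) by (0 , (1 , 0 ∷ []) ∷ (1 , 1 ∷ []) ∷ (1 , 2 ∷ []) ∷ [])) h (*-monoʳ-≤ (0≤ι x) 11≤) (1≤ι 1≤x))
      by-sign : β * (ι x * u (suc a)) ≤ m (suc a) ⊎ β * (ι x * u (suc a)) ≤ ι 0 - m (suc a) → ⊥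
      by-sign (inj₁ start) = too-large (≤-trans (NSC.sum-large j ℕₚ.≤-refl)
        (lin (ι x ∷ F a ∷ F b ∷ []) (λ a b c → (con 0 :- con 5 :* a ≼ b) ∷ (c ≼ con 5 :* a) ∷ [] ⊢ (c :- b ≼ con 10 :* a) by (0 , (1 , 0 ∷ []) ∷ (1 , 1 ∷ []) ∷ [])) (proj₁ Fa) (proj₂ Fb)))
        where
        module NSC = NoSignChange β 0≤β m (λ n p → proj₂ (step n p)) a b 2≤βa 1≤a 2≤βx large start
      by-sign (inj₂ start) = too-large (≤-trans (NSC.sum-large j ℕₚ.≤-refl)
        (lin (ι x ∷ F b ∷ F a ∷ ∑ b m′ ∷ ∑ a m′ ∷ []) (λ a b c d e → (con 0 :- con 5 :* a ≼ b) ∷ (c ≼ con 5 :* a) ∷ (d ≼ con 0 :- b) ∷ (con 0 :- c ≼ e) ∷ [] ⊢ (d :- e ≼ con 10 :* a) by (0 , (1 , 0 ∷ []) ∷ (1 , 1 ∷ []) ∷ (1 , 2 ∷ []) ∷ (1 , 3 ∷ []) ∷ [])) (proj₁ Fb) (proj₂ Fa) (≤-reflexive (∑neg b)) (≤-reflexive (sym (∑neg a)))))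
        where
        m′ : ℕ → R
        m′ n = ι 0 - m n
        ∑neg : ∀ n → ∑ n m′ ≡ ι 0 - F n
        ∑neg n = trans (∑-- n (λ _ → ι 0) m) (cong (_- F n) (∑-zero n (λ _ _ _ → refl)))
        flip : ∀ n → a ℕ.< n → n ℕ.≤ b → β * (ι x * u n) ≤ m′ n ⊎ β * (ι x * u n) ≤ ι 0 - m′ n
        flip n p q with large n p q
        ... | inj₁ h = inj₂ (≤-trans h (≤-reflexive (ring (m n ∷ []) (λ a → a ≈ con 0 :- (con 0 :- a)))))
        ... | inj₂ h = inj₁ h
        module NSC = NoSignChange β 0≤β m′ (λ n p → (lin (ι (x ÷ n) ∷ ι (x ÷ suc n) ∷ m n ∷ m (suc n) ∷ []) (λ a b c d → (con 0 :- (a :- b) ≼ c :- d) ∷ [] ⊢ (con 0 :- c :- (con 0 :- d) ≼ a :- b) by (0 , (1 , 0 ∷ []) ∷ [])) (proj₁ (step n p))))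
          a b 2≤βa 1≤a 2≤βx flip start

-- The contraction argument: M(x) = o(x)

module MertensBound where
  open SealedRationals
  open LinearArithmetic
  open FiniteSums
  open ArithmeticFunctions
  open MangoldtIdentities
  open LogarithmicSums
  open SelbergFormula
  open MertensPartialSums
  open import Data.Nat.Base using (_^_)

  1≤^ : ∀ {b} → 1 ℕ.≤ b → ∀ n → 1 ℕ.≤ b ^ n
  1≤^ p zero = s≤s z≤n
  1≤^ p (suc n) = 1≤-* p (1≤^ p n)

  n<2^n : ∀ n → n ℕ.< 2 ^ n
  n<2^n zero = s≤s z≤n
  n<2^n (suc n) = (linℕ (n ∷ 2 ^ n ∷ []) (λ n a → (con 1 :+ n ≼ a) ∷ (con 1 ≼ a) ∷ [] ⊢ (con 1 :+ (con 1 :+ n) ≼ con 2 :* a) by (0 , (1 , 0 ∷ []) ∷ (1 , 1 ∷ []) ∷ [])) (n<2^n n) (1≤^ {2} (s≤s z≤n) n))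

  ^-between : ∀ {b} → 2 ℕ.≤ b → ∀ x → 1 ℕ.≤ x → ∃ λ e → b ^ e ℕ.≤ x × x ℕ.< b ^ suc e
  ^-between {b} p (suc zero) _ = 0 , s≤s z≤n , ℕₚ.≤-trans p (ℕₚ.≤-reflexive (sym (ℕₚ.*-identityʳ b)))
  ^-between {b} p (suc x@(suc _)) _ with ^-between p x (s≤s z≤n)
  ... | e , lo , hi with suc x ℕₚ.<? b ^ suc e
  ... | yes h = e , ℕₚ.m≤n⇒m≤1+n lo , h
  ... | no ¬h = suc e , ℕₚ.≮⇒≥ ¬h , (linℕ (x ∷ b ^ suc e ∷ b ∷ []) (λ x a b → (con 1 :+ x ≼ a) ∷ (con 2 ≼ b) ∷ (con 1 ≼ a) ∷ (con 0 ≼ a) ∷ (con 0 ≼ b) ∷ [] ⊢ (con 1 :+ (con 1 :+ x) ≼ b :* a) by (1 , (2 , 0 ∷ []) ∷ (1 , 1 ∷ []) ∷ (1 , 1 ∷ 3 ∷ []) ∷ (1 , 2 ∷ 4 ∷ []) ∷ [])) hi p (1≤^ (ℕₚ.≤-trans (s≤s z≤n) p) (suc e)) ℕ.z≤n ℕ.z≤n)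

  module Growth {V : ℕ} {L : ℕ → R} (ls : LogSys V L) where
    open LogSys ls
    open LogarithmicSums.Estimates ls

    L-^ : ∀ {b} → 1 ℕ.≤ b → ∀ n → L (b ^ n) ≡ ι n * L b
    L-^ p zero = trans L-1 (sym (*-zeroˡ _))
    L-^ {b} p (suc n) = trans (L-* p (1≤^ p n)) (trans (cong (L b +_) (L-^ p n)) (trans (ring (L b ∷ ι n ∷ []) (λ a b → a :+ b :* a ≈ (con 1 :+ b) :* a)) (cong (_* L b) (sym (ι-suc n)))))

    -- The increment from 1 to 2 alone gives only `L 2 ≥ 0`. By additivity `L 2 = L 4 - L 2`, and
    -- the increments from 2 to 3 and from 3 to 4 together are at least 1/3.
    1≤3L2 : 4 ℕ.≤ V → ι 1 ≤ ι 3 * L 2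
    1≤3L2 v = (lin (u 3 ∷ u 2 ∷ L 3 ∷ L 2 ∷ u 4 ∷ L 4 ∷ []) (λ a b c d e f → (a :- (b :- a) ≼ c :- d) ∷ (e :- (a :- e) ≼ f :- c) ∷ (f ≼ d :+ d) ∷ (con 2 :* b ≼ con 1) ∷ (con 1 ≼ con 3 :* a) ∷ (con 1 ≼ con 4 :* e) ∷ [] ⊢ (con 1 ≼ con 3 :* d) by (1 , (6 , 0 ∷ []) ∷ (6 , 1 ∷ []) ∷ (6 , 2 ∷ []) ∷ (3 , 3 ∷ []) ∷ (2 , 4 ∷ []) ∷ (3 , 5 ∷ []) ∷ [])) (lower {2} (s≤s z≤n) (ℕₚ.≤-trans (s≤s (s≤s (s≤s z≤n))) v)) (lower {3} (s≤s z≤n) v) (≤-reflexive (L-* {2} {2} (s≤s z≤n) (s≤s z≤n))) (≤-reflexive (ι*u {2} (s≤s z≤n))) (≤-reflexive (sym (ι*u {3} (s≤s z≤n)))) (≤-reflexive (sym (ι*u {4} (s≤s z≤n)))))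

    L2≤2 : 2 ℕ.≤ V → L 2 ≤ ι 2
    L2≤2 v = (lin (L 2 ∷ L 1 ∷ u 2 ∷ []) (λ a b c → (a :- b ≼ con 3 :* c) ∷ (con 2 :* c ≼ con 1) ∷ (b ≼ con 0) ∷ [] ⊢ (a ≼ con 2) by (1 , (1 , []) ∷ (2 , 0 ∷ []) ∷ (3 , 1 ∷ []) ∷ (2 , 2 ∷ []) ∷ [])) (Step.D≤3b 1 (s≤s z≤n) v) (≤-reflexive (ι*u {2} (s≤s z≤n))) (≤-reflexive L-1))

  module Gain (q : ℕ) (1≤q : 1 ℕ.≤ q) where
    β : R
    -- Chosen so that `8 β = 1/q ≤ α`: near a value below β x/n the function stays below 4 β x/n,
    -- which is at most half of the assumed α x/n.
    β = u (8 ℕ.* q)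
    k B : ℕ
    -- As log 2 is at least 1/3, H grows by at least `100 q - 2` from a to 2^k a, and β times this
    -- exceeds the 11 required by `small-value`.
    k = 300 ℕ.* q
    -- The extra factor 2 leaves room for the neighbourhood of the small value, which may extend to
    -- twice its position.
    B = 2 ℕ.* 2 ^ k

    1≤8q : 1 ℕ.≤ 8 ℕ.* q
    1≤8q = (linℕ (q ∷ []) (λ q → (con 1 ≼ q) ∷ [] ⊢ (con 1 ≼ con 8 :* q) by (0 , (7 , []) ∷ (8 , 0 ∷ []) ∷ [])) 1≤q)
    0≤β : ι 0 ≤ β
    0≤β = 0≤u 1≤8q
    β≤1 : β ≤ ι 1
    β≤1 = u≤1 1≤8q
    8qβ : ι 8 * ι q * β ≡ ι 1
    8qβ = trans (cong (_* β) (sym (ι-* 8 q))) (ι*u 1≤8q)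
    8β : ι 8 * β ≡ u q
    8β = trans (cong (ι 8 *_) (u-* {8} {q} (s≤s z≤n) 1≤q)) (trans (sym (*-assoc _ _ _)) (trans (cong (_* u q) (ι*u {8} (s≤s z≤n))) (*-identityˡ _)))
    1≤B : 1 ℕ.≤ B
    1≤B = 1≤-* {2} (s≤s z≤n) (1≤^ {2} (s≤s z≤n) k)
    16q≤B : 16 ℕ.* q ℕ.≤ B
    16q≤B = (linℕ (q ∷ 2 ^ k ∷ []) (λ q a → (con 1 :+ con 300 :* q ≼ a) ∷ (con 0 ≼ a) ∷ [] ⊢ (con 16 :* q ≼ con 2 :* a) by (74 , (4 , []) ∷ (4 , 0 ∷ []) ∷ (146 , 1 ∷ []) ∷ [])) (n<2^n k) ℕ.z≤n)
    2≤βn : ∀ {n} → 16 ℕ.* q ℕ.≤ n → ι 2 ≤ β * ι n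
    2≤βn {n} h = (lin (β ∷ ι q ∷ ι n ∷ []) (λ a b c → (a :* (con 16 :* b) ≼ a :* c) ∷ (con 1 ≼ con 8 :* b :* a) ∷ [] ⊢ (con 2 ≼ a :* c) by (0 , (1 , 0 ∷ []) ∷ (2 , 1 ∷ []) ∷ [])) (*-monoʳ-≤ 0≤β (≤-trans (≤-reflexive (sym (ι-* 16 q))) (ι-mono h))) (≤-reflexive (sym 8qβ)))
    2≤βxu : ∀ {x n} → 1 ℕ.≤ n → 16 ℕ.* q ℕ.* n ℕ.≤ x → ι 2 ≤ β * (ι x * u n)
    2≤βxu {x} {n} p h = ≤-trans (≤-reflexive e) (*-monoʳ-≤ 0≤β (lin (u n ∷ ι q ∷ ι n ∷ ι x ∷ []) (λ a b c d → (con 0 ≼ a) ∷ (con 16 :* b :* c ≼ d) ∷ [] ⊢ (con 16 :* b :* c :* a ≼ d :* a) by (0 , (1 , 0 ∷ 1 ∷ []) ∷ [])) (0≤u p) (≤-trans (≤-reflexive (sym (trans (ι-* (16 ℕ.* q) n) (cong (_* ι n) (ι-* 16 q))))) (ι-mono h))))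
      where
      e : ι 2 ≡ β * (ι 16 * ι q * ι n * u n)
      e = (≤-antisym (lin (ι q ∷ β ∷ ι n ∷ u n ∷ []) (λ a b c d → (con 1 ≼ con 8 :* a :* b) ∷ (con 16 :* a :* b :* con 1 ≼ con 16 :* a :* b :* (c :* d)) ∷ [] ⊢ (con 2 ≼ b :* (con 16 :* a :* c :* d)) by (0 , (2 , 0 ∷ []) ∷ (1 , 1 ∷ []) ∷ [])) (≤-reflexive (sym 8qβ)) (≤-reflexive (sym (cong (ι 16 * ι q * β *_) (ι*u p))))) (lin (ι q ∷ β ∷ ι n ∷ u n ∷ []) (λ a b c d → (con 8 :* a :* b ≼ con 1) ∷ (con 16 :* a :* b :* (c :* d) ≼ con 16 :* a :* b :* con 1) ∷ [] ⊢ (b :* (con 16 :* a :* c :* d) ≼ con 2) by (0 , (2 , 0 ∷ []) ∷ (1 , 1 ∷ []) ∷ [])) (≤-reflexive 8qβ) (≤-reflexive (cong (ι 16 * ι q * β *_) (ι*u p)))))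

    module At {V : ℕ} {L : ℕ → R} (ls : LogSys V L) {x : ℕ} (1≤x : 1 ℕ.≤ x) (2x≤V : 2 ℕ.* x ℕ.≤ V) (4≤V : 4 ℕ.≤ V)
      (α K : R) (u≤α : u q ≤ α) (bound : ∀ y → abs (M y) ≤ α * ι y + K) where
      open LogSys ls
      open LogarithmicSums.Estimates ls
      open Growth ls
      open Partial x 1≤x using (small-value)

      X : R
      X = ι x
      0≤X : ι 0 ≤ X
      0≤X = 0≤ι x
      x≤V : x ℕ.≤ V
      x≤V = (linℕ (x ∷ V ∷ []) (λ x V → (con 2 :* x ≼ V) ∷ (con 0 ≼ V) ∷ [] ⊢ (x ≼ V) by (1 , (1 , 0 ∷ []) ∷ (1 , 1 ∷ []) ∷ [])) 2x≤V ℕ.z≤n)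
      0≤α : ι 0 ≤ α
      0≤α = ≤-trans (0≤u 1≤q) u≤α

      w f D : ℕ → R
      w n = abs (M (x ÷ n))
      -- The logarithmically weighted amount by which |M(x/n)| falls short of the assumed bound.
      -- Every lower bound for its sum `D x` is subtracted on the right of the recursion.
      f n = L n * (α * (X * u n) + K - w n)
      D N = ∑ N f

      0≤f : ∀ n → 1 ℕ.≤ n → n ℕ.≤ x → ι 0 ≤ f n
      0≤f n p _ = *-nonneg (0≤L p) (lin (w n ∷ α ∷ ι (x ÷ n) ∷ K ∷ X ∷ u n ∷ []) (λ a b c K X d → (a ≼ b :* c :+ K) ∷ (b :* c ≼ b :* (X :* d)) ∷ [] ⊢ (con 0 ≼ b :* (X :* d) :+ K :- a) by (0 , (1 , 0 ∷ []) ∷ (1 , 1 ∷ []) ∷ [])) (bound (x ÷ n)) (*-monoʳ-≤ 0≤α (ι-÷-≤ x p)))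

      D-mono : ∀ {m n} → m ℕ.≤ n → n ℕ.≤ x → D m ≤ D n
      D-mono p r = ∑-upper f p (λ i a b → 0≤f i a (ℕₚ.≤-trans b r))

      0≤K : ι 0 ≤ K
      0≤K = (lin (abs (M 0) ∷ α ∷ K ∷ []) (λ a b K → (con 0 ≼ a) ∷ (a ≼ b :* con 0 :+ K) ∷ [] ⊢ (con 0 ≼ K) by (0 , (1 , 0 ∷ []) ∷ (1 , 1 ∷ []) ∷ [])) (0≤abs (M 0)) (bound 0))

      H-growth : ∀ a → 1 ℕ.≤ a → 2 ^ k ℕ.* a ℕ.≤ V → ι 11 ≤ β * (H (2 ^ k ℕ.* a) - H a)
      H-growth a p r = (lin (β ∷ ι q ∷ H (2 ^ k ℕ.* a) ∷ H a ∷ []) (λ a b c d → (a :* (con 100 :* b :- con 2) ≼ a :* (c :- d)) ∷ (con 1 ≼ con 8 :* b :* a) ∷ (con 8 :* a ≼ con 1) ∷ [] ⊢ (con 11 ≼ a :* (c :- d)) by (3 , (5 , []) ∷ (4 , 0 ∷ []) ∷ (50 , 1 ∷ []) ∷ (1 , 2 ∷ []) ∷ [])) (*-monoʳ-≤ 0≤β lower-bound) (≤-reflexive (sym 8qβ)) β≤1/8)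
        where
        1≤2^k : 1 ℕ.≤ 2 ^ k
        1≤2^k = 1≤^ {2} (s≤s z≤n) k
        Lb : L (2 ^ k ℕ.* a) ≡ ι 300 * ι q * L 2 + L a
        Lb = trans (L-* 1≤2^k p) (cong (_+ L a) (trans (L-^ (s≤s z≤n) k) (cong (_* L 2) (ι-* 300 q))))
        β≤1/8 : ι 8 * β ≤ ι 1
        β≤1/8 = ≤-trans (≤-reflexive 8β) (u≤1 1≤q)
        lower-bound : ι 100 * ι q - ι 2 ≤ H (2 ^ k ℕ.* a) - H a
        lower-bound = (lin (H a ∷ L a ∷ u a ∷ H (2 ^ k ℕ.* a) ∷ L (2 ^ k ℕ.* a) ∷ u (2 ^ k ℕ.* a) ∷ ι q ∷ L 2 ∷ []) (λ a b c d e f g h → (a :- b :- con 2 :* c ≼ d :- e :- con 2 :* f) ∷ (con 300 :* g :* h :+ b ≼ e) ∷ (c ≼ con 1) ∷ (con 0 ≼ f) ∷ (g :* con 1 ≼ g :* (con 3 :* h)) ∷ [] ⊢ (con 100 :* g :- con 2 ≼ d :- a) by (0 , (1 , 0 ∷ []) ∷ (1 , 1 ∷ []) ∷ (2 , 2 ∷ []) ∷ (2 , 3 ∷ []) ∷ (100 , 4 ∷ []) ∷ [])) (H-L-lower p (ℕₚ.m≤n*m a (2 ^ k) {{ℕ.>-nonZero 1≤2^k}}) r) (≤-reflexive (sym Lb)) (u≤1 p) (0≤u (1≤-* 1≤2^k p)) (*-monoʳ-≤ (0≤ι q) (1≤3L2 4≤V)))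

      module Near {a n : ℕ} (1≤a : 1 ℕ.≤ a) (a<n : a ℕ.< n) (16q≤n : 16 ℕ.* q ℕ.≤ n) (2n-small : 16 ℕ.* q ℕ.* (2 ℕ.* n) ℕ.≤ x)
        (small : w n ≤ β * (X * u n)) where
        1≤n : 1 ℕ.≤ n
        1≤n = ℕₚ.≤-trans (s≤s z≤n) a<n
        J : ℕ
        J = n ÷ (8 ℕ.* q)
        c : R
        c = ι 2 * (L a * (β * (X * u n)))
        J≤n : J ℕ.≤ n
        J≤n = ÷-≤ n (8 ℕ.* q)
        2n≤x : 2 ℕ.* n ℕ.≤ x
        2n≤x = ℕₚ.≤-trans (ℕₚ.m≤n*m (2 ℕ.* n) (16 ℕ.* q) {{ℕ.>-nonZero (ℕₚ.≤-trans (s≤s z≤n) (ℕₚ.*-monoʳ-≤ 16 1≤q))}}) 2n-small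

        -- A move by at most β n changes x/n by a factor of at most 1 + β, so the Lipschitz property
        -- of M keeps |M(x/n′)| small and the deficit is of order β x/n throughout.
        near : ∀ j → j ℕ.≤ J → c ≤ f (n ℕ.+ j)
        near j j≤J = ≤-trans c≤ (*-mono-≤ (0≤L 1≤a) 0≤4βXU′ (L-mono 1≤a (ℕₚ.≤-trans (ℕₚ.<⇒≤ a<n) (ℕₚ.m≤m+n n j)) n′≤V) rest)
          where
          n′ : ℕ
          n′ = n ℕ.+ j
          U U′ : R
          U = u n
          U′ = u n′
          1≤n′ : 1 ℕ.≤ n′
          1≤n′ = ℕₚ.≤-trans 1≤n (ℕₚ.m≤m+n n j)
          n′≤2n : n′ ℕ.≤ 2 ℕ.* n
          n′≤2n = (linℕ (j ∷ n ∷ []) (λ j n → (j ≼ n) ∷ [] ⊢ (n :+ j ≼ con 2 :* n) by (0 , (1 , 0 ∷ []) ∷ [])) (ℕₚ.≤-trans j≤J J≤n))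
          n′≤V : n′ ℕ.≤ V
          n′≤V = ℕₚ.≤-trans n′≤2n (ℕₚ.≤-trans 2n≤x x≤V)
          0≤U : ι 0 ≤ U
          0≤U = 0≤u 1≤n
          0≤U′ : ι 0 ≤ U′
          0≤U′ = 0≤u 1≤n′
          2≤ : ι 2 ≤ β * (X * U′)
          2≤ = 2≤βxu 1≤n′ (ℕₚ.≤-trans (ℕₚ.*-monoʳ-≤ (16 ℕ.* q) n′≤2n) 2n-small)
          j≤βn : ι j ≤ β * ι n
          j≤βn = (lin (β ∷ ι q ∷ ι j ∷ ι n ∷ []) (λ a b c d → (a :* (con 8 :* b :* c) ≼ a :* d) ∷ (con 1 :* c ≼ con 8 :* b :* a :* c) ∷ [] ⊢ (c ≼ a :* d) by (0 , (1 , 0 ∷ []) ∷ (1 , 1 ∷ []) ∷ [])) (*-monoʳ-≤ 0≤β (≤-trans (≤-reflexive (sym (trans (ι-* (8 ℕ.* q) j) (cong (_* ι j) (ι-* 8 q))))) (ι-mono (÷-most {n} {8 ℕ.* q} j≤J)))) (≤-reflexive (sym (cong (_* ι j) 8qβ))))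
          jU≤β : ι j * U ≤ β
          jU≤β = (lin (ι n ∷ U ∷ ι j ∷ β ∷ []) (λ a U b c → (b :* U ≼ c :* a :* U) ∷ (c :* (a :* U) ≼ c :* con 1) ∷ [] ⊢ (b :* U ≼ c) by (0 , (1 , 0 ∷ []) ∷ (1 , 1 ∷ []) ∷ [])) m (≤-reflexive (cong (β *_) e)))
            where
            e : ι n * U ≡ ι 1
            e = ι*u 1≤n
            m : ι j * U ≤ β * ι n * U
            m = (lin (U ∷ ι j ∷ β ∷ ι n ∷ []) (λ U a b c → (con 0 ≼ U) ∷ (a ≼ b :* c) ∷ [] ⊢ (a :* U ≼ b :* c :* U) by (0 , (1 , 0 ∷ 1 ∷ []) ∷ [])) 0≤U j≤βn)
          U-U′ : U - U′ ≡ ι j * U * U′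
          U-U′ = (≤-antisym (lin (U ∷ ι n ∷ ι j ∷ U′ ∷ []) (λ U a b U′ → (U :* con 1 ≼ U :* ((a :+ b) :* U′)) ∷ (a :* U :* U′ ≼ con 1 :* U′) ∷ [] ⊢ (U :- U′ ≼ b :* U :* U′) by (0 , (1 , 0 ∷ []) ∷ (1 , 1 ∷ []) ∷ [])) (≤-reflexive (sym (cong (U *_) (trans (cong (_* U′) (sym (ι-+ n j))) (ι*u 1≤n′))))) (≤-reflexive (cong (_* U′) (ι*u 1≤n)))) (lin (U ∷ ι n ∷ ι j ∷ U′ ∷ []) (λ U a b U′ → (U :* ((a :+ b) :* U′) ≼ U :* con 1) ∷ (con 1 :* U′ ≼ a :* U :* U′) ∷ [] ⊢ (b :* U :* U′ ≼ U :- U′) by (0 , (1 , 0 ∷ []) ∷ (1 , 1 ∷ []) ∷ [])) (≤-reflexive (cong (U *_) (trans (cong (_* U′) (sym (ι-+ n j))) (ι*u 1≤n′)))) (≤-reflexive (sym (cong (_* U′) (ι*u 1≤n))))))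
          diff : U - U′ ≤ β * U′
          diff = ≤-trans (≤-reflexive U-U′) (lin (ι j ∷ U ∷ β ∷ U′ ∷ []) (λ a U b U′ → (a :* U ≼ b) ∷ (con 0 ≼ U′) ∷ [] ⊢ (a :* U :* U′ ≼ b :* U′) by (0 , (1 , 0 ∷ 1 ∷ []) ∷ [])) jU≤β 0≤U′)
          U≤2U′ : U ≤ ι 2 * U′
          U≤2U′ = (lin (U ∷ U′ ∷ β ∷ []) (λ U U′ a → (U :- U′ ≼ a :* U′) ∷ (a :* U′ ≼ con 1 :* U′) ∷ [] ⊢ (U ≼ con 2 :* U′) by (0 , (1 , 0 ∷ []) ∷ (1 , 1 ∷ []) ∷ [])) diff m)
            where
            m : β * U′ ≤ ι 1 * U′
            m = (lin (β ∷ U′ ∷ []) (λ a U′ → (a ≼ con 1) ∷ (con 0 ≼ U′) ∷ [] ⊢ (a :* U′ ≼ con 1 :* U′) by (0 , (1 , 0 ∷ 1 ∷ []) ∷ [])) β≤1 0≤U′)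
          0≤βX : ι 0 ≤ β * X
          0≤βX = *-nonneg 0≤β 0≤X
          w-near : w n′ ≤ ι 4 * (β * (X * U′))
          -- The 4 is composed of 2 for the small value, since `U ≤ 2 U′`, 1 for the move from n to
          -- n′, and 1 for the rounding of the quotients.
          w-near = (lin (w n ∷ w n′ ∷ ι (x ÷ n) ∷ ι (x ÷ n′) ∷ β ∷ X ∷ U ∷ U′ ∷ []) (λ a b c d e X U U′ → (con 0 :- (a :- b) ≼ c :- d) ∷ (a ≼ e :* (X :* U)) ∷ (c ≼ X :* U) ∷ (X :* U′ ≼ d :+ con 1) ∷ (e :* X :* U ≼ e :* X :* (con 2 :* U′)) ∷ (X :* (U :- U′) ≼ X :* (e :* U′)) ∷ (con 2 ≼ e :* (X :* U′)) ∷ [] ⊢ (b ≼ con 4 :* (e :* (X :* U′))) by (0 , (1 , []) ∷ (1 , 0 ∷ []) ∷ (1 , 1 ∷ []) ∷ (1 , 2 ∷ []) ∷ (1 , 3 ∷ []) ∷ (1 , 4 ∷ []) ∷ (1 , 5 ∷ []) ∷ (1 , 6 ∷ []) ∷ [])) (proj₂ (within-mono (M-lipschitz (÷-anti x 1≤n (ℕₚ.m≤m+n n j))) (within-neg (abs-abs-diff (M (x ÷ n)) (M (x ÷ n′)))))) small (ι-÷-≤ x 1≤n) (ι-÷-> x 1≤n′) (*-monoʳ-≤ 0≤βX U≤2U′) (*-monoʳ-≤ 0≤X diff) 2≤)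
          0≤4βXU′ : ι 0 ≤ ι 4 * (β * (X * U′))
          0≤4βXU′ = (lin (β ∷ X ∷ U′ ∷ []) (λ a X U′ → (con 2 ≼ a :* (X :* U′)) ∷ [] ⊢ (con 0 ≼ con 4 :* (a :* (X :* U′))) by (0 , (8 , []) ∷ (4 , 0 ∷ []) ∷ [])) 2≤)
          8βXU′ : ι 8 * β * (X * U′) ≤ α * (X * U′)
          8βXU′ = (lin (X ∷ U′ ∷ β ∷ α ∷ []) (λ X U′ a b → (con 0 ≼ X :* U′) ∷ (con 8 :* a ≼ b) ∷ [] ⊢ (con 8 :* a :* (X :* U′) ≼ b :* (X :* U′)) by (0 , (1 , 0 ∷ 1 ∷ []) ∷ [])) (*-nonneg 0≤X 0≤U′) (≤-trans (≤-reflexive 8β) u≤α))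
          rest : ι 4 * (β * (X * U′)) ≤ α * (X * U′) + K - w n′
          rest = (lin (w n′ ∷ β ∷ X ∷ U′ ∷ α ∷ K ∷ []) (λ a b X U′ c K → (a ≼ con 4 :* (b :* (X :* U′))) ∷ (con 8 :* b :* (X :* U′) ≼ c :* (X :* U′)) ∷ (con 0 ≼ K) ∷ [] ⊢ (con 4 :* (b :* (X :* U′)) ≼ c :* (X :* U′) :+ K :- a) by (0 , (1 , 0 ∷ []) ∷ (1 , 1 ∷ []) ∷ (1 , 2 ∷ []) ∷ [])) w-near 8βXU′ 0≤K)
          c≤ : c ≤ L a * (ι 4 * (β * (X * U′)))
          c≤ = (lin (L a ∷ β ∷ X ∷ U ∷ U′ ∷ []) (λ a b X U U′ → (a :* (b :* X) :* U ≼ a :* (b :* X) :* (con 2 :* U′)) ∷ [] ⊢ (con 2 :* (a :* (b :* (X :* U))) ≼ a :* (con 4 :* (b :* (X :* U′)))) by (0 , (2 , 0 ∷ []) ∷ [])) (*-monoʳ-≤ (*-nonneg (0≤L 1≤a) 0≤βX) U≤2U′))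

        collect : ∀ j → j ℕ.≤ J → ι j * c ≤ D (n ℕ.+ j) - D n
        collect zero _ = ≤-trans (lin (c ∷ D n ∷ []) (λ c a → [] ⊢ (con 0 :* c ≼ a :- a) by (0 , []))) (≤-reflexive (cong (λ t → D t - D n) (sym (ℕₚ.+-identityʳ n))))
        collect (suc j) p = subst (λ t → ι (suc j) * c ≤ D t - D n) (sym (ℕₚ.+-suc n j))
          (lin (ι j ∷ c ∷ D (n ℕ.+ j) ∷ D n ∷ f (suc (n ℕ.+ j)) ∷ ι (suc j) ∷ []) (λ a c b d e f → (a :* c ≼ b :- d) ∷ (c ≼ e) ∷ (f :* c ≼ (con 1 :+ a) :* c) ∷ [] ⊢ (f :* c ≼ b :+ e :- d) by (0 , (1 , 0 ∷ []) ∷ (1 , 1 ∷ []) ∷ (1 , 2 ∷ []) ∷ [])) (collect j (ℕₚ.<⇒≤ p)) (subst (λ t → c ≤ f t) (ℕₚ.+-suc n j) (near (suc j) p)) (≤-reflexive (cong (_* c) (ι-suc j))))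

        gain : β * β * X * L a ≤ D (n ℕ.+ J) - D n
        gain = ≤-trans (≤-trans (≤-reflexive e) (lin (β ∷ ι n ∷ ι J ∷ s ∷ []) (λ a b c s → (a :* b ≼ con 2 :* c) ∷ (con 0 ≼ s) ∷ [] ⊢ (a :* b :* s ≼ c :* (con 2 :* s)) by (0 , (1 , 0 ∷ 1 ∷ []) ∷ [])) half 0≤s)) (collect J ℕₚ.≤-refl)
          where
          s : R
          s = L a * (β * (X * u n))
          0≤s : ι 0 ≤ s
          0≤s = *-nonneg (0≤L 1≤a) (*-nonneg 0≤β (*-nonneg 0≤X (0≤u 1≤n)))
          half : β * ι n ≤ ι 2 * ι J
          half = (lin (β ∷ ι n ∷ ι q ∷ ι J ∷ []) (λ a b c d → (a :* b ≼ a :* (con 8 :* c :* (con 1 :+ d))) ∷ (con 8 :* c :* a :* (con 1 :+ d) ≼ con 1 :* (con 1 :+ d)) ∷ (con 2 ≼ a :* b) ∷ [] ⊢ (a :* b ≼ con 2 :* d) by (0 , (2 , 0 ∷ []) ∷ (2 , 1 ∷ []) ∷ (1 , 2 ∷ []) ∷ [])) (*-monoʳ-≤ 0≤β (≤-trans (ι-mono (ℕₚ.<⇒≤ (÷-upper n 1≤8q))) (≤-reflexive (trans (ι-* (8 ℕ.* q) (suc J)) (cong₂ _*_ (ι-* 8 q) (ι-suc J)))))) (≤-reflexive (cong (_* (ι 1 + ι J)) 8qβ)) (2≤βn 16q≤n))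
          e : β * β * X * L a ≡ β * ι n * s
          e = (≤-antisym (lin (β ∷ X ∷ L a ∷ ι n ∷ u n ∷ []) (λ a X b c d → (a :* a :* X :* b :* con 1 ≼ a :* a :* X :* b :* (c :* d)) ∷ [] ⊢ (a :* a :* X :* b ≼ a :* c :* (b :* (a :* (X :* d)))) by (0 , (1 , 0 ∷ []) ∷ [])) (≤-reflexive (sym (cong (β * β * X * L a *_) (ι*u 1≤n))))) (lin (β ∷ X ∷ L a ∷ ι n ∷ u n ∷ []) (λ a X b c d → (a :* a :* X :* b :* (c :* d) ≼ a :* a :* X :* b :* con 1) ∷ [] ⊢ (a :* c :* (b :* (a :* (X :* d))) ≼ a :* a :* X :* b) by (0 , (1 , 0 ∷ []) ∷ [])) (≤-reflexive (cong (β * β * X * L a *_) (ι*u 1≤n)))))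

      -- `small-value` finds n in (a, 2^k a], and the `J` places after it still lie below B a. As
      -- `J` is about β n, the run contributes β² x log a irrespective of n.
      block-gain : ∀ a → 16 ℕ.* q ℕ.≤ a → 16 ℕ.* q ℕ.* (B ℕ.* a) ℕ.≤ x → β * β * X * L a ≤ D (B ℕ.* a) - D a
      block-gain a 16q≤a Ba-small = from-small found
        where
        1≤16q : 1 ℕ.≤ 16 ℕ.* q
        1≤16q = (linℕ (q ∷ []) (λ q → (con 1 ≼ q) ∷ [] ⊢ (con 1 ≼ con 16 :* q) by (0 , (15 , []) ∷ (16 , 0 ∷ []) ∷ [])) 1≤q)
        1≤a : 1 ℕ.≤ a
        1≤a = ℕₚ.≤-trans 1≤16q 16q≤a
        b j : ℕ
        b = 2 ^ k ℕ.* a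
        j = b ℕ.∸ a
        a≤b : a ℕ.≤ b
        a≤b = ℕₚ.m≤n*m a (2 ^ k) {{ℕ.>-nonZero (1≤^ {2} (s≤s z≤n) k)}}
        a+j : a ℕ.+ j ≡ b
        a+j = ℕₚ.m+[n∸m]≡n a≤b
        2b≡ : 2 ℕ.* b ≡ B ℕ.* a
        2b≡ = sym (ℕₚ.*-assoc 2 (2 ^ k) a)
        Ba≤x : B ℕ.* a ℕ.≤ x
        Ba≤x = ℕₚ.≤-trans (ℕₚ.m≤n*m (B ℕ.* a) (16 ℕ.* q) {{ℕ.>-nonZero 1≤16q}}) Ba-small
        b≤x : b ℕ.≤ x
        b≤x = (linℕ (b ∷ B ∷ a ∷ x ∷ []) (λ b B a x → (con 2 :* b ≼ B :* a) ∷ (B :* a ≼ x) ∷ (con 0 ≼ x) ∷ [] ⊢ (b ≼ x) by (1 , (1 , 0 ∷ []) ∷ (1 , 1 ∷ []) ∷ (1 , 2 ∷ []) ∷ [])) (ℕₚ.≤-reflexive 2b≡) Ba≤x ℕ.z≤n)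
        1≤j : 1 ℕ.≤ j
        1≤j = (linℕ (a ∷ j ∷ b ∷ []) (λ a j b → (b ≼ a :+ j) ∷ (con 2 :* a ≼ b) ∷ (con 1 ≼ a) ∷ [] ⊢ (con 1 ≼ j) by (0 , (1 , 0 ∷ []) ∷ (1 , 1 ∷ []) ∷ (1 , 2 ∷ []) ∷ [])) (ℕₚ.≤-reflexive (sym a+j)) two 1≤a)
          where
          two : 2 ℕ.* a ℕ.≤ b
          two = ℕₚ.*-monoˡ-≤ a (ℕₚ.≤-trans (linℕ (q ∷ []) (λ q → (con 1 ≼ q) ∷ [] ⊢ (con 2 ≼ con 1 :+ con 300 :* q) by (0 , (299 , []) ∷ (300 , 0 ∷ []) ∷ [])) 1≤q) (n<2^n k))
        found : ∃ λ n → a ℕ.< n × n ℕ.≤ a ℕ.+ j × w n ≤ β * (X * u n)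
        found = small-value β 0≤β a j 1≤a 1≤j (ℕₚ.≤-trans (ℕₚ.≤-reflexive a+j) b≤x) (2≤βn 16q≤a)
          (λ n p r → 2≤βxu p (ℕₚ.≤-trans (ℕₚ.*-monoʳ-≤ (16 ℕ.* q) ((linℕ (n ∷ a ∷ j ∷ b ∷ B ∷ []) (λ n a j b B → (n ≼ a :+ j) ∷ (a :+ j ≼ b) ∷ (con 2 :* b ≼ B :* a) ∷ (con 0 ≼ n) ∷ [] ⊢ (n ≼ B :* a) by (0 , (2 , 0 ∷ []) ∷ (2 , 1 ∷ []) ∷ (1 , 2 ∷ []) ∷ (1 , 3 ∷ []) ∷ [])) r (ℕₚ.≤-reflexive a+j) (ℕₚ.≤-reflexive 2b≡) ℕ.z≤n))) Ba-small))
          (subst (λ t → ι 11 ≤ β * (H t - H a)) (sym a+j) (H-growth a 1≤a (ℕₚ.≤-trans b≤x x≤V)))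
        from-small : (∃ λ n → a ℕ.< n × n ℕ.≤ a ℕ.+ j × w n ≤ β * (X * u n)) → β * β * X * L a ≤ D (B ℕ.* a) - D a
        from-small (n , a<n , n≤ , small) = (lin (β ∷ X ∷ L a ∷ D (n ℕ.+ N.J) ∷ D n ∷ D a ∷ D (B ℕ.* a) ∷ []) (λ a X b c d e f → (a :* a :* X :* b ≼ c :- d) ∷ (e ≼ d) ∷ (c ≼ f) ∷ [] ⊢ (a :* a :* X :* b ≼ f :- e) by (0 , (1 , 0 ∷ []) ∷ (1 , 1 ∷ []) ∷ (1 , 2 ∷ []) ∷ [])) N.gain (D-mono (ℕₚ.<⇒≤ a<n) (ℕₚ.≤-trans n≤b b≤x)) (D-mono n+J≤ Ba≤x))
          where
          n≤b : n ℕ.≤ b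
          n≤b = ℕₚ.≤-trans n≤ (ℕₚ.≤-reflexive a+j)
          2n≤Ba : 2 ℕ.* n ℕ.≤ B ℕ.* a
          2n≤Ba = ℕₚ.≤-trans (ℕₚ.*-monoʳ-≤ 2 n≤b) (ℕₚ.≤-reflexive 2b≡)
          module N = Near 1≤a a<n (ℕₚ.≤-trans 16q≤a (ℕₚ.<⇒≤ a<n)) (ℕₚ.≤-trans (ℕₚ.*-monoʳ-≤ (16 ℕ.* q) 2n≤Ba) Ba-small) small
          n+J≤ : n ℕ.+ N.J ℕ.≤ B ℕ.* a
          n+J≤ = (linℕ (N.J ∷ n ∷ B ∷ a ∷ []) (λ b n B a → (b ≼ n) ∷ (con 2 :* n ≼ B :* a) ∷ [] ⊢ (n :+ b ≼ B :* a) by (0 , (1 , 0 ∷ []) ∷ (1 , 1 ∷ []) ∷ [])) N.J≤n 2n≤Ba)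

      λB : R
      λB = L B
      0≤λB : ι 0 ≤ λB
      0≤λB = 0≤L 1≤B

      -- The blocks starting at B, B², ..., B^i contribute multiples of `L (B ^ j) = j λB`, whence
      -- the triangular number i (i + 1) / 2.
      total-gain : ∀ i → B ^ suc (suc i) ℕ.≤ x → β * β * X * λB * (ι i * (ι i + ι 1)) ≤ ι 2 * D (B ^ suc i)
      total-gain zero p = ≤-trans (lin (β ∷ X ∷ λB ∷ []) (λ a X b → [] ⊢ (a :* a :* X :* b :* (con 0 :* (con 0 :+ con 1)) ≼ con 0) by (0 , []))) (*-nonneg (0≤ι 2) (∑-nonneg (B ^ 1) (λ n r s → 0≤f n r (ℕₚ.≤-trans s B^1≤x))))
        where
        B^1≤x : B ^ 1 ℕ.≤ x
        B^1≤x = ℕₚ.≤-trans (ℕₚ.m≤n*m (B ^ 1) B {{ℕ.>-nonZero 1≤B}}) p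
      total-gain (suc i) p = (lin (β ∷ X ∷ λB ∷ ι i ∷ D (B ^ suc i) ∷ L (B ^ suc i) ∷ D (B ^ suc (suc i)) ∷ ι (suc i) ∷ []) (λ a X b c d e f g → (a :* a :* X :* b :* (c :* (c :+ con 1)) ≼ con 2 :* d) ∷ (a :* a :* X :* e ≼ f :- d) ∷ (a :* a :* X :* ((con 1 :+ c) :* b) ≼ a :* a :* X :* e) ∷ (a :* a :* X :* b :* (g :* (g :+ con 1)) ≼ a :* a :* X :* b :* ((con 1 :+ c) :* (con 1 :+ c :+ con 1))) ∷ [] ⊢ (a :* a :* X :* b :* (g :* (g :+ con 1)) ≼ con 2 :* f) by (0 , (1 , 0 ∷ []) ∷ (2 , 1 ∷ []) ∷ (2 , 2 ∷ []) ∷ (1 , 3 ∷ []) ∷ [])) (total-gain i (ℕₚ.≤-trans (ℕₚ.m≤n*m (B ^ suc (suc i)) B {{ℕ.>-nonZero 1≤B}}) p)) (block-gain (B ^ suc i) (ℕₚ.≤-trans 16q≤B (ℕₚ.m≤m*n B (B ^ i) {{ℕ.>-nonZero (1≤^ 1≤B i)}})) (ℕₚ.≤-trans (ℕₚ.*-monoˡ-≤ (B ^ suc (suc i)) 16q≤B) p)) (≤-reflexive (sym (cong (β * β * X *_) (trans (L-^ 1≤B (suc i)) (cong (_* λB) (ι-suc i)))))) (≤-reflexive (cong (λ t → β * β * X * λB * (t * (t + ι 1))) (ι-suc i))))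

      log-size : ∀ i → B ^ i ℕ.≤ x → x ℕ.< B ^ suc i → B ℕ.≤ x → (ι i * λB ≤ L x) × (L x ≤ (ι 1 + ι i) * λB)
      log-size i lo hi B≤x = ≤-trans (≤-reflexive (sym (L-^ 1≤B i))) (L-mono 1≤B^i lo x≤V) ,
        (lin (L x ∷ L (B ^ i ℕ.* suc r) ∷ L (B ^ i) ∷ L (suc r) ∷ ι i ∷ λB ∷ []) (λ a b c d e f → (a ≼ b) ∷ (b ≼ c :+ d) ∷ (c ≼ e :* f) ∷ (d ≼ f) ∷ [] ⊢ (a ≼ (con 1 :+ e) :* f) by (0 , (1 , 0 ∷ []) ∷ (1 , 1 ∷ []) ∷ (1 , 2 ∷ []) ∷ (1 , 3 ∷ []) ∷ [])) (L-mono 1≤x (ℕₚ.<⇒≤ (÷-upper x 1≤B^i)) top≤V) (≤-reflexive (L-* 1≤B^i (s≤s z≤n))) (≤-reflexive (L-^ 1≤B i)) (L-mono (s≤s z≤n) r<B (ℕₚ.≤-trans B≤x x≤V)))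
        where
        1≤B^i : 1 ℕ.≤ B ^ i
        1≤B^i = 1≤^ 1≤B i
        r : ℕ
        r = x ÷ B ^ i
        top≤V : B ^ i ℕ.* suc r ℕ.≤ V
        top≤V = (linℕ (B ^ i ∷ r ∷ x ∷ V ∷ []) (λ a r x V → (a :* r ≼ x) ∷ (a ≼ x) ∷ (con 2 :* x ≼ V) ∷ [] ⊢ (a :* (con 1 :+ r) ≼ V) by (0 , (1 , 0 ∷ []) ∷ (1 , 1 ∷ []) ∷ (1 , 2 ∷ []) ∷ [])) (÷-lower x (B ^ i)) lo 2x≤V)
        r<B : r ℕ.< B
        r<B = ℕₚ.*-cancelˡ-< (B ^ i) r B (ℕₚ.≤-<-trans (÷-lower x (B ^ i)) (ℕₚ.≤-trans hi (ℕₚ.≤-reflexive (ℕₚ.*-comm B (B ^ i)))))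

      -- Let B^(i+2) be the largest power of B not exceeding x. The blocks begin at B, so that β a ≥
      -- 2, and end at B^(i+1), which leaves room for the factor `16 q`. The exponents lost at the
      -- two ends cost a term linear in `L x`, absorbed by the 5.
      D-lower : B ^ 2 ℕ.≤ x → β * β * X * (L x * L x) ≤ λB * (ι 2 * D x + ι 5 * (β * β * X * L x))
      D-lower B²≤x with ^-between {B} (ℕₚ.*-monoʳ-≤ 2 (1≤^ {2} (s≤s z≤n) k)) x 1≤x
      ... | zero , lo , hi = ⊥-elim (ℕₚ.<⇒≱ hi (ℕₚ.≤-trans (ℕₚ.m≤n*m (B ^ 1) B {{ℕ.>-nonZero 1≤B}}) B²≤x))
      ... | suc zero , lo , hi = ⊥-elim (ℕₚ.<⇒≱ hi B²≤x)
      ... | suc (suc i) , lo , hi = (lin (g ∷ ℓ ∷ Λ′ ∷ ι i ∷ D x ∷ []) (λ g a b c d → (g :* (a :* a) ≼ g :* (b :* (b :* (c :* (c :+ con 1))) :+ con 5 :* (b :* a))) ∷ (b :* (g :* b :* (c :* (c :+ con 1))) ≼ b :* (con 2 :* d)) ∷ [] ⊢ (g :* (a :* a) ≼ b :* (con 2 :* d :+ con 5 :* (g :* a))) by (0 , (1 , 0 ∷ []) ∷ (1 , 1 ∷ []) ∷ [])) (*-monoʳ-≤ 0≤g sq) (*-monoʳ-≤ 0≤λB (≤-trans (total-gain i lo) (*-monoʳ-≤ (0≤ι 2) (D-mono B^≤x ℕₚ.≤-refl)))))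
        where
        g ℓ Λ′ I : R
        g = β * β * X
        ℓ = L x
        Λ′ = λB
        I = ι i
        0≤g : ι 0 ≤ g
        0≤g = *-nonneg (*-nonneg 0≤β 0≤β) 0≤X
        B^≤x : B ^ suc i ℕ.≤ x
        B^≤x = ℕₚ.≤-trans (ℕₚ.m≤n*m (B ^ suc i) B {{ℕ.>-nonZero 1≤B}}) lo
        B≤x : B ℕ.≤ x
        B≤x = ℕₚ.≤-trans (ℕₚ.m≤m*n B (B ^ suc i) {{ℕ.>-nonZero (1≤^ 1≤B (suc i))}}) lo
        size : (ι (suc (suc i)) * λB ≤ L x) × (L x ≤ (ι 1 + ι (suc (suc i))) * λB)
        size = log-size (suc (suc i)) lo hi B≤x
        i+2 : ι (suc (suc i)) ≡ ι 2 + I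
        i+2 = ι-+ 2 i
        ℓ≥ : (ι 2 + I) * Λ′ ≤ ℓ
        ℓ≥ = ≤-trans (≤-reflexive (cong (_* Λ′) (sym i+2))) (proj₁ size)
        ℓ≤ : ℓ ≤ (ι 3 + I) * Λ′
        ℓ≤ = ≤-trans (proj₂ size) (≤-reflexive (trans (cong (λ t → (ι 1 + t) * Λ′) i+2) (ring (I ∷ Λ′ ∷ []) (λ I a → (con 1 :+ (con 2 :+ I)) :* a ≈ (con 3 :+ I) :* a))))
        sq : ℓ * ℓ ≤ Λ′ * (Λ′ * (I * (I + ι 1))) + ι 5 * (Λ′ * ℓ)
        sq = subst (λ ℓ → ℓ * ℓ ≤ Λ′ * (Λ′ * (I * (I + ι 1))) + ι 5 * (Λ′ * ℓ)) (ring (I ∷ Λ′ ∷ ℓ ∷ []) (λ I a b → (con 2 :+ I) :* a :+ (b :- (con 2 :+ I) :* a) ≈ b))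
          (lin (s ∷ Λ′ ∷ I ∷ []) (λ s a I → (con 0 ≼ s) ∷ (s ≼ a) ∷ (I :* a :* s ≼ I :* a :* a) ∷ [] ⊢ (((con 2 :+ I) :* a :+ s) :* ((con 2 :+ I) :* a :+ s) ≼ a :* (a :* (I :* (I :+ con 1))) :+ con 5 :* (a :* ((con 2 :+ I) :* a :+ s))) by (0 , (2 , 2 ∷ []) ∷ (6 , 0 ∷ 0 ∷ []) ∷ (13 , 0 ∷ 1 ∷ []) ∷ (6 , 1 ∷ 1 ∷ []) ∷ [])) 0≤s s≤ (*-monoʳ-≤ (*-nonneg (0≤ι i) 0≤λB) s≤))
          where
          s : R
          s = ℓ - (ι 2 + I) * Λ′
          0≤s : ι 0 ≤ s
          0≤s = (lin (I ∷ Λ′ ∷ ℓ ∷ []) (λ I a b → ((con 2 :+ I) :* a ≼ b) ∷ [] ⊢ (con 0 ≼ b :- (con 2 :+ I) :* a) by (0 , (1 , 0 ∷ []) ∷ [])) ℓ≥)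
          s≤ : s ≤ Λ′
          s≤ = (lin (ℓ ∷ I ∷ Λ′ ∷ []) (λ a I b → (a ≼ (con 3 :+ I) :* b) ∷ [] ⊢ (a :- (con 2 :+ I) :* b ≼ b) by (0 , (1 , 0 ∷ []) ∷ [])) ℓ≤)

      private
        c : ℕ
        -- An upper bound for `L B` that depends on `q` alone, from `L 2 ≤ 2`.
        c = 2 ℕ.* suc k
        ℓ g : R
        ℓ = L x
        g = β * β * X
        0≤ℓ : ι 0 ≤ ℓ
        0≤ℓ = 0≤L 1≤x
        0≤g : ι 0 ≤ g
        0≤g = *-nonneg (*-nonneg 0≤β 0≤β) 0≤X

      λB≤c : λB ≤ ι c
      λB≤c = ≤-trans (≤-reflexive (L-^ {2} (s≤s z≤n) (suc k))) (≤-trans (*-monoʳ-≤ (0≤ι (suc k)) (L2≤2 (ℕₚ.≤-trans (s≤s (s≤s z≤n)) 4≤V)))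
        (≤-reflexive (trans (*-comm _ _) (sym (ι-* 2 (suc k))))))

      -- The weighted sum in the recursion is `α X H₁ x + K T x - D x`. Twice the first term has
      -- main part α X ℓ², and `D-lower` removes the share β²/c of X ℓ². The constant is 9600 + 4 +
      -- 42 + 5: recursion, errors of `H₁`, linear term of `D-lower`.
      contraction : B ^ 2 ℕ.≤ x → α ≤ ι 1 →
        abs (M x) * (ℓ * ℓ) ≤ (α - u c * (β * β)) * X * (ℓ * ℓ) + (ι 2 * K + ι 9651) * (X * (ℓ + ι 1))
      contraction B²≤x α≤1 = (lin (abs (M x) ∷ ℓ ∷ W ∷ X ∷ α ∷ H₁ x ∷ K ∷ T x ∷ D x ∷ u c ∷ β ∷ []) (λ a b W X c d K e f g h → (a :* (b :* b) ≼ con 2 :* W :+ con 9600 :* (X :* (b :+ con 1))) ∷ (W ≼ c :* X :* d :+ K :* e :- f) ∷ (c :* X :* (con 2 :* d) ≼ c :* X :* (b :* b :+ con 4 :* b :+ con 42)) ∷ (K :* e ≼ K :* (X :* b)) ∷ (g :* (h :* h :* X :* (b :* b)) ≼ con 2 :* f :+ con 5 :* (h :* h :* X :* b)) ∷ (c :* (X :* (con 4 :* b :+ con 42)) ≼ con 1 :* (X :* (con 4 :* b :+ con 42))) ∷ (h :* h :* (X :* b) ≼ con 1 :* (X :* b)) ∷ (con 0 ≼ X :* b) ∷ (con 0 ≼ K :* X) ∷ (con 0 ≼ X) ∷ [] ⊢ (a :* (b :* b) ≼ (c :- g :* (h :* h)) :* X :* (b :* b) :+ (con 2 :* K :+ con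 9651) :* (X :* (b :+ con 1))) by (0 , (1 , 0 ∷ []) ∷ (2 , 1 ∷ []) ∷ (1 , 2 ∷ []) ∷ (2 , 3 ∷ []) ∷ (1 , 4 ∷ []) ∷ (1 , 5 ∷ []) ∷ (5 , 6 ∷ []) ∷ (42 , 7 ∷ []) ∷ (2 , 8 ∷ []) ∷ (9 , 9 ∷ []) ∷ [])) M-rec (≤-reflexive W≡) (*-monoʳ-≤ (*-nonneg 0≤α 0≤X) h₁) (*-monoʳ-≤ 0≤K T≤) d αX ββ (*-nonneg 0≤X 0≤ℓ) (*-nonneg 0≤K 0≤X) 0≤X)
        where
        W : R
        W = ∑ x (λ n → L n * w n)
        M-rec : abs (M x) * (ℓ * ℓ) ≤ ι 2 * W + ι 9600 * (X * (ℓ + ι 1))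
        M-rec = SelbergFormula.Selberg.M-recursion ls 1≤x 2x≤V
        W≡ : W ≡ α * X * H₁ x + K * T x - D x
        W≡ = trans (∑-cong x (λ n _ _ → (ring (L n ∷ w n ∷ α ∷ X ∷ u n ∷ K ∷ []) (λ a b c X d K → a :* b ≈ c :* X :* (a :* d) :+ K :* a :- a :* (c :* (X :* d) :+ K :- b)))))
          (trans (∑-- x _ _) (cong (_- D x) (trans (∑-+ x _ _) (cong₂ _+_ (∑-*ˡ x (α * X) _) (∑-*ˡ x K L)))))
        h₁ : ι 2 * H₁ x ≤ ℓ * ℓ + ι 4 * ℓ + ι 42
        h₁ = (lin (H₁ x ∷ ℓ ∷ γ₁ ∷ u x ∷ []) (λ a b c d → (con 2 :* a :- b :* b :- c ≼ (con 4 :* b :+ con 21) :* d) ∷ (c ≼ con 21) ∷ ((con 4 :* b :+ con 21) :* d ≼ (con 4 :* b :+ con 21) :* con 1) ∷ [] ⊢ (con 2 :* a ≼ b :* b :+ con 4 :* b :+ con 42) by (0 , (1 , 0 ∷ []) ∷ (1 , 1 ∷ []) ∷ (1 , 2 ∷ []) ∷ [])) (proj₂ (H₁-approx 1≤x x≤V)) (proj₂ (γ₁-bounds (ℕₚ.≤-trans 1≤x x≤V))) (*-monoʳ-≤ (lin (ℓ ∷ []) (λ a → (con 0 ≼ a) ∷ [] ⊢ (con 0 ≼ con 4 :* a :+ con 21) by (0 , (21 , []) ∷ (4 , 0 ∷ []) ∷ [])) 0≤ℓ) (u≤1 1≤x)))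
        T≤ : T x ≤ X * ℓ
        T≤ = ≤-trans (∑-mono x (λ i p r → L-mono p r x≤V)) (≤-reflexive (∑-const x ℓ))
        1≤c : 1 ℕ.≤ c
        1≤c = s≤s z≤n
        d : u c * (g * (ℓ * ℓ)) ≤ ι 2 * D x + ι 5 * (g * ℓ)
        d = ≤-trans (*-monoʳ-≤ (0≤u 1≤c) (≤-trans (D-lower B²≤x) (lin (λB ∷ ι c ∷ s ∷ []) (λ a b s → (a ≼ b) ∷ (con 0 ≼ s) ∷ [] ⊢ (a :* s ≼ b :* s) by (0 , (1 , 0 ∷ 1 ∷ []) ∷ [])) λB≤c 0≤s)))
          (≤-reflexive (trans (sym (*-assoc _ _ _)) (trans (cong (_* s) (trans (*-comm _ _) (ι*u 1≤c))) (*-identityˡ s))))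
          where
          s : R
          s = ι 2 * D x + ι 5 * (g * ℓ)
          0≤s : ι 0 ≤ s
          0≤s = (lin (D x ∷ g ∷ ℓ ∷ []) (λ a g b → (con 0 ≼ a) ∷ (con 0 ≼ g :* b) ∷ [] ⊢ (con 0 ≼ con 2 :* a :+ con 5 :* (g :* b)) by (0 , (2 , 0 ∷ []) ∷ (5 , 1 ∷ []) ∷ [])) (∑-nonneg x (λ n p r → 0≤f n p r)) (*-nonneg 0≤g 0≤ℓ))
        0≤s₁ : ι 0 ≤ X * (ι 4 * ℓ + ι 42)
        0≤s₁ = *-nonneg 0≤X (lin (ℓ ∷ []) (λ a → (con 0 ≼ a) ∷ [] ⊢ (con 0 ≼ con 4 :* a :+ con 42) by (0 , (42 , []) ∷ (4 , 0 ∷ []) ∷ [])) 0≤ℓ)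
        αX : α * (X * (ι 4 * ℓ + ι 42)) ≤ ι 1 * (X * (ι 4 * ℓ + ι 42))
        αX = *-mono-≤ 0≤α 0≤s₁ α≤1 ≤-refl
        ββ : β * β * (X * ℓ) ≤ ι 1 * (X * ℓ)
        ββ = *-mono-≤ (*-nonneg 0≤β 0≤β) (*-nonneg 0≤X 0≤ℓ) (≤-trans (*-mono-≤ 0≤β 0≤β β≤1 β≤1) (lin ([]) ([] ⊢ (con 1 :* con 1 ≼ con 1) by (0 , [])))) ≤-refl

    -- Its reciprocal `η` is half of the gain β²/c of `contraction`; the other half absorbs the
    -- lower-order term once log x is large.
    P : ℕ
    P = 2 ℕ.* ((2 ℕ.* suc k) ℕ.* ((8 ℕ.* q) ℕ.* (8 ℕ.* q)))

    1≤P : 1 ℕ.≤ P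
    1≤P = 1≤-* {2} (s≤s z≤n) (1≤-* {2 ℕ.* suc k} (s≤s z≤n) (1≤-* 1≤8q 1≤8q))

    η : R
    η = u P

    2η : ι 2 * η ≡ u (2 ℕ.* suc k) * (β * β)
    2η = trans (cong (ι 2 *_) (u-* {2} (s≤s z≤n) (1≤-* {2 ℕ.* suc k} (s≤s z≤n) (1≤-* 1≤8q 1≤8q))))
      (trans (sym (*-assoc _ _ _)) (trans (cong₂ _*_ (ι*u {2} (s≤s z≤n)) (trans (u-* {2 ℕ.* suc k} (s≤s z≤n) (1≤-* 1≤8q 1≤8q)) (cong (u (2 ℕ.* suc k) *_) (u-* 1≤8q 1≤8q))))
        (*-identityˡ _)))

    η≤u : η ≤ u q
    η≤u = u-anti 1≤q ((linℕ (P ∷ c ∷ q ∷ []) (λ P c q → (con 2 :* (c :* (con 8 :* q :* (con 8 :* q))) ≼ P) ∷ (q ≼ c :* (con 8 :* q :* (con 8 :* q))) ∷ (con 0 ≼ P) ∷ [] ⊢ (q ≼ P) by (1 , (1 , 0 ∷ []) ∷ (2 , 1 ∷ []) ∷ (1 , 2 ∷ []) ∷ [])) (ℕₚ.≤-reflexive (sym e)) p ℕ.z≤n))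
      where
      c : ℕ
      c = 2 ℕ.* suc k
      e : P ≡ 2 ℕ.* (c ℕ.* (8 ℕ.* q ℕ.* (8 ℕ.* q)))
      e = refl
      p : q ℕ.≤ c ℕ.* (8 ℕ.* q ℕ.* (8 ℕ.* q))
      p = ℕₚ.≤-trans (linℕ (q ∷ []) (λ q → (con 1 ≼ q) ∷ [] ⊢ (q ≼ con 8 :* q :* (con 8 :* q)) by (0 , (63 , []) ∷ (127 , 0 ∷ []) ∷ (64 , 0 ∷ 0 ∷ []) ∷ [])) 1≤q) (ℕₚ.m≤n*m (8 ℕ.* q ℕ.* (8 ℕ.* q)) c)

  -- No logarithm occurs here, so a bound obtained with one approximate logarithm can be improved
  -- with another, of larger range.
  Bound : R → Set
  Bound α = ∃ λ K → ∀ x → abs (M x) ≤ α * ι x + ι K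

  module Iterate (logs : ∀ V → ∃ λ L → LogSys V L) where

    shrink : ∀ q (1≤q : 1 ℕ.≤ q) {α} → u q ≤ α → α ≤ ι 1 → Bound α → Bound (α - Gain.η q 1≤q)
    shrink q 1≤q {α} u≤α α≤1 (K , bound) = x₀ , λ x → by-size x (ℕₚ.≤-total x₀ x)
      where
      open Gain q 1≤q
      Q x₀ : ℕ
      Q = 2 ℕ.* (2 ℕ.* K ℕ.+ 9651)
      -- Beyond the first summand log x is at least `P Q`, as log 2 is at least 1/3; hence
      -- `η ℓ ≥ Q`, where `Q` is twice the coefficient of the lower-order term since `ℓ + 1 ≤ 2 ℓ`.
      -- The second summand is the condition of `contraction`. Below `x₀` the trivial bound |M(x)| ≤
      -- x suffices.
      x₀ = 2 ^ (3 ℕ.* (P ℕ.* Q)) ℕ.+ B ^ 2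
      by-size : ∀ x → x₀ ℕ.≤ x ⊎ x ℕ.≤ x₀ → abs (M x) ≤ (α - η) * ι x + ι x₀
      by-size x (inj₂ x≤x₀) = (lin (abs (M x) ∷ ι x ∷ ι x₀ ∷ α ∷ η ∷ []) (λ a b c d e → (a ≼ b) ∷ (b ≼ c) ∷ (con 0 ≼ (d :- e) :* b) ∷ [] ⊢ (a ≼ (d :- e) :* b :+ c) by (0 , (1 , 0 ∷ []) ∷ (1 , 1 ∷ []) ∷ (1 , 2 ∷ []) ∷ [])) (∣M∣≤ x) (ι-mono x≤x₀) (*-nonneg (lin (u q ∷ α ∷ η ∷ []) (λ a b c → (a ≼ b) ∷ (c ≼ a) ∷ [] ⊢ (con 0 ≼ b :- c) by (0 , (1 , 0 ∷ []) ∷ (1 , 1 ∷ []) ∷ [])) u≤α η≤u) (0≤ι x)))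
      by-size x (inj₁ x₀≤x) = (lin (abs (M x) ∷ α ∷ η ∷ ι x ∷ ι x₀ ∷ []) (λ a b c d e → (a ≼ (b :- c) :* d) ∷ (con 0 ≼ e) ∷ [] ⊢ (a ≼ (b :- c) :* d :+ e) by (0 , (1 , 0 ∷ []) ∷ (1 , 1 ∷ []) ∷ [])) main (0≤ι x₀))
        where
        V : ℕ
        V = 2 ℕ.* x ℕ.+ 4
        L : ℕ → R
        L = proj₁ (logs V)
        ls : LogSys V L
        ls = proj₂ (logs V)
        open LogSys ls using (L-1)
        2^≤x : 2 ^ (3 ℕ.* (P ℕ.* Q)) ℕ.≤ x
        2^≤x = ℕₚ.≤-trans (ℕₚ.m≤m+n _ (B ^ 2)) x₀≤x
        1≤x : 1 ℕ.≤ x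
        1≤x = ℕₚ.≤-trans (1≤^ {2} (s≤s z≤n) (3 ℕ.* (P ℕ.* Q))) 2^≤x
        B²≤x : B ^ 2 ℕ.≤ x
        B²≤x = ℕₚ.≤-trans (ℕₚ.m≤n+m (B ^ 2) _) x₀≤x
        2x≤V : 2 ℕ.* x ℕ.≤ V
        2x≤V = ℕₚ.m≤m+n (2 ℕ.* x) 4
        4≤V : 4 ℕ.≤ V
        4≤V = ℕₚ.m≤n+m 4 (2 ℕ.* x)
        x≤V : x ℕ.≤ V
        x≤V = ℕₚ.≤-trans (ℕₚ.m≤n*m x 2) 2x≤V
        module G = At ls 1≤x 2x≤V 4≤V α (ι K) u≤α bound
        X ℓ : R
        X = ι x
        ℓ = L x
        ℓ-large : ι P * ι Q ≤ ℓ
        ℓ-large = ≤-trans (lin (ι P ∷ ι Q ∷ L 2 ∷ []) (λ a b c → (a :* b :* con 1 ≼ a :* b :* (con 3 :* c)) ∷ [] ⊢ (a :* b ≼ con 3 :* (a :* b) :* c) by (0 , (1 , 0 ∷ []) ∷ [])) (*-monoʳ-≤ (*-nonneg (0≤ι P) (0≤ι Q)) (Growth.1≤3L2 ls 4≤V)))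
          (≤-trans (≤-reflexive (trans (cong (_* L 2) (sym (trans (ι-* 3 _) (cong (ι 3 *_) (ι-* P Q))))) (sym (Growth.L-^ ls {2} (s≤s z≤n) (3 ℕ.* (P ℕ.* Q))))))
            (LogarithmicSums.Estimates.L-mono ls (1≤^ {2} (s≤s z≤n) (3 ℕ.* (P ℕ.* Q))) 2^≤x x≤V))
        0≤X : ι 0 ≤ X
        0≤X = 0≤ι x
        1≤ℓ : ι 1 ≤ ℓ
        1≤ℓ = ≤-trans (≤-trans (ι-mono (1≤-* 1≤P (1≤-* {2} {2 ℕ.* K ℕ.+ 9651} (s≤s z≤n) (ℕₚ.≤-trans (s≤s z≤n) (ℕₚ.m≤n+m 9651 (2 ℕ.* K)))))) (≤-reflexive (ι-* P Q))) ℓ-large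
        Q≤ηℓ : ι Q ≤ η * ℓ
        Q≤ηℓ = (lin (η ∷ ι P ∷ ι Q ∷ ℓ ∷ []) (λ a b c d → (a :* (b :* c) ≼ a :* d) ∷ (con 1 :* c ≼ b :* a :* c) ∷ [] ⊢ (c ≼ a :* d) by (0 , (1 , 0 ∷ []) ∷ (1 , 1 ∷ []) ∷ [])) (*-monoʳ-≤ (0≤u 1≤P) ℓ-large) (≤-reflexive (sym (cong (_* ι Q) (ι*u 1≤P)))))
        Q≡ : ι Q ≡ ι 2 * (ι 2 * ι K + ι 9651)
        Q≡ = trans (ι-* 2 _) (cong (ι 2 *_) (trans (ι-+ (2 ℕ.* K) 9651) (cong (_+ ι 9651) (ι-* 2 K))))
        square : abs (M x) * (ℓ * ℓ) ≤ (α - η) * X * (ℓ * ℓ)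
        square = (lin (abs (M x) ∷ ℓ ∷ α ∷ C ∷ X ∷ ι K ∷ η ∷ ι Q ∷ []) (λ a b c C X d e f → (a :* (b :* b) ≼ (c :- C) :* X :* (b :* b) :+ (con 2 :* d :+ con 9651) :* (X :* (b :+ con 1))) ∷ (con 2 :* e :* X :* (b :* b) ≼ C :* X :* (b :* b)) ∷ (X :* b :* f ≼ X :* b :* (e :* b)) ∷ (X :* b :* (con 2 :* (con 2 :* d :+ con 9651)) ≼ X :* b :* f) ∷ ((con 2 :* d :+ con 9651) :* X :* con 1 ≼ (con 2 :* d :+ con 9651) :* X :* b) ∷ [] ⊢ (a :* (b :* b) ≼ (c :- e) :* X :* (b :* b)) by (0 , (1 , 0 ∷ []) ∷ (1 , 1 ∷ []) ∷ (1 , 2 ∷ []) ∷ (1 , 3 ∷ []) ∷ (1 , 4 ∷ []) ∷ [])) (G.contraction B²≤x α≤1) (≤-reflexive (cong (λ t → t * X * (ℓ * ℓ)) 2η)) (*-monoʳ-≤ (*-nonneg 0≤X (≤-trans (0≤ι 1) 1≤ℓ)) Q≤ηℓ) (≤-reflexive (sym (cong (X * ℓ *_) Q≡))) (*-monoʳ-≤ (*-nonneg 0≤c 0≤X) 1≤ℓ))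
          where
          C : R
          C = u (2 ℕ.* suc k) * (β * β)
          0≤c : ι 0 ≤ ι 2 * ι K + ι 9651
          0≤c = (lin (ι K ∷ []) (λ a → (con 0 ≼ a) ∷ [] ⊢ (con 0 ≼ con 2 :* a :+ con 9651) by (0 , (9651 , []) ∷ (2 , 0 ∷ []) ∷ [])) (0≤ι K))
        main : abs (M x) ≤ (α - η) * X
        main = *-cancel-≤ (≤-trans (lin ([]) ([] ⊢ (con 1 ≼ con 1 :* con 1) by (0 , []))) (*-mono-≤ (0≤ι 1) (0≤ι 1) 1≤ℓ 1≤ℓ)) (subst₂ _≤_ (*-comm _ _) (*-comm _ _) square)

    bound-weaken : ∀ {α α′} → α ≤ α′ → Bound α → Bound α′
    bound-weaken {α} {α′} p (K , h) = K , λ x → (lin (abs (M x) ∷ α ∷ ι x ∷ ι K ∷ α′ ∷ []) (λ a b c d e → (a ≼ b :* c :+ d) ∷ (c :* b ≼ c :* e) ∷ [] ⊢ (a ≼ e :* c :+ d) by (0 , (1 , 0 ∷ []) ∷ (1 , 1 ∷ []) ∷ [])) (h x) (*-monoʳ-≤ (0≤ι x) p))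

    descend : ∀ q (1≤q : 1 ℕ.≤ q) n → ∃ λ α → α ≤ ι 1 × Bound α × (α ≤ u q ⊎ α ≤ ι 1 - ι n * Gain.η q 1≤q)
    descend q 1≤q zero = ι 1 , ≤-refl , (0 , λ x → ≤-trans (∣M∣≤ x) (lin (ι x ∷ []) (λ a → [] ⊢ (a ≼ con 1 :* a :+ con 0) by (0 , [])))) , inj₂ (lin (Gain.η q 1≤q ∷ []) (λ a → [] ⊢ (con 1 ≼ con 1 :- con 0 :* a) by (0 , [])))
    descend q 1≤q (suc n) with descend q 1≤q n
    ... | α , α≤1 , b , inj₁ p = α , α≤1 , b , inj₁ p
    ... | α , α≤1 , b , inj₂ p with ≤-total (u q) α
    ... | inj₂ r = α , α≤1 , b , inj₁ r
    ... | inj₁ r = α - η , (lin (α ∷ η ∷ []) (λ a b → (a ≼ con 1) ∷ (con 0 ≼ b) ∷ [] ⊢ (a :- b ≼ con 1) by (0 , (1 , 0 ∷ []) ∷ (1 , 1 ∷ []) ∷ [])) α≤1 (0≤u 1≤P)) , shrink q 1≤q r α≤1 b , inj₂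
      (lin (α ∷ ι n ∷ η ∷ ι (suc n) ∷ []) (λ a b c d → (a ≼ con 1 :- b :* c) ∷ (d :* c ≼ (con 1 :+ b) :* c) ∷ [] ⊢ (a :- c ≼ con 1 :- d :* c) by (0 , (1 , 0 ∷ []) ∷ (1 , 1 ∷ []) ∷ [])) p (≤-reflexive (cong (_* η) (ι-suc n))))
      where open Gain q 1≤q

    -- The decrement `η` depends on `q` alone and not on α or K, so `P = 1/η` rounds starting from α
    -- = 1 are enough.
    M-small : ∀ q → 1 ℕ.≤ q → Bound (u q)
    M-small q 1≤q with descend q 1≤q (Gain.P q 1≤q)
    ... | α , _ , b , inj₁ p = bound-weaken p b
    ... | α , _ , b , inj₂ p = bound-weaken (lin (α ∷ ι P ∷ η ∷ u q ∷ []) (λ a b c d → (a ≼ con 1 :- b :* c) ∷ (con 1 ≼ b :* c) ∷ (con 0 ≼ d) ∷ [] ⊢ (a ≼ d) by (0 , (1 , 0 ∷ []) ∷ (1 , 1 ∷ []) ∷ (1 , 2 ∷ []) ∷ [])) p (≤-reflexive (sym (ι*u 1≤P))) (0≤u 1≤q)) b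
      where open Gain q 1≤q

-- From M(x) = o(x) to the lower bound for ψ

module ChebyshevBound where
  open SealedRationals
  open LinearArithmetic
  open FiniteSums
  open ArithmeticFunctions
  open MangoldtIdentities
  open LogarithmicSums
  open SelbergFormula
  open MertensBound
  open import Data.Nat.Base using (_^_)

  -- Summation by parts, as an induction. With the boundary term `M n * g n` subtracted, one more
  -- summand adds exactly `M n * (g n - g (suc n))`, and these telescope.
  ∑μ-antitone : ∀ (g : ℕ → R) Y m j → (∀ d → d ℕ.≤ m ℕ.+ suc j → abs (M d) ≤ Y) → (∀ d → m ℕ.< d → ι 0 ≤ g d) →
    (∀ d → m ℕ.< d → g (suc d) ≤ g d) →
    Within (Y * (ι 2 * g (suc m) - g (m ℕ.+ suc j))) (∑ (m ℕ.+ suc j) (λ d → μ d * g d) - ∑ m (λ d → μ d * g d) - M (m ℕ.+ suc j) * g (m ℕ.+ suc j))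
  ∑μ-antitone g Y m zero h 0≤g anti rewrite ℕₚ.+-comm m 1 =
    subst₂ Within (ring (Y ∷ G ∷ []) (λ Y G → Y :* G ≈ Y :* (con 2 :* G :- G))) (ring (M m ∷ G ∷ ∑ m (λ d → μ d * g d) ∷ μ (suc m) ∷ []) (λ a G b c → (con 0 :- a) :* G ≈ b :+ c :* G :- b :- (a :+ c) :* G))
      (within-* (within-neg (abs-within (h m (ℕₚ.n≤1+n m)))) (within-0≤ (0≤g (suc m) ℕₚ.≤-refl) ≤-refl))
    where
    G : R
    G = g (suc m)
  ∑μ-antitone g Y m (suc j) h 0≤g anti rewrite ℕₚ.+-suc m (suc j) =
    subst₂ Within (ring (Y ∷ G ∷ g n ∷ g (suc n) ∷ []) (λ Y G a b → Y :* (con 2 :* G :- a) :+ Y :* (a :- b) ≈ Y :* (con 2 :* G :- b)))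
      (ring (S n ∷ S m ∷ M n ∷ g n ∷ g (suc n) ∷ μ (suc n) ∷ []) (λ a b c d e f → a :- b :- c :* d :+ c :* (d :- e) ≈ a :+ f :* e :- b :- (c :+ f) :* e))
      (within-+ (∑μ-antitone g Y m j (λ d p → h d (ℕₚ.m≤n⇒m≤1+n p)) 0≤g anti)
        (within-* (abs-within (h n (ℕₚ.n≤1+n n))) (within-0≤ (lin (g (suc n) ∷ g n ∷ []) (λ a b → (a ≼ b) ∷ [] ⊢ (con 0 ≼ b :- a) by (0 , (1 , 0 ∷ []) ∷ [])) (anti n m<n)) ≤-refl)))
    where
    n : ℕ
    n = m ℕ.+ suc j
    m<n : m ℕ.< n
    m<n = ℕₚ.m<m+n m (s≤s z≤n)
    G : R
    G = g (suc m)
    S : ℕ → R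
    S n = ∑ n (λ d → μ d * g d)

  ∑μ-antitone-bound : ∀ (g : ℕ → R) Y {m n} → m ℕ.≤ n → ι 0 ≤ Y → (∀ d → d ℕ.≤ n → abs (M d) ≤ Y) → (∀ d → m ℕ.< d → ι 0 ≤ g d) →
    (∀ d → m ℕ.< d → g (suc d) ≤ g d) → Within (ι 2 * Y * g (suc m)) (∑ n (λ d → μ d * g d) - ∑ m (λ d → μ d * g d))
  ∑μ-antitone-bound g Y {m} {n} m≤n 0≤Y h 0≤g anti with n ℕ.∸ m in e
  ... | zero rewrite ℕₚ.≤-antisym (ℕₚ.m∸n≡0⇒m≤n e) m≤n = subst (Within _) (sym (+-inverseʳ _))
    (within-0≤ ≤-refl (*-nonneg (*-nonneg (0≤ι 2) 0≤Y) (0≤g (suc m) ℕₚ.≤-refl)))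
  ... | suc j = subst (λ n → Within (ι 2 * Y * g (suc m)) (∑ n (λ d → μ d * g d) - ∑ m (λ d → μ d * g d))) n≡
    (subst₂ Within (ring (Y ∷ g (suc m) ∷ g n′ ∷ []) (λ Y a b → Y :* (con 2 :* a :- b) :+ Y :* b ≈ con 2 :* Y :* a)) (ring (S n′ ∷ S m ∷ M n′ ∷ g n′ ∷ []) (λ a b c d → a :- b :- c :* d :+ c :* d ≈ a :- b))
      (within-+ (∑μ-antitone g Y m j (λ d p → h d (ℕₚ.≤-trans p (ℕₚ.≤-reflexive n≡))) 0≤g anti)
        (within-* (abs-within (h n′ (ℕₚ.≤-reflexive n≡))) (within-0≤ (0≤g n′ (ℕₚ.m<m+n m (s≤s z≤n))) ≤-refl))))
    where
    n′ : ℕ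
    n′ = m ℕ.+ suc j
    n≡ : n′ ≡ n
    n≡ = trans (cong (m ℕ.+_) (sym e)) (ℕₚ.m+[n∸m]≡n m≤n)
    S : ℕ → R
    S n = ∑ n (λ d → μ d * g d)

  module Psi {V : ℕ} {L : ℕ → R} (ls : LogSys V L) {x : ℕ} (1≤x : 1 ℕ.≤ x) (2x≤V : 2 ℕ.* x ℕ.≤ V) where
    open SelbergFormula.Selberg ls
    open Fixed 1≤x 2x≤V
    open Growth ls using (L-^; L2≤2)

    private
      X c : R
      X = ι x
      c = ι 1 + γ

    c-within : Within (ι 3) c
    c-within = (lin (γ ∷ []) (λ a → (con 0 :- con 1 ≼ a) ∷ [] ⊢ (con 0 :- con 3 ≼ con 1 :+ a) by (0 , (3 , []) ∷ (1 , 0 ∷ []) ∷ [])) (proj₁ (γ-bounds 1≤V))) , (lin (γ ∷ []) (λ a → (a ≼ con 2) ∷ [] ⊢ (con 1 :+ a ≼ con 3) by (0 , (1 , 0 ∷ []) ∷ [])) (proj₂ (γ-bounds 1≤V)))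

    -- Its Möbius transform imitates `T`: with y = x/d the sum over n ≤ y is about y (log y + γ) -
    -- (1 + γ) y = y log y - y. By Möbius inversion its contribution to ψ(x) is `κ₁ 1`, that is, x
    -- up to a constant.
    κ₁ : ℕ → R
    κ₁ e = X * u e - c

    E₁ : ℕ → R
    E₁ d = T (x ÷ d) - ∑ (x ÷ d) (λ n → κ₁ (d ℕ.* n))

    E₁≡ : ∀ {d} → 1 ℕ.≤ d → E₁ d ≡ T (x ÷ d) - X * u d * H (x ÷ d) + c * ι (x ÷ d)
    E₁≡ {d} p = trans (cong (T N -_) (trans (∑-cong N (λ n r _ → trans (cong (λ t → X * t - c) (u-* p r)) (ring (X ∷ u d ∷ u n ∷ c ∷ []) (λ X a b c → X :* (a :* b) :- c ≈ X :* a :* b :- c))))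
        (trans (∑-- N _ _) (cong₂ _-_ (∑-*ˡ N (X * u d) u) (∑-const N c)))))
      (ring (T N ∷ X ∷ u d ∷ H N ∷ ι N ∷ c ∷ []) (λ a X b d e c → a :- (X :* b :* d :- e :* c) ≈ a :- X :* b :* d :+ c :* e))
      where
      N : ℕ
      N = x ÷ d

    ψ≡ : ψ x ≡ (X - c) + ∑ x (λ d → μ d * E₁ d)
    ψ≡ = begin
      ψ x
        ≡⟨ sym (ψ-möbius x) ⟩
      ∑ x (λ d → μ d * T (x ÷ d))
        ≡⟨ ∑-cong x (λ d _ _ → trans (ring (μ d ∷ T (x ÷ d) ∷ ∑ (x ÷ d) (λ n → κ₁ (d ℕ.* n)) ∷ []) (λ a b c → a :* b ≈ a :* c :+ a :* (b :- c)))
             (cong (_+ μ d * E₁ d) (sym (∑-*ˡ (x ÷ d) (μ d) _)))) ⟩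
      ∑ x (λ d → ∑ (x ÷ d) (λ n → μ d * κ₁ (d ℕ.* n)) + μ d * E₁ d)
        ≡⟨ ∑-+ x _ _ ⟩
      ∑ x (λ d → ∑ (x ÷ d) (λ n → μ d * κ₁ (d ℕ.* n))) + ∑ x (λ d → μ d * E₁ d)
        ≡⟨ cong (_+ ∑ x (λ d → μ d * E₁ d)) (trans (möbius κ₁ 1≤x) (trans (cong (λ t → X * t - c) u-1) (cong (_- c) (*-identityʳ X)))) ⟩
      (X - c) + ∑ x (λ d → μ d * E₁ d) ∎
      where open ≡-Reasoning

    E₁-within : ∀ {d} → 1 ℕ.≤ d → d ℕ.≤ x → Within (ι 9 * q d) (E₁ d)
    E₁-within {d} p r = subst (Within _) (sym (trans (E₁≡ p) ring-eq)) (within-mono size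
      (within-+ (within-+ (T-approx 1≤N N≤V) (within-neg (within-* φ-within (within-+ LN-within γ-within))))
        (within-neg (y-small (0≤ι 2) β-within))))
      where
      open Quotient {x} {d} p r 2x≤V hiding (x≤V; 1≤x; 1≤V; c)
      ring-eq : T N - y * H N + (ι 1 + γ) * n ≡ (T N - (n * L N - n)) + (ι 0 - φ * (L N + γ)) + (ι 0 - y * β)
      ring-eq = (ring (T N ∷ y ∷ H N ∷ γ ∷ n ∷ L N ∷ []) (λ a y b c n d → a :- y :* b :+ (con 1 :+ c) :* n ≈ a :- (n :* d :- n) :+ (con 0 :- (y :- n) :* (d :+ c)) :+ (con 0 :- y :* (b :- d :- c))))
      size : ι 2 * L N + ι 3 + ι 1 * (L N + ι 2) + ι 2 * ι 2 ≤ ι 9 * q d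
      size = (lin (L N ∷ L x ∷ L d ∷ []) (λ a b c → (a ≼ b :- c) ∷ (con 0 ≼ a) ∷ [] ⊢ (con 2 :* a :+ con 3 :+ con 1 :* (a :+ con 2) :+ con 2 :* con 2 ≼ con 9 :* (con 1 :+ (b :- c))) by (0 , (9 , 0 ∷ []) ∷ (6 , 1 ∷ []) ∷ [])) a-lo 0≤LN)

    module Cut (t : ℕ) where
      A D₀ : ℕ
      -- Below `D₀` the logarithmic bound on `E₁` is summed in absolute value, which is harmless
      -- since `D₀` is only x/2^t. Above it the quotients x/d are at most 2^t, and the smallness of
      -- M is used.
      A = 2 ^ t
      D₀ = x ÷ A
      τ : R
      -- Bounds 1 + log(x/D₀): the quotient `x ÷ D₀` is at most 2^(t+1), log 2 is at most 2, and
      -- rounding costs 3.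
      τ = ι 2 * ι t + ι 6
      1≤A : 1 ℕ.≤ A
      1≤A = 1≤^ {2} (s≤s z≤n) t
      D₀≤x : D₀ ℕ.≤ x
      D₀≤x = ÷-≤ x A
      s : ℕ → R
      s n = ∑ n (λ d → μ d * E₁ d)

      q-cut : 1 ℕ.≤ D₀ → q D₀ ≤ τ
      q-cut p = (lin (L x ∷ L D₀ ∷ L N ∷ u N ∷ L (2 ^ suc t) ∷ ι (suc t) ∷ L 2 ∷ ι t ∷ []) (λ a b c d e f g h → (a :- b ≼ c :+ con 3 :* d) ∷ (d ≼ con 1) ∷ (c ≼ e) ∷ (e ≼ f :* g) ∷ (f :* g ≼ f :* con 2) ∷ (f ≼ con 1 :+ h) ∷ [] ⊢ (con 1 :+ (a :- b) ≼ con 2 :* h :+ con 6) by (0 , (1 , 0 ∷ []) ∷ (3 , 1 ∷ []) ∷ (1 , 2 ∷ []) ∷ (1 , 3 ∷ []) ∷ (1 , 4 ∷ []) ∷ (2 , 5 ∷ []) ∷ [])) a-hi uN≤1 (L-mono 1≤N N≤2A 2A≤V) (≤-reflexive (L-^ {2} (s≤s z≤n) (suc t))) (*-monoʳ-≤ (0≤ι (suc t)) (L2≤2 2≤V)) (≤-reflexive (ι-suc t)))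
        where
        open Quotient {x} {D₀} p D₀≤x 2x≤V using (a-hi; uN≤1; 1≤N; N)
        2≤V : 2 ℕ.≤ V
        2≤V = (linℕ (x ∷ V ∷ []) (λ x V → (con 1 ≼ x) ∷ (con 2 :* x ≼ V) ∷ [] ⊢ (con 2 ≼ V) by (0 , (2 , 0 ∷ []) ∷ (1 , 1 ∷ []) ∷ [])) 1≤x 2x≤V)
        A≤x : A ℕ.≤ x
        A≤x = ℕₚ.≤-trans (ℕₚ.≤-trans (ℕₚ.≤-reflexive (sym (ℕₚ.*-identityʳ A))) (ℕₚ.*-monoʳ-≤ A p)) (÷-lower x A)
        2A≤V : 2 ^ suc t ℕ.≤ V
        2A≤V = ℕₚ.≤-trans (ℕₚ.*-monoʳ-≤ 2 A≤x) 2x≤V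
        N≤2A : N ℕ.≤ 2 ^ suc t
        N≤2A = ℕₚ.<⇒≤ (ℕₚ.*-cancelˡ-< D₀ N (2 ℕ.* A) (ℕₚ.≤-<-trans (÷-lower x D₀)
          (ℕₚ.<-≤-trans (÷-upper x 1≤A) (linℕ (A ∷ D₀ ∷ []) (λ A a → (A :* con 1 ≼ A :* a) ∷ [] ⊢ (A :* (con 1 :+ a) ≼ a :* (con 2 :* A)) by (0 , (1 , 0 ∷ []) ∷ [])) *≤))))
          where
          *≤ : A ℕ.* 1 ℕ.≤ A ℕ.* D₀
          *≤ = ℕₚ.*-monoʳ-≤ A p

      poly : R
      poly = τ * τ + ι 6 * τ + ι 24

      s-small : Within (ι 9 * (X * u A * poly)) (s D₀)
      s-small = abs-within (by-cases D₀ refl)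
        where
        0≤τ : ι 0 ≤ τ
        0≤τ = (lin (ι t ∷ []) (λ a → (con 0 ≼ a) ∷ [] ⊢ (con 0 ≼ con 2 :* a :+ con 6) by (0 , (6 , []) ∷ (2 , 0 ∷ []) ∷ [])) (0≤ι t))
        0≤poly : ι 0 ≤ poly
        0≤poly = (lin (τ ∷ []) (λ a → (con 0 ≼ a) ∷ [] ⊢ (con 0 ≼ a :* a :+ con 6 :* a :+ con 24) by (0 , (24 , []) ∷ (6 , 0 ∷ []) ∷ (1 , 0 ∷ 0 ∷ []) ∷ [])) 0≤τ)
        by-cases : ∀ D → D ≡ D₀ → abs (s D) ≤ ι 9 * (X * u A * poly)
        by-cases zero _ = ≤-trans (≤-reflexive (abs-nonneg ≤-refl)) (*-nonneg (0≤ι 9) (*-nonneg (*-nonneg (0≤ι x) (0≤u 1≤A)) 0≤poly))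
        by-cases (suc D) refl′ = ≤-trans (∑-abs (suc D) _) (≤-trans (∑-mono (suc D) each) (≤-trans (≤-reflexive (∑-*ˡ (suc D) (ι 9) _))
          (*-monoʳ-≤ (0≤ι 9) (≤-trans (∑q² (suc D) (s≤s z≤n) D≤x) (≤-trans (*-monoʳ-≤ (0≤ι (suc D)) mono)
            (lin (ι (suc D) ∷ X ∷ u A ∷ poly ∷ []) (λ a X b poly → (a ≼ X :* b) ∷ (con 0 ≼ poly) ∷ [] ⊢ (a :* poly ≼ X :* b :* poly) by (0 , (1 , 0 ∷ 1 ∷ []) ∷ [])) (subst (λ t → ι t ≤ X * u A) (sym refl′) (ι-÷-≤ x 1≤A)) 0≤poly))))))
          where
          D≤x : suc D ℕ.≤ x
          D≤x = ℕₚ.≤-trans (ℕₚ.≤-reflexive refl′) D₀≤x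
          each : ∀ d → 1 ℕ.≤ d → d ℕ.≤ suc D → abs (μ d * E₁ d) ≤ ι 9 * (q d * q d)
          each d p r = ≤-trans (abs-* _ _) (≤-trans (*-mono-≤ (0≤abs _) (0≤abs _) (μ-abs d) (within-abs (E₁-within p (ℕₚ.≤-trans r D≤x))))
            (lin (q d ∷ []) (λ a → (con 1 ≼ a) ∷ [] ⊢ (con 1 :* (con 9 :* a) ≼ con 9 :* (a :* a)) by (0 , (9 , 0 ∷ []) ∷ (9 , 0 ∷ 0 ∷ []) ∷ [])) (1≤q p (ℕₚ.≤-trans r D≤x))))
          Q : R
          Q = q (suc D)
          Q≤τ : Q ≤ τ
          Q≤τ = subst (λ t → q t ≤ τ) (sym refl′) (q-cut (ℕₚ.≤-trans (s≤s z≤n) (ℕₚ.≤-reflexive refl′)))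
          mono : Q * Q + ι 6 * Q + ι 24 ≤ poly
          mono = (lin (Q ∷ τ ∷ []) (λ Q a → (Q ≼ a) ∷ (con 1 ≼ Q) ∷ [] ⊢ (Q :* Q :+ con 6 :* Q :+ con 24 ≼ a :* a :+ con 6 :* a :+ con 24) by (0 , (8 , 0 ∷ []) ∷ (1 , 0 ∷ 0 ∷ []) ∷ (2 , 0 ∷ 1 ∷ []) ∷ [])) Q≤τ (1≤q (s≤s z≤n) D≤x))

      module Large (Y : R) (0≤Y : ι 0 ≤ Y) (M≤Y : ∀ d → d ℕ.≤ x → abs (M d) ≤ Y) where
        a : R
        a = ι A
        1≤a : ι 1 ≤ a
        1≤a = 1≤ι 1≤A
        g₁ g₂ g₃ : ℕ → R
        -- `E₁` itself is not monotone, but it is a combination of these three, each decreasing in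
        -- d; summation by parts is applied to them separately.
        g₁ d = T (x ÷ d)
        g₂ d = X * u d * H (x ÷ d)
        g₃ d = ι (x ÷ d)
        0≤T : ∀ N → ι 0 ≤ T N
        0≤T N = ∑-nonneg N (λ i p _ → 0≤L p)
        D₁ : ℕ
        D₁ = suc D₀
        N₁ : ℕ
        N₁ = x ÷ D₁
        N₁≤A : N₁ ℕ.≤ A
        N₁≤A = ℕₚ.<⇒≤ (ℕₚ.*-cancelˡ-< D₁ N₁ A (ℕₚ.≤-<-trans (÷-lower x D₁) (ℕₚ.<-≤-trans (÷-upper x 1≤A) (ℕₚ.≤-reflexive (ℕₚ.*-comm A D₁)))))
        H≤ : ∀ N → H N ≤ ι N
        H≤ N = ≤-trans (∑-mono N (λ i p _ → u≤1 p)) (≤-reflexive (trans (∑-const N (ι 1)) (*-identityʳ _)))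
        N₁≤V : N₁ ℕ.≤ V
        N₁≤V = ℕₚ.≤-trans (÷-≤ x D₁) x≤V
        b₁ : g₁ D₁ ≤ a * (a + ι 1)
        b₁ = ≤-trans (∑-mono N₁ (λ i p r → ≤-trans (L≤H+1 p (ℕₚ.≤-trans r N₁≤V)) (+-mono-≤ (≤-trans (H≤ i) (ι-mono (ℕₚ.≤-trans r N₁≤A))) ≤-refl)))
          (≤-trans (≤-reflexive (∑-const N₁ _)) (lin (ι N₁ ∷ a ∷ []) (λ b a → (b ≼ a) ∷ (con 1 ≼ a) ∷ [] ⊢ (b :* (a :+ con 1) ≼ a :* (a :+ con 1)) by (0 , (2 , 0 ∷ []) ∷ (1 , 0 ∷ 1 ∷ []) ∷ [])) (ι-mono N₁≤A) 1≤a))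
        b₂ : g₂ D₁ ≤ (a + ι 1) * a
        b₂ = *-mono-≤ (*-nonneg (0≤ι x) (0≤u (s≤s z≤n))) (0≤H N₁) (lin (X ∷ u D₁ ∷ ι N₁ ∷ a ∷ []) (λ X b c a → (X :* b ≼ c :+ con 1) ∷ (c ≼ a) ∷ [] ⊢ (X :* b ≼ a :+ con 1) by (0 , (1 , 0 ∷ []) ∷ (1 , 1 ∷ []) ∷ [])) (ι-÷-> x {D₁} (s≤s z≤n)) (ι-mono N₁≤A)) (≤-trans (H≤ N₁) (ι-mono N₁≤A))
        b₃ : g₃ D₁ ≤ a
        b₃ = ι-mono N₁≤A
        pos : ∀ d → D₀ ℕ.< d → 1 ℕ.≤ d
        pos d p = ℕₚ.≤-trans (s≤s z≤n) p
        ÷-step : ∀ d → D₀ ℕ.< d → x ÷ suc d ℕ.≤ x ÷ d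
        ÷-step d p = ÷-anti x (pos d p) (ℕₚ.n≤1+n d)
        monoT : ∀ {m n} → m ℕ.≤ n → T m ≤ T n
        monoT p = ∑-upper L p (λ i r _ → 0≤L r)
        monoH : ∀ {m n} → m ℕ.≤ n → H m ≤ H n
        monoH p = ∑-upper u p (λ i r _ → 0≤u r)
        r₁ : Within (ι 2 * Y * g₁ D₁) (∑ x (λ d → μ d * g₁ d) - ∑ D₀ (λ d → μ d * g₁ d))
        r₁ = ∑μ-antitone-bound g₁ Y D₀≤x 0≤Y M≤Y (λ d _ → 0≤T (x ÷ d)) (λ d p → monoT (÷-step d p))
        r₂ : Within (ι 2 * Y * g₂ D₁) (∑ x (λ d → μ d * g₂ d) - ∑ D₀ (λ d → μ d * g₂ d))
        r₂ = ∑μ-antitone-bound g₂ Y D₀≤x 0≤Y M≤Y (λ d p → *-nonneg (*-nonneg (0≤ι x) (0≤u (pos d p))) (0≤H (x ÷ d)))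
          (λ d p → *-mono-≤ (*-nonneg (0≤ι x) (0≤u (s≤s z≤n))) (0≤H (x ÷ suc d)) (*-monoʳ-≤ (0≤ι x) (u-anti (pos d p) (ℕₚ.n≤1+n d))) (monoH (÷-step d p)))
        r₃ : Within (ι 2 * Y * g₃ D₁) (∑ x (λ d → μ d * g₃ d) - ∑ D₀ (λ d → μ d * g₃ d))
        r₃ = ∑μ-antitone-bound g₃ Y D₀≤x 0≤Y M≤Y (λ d _ → 0≤ι (x ÷ d)) (λ d p → ι-mono (÷-step d p))
        S : (ℕ → R) → ℕ → R
        S g n = ∑ n (λ d → μ d * g d)
        split : ∀ n → s n ≡ S g₁ n - S g₂ n + c * S g₃ n
        split n = trans (∑-cong n (λ d p _ → trans (cong (μ d *_) (E₁≡ p)) (ring (μ d ∷ g₁ d ∷ X ∷ u d ∷ H (x ÷ d) ∷ c ∷ g₃ d ∷ []) (λ a b X d e c f → a :* (b :- X :* d :* e :+ c :* f) ≈ a :* b :- a :* (X :* d :* e) :+ c :* (a :* f)))))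
          (trans (∑-+ n _ _) (cong₂ _+_ (∑-- n _ _) (∑-*ˡ n c _)))

        s-large : Within (ι 20 * (a * a) * Y) (s x - s D₀)
        s-large = subst (Within _) (sym eq) (within-mono size (within-+ (within-+ r₁ (within-neg r₂)) (within-* c-within r₃)))
          where
          eq : s x - s D₀ ≡ (S g₁ x - S g₁ D₀) + (ι 0 - (S g₂ x - S g₂ D₀)) + c * (S g₃ x - S g₃ D₀)
          eq = trans (cong₂ _-_ (split x) (split D₀))
            (ring (S g₁ x ∷ S g₂ x ∷ c ∷ S g₃ x ∷ S g₁ D₀ ∷ S g₂ D₀ ∷ S g₃ D₀ ∷ []) (λ a b c d e f g → a :- b :+ c :* d :- (e :- f :+ c :* g) ≈ a :- e :+ (con 0 :- (b :- f)) :+ c :* (d :- g)))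
          total : g₁ D₁ + g₂ D₁ + ι 3 * g₃ D₁ ≤ ι 10 * (a * a)
          total = (lin (g₁ D₁ ∷ a ∷ g₂ D₁ ∷ g₃ D₁ ∷ []) (λ b a c d → (b ≼ a :* (a :+ con 1)) ∷ (c ≼ (a :+ con 1) :* a) ∷ (d ≼ a) ∷ (con 1 ≼ a) ∷ (a :* con 1 ≼ a :* a) ∷ [] ⊢ (b :+ c :+ con 3 :* d ≼ con 10 :* (a :* a)) by (0 , (3 , []) ∷ (1 , 0 ∷ []) ∷ (1 , 1 ∷ []) ∷ (3 , 2 ∷ []) ∷ (3 , 3 ∷ []) ∷ (8 , 4 ∷ []) ∷ [])) b₁ b₂ b₃ 1≤a (*-monoʳ-≤ (≤-trans (0≤ι 1) 1≤a) 1≤a))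
          size : ι 2 * Y * g₁ D₁ + ι 2 * Y * g₂ D₁ + ι 3 * (ι 2 * Y * g₃ D₁) ≤ ι 20 * (a * a) * Y
          size = (lin (Y ∷ g₁ D₁ ∷ g₂ D₁ ∷ g₃ D₁ ∷ a ∷ []) (λ Y b c d a → (Y :* (b :+ c :+ con 3 :* d) ≼ Y :* (con 10 :* (a :* a))) ∷ [] ⊢ (con 2 :* Y :* b :+ con 2 :* Y :* c :+ con 3 :* (con 2 :* Y :* d) ≼ con 20 :* (a :* a) :* Y) by (0 , (2 , 0 ∷ []) ∷ [])) (*-monoʳ-≤ 0≤Y total))

        ψ-lower : X ≤ ψ x + ι 9 * (X * u A * poly) + ι 20 * (a * a) * Y + ι 3
        ψ-lower = (lin (ψ x ∷ X ∷ c ∷ s x ∷ a ∷ Y ∷ s D₀ ∷ u A ∷ poly ∷ []) (λ b X c d a Y e f poly → (X :- c :+ d ≼ b) ∷ (c ≼ con 3) ∷ (con 0 :- con 20 :* (a :* a) :* Y ≼ d :- e) ∷ (con 0 :- con 9 :* (X :* f :* poly) ≼ e) ∷ [] ⊢ (X ≼ b :+ con 9 :* (X :* f :* poly) :+ con 20 :* (a :* a) :* Y :+ con 3) by (0 , (1 , 0 ∷ []) ∷ (1 , 1 ∷ []) ∷ (1 , 2 ∷ []) ∷ (1 , 3 ∷ []) ∷ [])) (≤-reflexive (sym ψ≡)) (proj₂ c-within) (proj₁ s-large) (proj₁ s-small))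

  module PNT (logs : ∀ V → ∃ λ L → LogSys V L) where
    open MertensBound.Iterate logs

    ψ-lower-bound : ∀ q → 1 ℕ.≤ q → ∃ λ K → ∀ {V L} (ls : LogSys V L) {x} → 1 ℕ.≤ x → 2 ℕ.* x ℕ.≤ V →
      ι x ≤ LogSys.ψ ls x + u q * ι x + ι K
    ψ-lower-bound q 1≤q = 20 ℕ.* (A ℕ.* A) ℕ.* K₀ ℕ.+ 3 , main
      where
      z t A Q : ℕ
      -- With `τ = 6 z` the polynomial is at most `96 z²`, so `18 poly` is at most `1728 z²`, hence
      -- at most z³/q and A/q. This makes the part below `D₀` at most x/(2 q).
      z = suc (1728 ℕ.* q)
      t = 3 ℕ.* (1728 ℕ.* q)
      A = 2 ^ t
      -- The part above `D₀` is `20 A²` times the bound for M; with slope 1/Q for the latter it is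
      -- x/(2 q) plus a constant.
      Q = 40 ℕ.* (A ℕ.* A) ℕ.* q
      1≤A : 1 ℕ.≤ A
      1≤A = 1≤^ {2} (s≤s z≤n) t
      1≤Q : 1 ℕ.≤ Q
      1≤Q = 1≤-* {40 ℕ.* (A ℕ.* A)} (1≤-* {40} (s≤s z≤n) (1≤-* 1≤A 1≤A)) 1≤q
      K₀ : ℕ
      K₀ = proj₁ (M-small Q 1≤Q)
      a : R
      a = ι A
      -- 2^t exceeds (1728 q + 1)³, hence the quadratic in t by a factor of order q.
      z³≤A : ι z * (ι z * ι z) ≤ a
      z³≤A = ≤-trans (≤-reflexive (sym (trans (ι-* z (z ℕ.* z)) (cong (ι z *_) (ι-* z z))))) (ι-mono (ℕₚ.≤-trans (ℕₚ.*-mono-≤ zp (ℕₚ.*-mono-≤ zp zp)) (ℕₚ.≤-reflexive pow)))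
        where
        p : ℕ
        p = 2 ^ (1728 ℕ.* q)
        zp : z ℕ.≤ p
        zp = n<2^n (1728 ℕ.* q)
        pow : p ℕ.* (p ℕ.* p) ≡ A
        pow = sym (trans (ℕₚ.^-distribˡ-+-* 2 (1728 ℕ.* q) _) (cong (p ℕ.*_) (trans (ℕₚ.^-distribˡ-+-* 2 (1728 ℕ.* q) _)
          (cong (p ℕ.*_) (cong (2 ^_) (ℕₚ.+-identityʳ (1728 ℕ.* q)))))))
      main : ∀ {V L} (ls : LogSys V L) {x} → 1 ℕ.≤ x → 2 ℕ.* x ℕ.≤ V → ι x ≤ LogSys.ψ ls x + u q * ι x + ι (20 ℕ.* (A ℕ.* A) ℕ.* K₀ ℕ.+ 3)
      main {V} {L} ls {x} 1≤x 2x≤V = (lin (X ∷ ψ x ∷ u A ∷ poly ∷ a ∷ u Q ∷ ι K₀ ∷ u q ∷ ι (20 ℕ.* (A ℕ.* A) ℕ.* K₀ ℕ.+ 3) ∷ []) (λ X b c poly a d e f g → (X ≼ b :+ con 9 :* (X :* c :* poly) :+ con 20 :* (a :* a) :* (d :* X :+ e) :+ con 3) ∷ (con 9 :* (X :* c :* poly) :* con 2 ≼ f :* X) ∷ (con 20 :* (a :* a) :* (d :* X) :* con 2 ≼ f :* X) ∷ (con 20 :* (a :* a) :* e :+ con 3 ≼ g) ∷ [] ⊢ (X ≼ b :+ f :* X :+ g) by (1 , (2 , 0 ∷ []) ∷ (1 , 1 ∷ []) ∷ (1 , 2 ∷ []) ∷ (2 , 3 ∷ []) ∷ [])) (Large.ψ-lower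 Y 0≤Y M≤Y) small-part (≤-reflexive large-part) (≤-reflexive (sym K≡)))
        where
        open LogSys ls using (ψ)
        open Psi ls 1≤x 2x≤V using (module Cut)
        open Cut t using (poly; τ; module Large)
        X Y : R
        X = ι x
        Y = u Q * X + ι K₀
        0≤Y : ι 0 ≤ Y
        0≤Y = (lin (u Q ∷ X ∷ ι K₀ ∷ []) (λ a X b → (con 0 ≼ a :* X) ∷ (con 0 ≼ b) ∷ [] ⊢ (con 0 ≼ a :* X :+ b) by (0 , (1 , 0 ∷ []) ∷ (1 , 1 ∷ []) ∷ [])) (*-nonneg (0≤u 1≤Q) (0≤ι x)) (0≤ι K₀))
        M≤Y : ∀ d → d ℕ.≤ x → abs (M d) ≤ Y
        M≤Y d p = ≤-trans (proj₂ (M-small Q 1≤Q) d) (+-mono-≤ (*-monoʳ-≤ (0≤u 1≤Q) (ι-mono p)) ≤-refl)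
        K≡ : ι (20 ℕ.* (A ℕ.* A) ℕ.* K₀ ℕ.+ 3) ≡ ι 20 * (a * a) * ι K₀ + ι 3
        K≡ = trans (ι-+ (20 ℕ.* (A ℕ.* A) ℕ.* K₀) 3) (cong (_+ ι 3) (trans (ι-* (20 ℕ.* (A ℕ.* A)) K₀) (cong (_* ι K₀) (trans (ι-* 20 (A ℕ.* A)) (cong (ι 20 *_) (ι-* A A))))))
        uQ : ι 40 * (a * a) * u Q ≡ u q
        uQ = trans (cong (ι 40 * (a * a) *_) (u-* {40 ℕ.* (A ℕ.* A)} (1≤-* {40} (s≤s z≤n) (1≤-* 1≤A 1≤A)) 1≤q))
          (trans (sym (*-assoc _ _ _)) (trans (cong (_* u q) (trans (cong (_* u (40 ℕ.* (A ℕ.* A))) (sym (trans (ι-* 40 (A ℕ.* A)) (cong (ι 40 *_) (ι-* A A)))))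
            (ι*u {40 ℕ.* (A ℕ.* A)} (1≤-* {40} (s≤s z≤n) (1≤-* 1≤A 1≤A))))) (*-identityˡ _)))
        large-part : ι 20 * (a * a) * (u Q * X) * ι 2 ≡ u q * X
        large-part = trans (ring (a ∷ u Q ∷ X ∷ []) (λ a b X → con 20 :* (a :* a) :* (b :* X) :* con 2 ≈ con 40 :* (a :* a) :* b :* X)) (cong (_* X) uQ)
        Z : R
        Z = ι z
        z≡ : Z ≡ ι 1 + ι 1728 * ι q
        z≡ = trans (ι-suc _) (cong (ι 1 +_) (ι-* 1728 q))
        1≤Z : ι 1 ≤ Z
        1≤Z = 1≤ι {z} (s≤s z≤n)
        τ≡ : τ ≡ ι 6 * Z
        τ≡ = trans (cong (λ t → ι 2 * t + ι 6) (trans (ι-* 3 _) (cong (ι 3 *_) (ι-* 1728 q)))) (trans (ring (ι q ∷ []) (λ a → con 2 :* (con 3 :* (con 1728 :* a)) :+ con 6 ≈ con 6 :* (con 1 :+ con 1728 :* a))) (cong (ι 6 *_) (sym z≡)))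
        poly≤ : poly ≤ ι 96 * (Z * Z)
        poly≤ = ≤-trans (≤-reflexive (cong (λ τ → τ * τ + ι 6 * τ + ι 24) τ≡)) (lin (Z ∷ []) (λ Z → (con 1 ≼ Z) ∷ [] ⊢ (con 6 :* Z :* (con 6 :* Z) :+ con 6 :* (con 6 :* Z) :+ con 24 ≼ con 96 :* (Z :* Z)) by (0 , (84 , 0 ∷ []) ∷ (60 , 0 ∷ 0 ∷ []) ∷ [])) 1≤Z)
        18poly≤ : ι 18 * poly ≤ u q * a
        18poly≤ = ≤-trans (lin (poly ∷ Z ∷ u q ∷ []) (λ poly Z a → (poly ≼ con 96 :* (Z :* Z)) ∷ (con 1728 :* (Z :* Z) ≼ a :* (Z :* (Z :* Z))) ∷ [] ⊢ (con 18 :* poly ≼ a :* (Z :* (Z :* Z))) by (0 , (18 , 0 ∷ []) ∷ (1 , 1 ∷ []) ∷ [])) poly≤ e) (*-monoʳ-≤ (0≤u 1≤q) z³≤A)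
          where
          1728≤ : ι 1728 ≤ u q * Z
          1728≤ = (lin (u q ∷ Z ∷ ι q ∷ []) (λ a Z b → (a :* (con 1 :+ con 1728 :* b) ≼ a :* Z) ∷ (con 1 ≼ b :* a) ∷ (con 0 ≼ a) ∷ [] ⊢ (con 1728 ≼ a :* Z) by (0 , (1 , 0 ∷ []) ∷ (1728 , 1 ∷ []) ∷ (1 , 2 ∷ []) ∷ [])) (≤-reflexive (sym (cong (u q *_) z≡))) (≤-reflexive (sym (ι*u 1≤q))) (0≤u 1≤q))
          e : ι 1728 * (Z * Z) ≤ u q * (Z * (Z * Z))
          e = (lin (Z ∷ u q ∷ []) (λ Z a → (Z :* Z :* con 1728 ≼ Z :* Z :* (a :* Z)) ∷ [] ⊢ (con 1728 :* (Z :* Z) ≼ a :* (Z :* (Z :* Z))) by (0 , (1 , 0 ∷ []) ∷ [])) (*-monoʳ-≤ (*-nonneg (0≤ι z) (0≤ι z)) 1728≤))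
        small-part : ι 9 * (X * u A * poly) * ι 2 ≤ u q * X
        small-part = (lin (X ∷ u A ∷ poly ∷ u q ∷ a ∷ []) (λ X b poly c a → (X :* b :* (con 18 :* poly) ≼ X :* b :* (c :* a)) ∷ (X :* c :* (a :* b) ≼ X :* c :* con 1) ∷ [] ⊢ (con 9 :* (X :* b :* poly) :* con 2 ≼ c :* X) by (0 , (1 , 0 ∷ []) ∷ (1 , 1 ∷ []) ∷ [])) (*-monoʳ-≤ (*-nonneg (0≤ι x) (0≤u 1≤A)) 18poly≤) (≤-reflexive (cong (X * u q *_) (ι*u 1≤A))))

-- Construction of the exactly additive approximate logarithm

module ApproximateLogarithm where
  open SealedRationals
  open LinearArithmetic
  open FiniteSums
  open ArithmeticFunctions
  open LogarithmicSums
  open import Data.Nat.Primality using (Prime; prime⇒nonTrivial)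
  open import Data.Nat.ListAction using (product; sum)
  open import Data.Nat.ListAction.Properties using (sum-++; sum-↭)
  open import Data.List.Base using (map; length)
  import Data.List.Properties as Listₚ
  open import Data.List.Relation.Unary.All using (All; []; _∷_)
  open import Data.List.Relation.Binary.Permutation.Propositional.Properties using () renaming (map⁺ to ↭-map⁺)

  pw : R → ℕ → R
  pw b zero = ι 1
  pw b (suc n) = b * pw b n

  pw-+ : ∀ b i j → pw b (i ℕ.+ j) ≡ pw b i * pw b j
  pw-+ b zero j = sym (*-identityˡ _)
  pw-+ b (suc i) j = trans (cong (b *_) (pw-+ b i j)) (sym (*-assoc _ _ _))

  pw-* : ∀ a b n → pw (a * b) n ≡ pw a n * pw b n
  pw-* a b zero = sym (*-identityˡ _)
  pw-* a b (suc n) = trans (cong (a * b *_) (pw-* a b n)) (*-interchange _ _ _ _)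

  pw-pw : ∀ b i j → pw b (i ℕ.* j) ≡ pw (pw b i) j
  pw-pw b i zero = cong (pw b) (ℕₚ.*-zeroʳ i)
  pw-pw b i (suc j) = trans (cong (pw b) (ℕₚ.*-suc i j)) (trans (pw-+ b i (i ℕ.* j)) (cong (pw b i *_) (pw-pw b i j)))

  0≤pw : ∀ {b} → ι 0 ≤ b → ∀ n → ι 0 ≤ pw b n
  0≤pw p zero = 0≤ι 1
  0≤pw p (suc n) = *-nonneg p (0≤pw p n)

  1≤pw : ∀ {b} → ι 1 ≤ b → ∀ n → ι 1 ≤ pw b n
  1≤pw p zero = ≤-refl
  1≤pw {b} p (suc n) = (lin (b ∷ pw b n ∷ []) (λ b a → (con 1 ≼ b) ∷ (con 1 ≼ a) ∷ [] ⊢ (con 1 ≼ b :* a) by (0 , (1 , 0 ∷ []) ∷ (1 , 1 ∷ []) ∷ (1 , 0 ∷ 1 ∷ []) ∷ [])) p (1≤pw p n))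

  pw-mono-exp : ∀ {b i j} → ι 1 ≤ b → i ℕ.≤ j → pw b i ≤ pw b j
  pw-mono-exp {b} p (z≤n {j}) = 1≤pw p j
  pw-mono-exp p (s≤s q) = *-monoʳ-≤ (≤-trans (0≤ι 1) p) (pw-mono-exp p q)

  pw-mono : ∀ {a b} → ι 0 ≤ a → a ≤ b → ∀ n → pw a n ≤ pw b n
  pw-mono p q zero = ≤-refl
  pw-mono p q (suc n) = *-mono-≤ p (0≤pw p n) q (pw-mono p q n)

  bernoulli : ∀ {y} → ι 0 ≤ y → ∀ n → ι 1 + ι n * y ≤ pw (ι 1 + y) n
  bernoulli {y} p zero = (lin (y ∷ []) (λ y → [] ⊢ (con 1 :+ con 0 :* y ≼ con 1) by (0 , [])))
  bernoulli {y} p (suc n) = (lin (ι n ∷ y ∷ pw (ι 1 + y) n ∷ ι (suc n) ∷ []) (λ a y b c → (con 1 :+ a :* y ≼ b) ∷ (y :* (con 1 :+ a :* y) ≼ y :* b) ∷ (c :* y ≼ (con 1 :+ a) :* y) ∷ (con 0 ≼ a :* (y :* y)) ∷ [] ⊢ (con 1 :+ c :* y ≼ (con 1 :+ y) :* b) by (0 , (1 , 0 ∷ []) ∷ (1 , 1 ∷ []) ∷ (1 , 2 ∷ []) ∷ (1 , 3 ∷ []) ∷ [])) (bernoulli p n) (*-monoʳ-≤ p (bernoulli p n)) (≤-reflexive (cong (_* y) (ι-suc n))) (*-nonneg (0≤ι n) (*-nonneg p p)))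

  module LogBase (m : ℕ) (1≤m : 1 ℕ.≤ m) where
    b : R
    b = ι 1 + u m
    0≤um : ι 0 ≤ u m
    0≤um = 0≤u 1≤m
    1≤b : ι 1 ≤ b
    1≤b = (lin (u m ∷ []) (λ a → (con 0 ≼ a) ∷ [] ⊢ (con 1 ≼ con 1 :+ a) by (0 , (1 , 0 ∷ []) ∷ [])) 0≤um)
    0≤b : ι 0 ≤ b
    0≤b = ≤-trans (0≤ι 1) 1≤b

    find : ∀ x → ι 1 ≤ x → ∀ j → x < pw b j → ∃ λ a → pw b a ≤ x × x < pw b (suc a)
    find x p zero q = ⊥-elim (q p)
    find x p (suc j) q with pw b j ≤? x
    ... | yes r = j , r , q
    ... | no r = find x p j r

    unbounded : ∀ n → ι n < pw b (m ℕ.* n)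
    unbounded n h = 1≰0 (lin (pw b (m ℕ.* n) ∷ ι n ∷ ι (m ℕ.* n) ∷ u m ∷ []) (λ a b c d → (a ≼ b) ∷ (con 1 :+ c :* d ≼ a) ∷ (b ≼ c :* d) ∷ [] ⊢ (con 1 ≼ con 0) by (0 , (1 , 0 ∷ []) ∷ (1 , 1 ∷ []) ∷ (1 , 2 ∷ []) ∷ [])) h (bernoulli 0≤um (m ℕ.* n)) (≤-reflexive (sym e)))
      where
      e : ι (m ℕ.* n) * u m ≡ ι n
      e = trans (cong (_* u m) (ι-* m n)) (trans (ring (ι m ∷ ι n ∷ u m ∷ []) (λ a b c → a :* b :* c ≈ b :* (a :* c))) (trans (cong (ι n *_) (ι*u 1≤m)) (*-identityʳ _)))

    lg : ℕ → ℕ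
    lg zero = 0
    lg (suc n) = proj₁ (find (ι (suc n)) (ι-mono (s≤s z≤n)) (m ℕ.* suc n) (unbounded (suc n)))

    lg-bounds : ∀ {n} → 1 ℕ.≤ n → pw b (lg n) ≤ ι n × ι n ≤ pw b (suc (lg n))
    lg-bounds {suc n} _ with find (ι (suc n)) (ι-mono (s≤s z≤n)) (m ℕ.* suc n) (unbounded (suc n))
    ... | a , lo , hi = lo , <⇒≤ hi

    -- Rounding the logarithm at the primes only makes `A` exactly additive. The price is one unit
    -- of the exponent per prime factor, that is `Ω n ≤ n` in all, which becomes negligible after
    -- division by a large `m`.
    A Ω : ℕ → ℕ
    A n = sum (map lg (facs n))
    Ω n = length (facs n)

    A-* : ∀ {x y} → 1 ℕ.≤ x → 1 ℕ.≤ y → A (x ℕ.* y) ≡ A x ℕ.+ A y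
    A-* {x} {y} p q = trans (sum-↭ (↭-map⁺ lg (facs-* p q))) (trans (cong sum (Listₚ.map-++ lg (facs x) (facs y))) (sum-++ (map lg (facs x)) _))

    list-bounds : ∀ {ps} → All Prime ps → pw b (sum (map lg ps)) ≤ ι (product ps) × ι (product ps) ≤ pw b (sum (map lg ps) ℕ.+ length ps)
    list-bounds [] = ≤-refl , ≤-refl
    list-bounds {p ∷ ps} (h ∷ hs) =
      ≤-trans (≤-reflexive (pw-+ b (lg p) _)) (≤-trans (*-mono-≤ (0≤pw 0≤b (lg p)) (0≤pw 0≤b (sum (map lg ps))) (proj₁ (lg-bounds (1≤prime h))) (proj₁ (list-bounds hs))) (≤-reflexive (sym (ι-* p _)))) ,
      ≤-trans (≤-reflexive (ι-* p _)) (≤-trans (*-mono-≤ (0≤ι p) (0≤ι _) (proj₂ (lg-bounds (1≤prime h))) (proj₂ (list-bounds hs)))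
        (≤-reflexive (trans (sym (pw-+ b (suc (lg p)) _)) (cong (pw b) (ℕₚ.≤-antisym (linℕ (lg p ∷ sum (map lg ps) ∷ length ps ∷ []) (λ a b c → [] ⊢ (con 1 :+ a :+ (b :+ c) ≼ a :+ b :+ (con 1 :+ c)) by (0 , []))) (linℕ (lg p ∷ sum (map lg ps) ∷ length ps ∷ []) (λ a b c → [] ⊢ (a :+ b :+ (con 1 :+ c) ≼ con 1 :+ a :+ (b :+ c)) by (0 , []))))))))

    A-lower : ∀ {n} → 1 ℕ.≤ n → pw b (A n) ≤ ι n
    A-lower {n} p = ≤-trans (proj₁ (list-bounds (facs-prime n))) (≤-reflexive (cong ι (facs-product p)))

    A-upper : ∀ {n} → 1 ℕ.≤ n → ι n ≤ pw b (A n ℕ.+ Ω n)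
    A-upper {n} p = ≤-trans (≤-reflexive (cong ι (sym (facs-product p)))) (proj₂ (list-bounds (facs-prime n)))

    2≤prime : ∀ {p} → Prime p → 2 ℕ.≤ p
    2≤prime {p} h = ℕ.nonTrivial⇒n>1 p {{prime⇒nonTrivial h}}

    length≤product : ∀ {ps} → All Prime ps → suc (length ps) ℕ.≤ product ps
    length≤product [] = s≤s z≤n
    length≤product {p ∷ ps} (h ∷ hs) = (linℕ (p ∷ length ps ∷ product ps ∷ []) (λ p a b → (con 2 ≼ p) ∷ (con 1 :+ a ≼ b) ∷ (con 0 ≼ p) ∷ (con 0 ≼ a) ∷ (con 0 ≼ b) ∷ [] ⊢ (con 1 :+ (con 1 :+ a) ≼ p :* b) by (1 , (1 , 0 ∷ []) ∷ (4 , 1 ∷ []) ∷ (1 , 0 ∷ 1 ∷ []) ∷ (1 , 0 ∷ 4 ∷ []) ∷ (1 , 2 ∷ 3 ∷ []) ∷ [])) (2≤prime h) (length≤product hs) ℕ.z≤n ℕ.z≤n ℕ.z≤n)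

    Ω≤ : ∀ {n} → 1 ℕ.≤ n → Ω n ℕ.≤ n
    Ω≤ {n} p = ℕₚ.≤-trans (ℕₚ.n≤1+n _) (ℕₚ.≤-trans (length≤product (facs-prime n)) (ℕₚ.≤-reflexive (facs-product p)))

    L : ℕ → R
    L n = ι (A n) * u m

    additive : Additive L
    additive = record
      { L-* = λ {x} {y} p q → trans (cong (λ t → ι t * u m) (A-* p q)) (trans (cong (_* u m) (ι-+ (A x) (A y))) (*-distribʳ-+ _ _ _))
      ; 0≤L = λ {x} _ → *-nonneg (0≤ι (A x)) 0≤um
      }

    pw-cancel : ∀ {i j c} → c * pw b i ≤ pw b (i ℕ.+ j) → c ≤ pw b j
    pw-cancel {i} {j} {c} h = *-cancel-≤ (1≤pw 1≤b i) (≤-trans (≤-reflexive (*-comm _ _)) (≤-trans h (≤-reflexive (pw-+ b i j))))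

    -- `1 - 1/(m+1)` is the inverse of `b`. This is Bernoulli's inequality for it, multiplied by
    -- b^s, and bounds b^s from above where `bernoulli` bounds it from below.
    inverse-bernoulli : ∀ s → pw b s * (ι 1 - ι s * u (suc m)) ≤ ι 1
    inverse-bernoulli zero = (lin (u (suc m) ∷ []) (λ a → [] ⊢ (con 1 :* (con 1 :- con 0 :* a) ≼ con 1) by (0 , [])))
    inverse-bernoulli (suc s) = ≤-trans (≤-trans (≤-reflexive (cong (λ t → b * P * (ι 1 - t * v)) (ι-suc s))) (lin (u m ∷ P ∷ v ∷ ι s ∷ []) (λ a P v b → ((con 1 :+ a) :* (P :* (con 1 :- v)) ≼ P) ∷ (con 0 ≼ P :* a :* (b :* v)) ∷ [] ⊢ ((con 1 :+ a) :* P :* (con 1 :- (con 1 :+ b) :* v) ≼ P :* (con 1 :- b :* v)) by (0 , (1 , 0 ∷ []) ∷ (1 , 1 ∷ []) ∷ [])) (≤-reflexive e) (*-nonneg (*-nonneg (0≤pw 0≤b s) 0≤um) (*-nonneg (0≤ι s) 0≤v)))) (inverse-bernoulli s)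
      where
      P v : R
      P = pw b s
      v = u (suc m)
      0≤v : ι 0 ≤ v
      0≤v = 0≤u (s≤s z≤n)
      e : (ι 1 + u m) * (P * (ι 1 - v)) ≡ P
      e = (≤-antisym (lin (P ∷ u m ∷ v ∷ []) (λ P a v → (P :* (a :- v) ≼ P :* (a :* v)) ∷ [] ⊢ ((con 1 :+ a) :* (P :* (con 1 :- v)) ≼ P) by (0 , (1 , 0 ∷ []) ∷ [])) (≤-reflexive (cong (P *_) (u-step 1≤m)))) (lin (P ∷ u m ∷ v ∷ []) (λ P a v → (P :* (a :* v) ≼ P :* (a :- v)) ∷ [] ⊢ (P ≼ (con 1 :+ a) :* (P :* (con 1 :- v))) by (0 , (1 , 0 ∷ []) ∷ [])) (≤-reflexive (sym (cong (P *_) (u-step 1≤m))))))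
      f : P * (u m * v) * ι s ≡ P * (u m - v) * ι s
      f = cong (λ t → P * t * ι s) (sym (u-step 1≤m))
      g : ι 0 ≤ ι s * (P * v)
      g = *-nonneg (0≤ι s) (*-nonneg (0≤pw 0≤b s) 0≤v)
      g₂ : ι 0 ≤ P * v * u m
      g₂ = *-nonneg (*-nonneg (0≤pw 0≤b s) 0≤v) 0≤um

    module Increments {V : ℕ} (V³≤m : V ℕ.* (V ℕ.* V) ℕ.≤ m) (n : ℕ) (1≤n : 1 ℕ.≤ n) (n<V : n ℕ.< V) where
      a v : R
      a = u n
      v = u (suc n)
      A₀ A₁ : ℕ
      A₀ = A n
      A₁ = A (suc n)
      0≤a : ι 0 ≤ a
      0≤a = 0≤u 1≤n
      0≤v : ι 0 ≤ v
      0≤v = 0≤u (s≤s z≤n)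
      1≤V : 1 ℕ.≤ V
      1≤V = ℕₚ.≤-trans (s≤s z≤n) n<V
      step : a - v ≡ a * v
      step = u-step 1≤n
      ιs : ι (suc n) ≡ (ι 1 + a) * ι n
      ιs = trans (ι-suc n) (≤-antisym (lin (ι n ∷ a ∷ []) (λ b a → (con 1 ≼ b :* a) ∷ [] ⊢ (con 1 :+ b ≼ (con 1 :+ a) :* b) by (0 , (1 , 0 ∷ []) ∷ [])) (≤-reflexive (sym (ι*u 1≤n)))) (lin (ι n ∷ a ∷ []) (λ b a → (b :* a ≼ con 1) ∷ [] ⊢ ((con 1 :+ a) :* b ≼ con 1 :+ b) by (0 , (1 , 0 ∷ []) ∷ [])) (≤-reflexive (ι*u 1≤n))))
      -- Exponents are off by at most `V`, so values of `L` by at most V/m. The condition V³ ≤ m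
      -- brings this below 1/V², hence below 1/(n(n+1)), the slack that `LogSys` allows.
      small : ι V * u m ≤ a - v
      small = ≤-trans (≤-trans Vum (*-mono-≤ (0≤u 1≤V) (0≤u 1≤V) (u-anti 1≤n (ℕₚ.<⇒≤ n<V)) (u-anti (s≤s z≤n) n<V))) (≤-reflexive (sym step))
        where
        w : R
        w = u V
        Vw : ι V * w ≡ ι 1
        Vw = ι*u 1≤V
        V³u≤1 : ι V * (ι V * ι V) * u m ≤ ι 1
        V³u≤1 = (lin (u m ∷ ι V ∷ ι m ∷ []) (λ a b c → (con 0 ≼ a) ∷ (b :* (b :* b) ≼ c) ∷ (c :* a ≼ con 1) ∷ [] ⊢ (b :* (b :* b) :* a ≼ con 1) by (0 , (1 , 2 ∷ []) ∷ (1 , 0 ∷ 1 ∷ []) ∷ [])) 0≤um (≤-trans (≤-reflexive (sym (trans (ι-* V _) (cong (ι V *_) (ι-* V V))))) (ι-mono V³≤m)) (≤-reflexive (ι*u 1≤m)))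
        Vum : ι V * u m ≤ w * w
        Vum = (lin (w ∷ ι V ∷ u m ∷ []) (λ w a b → (w :* w :* (a :* (a :* a) :* b) ≼ w :* w :* con 1) ∷ (a :* b ≼ w :* w :* (a :* (a :* a) :* b)) ∷ [] ⊢ (a :* b ≼ w :* w) by (0 , (1 , 0 ∷ []) ∷ (1 , 1 ∷ []) ∷ [])) (*-monoʳ-≤ (*-nonneg (0≤u 1≤V) (0≤u 1≤V)) V³u≤1) (≤-reflexive (sym e)))
          where
          e : w * w * (ι V * (ι V * ι V) * u m) ≡ ι V * u m
          e = trans (ring (w ∷ ι V ∷ u m ∷ []) (λ w a b → w :* w :* (a :* (a :* a) :* b) ≈ a :* w :* (a :* w) :* (a :* b))) (trans (cong (λ t → t * t * (ι V * u m)) Vw) (ring (ι V ∷ u m ∷ []) (λ a b → con 1 :* con 1 :* (a :* b) ≈ a :* b)))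

      -- For the excess `t` of `A₁` over `A₀ + V` one has b^t ≤ (n+1)/n = 1 + a, and Bernoulli's
      -- inequality turns this into t/m ≤ a.
      ΔA-upper : ι A₁ * u m ≤ ι (A₀ ℕ.+ V) * u m + a
      ΔA-upper with ℕₚ.≤-total A₁ (A₀ ℕ.+ V)
      ... | inj₁ p = (lin (ι A₁ ∷ ι (A₀ ℕ.+ V) ∷ u m ∷ a ∷ []) (λ b c d a → (b ≼ c) ∷ (con 0 ≼ d) ∷ (con 0 ≼ a) ∷ [] ⊢ (b :* d ≼ c :* d :+ a) by (0 , (1 , 2 ∷ []) ∷ (1 , 0 ∷ 1 ∷ []) ∷ [])) (ι-mono p) 0≤um 0≤a)
      ... | inj₂ p = (lin (ι A₁ ∷ u m ∷ ι (A₀ ℕ.+ V ℕ.+ t) ∷ ι (A₀ ℕ.+ V) ∷ ι t ∷ pw b t ∷ a ∷ []) (λ b c d e f g a → (b :* c ≼ d :* c) ∷ (d :* c ≼ (e :+ f) :* c) ∷ (con 1 :+ f :* c ≼ g) ∷ (g ≼ con 1 :+ a) ∷ [] ⊢ (b :* c ≼ e :* c :+ a) by (0 , (1 , 0 ∷ []) ∷ (1 , 1 ∷ []) ∷ (1 , 2 ∷ []) ∷ (1 , 3 ∷ []) ∷ [])) (≤-reflexive (cong (λ t → ι t * u m) (sym e))) (≤-reflexive (cong (_* u m) (ι-+ (A₀ ℕ.+ V) t))) (bernoulli 0≤um t) bt)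
        where
        t : ℕ
        t = A₁ ℕ.∸ (A₀ ℕ.+ V)
        e : A₀ ℕ.+ V ℕ.+ t ≡ A₁
        e = ℕₚ.m+[n∸m]≡n p
        Pw : R
        Pw = pw b (A₀ ℕ.+ V)
        n≤ : ι n ≤ Pw
        n≤ = ≤-trans (A-upper 1≤n) (pw-mono-exp 1≤b (ℕₚ.+-monoʳ-≤ A₀ (ℕₚ.≤-trans (Ω≤ 1≤n) (ℕₚ.<⇒≤ n<V))))
        bt : pw b t ≤ ι 1 + a
        bt = *-cancel-≤ (1≤pw 1≤b (A₀ ℕ.+ V)) (≤-trans (≤-reflexive (trans (sym (pw-+ b (A₀ ℕ.+ V) t)) (cong (pw b) e)))
          (≤-trans (A-lower (s≤s z≤n)) (≤-trans (≤-reflexive ιs) (lin (ι n ∷ Pw ∷ a ∷ []) (λ b Pw a → (b ≼ Pw) ∷ (con 0 ≼ a) ∷ [] ⊢ ((con 1 :+ a) :* b ≼ Pw :* (con 1 :+ a)) by (0 , (1 , 0 ∷ []) ∷ (1 , 0 ∷ 1 ∷ []) ∷ [])) n≤ 0≤a))))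

      A₀≤ : A₀ ℕ.≤ A₁ ℕ.+ V
      key : (ι 1 + a) * pw b A₀ ≤ pw b (A₁ ℕ.+ V)
      key = ≤-trans (*-monoʳ-≤ (≤-trans (0≤ι 1) (lin (a ∷ []) (λ a → (con 0 ≼ a) ∷ [] ⊢ (con 1 ≼ con 1 :+ a) by (0 , (1 , 0 ∷ []) ∷ [])) 0≤a)) (A-lower 1≤n)) (≤-trans (≤-reflexive (sym ιs))
        (≤-trans (A-upper (s≤s z≤n)) (pw-mono-exp 1≤b (ℕₚ.+-monoʳ-≤ A₁ (ℕₚ.≤-trans (Ω≤ (s≤s z≤n)) n<V)))))
      A₀≤ with ℕₚ.≤-total A₀ (A₁ ℕ.+ V)
      ... | inj₁ p = p
      ... | inj₂ p = ⊥-elim (1≰0 (lin (a ∷ P ∷ ι n ∷ []) (λ a P b → (con 1 ≼ P) ∷ (b :* (a :* P) ≼ b :* con 0) ∷ (con 1 :* P ≼ b :* a :* P) ∷ [] ⊢ (con 1 ≼ con 0) by (0 , (1 , 0 ∷ []) ∷ (1 , 1 ∷ []) ∷ (1 , 2 ∷ []) ∷ [])) (1≤pw 1≤b A₀) (*-monoʳ-≤ (0≤ι n) aP) (≤-reflexive (sym (cong (_* P) (ι*u 1≤n))))))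
        where
        P Q : R
        P = pw b A₀
        Q = pw b (A₁ ℕ.+ V)
        aP : a * P ≤ ι 0
        aP = (lin (a ∷ P ∷ Q ∷ []) (λ a P Q → ((con 1 :+ a) :* P ≼ Q) ∷ (Q ≼ P) ∷ [] ⊢ (a :* P ≼ con 0) by (0 , (1 , 0 ∷ []) ∷ (1 , 1 ∷ []) ∷ [])) key (pw-mono-exp 1≤b p))

      -- Here 1 + a ≤ b^s, so `inverse-bernoulli` gives (1 + a)(1 - σ) ≤ 1 with σ = s/(m+1). As 1 -
      -- v is the inverse of 1 + a, it follows that v ≤ σ ≤ s/m.
      ΔA-lower : ι A₀ * u m + v ≤ ι (A₁ ℕ.+ V) * u m
      ΔA-lower = (lin (ι (A₁ ℕ.+ V) ∷ u m ∷ ι (A₀ ℕ.+ s) ∷ ι A₀ ∷ ι s ∷ v ∷ []) (λ a b c d e v → (c :* b ≼ a :* b) ∷ ((d :+ e) :* b ≼ c :* b) ∷ (v ≼ e :* b) ∷ [] ⊢ (d :* b :+ v ≼ a :* b) by (0 , (1 , 0 ∷ []) ∷ (1 , 1 ∷ []) ∷ (1 , 2 ∷ []) ∷ [])) (≤-reflexive (sym (cong (λ t → ι t * u m) (sym e)))) (≤-reflexive (sym (cong (_* u m) (ι-+ A₀ s)))) v≤su)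
        where
        s : ℕ
        s = (A₁ ℕ.+ V) ℕ.∸ A₀
        e : A₀ ℕ.+ s ≡ A₁ ℕ.+ V
        e = ℕₚ.m+[n∸m]≡n A₀≤
        1+a≤ : ι 1 + a ≤ pw b s
        1+a≤ = pw-cancel {A₀} {s} (≤-trans key (≤-reflexive (cong (pw b) (sym e))))
        v₁ σ : R
        v₁ = u (suc m)
        σ = ι s * v₁
        v≤σ : v ≤ σ
        v≤σ with ≤-total v σ
        ... | inj₁ p = p
        ... | inj₂ p = *-cancel-≤ 1≤1+a (lin (a ∷ σ ∷ pw b s ∷ v ∷ []) (λ a b c v → ((con 1 :+ a) :* (con 1 :- b) ≼ c :* (con 1 :- b)) ∷ (c :* (con 1 :- b) ≼ con 1) ∷ (a :* v ≼ a :- v) ∷ [] ⊢ ((con 1 :+ a) :* v ≼ (con 1 :+ a) :* b) by (0 , (1 , 0 ∷ []) ∷ (1 , 1 ∷ []) ∷ (1 , 2 ∷ []) ∷ [])) h (inverse-bernoulli s) (≤-reflexive (sym step)))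
          where
          1≤1+a : ι 1 ≤ ι 1 + a
          1≤1+a = (lin (a ∷ []) (λ a → (con 0 ≼ a) ∷ [] ⊢ (con 1 ≼ con 1 :+ a) by (0 , (1 , 0 ∷ []) ∷ [])) 0≤a)
          0≤1-σ : ι 0 ≤ ι 1 - σ
          0≤1-σ = (lin (σ ∷ v ∷ []) (λ a v → (a ≼ v) ∷ (v ≼ con 1) ∷ [] ⊢ (con 0 ≼ con 1 :- a) by (0 , (1 , 0 ∷ []) ∷ (1 , 1 ∷ []) ∷ [])) p (u≤1 {suc n} (s≤s z≤n)))
          h : (ι 1 + a) * (ι 1 - σ) ≤ pw b s * (ι 1 - σ)
          h = *-mono-≤ (≤-trans (0≤ι 1) 1≤1+a) 0≤1-σ 1+a≤ ≤-refl
        v≤su : v ≤ ι s * u m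
        v≤su = ≤-trans v≤σ (*-monoʳ-≤ (0≤ι s) (u-anti 1≤m (ℕₚ.n≤1+n m)))

      L-lower : v - (a - v) ≤ L (suc n) - L n
      L-lower = (lin (ι A₀ ∷ u m ∷ v ∷ ι (A₁ ℕ.+ V) ∷ ι A₁ ∷ ι V ∷ a ∷ []) (λ b c v d e f a → (b :* c :+ v ≼ d :* c) ∷ (d :* c ≼ (e :+ f) :* c) ∷ (f :* c ≼ a :- v) ∷ [] ⊢ (v :- (a :- v) ≼ e :* c :- b :* c) by (0 , (1 , 0 ∷ []) ∷ (1 , 1 ∷ []) ∷ (1 , 2 ∷ []) ∷ [])) ΔA-lower (≤-reflexive (cong (_* u m) (ι-+ A₁ V))) small)

      L-upper : L (suc n) - L n ≤ v + ι 2 * (a - v)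
      L-upper = (lin (ι A₁ ∷ u m ∷ ι (A₀ ℕ.+ V) ∷ a ∷ ι A₀ ∷ ι V ∷ v ∷ []) (λ b c d a e f v → (b :* c ≼ d :* c :+ a) ∷ (d :* c ≼ (e :+ f) :* c) ∷ (f :* c ≼ a :- v) ∷ [] ⊢ (b :* c :- e :* c ≼ v :+ con 2 :* (a :- v)) by (0 , (1 , 0 ∷ []) ∷ (1 , 1 ∷ []) ∷ (1 , 2 ∷ []) ∷ [])) ΔA-upper (≤-reflexive (cong (_* u m) (ι-+ A₀ V))) small)

    logSys : ∀ {V} → V ℕ.* (V ℕ.* V) ℕ.≤ m → LogSys V L
    logSys h = record
      { additive = additive
      ; lower = λ {n} p q → Increments.L-lower h n p q
      ; upper = λ {n} p q → Increments.L-upper h n p q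
      }

  logs : ∀ V → ∃ λ L → LogSys V L
  logs V = LogBase.L (suc m) (s≤s z≤n) , LogBase.logSys (suc m) (s≤s z≤n) (ℕₚ.n≤1+n m)
    where
    m : ℕ
    m = V ℕ.* (V ℕ.* V)

-- Divided differences on lists of nodes and their denominators

module DividedDifferences where
  open SealedRationals
  open LinearArithmetic
  open FiniteSums
  open ArithmeticFunctions using (lcmTo; ∣lcmTo; 1≤lcmTo; 1≤-*; 1≤-∣; ∣⇒≤′)
  open import Data.Nat.Divisibility using (_∣_; divides; ∣-trans)
  open import Data.Nat.GCD using (gcd; gcd-GCD; gcd[m,n]∣m; gcd[m,n]∣n; module Bézout)
  open import Data.Integer.Base as ℤ using (ℤ; -[1+_]) renaming (+_ to pos)
  open import Data.List.Base using (_++_; length)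
  import Data.List.Properties as Listₚ
  open import Data.List.Relation.Unary.All as All using (All; []; _∷_)
  open import Data.List.Relation.Unary.AllPairs using (AllPairs; []; _∷_)
  open import Data.List.Relation.Binary.Permutation.Propositional as Perm using (_↭_; ↭-trans)
  open import Data.List.Relation.Binary.Permutation.Propositional.Properties using (All-resp-↭; shift; ↭-length)

  IsInt : R → Set
  IsInt x = ∃ λ z → x ≡ ιℤ z

  int-+ : ∀ {x y} → IsInt x → IsInt y → IsInt (x + y)
  int-+ (a , p) (b , q) = a ℤ.+ b , trans (cong₂ _+_ p q) (sym (ιℤ-+ a b))

  int-* : ∀ {x y} → IsInt x → IsInt y → IsInt (x * y)
  int-* (a , p) (b , q) = a ℤ.* b , trans (cong₂ _*_ p q) (sym (ιℤ-* a b))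

  int-ι : ∀ n → IsInt (ι n)
  int-ι n = pos n , sym (ιℤ-pos n)

  int-- : ∀ {x y} → IsInt x → IsInt y → IsInt (x - y)
  int-- {x} {y} p q = int-+ p (subst IsInt (-1*a y) (int-* (-[1+ 0 ] , refl) q))

  nonzero-* : ∀ {x y} → x ≢ ι 0 → y ≢ ι 0 → x * y ≢ ι 0
  nonzero-* {x} {y} p q e = q (trans (sym (*-identityˡ y)) (trans (cong (_* y) (trans (sym (*-inverseʳ p)) (*-comm x _)))
    (trans (*-assoc (inv x) x y) (trans (cong (inv x *_) e) (*-zeroʳ _)))))

  inv-* : ∀ {x y} → x ≢ ι 0 → y ≢ ι 0 → inv (x * y) ≡ inv x * inv y
  inv-* {x} {y} p q = begin
    z                                       ≡⟨ (ring (z ∷ []) (λ z → z ≈ z :* (con 1 :* con 1))) ⟩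
    z * (ι 1 * ι 1)                         ≡⟨ cong₂ (λ s t → z * (s * t)) (sym (*-inverseʳ p)) (sym (*-inverseʳ q)) ⟩
    z * ((x * inv x) * (y * inv y))         ≡⟨ (ring (z ∷ x ∷ inv x ∷ y ∷ inv y ∷ []) (λ z x a y b → z :* (x :* a :* (y :* b)) ≈ x :* y :* z :* (a :* b))) ⟩
    (x * y * z) * (inv x * inv y)           ≡⟨ cong (_* (inv x * inv y)) (*-inverseʳ (nonzero-* p q)) ⟩
    ι 1 * (inv x * inv y)                   ≡⟨ *-identityˡ _ ⟩
    inv x * inv y                           ∎
    where
    open ≡-Reasoning
    z : R
    z = inv (x * y)

  inv-1 : inv (ι 1) ≡ ι 1
  inv-1 = trans (sym (*-identityˡ _)) (*-inverseʳ {ι 1} (λ e → 1≰0 (≤-reflexive e)))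

  -- The value 1 on the diagonal lets the product over all other nodes run over the whole list.
  fac : ℕ → ℕ → R
  fac x y with x ℕₚ.≟ y
  ... | yes _ = ι 1
  ... | no _ = ι x - ι y

  fac-≡ : ∀ x → fac x x ≡ ι 1
  fac-≡ x with x ℕₚ.≟ x
  ... | yes _ = refl
  ... | no n = ⊥-elim (n refl)

  fac-≢ : ∀ {x y} → x ≢ y → fac x y ≡ ι x - ι y
  fac-≢ {x} {y} h with x ℕₚ.≟ y
  ... | yes e = ⊥-elim (h e)
  ... | no _ = refl

  fac-nonzero : ∀ x y → fac x y ≢ ι 0
  fac-nonzero x y e with x ℕₚ.≟ y
  ... | yes _ = 1≰0 (≤-reflexive e)
  ... | no n = n (ℕₚ.≤-antisym (ι-cancel-≤ (≤-reflexive (x-y≡0⇒x≡y e))) (ι-cancel-≤ (≤-reflexive (sym (x-y≡0⇒x≡y e)))))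

  prodFac : ℕ → List ℕ → R
  prodFac x [] = ι 1
  prodFac x (y ∷ l) = fac x y * prodFac x l

  prodFac-nonzero : ∀ x l → prodFac x l ≢ ι 0
  prodFac-nonzero x [] e = 1≰0 (≤-reflexive e)
  prodFac-nonzero x (y ∷ l) = nonzero-* (fac-nonzero x y) (prodFac-nonzero x l)

  sumList : (ℕ → R) → List ℕ → R
  sumList f [] = ι 0
  sumList f (x ∷ l) = f x + sumList f l

  sumList-cong : ∀ {f g} {l} → All (λ x → f x ≡ g x) l → sumList f l ≡ sumList g l
  sumList-cong [] = refl
  sumList-cong (p ∷ ps) = cong₂ _+_ p (sumList-cong ps)

  prodFac-↭ : ∀ x {l l′} → l ↭ l′ → prodFac x l ≡ prodFac x l′
  prodFac-↭ x Perm.refl = refl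
  prodFac-↭ x (Perm.prep y σ) = cong (fac x y *_) (prodFac-↭ x σ)
  prodFac-↭ x (Perm.swap {l} {l′} y z σ) = trans (ring (fac x y ∷ fac x z ∷ prodFac x l ∷ []) (λ a b c → a :* (b :* c) ≈ b :* (a :* c)))
    (cong (λ t → fac x z * (fac x y * t)) (prodFac-↭ x σ))
  prodFac-↭ x (Perm.trans σ τ) = trans (prodFac-↭ x σ) (prodFac-↭ x τ)

  sumList-↭ : ∀ f {l l′} → l ↭ l′ → sumList f l ≡ sumList f l′
  sumList-↭ f Perm.refl = refl
  sumList-↭ f (Perm.prep y σ) = cong (f y +_) (sumList-↭ f σ)
  sumList-↭ f (Perm.swap {l} {l′} y z σ) = trans (ring (f y ∷ f z ∷ sumList f l ∷ []) (λ a b c → a :+ (b :+ c) ≈ b :+ (a :+ c)))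
    (cong (λ t → f z + (f y + t)) (sumList-↭ f σ))
  sumList-↭ f (Perm.trans σ τ) = trans (sumList-↭ f σ) (sumList-↭ f τ)

  Distinct : List ℕ → Set
  Distinct = AllPairs _≢_

  distinct-↭ : ∀ {l l′} → l ↭ l′ → Distinct l → Distinct l′
  distinct-↭ Perm.refl d = d
  distinct-↭ (Perm.prep x σ) (h ∷ d) = All-resp-↭ σ h ∷ distinct-↭ σ d
  distinct-↭ (Perm.swap x y σ) ((h ∷ hs) ∷ (g ∷ d)) = (≢-sym h ∷ All-resp-↭ σ g) ∷ (All-resp-↭ σ hs ∷ distinct-↭ σ d)
  distinct-↭ (Perm.trans σ τ) d = distinct-↭ τ (distinct-↭ σ d)

  Sorted : List ℕ → Set
  Sorted = AllPairs ℕ._<_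

  after range : ℕ → ℕ → List ℕ
  after h zero = []
  after h (suc k) = range (suc h) k
  range h k = h ∷ after h k

  range-last : ∀ h k → range h (suc k) ↭ (h ℕ.+ suc k) ∷ range h k
  range-last h zero = subst (λ t → h ∷ suc h ∷ [] ↭ t ∷ h ∷ []) (ℕₚ.+-comm 1 h) (Perm.swap h (suc h) Perm.refl)
  range-last h (suc k) = ↭-trans (Perm.prep h (subst (λ t → range (suc h) (suc k) ↭ t ∷ range (suc h) k) (sym (ℕₚ.+-suc h (suc k))) (range-last (suc h) k)))
    (Perm.swap h (h ℕ.+ suc (suc k)) Perm.refl)

  range-above : ∀ {a} h k → a ℕ.< h → All (a ℕ.<_) (range h k)
  range-above h zero p = p ∷ []
  range-above h (suc k) p = p ∷ range-above (suc h) k (ℕₚ.m≤n⇒m≤1+n p)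

  range-sorted : ∀ h k → Sorted (range h k)
  range-sorted h zero = [] ∷ []
  range-sorted h (suc k) = range-above (suc h) k ℕₚ.≤-refl ∷ range-sorted (suc h) k

  sorted⇒distinct : ∀ {l} → Sorted l → Distinct l
  sorted⇒distinct [] = []
  sorted⇒distinct (h ∷ d) = All.map ℕₚ.<⇒≢ h ∷ sorted⇒distinct d

  module _ (s : ℕ → R) where

    weight : List ℕ → ℕ → R
    weight l x = inv (prodFac x l) * s x

    dd : List ℕ → R
    dd l = sumList (weight l) l

    dd-↭ : ∀ {l l′} → l ↭ l′ → dd l ≡ dd l′
    dd-↭ {l} {l′} σ = trans (sumList-cong (All.universal (λ x → cong (λ t → inv t * s x) (prodFac-↭ x σ)) l)) (sumList-↭ (weight l′) σ)

    -- Term by term: at a node x of `l` write a - b = (x - b) - (x - a), and each difference cancels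
    -- one factor of the weight. At `a` and `b` one factor cancels directly.
    dd-recursion : ∀ {a b l} → Distinct (a ∷ b ∷ l) → (ι a - ι b) * dd (a ∷ b ∷ l) ≡ dd (a ∷ l) - dd (b ∷ l)
    dd-recursion {a} {b} {l} ((a≢b ∷ a≢l) ∷ (b≢l ∷ d)) = begin
      c * (wa + (wb + sumList (weight (a ∷ b ∷ l)) l))
        ≡⟨ (ring (c ∷ wa ∷ wb ∷ sumList (weight (a ∷ b ∷ l)) l ∷ []) (λ c wa wb a → c :* (wa :+ (wb :+ a)) ≈ c :* wa :+ (c :* wb :+ c :* a))) ⟩
      c * wa + (c * wb + c * sumList (weight (a ∷ b ∷ l)) l)
        ≡⟨ cong₂ _+_ first (cong₂ _+_ second (rest l (All.zip (a≢l , b≢l)))) ⟩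
      weight (a ∷ l) a + ((ι 0 - weight (b ∷ l) b) + (sumList (weight (a ∷ l)) l - sumList (weight (b ∷ l)) l))
        ≡⟨ (ring (weight (a ∷ l) a ∷ weight (b ∷ l) b ∷ sumList (weight (a ∷ l)) l ∷ sumList (weight (b ∷ l)) l ∷ []) (λ a b c d → a :+ (con 0 :- b :+ (c :- d)) ≈ a :+ c :- (b :+ d))) ⟩
      dd (a ∷ l) - dd (b ∷ l) ∎
      where
      open ≡-Reasoning
      c wa wb : R
      c = ι a - ι b
      wa = weight (a ∷ b ∷ l) a
      wb = weight (a ∷ b ∷ l) b
      c≢0 : c ≢ ι 0
      c≢0 = subst (_≢ ι 0) (fac-≢ a≢b) (fac-nonzero a b)
      b≢a : b ≢ a
      b≢a = ≢-sym a≢b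
      self : ∀ x → prodFac x (x ∷ l) ≡ prodFac x l
      self x = trans (cong (_* prodFac x l) (fac-≡ x)) (*-identityˡ _)
      first : c * wa ≡ weight (a ∷ l) a
      first = begin
        c * (inv (fac a a * (fac a b * prodFac a l)) * s a)
          ≡⟨ cong (λ t → c * (inv t * s a)) (trans (cong₂ (λ u v → u * (v * prodFac a l)) (fac-≡ a) (fac-≢ a≢b)) (*-identityˡ _)) ⟩
        c * (inv (c * prodFac a l) * s a)
          ≡⟨ cong (λ t → c * (t * s a)) (inv-* c≢0 (prodFac-nonzero a l)) ⟩
        c * (inv c * inv (prodFac a l) * s a)
          ≡⟨ (ring (c ∷ inv c ∷ inv (prodFac a l) ∷ s a ∷ []) (λ c a b d → c :* (a :* b :* d) ≈ c :* a :* (b :* d))) ⟩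
        (c * inv c) * (inv (prodFac a l) * s a)
          ≡⟨ trans (cong (_* (inv (prodFac a l) * s a)) (*-inverseʳ c≢0)) (*-identityˡ _) ⟩
        inv (prodFac a l) * s a
          ≡⟨ cong (λ t → inv t * s a) (sym (self a)) ⟩
        weight (a ∷ l) a ∎
      second : c * wb ≡ ι 0 - weight (b ∷ l) b
      second = begin
        c * (inv (fac b a * (fac b b * prodFac b l)) * s b)
          ≡⟨ cong (λ t → c * (inv t * s b)) (cong (_* prodFac b (b ∷ l)) (fac-≢ b≢a)) ⟩
        c * (inv (e * P) * s b)
          ≡⟨ cong (λ t → c * (t * s b)) (inv-* e≢0 (prodFac-nonzero b (b ∷ l))) ⟩
        c * (inv e * inv P * s b)
          ≡⟨ (ring (ι a ∷ ι b ∷ inv e ∷ inv P ∷ s b ∷ []) (λ a b c d e → (a :- b) :* (c :* d :* e) ≈ con 0 :- (b :- a) :* c :* (d :* e))) ⟩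
        ι 0 - (e * inv e) * (inv P * s b)
          ≡⟨ cong (ι 0 -_) (trans (cong (_* (inv P * s b)) (*-inverseʳ e≢0)) (*-identityˡ _)) ⟩
        ι 0 - weight (b ∷ l) b ∎
        where
        e P : R
        e = ι b - ι a
        P = prodFac b (b ∷ l)
        e≢0 : e ≢ ι 0
        e≢0 = subst (_≢ ι 0) (fac-≢ b≢a) (fac-nonzero b a)
      term : ∀ x → a ≢ x → b ≢ x → c * weight (a ∷ b ∷ l) x ≡ weight (a ∷ l) x - weight (b ∷ l) x
      term x a≢x b≢x = begin
        c * (inv (fac x a * (fac x b * P)) * s x)
          ≡⟨ cong (λ t → c * (t * s x)) (trans (inv-* (fac-nonzero x a) (nonzero-* (fac-nonzero x b) (prodFac-nonzero x l)))
               (cong (inv (fac x a) *_) (inv-* (fac-nonzero x b) (prodFac-nonzero x l)))) ⟩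
        c * (ip * (iq * iP) * s x)
          ≡⟨ cong (_* (ip * (iq * iP) * s x)) c≡ ⟩
        (q - p) * (ip * (iq * iP) * s x)
          ≡⟨ (ring (q ∷ p ∷ ip ∷ iq ∷ iP ∷ s x ∷ []) (λ q p ip iq iP a → (q :- p) :* (ip :* (iq :* iP) :* a) ≈ q :* iq :* (ip :* iP :* a) :- p :* ip :* (iq :* iP :* a))) ⟩
        (q * iq) * (ip * iP * s x) - (p * ip) * (iq * iP * s x)
          ≡⟨ cong₂ (λ u v → u * (ip * iP * s x) - v * (iq * iP * s x)) (*-inverseʳ (fac-nonzero x b)) (*-inverseʳ (fac-nonzero x a)) ⟩
        ι 1 * (ip * iP * s x) - ι 1 * (iq * iP * s x)
          ≡⟨ cong₂ _-_ (trans (*-identityˡ _) (cong (_* s x) (sym (inv-* (fac-nonzero x a) (prodFac-nonzero x l)))))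
                       (trans (*-identityˡ _) (cong (_* s x) (sym (inv-* (fac-nonzero x b) (prodFac-nonzero x l))))) ⟩
        weight (a ∷ l) x - weight (b ∷ l) x ∎
        where
        P p q ip iq iP : R
        P = prodFac x l
        p = fac x a
        q = fac x b
        ip = inv p
        iq = inv q
        iP = inv P
        c≡ : c ≡ q - p
        c≡ = sym (trans (cong₂ _-_ (fac-≢ (≢-sym b≢x)) (fac-≢ (≢-sym a≢x))) (ring (ι x ∷ ι b ∷ ι a ∷ []) (λ a b c → a :- b :- (a :- c) ≈ c :- b)))
      rest : ∀ r → All (λ x → a ≢ x × b ≢ x) r → c * sumList (weight (a ∷ b ∷ l)) r ≡ sumList (weight (a ∷ l)) r - sumList (weight (b ∷ l)) r
      rest [] [] = trans (*-zeroʳ c) (ring ([]) (con 0 ≈ con 0 :- con 0))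
      rest (x ∷ r) ((p , q) ∷ h) = trans (*-distribˡ-+ c _ _) (trans (cong₂ _+_ (term x p q) (rest r h))
        (ring (weight (a ∷ l) x ∷ weight (b ∷ l) x ∷ sumList (weight (a ∷ l)) r ∷ sumList (weight (b ∷ l)) r ∷ []) (λ a b c d → a :- b :+ (c :- d) ≈ a :+ c :- (b :+ d))))

    dd-singleton : ∀ a → dd (a ∷ []) ≡ s a
    dd-singleton a = trans (+-identityʳ _) (trans (cong (λ t → inv t * s a) (trans (*-identityʳ _) (fac-≡ a))) (trans (cong (_* s a) inv-1) (*-identityˡ _)))

    Δ : ℕ → ℕ → R
    Δ zero h = s h
    Δ (suc k) h = Δ k (suc h) - Δ k h

    Δ≡dd : ∀ k h → Δ k h ≡ ι (k !) * dd (range h k)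
    Δ≡dd zero h = trans (sym (dd-singleton h)) (sym (*-identityˡ _))
    Δ≡dd (suc k) h = begin
      Δ k (suc h) - Δ k h
        ≡⟨ cong₂ _-_ (Δ≡dd k (suc h)) (Δ≡dd k h) ⟩
      ι (k !) * dd (range (suc h) k) - ι (k !) * dd (range h k)
        ≡⟨ (ring (ι (k !) ∷ dd (range (suc h) k) ∷ dd (range h k) ∷ []) (λ a b c → a :* b :- a :* c ≈ a :* (b :- c))) ⟩
      ι (k !) * (dd (range (suc h) k) - dd (range h k))
        ≡⟨ cong (λ t → ι (k !) * (t - dd (range h k))) (dd-↭ (shifted k)) ⟩
      ι (k !) * (dd (z ∷ after h k) - dd (h ∷ after h k))
        ≡⟨ cong (ι (k !) *_) (sym (dd-recursion (distinct-↭ (range-last h k) (sorted⇒distinct (range-sorted h (suc k)))))) ⟩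
      ι (k !) * ((ι z - ι h) * dd (z ∷ range h k))
        ≡⟨ cong (λ t → ι (k !) * (t * dd (z ∷ range h k))) (trans (cong (_- ι h) (ι-+ h (suc k))) (ring (ι h ∷ ι (suc k) ∷ []) (λ a b → a :+ b :- a ≈ b))) ⟩
      ι (k !) * (ι (suc k) * dd (z ∷ range h k))
        ≡⟨ trans (ring (ι (k !) ∷ ι (suc k) ∷ dd (z ∷ range h k) ∷ []) (λ a b c → a :* (b :* c) ≈ b :* a :* c)) (cong₂ _*_ (sym (ι-* (suc k) (k !))) (sym (dd-↭ (range-last h k)))) ⟩
      ι (suc k !) * dd (range h (suc k)) ∎
      where
      open ≡-Reasoning
      z : ℕ
      z = h ℕ.+ suc k
      shifted : ∀ k → range (suc h) k ↭ (h ℕ.+ suc k) ∷ after h k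
      shifted zero = subst (λ t → suc h ∷ [] ↭ t ∷ []) (ℕₚ.+-comm 1 h) Perm.refl
      shifted (suc k) = subst (λ t → range (suc h) (suc k) ↭ t ∷ range (suc h) k) (sym (ℕₚ.+-suc h (suc k))) (range-last (suc h) k)

  module _ {P : ℕ → Set} where
    all-drop₁ : ∀ pre {x post} → All P (pre ++ x ∷ post) → All P (pre ++ post)
    all-drop₁ [] (p ∷ ps) = ps
    all-drop₁ (z ∷ pre) (p ∷ ps) = p ∷ all-drop₁ pre ps

    all-drop₂ : ∀ pre {x y post} → All P (pre ++ x ∷ y ∷ post) → All P (pre ++ x ∷ post)
    all-drop₂ [] (p ∷ q ∷ ps) = p ∷ ps
    all-drop₂ (z ∷ pre) (p ∷ ps) = p ∷ all-drop₂ pre ps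

  sorted-drop₁ : ∀ pre {x post} → Sorted (pre ++ x ∷ post) → Sorted (pre ++ post)
  sorted-drop₁ [] (p ∷ ps) = ps
  sorted-drop₁ (z ∷ pre) (p ∷ ps) = all-drop₁ pre p ∷ sorted-drop₁ pre ps

  sorted-drop₂ : ∀ pre {x y post} → Sorted (pre ++ x ∷ y ∷ post) → Sorted (pre ++ x ∷ post)
  sorted-drop₂ [] ((_ ∷ p) ∷ (_ ∷ ps)) = p ∷ ps
  sorted-drop₂ (z ∷ pre) (p ∷ ps) = all-drop₂ pre p ∷ sorted-drop₂ pre ps

  sorted-suffix : ∀ pre {l} → Sorted (pre ++ l) → Sorted l
  sorted-suffix [] d = d
  sorted-suffix (z ∷ pre) (_ ∷ d) = sorted-suffix pre d

  -- The gcd of neighbouring gaps is that of all differences. The value 0 on short lists is neutral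
  -- for gcd.
  gapGcd : List ℕ → ℕ
  gapGcd [] = 0
  gapGcd (x ∷ []) = 0
  gapGcd (x ∷ l@(y ∷ _)) = gcd (y ℕ.∸ x) (gapGcd l)

  -- Every gap is a multiple of `g`, hence at least `g`. Stating this for every divisor `g` of the
  -- gcd makes the induction pass to the tail, whose gcd may be larger.
  gap-fits : ∀ {g x l k} → Sorted (x ∷ l) → All (ℕ._≤ k) (x ∷ l) → g ∣ gapGcd (x ∷ l) → x ℕ.+ g ℕ.* length l ℕ.≤ k
  gap-fits {g} {x} {[]} {k} _ (p ∷ _) _ = (linℕ (x ∷ k ∷ g ∷ []) (λ x k g → (x ≼ k) ∷ [] ⊢ (x :+ g :* con 0 ≼ k) by (0 , (1 , 0 ∷ []) ∷ [])) p)
  gap-fits {g} {x} {y ∷ l} {k} ((x<y ∷ _) ∷ srt) (_ ∷ bnd) h = (linℕ (y ∷ g ∷ length l ∷ k ∷ y ℕ.∸ x ∷ x ∷ []) (λ y g a k b x → (y :+ g :* a ≼ k) ∷ (g ≼ b) ∷ (x :+ b ≼ y) ∷ [] ⊢ (x :+ g :* (con 1 :+ a) ≼ k) by (0 , (1 , 0 ∷ []) ∷ (1 , 1 ∷ []) ∷ (1 , 2 ∷ []) ∷ [])) (gap-fits srt bnd (∣-trans h (gcd[m,n]∣n (y ℕ.∸ x) _))) g≤ (ℕₚ.≤-reflexive (ℕₚ.m+[n∸m]≡n (ℕₚ.<⇒≤ x<y))))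
    where
    g≤ : g ℕ.≤ y ℕ.∸ x
    g≤ = ∣⇒≤′ (ℕₚ.m<n⇒0<n∸m x<y) (∣-trans h (gcd[m,n]∣m (y ℕ.∸ x) _))

  1≤gapGcd : ∀ {x y l} → x ℕ.< y → 1 ℕ.≤ gapGcd (x ∷ y ∷ l)
  1≤gapGcd {x} {y} {l} p = 1≤-∣ (ℕₚ.m<n⇒0<n∸m p) (gcd[m,n]∣m (y ℕ.∸ x) (gapGcd (y ∷ l)))

  module _ {Q : R} where
    multiple-int : ∀ {d n} → d ∣ n → IsInt (ι d * Q) → IsInt (ι n * Q)
    multiple-int {d} (divides c refl) h = subst IsInt (trans (sym (*-assoc _ _ _)) (cong (_* Q) (sym (ι-* c d)))) (int-* (int-ι c) h)

    -- The integers n that make n Q integral form an ideal; Bézout's identity is used in its two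
    -- subtraction-free forms.
    gcd-int : ∀ m n → IsInt (ι m * Q) → IsInt (ι n * Q) → IsInt (ι (gcd m n) * Q)
    gcd-int m n p q with Bézout.identity (gcd-GCD m n)
    ... | Bézout.+- x y e = subst IsInt
      (≤-antisym (lin (ι (gcd m n) ∷ ι y ∷ ι n ∷ Q ∷ ι x ∷ ι m ∷ []) (λ a b c Q d e → (d :* e :* Q ≼ (a :+ b :* c) :* Q) ∷ [] ⊢ (d :* (e :* Q) :- b :* (c :* Q) ≼ a :* Q) by (0 , (1 , 0 ∷ []) ∷ [])) (≤-reflexive (sym (cong (_* Q) (trans (sym (trans (ι-+ (gcd m n) _) (cong (ι (gcd m n) +_) (ι-* y n)))) (trans (cong ι e) (ι-* x m))))))) (lin (ι (gcd m n) ∷ ι y ∷ ι n ∷ Q ∷ ι x ∷ ι m ∷ []) (λ a b c Q d e → ((a :+ b :* c) :* Q ≼ d :* e :* Q) ∷ [] ⊢ (a :* Q ≼ d :* (e :* Q) :- b :* (c :* Q)) by (0 , (1 , 0 ∷ []) ∷ [])) (≤-reflexive (cong (_* Q) (trans (sym (trans (ι-+ (gcd m n) _) (cong (ι (gcd m n) +_) (ι-* y n)))) (trans (cong ι e) (ι-* x m)))))))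
      (int-- (int-* (int-ι x) p) (int-* (int-ι y) q))
    ... | Bézout.-+ x y e = subst IsInt
      (≤-antisym (lin (ι (gcd m n) ∷ ι x ∷ ι m ∷ Q ∷ ι y ∷ ι n ∷ []) (λ a b c Q d e → (d :* e :* Q ≼ (a :+ b :* c) :* Q) ∷ [] ⊢ (d :* (e :* Q) :- b :* (c :* Q) ≼ a :* Q) by (0 , (1 , 0 ∷ []) ∷ [])) (≤-reflexive (sym (cong (_* Q) (trans (sym (trans (ι-+ (gcd m n) _) (cong (ι (gcd m n) +_) (ι-* x m)))) (trans (cong ι e) (ι-* y n))))))) (lin (ι (gcd m n) ∷ ι x ∷ ι m ∷ Q ∷ ι y ∷ ι n ∷ []) (λ a b c Q d e → ((a :+ b :* c) :* Q ≼ d :* e :* Q) ∷ [] ⊢ (a :* Q ≼ d :* (e :* Q) :- b :* (c :* Q)) by (0 , (1 , 0 ∷ []) ∷ [])) (≤-reflexive (cong (_* Q) (trans (sym (trans (ι-+ (gcd m n) _) (cong (ι (gcd m n) +_) (ι-* x m)))) (trans (cong ι e) (ι-* y n)))))))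
      (int-- (int-* (int-ι y) q) (int-* (int-ι x) p))

  module Integrality (s : ℕ → R) (m : ℕ) (base : ∀ l → Sorted l → length l ≡ suc m → IsInt (dd s l)) (k : ℕ) where

    -- The gcd by which one may divide depends on the nodes. The lcm of 1, ..., ⌊k/r⌋ is a multiple
    -- of all the gcds that can occur, so a single denominator serves all node sets in [0, k], as
    -- the induction requires.
    denominator : ℕ → ℕ
    denominator zero = 1
    denominator (suc j) = denominator j ℕ.* lcmTo (k ÷ suc (m ℕ.+ j))

    1≤denominator : ∀ j → 1 ℕ.≤ denominator j
    1≤denominator zero = s≤s z≤n
    1≤denominator (suc j) = 1≤-* (1≤denominator j) (1≤lcmTo (k ÷ suc (m ℕ.+ j)))

    -- The gaps of S annihilate δ^{r+1} modulo δ^r, hence so does their gcd g; as S ⊂ [0, k], g (r+1) ≤ k.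
    integral : ∀ j l → Sorted l → All (ℕ._≤ k) l → length l ≡ suc (m ℕ.+ j) → IsInt (ι (denominator j) * dd s l)
    integral zero l srt _ len = subst IsInt (sym (*-identityˡ _)) (base l srt (trans len (cong suc (ℕₚ.+-identityʳ m))))
    integral (suc j) [] srt bnd ()
    integral (suc j) (x ∷ []) srt bnd len = ⊥-elim (ℕₚ.0≢1+n (trans (ℕₚ.suc-injective len) (ℕₚ.+-suc m j)))
    integral (suc j) S@(x ∷ y ∷ l) srt@((x<y ∷ _) ∷ _) bnd len = subst IsInt eq (multiple-int {Q} (∣lcmTo {k ÷ r} (1≤gapGcd {x} {y} {l} x<y) g≤) (all-gaps [] (x ∷ y ∷ l) refl))
      where
      P Q : R
      P = ι (denominator j)
      Q = P * dd s S
      r g : ℕ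
      r = suc (m ℕ.+ j)
      g = gapGcd S
      length≡ : length (y ∷ l) ≡ r
      length≡ = trans (ℕₚ.suc-injective len) (ℕₚ.+-suc m j)
      g≤ : g ℕ.≤ k ÷ r
      g≤ = ÷-least (s≤s z≤n) (ℕₚ.≤-trans (ℕₚ.≤-reflexive (trans (ℕₚ.*-comm r g) (cong (g ℕ.*_) (sym length≡)))) (ℕₚ.≤-trans (ℕₚ.m≤n+m _ x) (gap-fits srt bnd (divides 1 (sym (ℕₚ.*-identityˡ g))))))
      eq : ι (lcmTo (k ÷ r)) * Q ≡ ι (denominator j ℕ.* lcmTo (k ÷ r)) * dd s S
      eq = trans (ring (ι (lcmTo (k ÷ r)) ∷ P ∷ dd s S ∷ []) (λ a P b → a :* (P :* b) ≈ P :* a :* b)) (cong (_* dd s S) (sym (ι-* (denominator j) _)))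
      -- Deleting either of two neighbouring nodes leaves a sorted list with one node fewer, to
      -- which the induction hypothesis applies; by `dd-recursion` the difference of the two results
      -- carries the factor y - x.
      one-gap : ∀ pre x y post → pre ++ x ∷ y ∷ post ≡ S → IsInt (ι (y ℕ.∸ x) * Q)
      one-gap pre x y post e = subst IsInt calc (int-- (smaller (y ∷ post) sortedY allY lenY) (smaller (x ∷ post) sortedX allX lenX))
        where
        srt′ : Sorted (pre ++ x ∷ y ∷ post)
        srt′ = subst Sorted (sym e) srt
        bnd′ : All (ℕ._≤ k) (pre ++ x ∷ y ∷ post)
        bnd′ = subst (All (ℕ._≤ k)) (sym e) bnd
        sortedY : Sorted (pre ++ y ∷ post)
        sortedY = sorted-drop₁ pre srt′
        sortedX : Sorted (pre ++ x ∷ post)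
        sortedX = sorted-drop₂ pre srt′
        allY : All (ℕ._≤ k) (pre ++ y ∷ post)
        allY = all-drop₁ pre bnd′
        allX : All (ℕ._≤ k) (pre ++ x ∷ post)
        allX = all-drop₂ pre bnd′
        S↭ : S ↭ y ∷ x ∷ (pre ++ post)
        S↭ = ↭-trans (Perm.↭-reflexive (sym e)) (↭-trans (shift x pre (y ∷ post)) (↭-trans (Perm.prep x (shift y pre post)) (Perm.swap x y Perm.refl)))
        drop-length : ∀ z → length (pre ++ z ∷ post) ≡ r
        drop-length z = ℕₚ.suc-injective (trans (cong suc (↭-length (shift z pre post))) (trans (sym (↭-length S↭)) (cong suc length≡)))
        lenY : length (pre ++ y ∷ post) ≡ suc (m ℕ.+ j)
        lenY = drop-length y
        lenX : length (pre ++ x ∷ post) ≡ suc (m ℕ.+ j)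
        lenX = drop-length x
        smaller : ∀ tail → Sorted (pre ++ tail) → All (ℕ._≤ k) (pre ++ tail) → length (pre ++ tail) ≡ r → IsInt (P * dd s (pre ++ tail))
        smaller tail p q h = integral j (pre ++ tail) p q h
        x<y′ : x ℕ.< y
        x<y′ with sorted-suffix pre srt′
        ... | (h ∷ _) ∷ _ = h
        gap : ι (y ℕ.∸ x) ≡ ι y - ι x
        gap = (≤-antisym (lin (ι x ∷ ι (y ℕ.∸ x) ∷ ι y ∷ []) (λ a b c → (a :+ b ≼ c) ∷ [] ⊢ (b ≼ c :- a) by (0 , (1 , 0 ∷ []) ∷ [])) (≤-reflexive (trans (sym (ι-+ x (y ℕ.∸ x))) (cong ι (ℕₚ.m+[n∸m]≡n (ℕₚ.<⇒≤ x<y′)))))) (lin (ι x ∷ ι (y ℕ.∸ x) ∷ ι y ∷ []) (λ a b c → (c ≼ a :+ b) ∷ [] ⊢ (c :- a ≼ b) by (0 , (1 , 0 ∷ []) ∷ [])) (≤-reflexive (sym (trans (sym (ι-+ x (y ℕ.∸ x))) (cong ι (ℕₚ.m+[n∸m]≡n (ℕₚ.<⇒≤ x<y′))))))))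
        calc : P * dd s (pre ++ y ∷ post) - P * dd s (pre ++ x ∷ post) ≡ ι (y ℕ.∸ x) * Q
        calc = begin
          P * dd s (pre ++ y ∷ post) - P * dd s (pre ++ x ∷ post)
            ≡⟨ cong₂ (λ u v → P * u - P * v) (dd-↭ s (shift y pre post)) (dd-↭ s (shift x pre post)) ⟩
          P * dd s (y ∷ pre ++ post) - P * dd s (x ∷ pre ++ post)
            ≡⟨ (ring (P ∷ dd s (y ∷ pre ++ post) ∷ dd s (x ∷ pre ++ post) ∷ []) (λ P a b → P :* a :- P :* b ≈ P :* (a :- b))) ⟩
          P * (dd s (y ∷ pre ++ post) - dd s (x ∷ pre ++ post))
            ≡⟨ cong (P *_) (sym (dd-recursion s (distinct-↭ S↭ (sorted⇒distinct srt)))) ⟩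
          P * ((ι y - ι x) * dd s (y ∷ x ∷ pre ++ post))
            ≡⟨ cong₂ (λ u v → P * (u * v)) (sym gap) (sym (dd-↭ s S↭)) ⟩
          P * (ι (y ℕ.∸ x) * dd s S)
            ≡⟨ (ring (P ∷ ι (y ℕ.∸ x) ∷ dd s S ∷ []) (λ P a b → P :* (a :* b) ≈ a :* (P :* b))) ⟩
          ι (y ℕ.∸ x) * Q ∎
          where open ≡-Reasoning
      all-gaps : ∀ pre l → pre ++ l ≡ S → IsInt (ι (gapGcd l) * Q)
      all-gaps pre [] e = subst IsInt (sym (*-zeroˡ Q)) (int-ι 0)
      all-gaps pre (x ∷ []) e = subst IsInt (sym (*-zeroˡ Q)) (int-ι 0)
      all-gaps pre (x ∷ y ∷ post) e = gcd-int {Q} (y ℕ.∸ x) (gapGcd (y ∷ post)) (one-gap pre x y post e)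
        (all-gaps (pre ++ x ∷ []) (y ∷ post) (trans (Listₚ.++-assoc pre (x ∷ []) (y ∷ post)) e))

    range-integral : ∀ j → m ℕ.+ j ≡ k → IsInt (ι (denominator j) * dd s (range 0 k))
    range-integral j e = integral j (range 0 k) (range-sorted 0 k) (bounded 0 k refl) (trans (len 0 k) (cong suc (sym e)))
      where
      len : ∀ h k → length (range h k) ≡ suc k
      len h zero = refl
      len h (suc k) = cong suc (len (suc h) k)
      bounded : ∀ h i → h ℕ.+ i ≡ k → All (ℕ._≤ k) (range h i)
      bounded h zero e = ℕₚ.≤-reflexive (trans (sym (ℕₚ.+-identityʳ h)) e) ∷ []
      bounded h (suc i) e = ℕₚ.≤-trans (ℕₚ.m≤m+n h (suc i)) (ℕₚ.≤-reflexive e) ∷ bounded (suc h) i (trans (sym (ℕₚ.+-suc h i)) e)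

-- Binomial polynomials and Newton's finite expansion

module NewtonInterpolation where
  open SealedRationals
  open LinearArithmetic
  open FiniteSums
  open DividedDifferences
  open import Data.List.Base using (map)

  evalR : List R → R → R
  evalR [] x = ι 0
  evalR (c ∷ cs) x = c + x * evalR cs x

  addL : List R → List R → List R
  addL [] q = q
  addL p@(_ ∷ _) [] = p
  addL (a ∷ p) (b ∷ q) = (a + b) ∷ addL p q

  evalR-add : ∀ p q x → evalR (addL p q) x ≡ evalR p x + evalR q x
  evalR-add [] q x = sym (+-identityˡ _)
  evalR-add (a ∷ p) [] x = sym (+-identityʳ _)
  evalR-add (a ∷ p) (b ∷ q) x = trans (cong (λ t → (a + b) + x * t) (evalR-add p q x))
    (ring (a ∷ b ∷ x ∷ evalR p x ∷ evalR q x ∷ []) (λ a b x c d → a :+ b :+ x :* (c :+ d) ≈ a :+ x :* c :+ (b :+ x :* d)))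

  evalR-scale : ∀ c p x → evalR (map (c *_) p) x ≡ c * evalR p x
  evalR-scale c [] x = sym (*-zeroʳ c)
  evalR-scale c (a ∷ p) x = trans (cong (λ t → c * a + x * t) (evalR-scale c p x)) (ring (c ∷ a ∷ x ∷ evalR p x ∷ []) (λ c a x b → c :* a :+ x :* (c :* b) ≈ c :* (a :+ x :* b)))

  -- Coefficients of the polynomial "x choose k", lowest degree first, by the recursion that
  -- multiplies by (x - k)/(k + 1).
  binomial : ℕ → List R
  binomial zero = ι 1 ∷ []
  binomial (suc k) = map (u (suc k) *_) (addL (ι 0 ∷ binomial k) (map ((ι 0 - ι k) *_) (binomial k)))

  binom : ℕ → ℕ → R
  binom k n = evalR (binomial k) (ι n)

  binom-suc : ∀ k n → binom (suc k) n ≡ u (suc k) * ((ι n - ι k) * binom k n)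
  binom-suc k n = trans (evalR-scale _ (addL (ι 0 ∷ binomial k) (map ((ι 0 - ι k) *_) (binomial k))) (ι n)) (cong (u (suc k) *_) (trans (evalR-add (ι 0 ∷ binomial k) (map ((ι 0 - ι k) *_) (binomial k)) (ι n))
    (trans (cong (ι 0 + ι n * binom k n +_) (evalR-scale _ (binomial k) (ι n))) (ring (ι n ∷ binom k n ∷ ι k ∷ []) (λ a b c → con 0 :+ a :* b :+ (con 0 :- c) :* b ≈ (a :- c) :* b)))))

  binom-absorb : ∀ k n → ι (suc k) * binom (suc k) n ≡ (ι n - ι k) * binom k n
  binom-absorb k n = trans (cong (ι (suc k) *_) (binom-suc k n)) (trans (sym (*-assoc _ _ _)) (trans (cong (_* ((ι n - ι k) * binom k n)) (ι*u (s≤s z≤n))) (*-identityˡ _)))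

  binom-zero : ∀ n → binom 0 n ≡ ι 1
  binom-zero n = (ring (ι n ∷ []) (λ a → con 1 :+ a :* con 0 ≈ con 1))

  cancel-ι : ∀ k {x y} → ι (suc k) * x ≡ ι (suc k) * y → x ≡ y
  cancel-ι k e = ≤-antisym (*-cancel-≤ (1≤ι {suc k} (s≤s z≤n)) (≤-reflexive e)) (*-cancel-≤ (1≤ι {suc k} (s≤s z≤n)) (≤-reflexive (sym e)))

  -- Binomials are defined here by their product formula, so Pascal's rule needs a proof: multiplied
  -- by the lower index it follows by induction from `binom-absorb`.
  pascal : ∀ k n → binom (suc k) (suc n) - binom (suc k) n ≡ binom k n
  pascal zero n = cancel-ι 0 (≤-antisym (lin (b₁′ ∷ ι (suc n) ∷ binom 0 (suc n) ∷ b₁ ∷ ι n ∷ binom 0 n ∷ []) (λ a b c d e f → (con 1 :* a ≼ (b :- con 0) :* c) ∷ ((e :- con 0) :* f ≼ con 1 :* d) ∷ (con 1 ≼ f) ∷ ((b :- con 0) :* c ≼ (b :- con 0) :* con 1) ∷ ((e :- con 0) :* con 1 ≼ (e :- con 0) :* f) ∷ (b ≼ con 1 :+ e) ∷ [] ⊢ (con 1 :* (a :- d) ≼ con 1 :* f) by (0 , (1 , 0 ∷ []) ∷ (1 , 1 ∷ []) ∷ (1 , 2 ∷ []) ∷ (1 , 3 ∷ []) ∷ (1 , 4 ∷ []) ∷ (1 , 5 ∷ []) ∷ [])) (≤-reflexive (binom-absorb 0 (suc n))) (≤-reflexive (sym (binom-absorb 0 n))) (≤-reflexive (sym (binom-zero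 n))) (≤-reflexive (cong ((ι (suc n) - ι 0) *_) (binom-zero (suc n)))) (≤-reflexive (sym (cong ((ι n - ι 0) *_) (binom-zero n)))) (≤-reflexive (ι-suc n))) (lin (b₁′ ∷ ι (suc n) ∷ binom 0 (suc n) ∷ b₁ ∷ ι n ∷ binom 0 n ∷ []) (λ a b c d e f → ((b :- con 0) :* c ≼ con 1 :* a) ∷ (con 1 :* d ≼ (e :- con 0) :* f) ∷ (f ≼ con 1) ∷ ((b :- con 0) :* con 1 ≼ (b :- con 0) :* c) ∷ ((e :- con 0) :* f ≼ (e :- con 0) :* con 1) ∷ (con 1 :+ e ≼ b) ∷ [] ⊢ (con 1 :* f ≼ con 1 :* (a :- d)) by (0 , (1 , 0 ∷ []) ∷ (1 , 1 ∷ []) ∷ (1 , 2 ∷ []) ∷ (1 , 3 ∷ []) ∷ (1 , 4 ∷ []) ∷ (1 , 5 ∷ []) ∷ [])) (≤-reflexive (sym (binom-absorb 0 (suc n)))) (≤-reflexive (binom-absorb 0 n)) (≤-reflexive (binom-zero n)) (≤-reflexive (sym (cong ((ι (suc n) - ι 0) *_) (binom-zero (suc n))))) (≤-reflexive (cong ((ι n - ι 0) *_) (binom-zero n))) (≤-reflexive (sym (ι-suc n)))))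
    where
    b₁ b₁′ : R
    b₁ = binom 1 n
    b₁′ = binom 1 (suc n)
  pascal (suc k) n = cancel-ι (suc k) (≤-antisym (lin (ι (suc (suc k)) ∷ binom (suc (suc k)) (suc n) ∷ ι (suc n) ∷ ι (suc k) ∷ binom (suc k) (suc n) ∷ binom (suc (suc k)) n ∷ ι n ∷ binom (suc k) n ∷ binom k n ∷ ι k ∷ []) (λ a b c d e f g h i j → (a :* b ≼ (c :- d) :* e) ∷ ((g :- d) :* h ≼ a :* f) ∷ ((c :- d) :* e ≼ (con 1 :+ g :- d) :* e) ∷ ((con 1 :+ g :- d) :* e ≼ (con 1 :+ g :- d) :* (h :+ i)) ∷ ((con 1 :+ g :- d) :* i ≼ (con 1 :+ g :- (con 1 :+ j)) :* i) ∷ ((g :- j) :* i ≼ d :* h) ∷ ((con 1 :+ d) :* h ≼ a :* h) ∷ [] ⊢ (a :* (b :- f) ≼ a :* h) by (0 , (1 , 0 ∷ []) ∷ (1 , 1 ∷ []) ∷ (1 , 2 ∷ []) ∷ (1 , 3 ∷ []) ∷ (1 , 4 ∷ []) ∷ (1 , 5 ∷ []) ∷ (1 , 6 ∷ []) ∷ [])) (≤-reflexive (binom-absorb (suc k) (suc n))) (≤-reflexive (sym (binom-absorb (suc k) n))) (≤-reflexive (cong (λ t → (t - ι (suc k)) * binom (suc k) (suc n)) (ι-suc n))) (≤-reflexive (cong (λ t → (ι 1 + ι n - ι (suc k)) * t) next)) (≤-reflexive (cong (λ t → (ι 1 + ι n - t) * binom k n) (ι-suc k))) (≤-reflexive (sym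 (binom-absorb k n))) (≤-reflexive (sym (cong (_* binom (suc k) n) (ι-suc (suc k)))))) (lin (ι (suc (suc k)) ∷ binom (suc (suc k)) (suc n) ∷ ι (suc n) ∷ ι (suc k) ∷ binom (suc k) (suc n) ∷ binom (suc (suc k)) n ∷ ι n ∷ binom (suc k) n ∷ binom k n ∷ ι k ∷ []) (λ a b c d e f g h i j → ((c :- d) :* e ≼ a :* b) ∷ (a :* f ≼ (g :- d) :* h) ∷ ((con 1 :+ g :- d) :* e ≼ (c :- d) :* e) ∷ ((con 1 :+ g :- d) :* (h :+ i) ≼ (con 1 :+ g :- d) :* e) ∷ ((con 1 :+ g :- (con 1 :+ j)) :* i ≼ (con 1 :+ g :- d) :* i) ∷ (d :* h ≼ (g :- j) :* i) ∷ (a :* h ≼ (con 1 :+ d) :* h) ∷ [] ⊢ (a :* h ≼ a :* (b :- f)) by (0 , (1 , 0 ∷ []) ∷ (1 , 1 ∷ []) ∷ (1 , 2 ∷ []) ∷ (1 , 3 ∷ []) ∷ (1 , 4 ∷ []) ∷ (1 , 5 ∷ []) ∷ (1 , 6 ∷ []) ∷ [])) (≤-reflexive (sym (binom-absorb (suc k) (suc n)))) (≤-reflexive (binom-absorb (suc k) n)) (≤-reflexive (sym (cong (λ t → (t - ι (suc k)) * binom (suc k) (suc n)) (ι-suc n)))) (≤-reflexive (sym (cong (λ t → (ι 1 + ι n - ι (suc k)) * t) next))) (≤-reflexive (sym (cong (λ t → (ι 1 + ι n - t) * binom k n) (ι-suc k)))) (≤-reflexive (binom-absorb k n)) (≤-reflexive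 (cong (_* binom (suc k) n) (ι-suc (suc k))))))
    where
    next : binom (suc k) (suc n) ≡ binom (suc k) n + binom k n
    next = (≤-antisym (lin (binom (suc k) (suc n) ∷ binom (suc k) n ∷ binom k n ∷ []) (λ a b c → (a :- b ≼ c) ∷ [] ⊢ (a ≼ b :+ c) by (0 , (1 , 0 ∷ []) ∷ [])) (≤-reflexive (pascal k n))) (lin (binom (suc k) (suc n) ∷ binom (suc k) n ∷ binom k n ∷ []) (λ a b c → (c ≼ a :- b) ∷ [] ⊢ (b :+ c ≼ a) by (0 , (1 , 0 ∷ []) ∷ [])) (≤-reflexive (sym (pascal k n)))))

  binom-0 : ∀ k → binom (suc k) 0 ≡ ι 0
  binom-0 zero = cancel-ι 0 (trans (binom-absorb 0 0) (ring (binom 0 0 ∷ []) (λ a → (con 0 :- con 0) :* a ≈ con 1 :* con 0)))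
  binom-0 (suc k) = cancel-ι (suc k) (trans (binom-absorb (suc k) 0) (trans (cong ((ι 0 - ι (suc k)) *_) (binom-0 k)) (ring (ι (suc k) ∷ ι (suc (suc k)) ∷ []) (λ a b → (con 0 :- a) :* con 0 ≈ b :* con 0))))

  Δ-cong : ∀ {f g : ℕ → R} → (∀ n → f n ≡ g n) → ∀ j h → Δ f j h ≡ Δ g j h
  Δ-cong e zero h = e h
  Δ-cong e (suc j) h = cong₂ _-_ (Δ-cong e j (suc h)) (Δ-cong e j h)

  Δ-inner : ∀ (f : ℕ → R) j h → Δ f (suc j) h ≡ Δ (λ n → f (suc n) - f n) j h
  Δ-inner f zero h = refl
  Δ-inner f (suc j) h = cong₂ _-_ (Δ-inner f j (suc h)) (Δ-inner f j h)

  Δ-shift : ∀ (f : ℕ → R) j h → Δ (λ n → f (suc n)) j h ≡ Δ f j (suc h)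
  Δ-shift f zero h = refl
  Δ-shift f (suc j) h = cong₂ _-_ (Δ-shift f j (suc h)) (Δ-shift f j h)

  Δ-linear : ∀ (f g : ℕ → R) c j h → Δ (λ n → f n + c * g n) j h ≡ Δ f j h + c * Δ g j h
  Δ-linear f g c zero h = refl
  Δ-linear f g c (suc j) h = trans (cong₂ _-_ (Δ-linear f g c j (suc h)) (Δ-linear f g c j h))
    (ring (Δ f j (suc h) ∷ c ∷ Δ g j (suc h) ∷ Δ f j h ∷ Δ g j h ∷ []) (λ a c b d e → a :+ c :* b :- (d :+ c :* e) ≈ a :- d :+ c :* (b :- e)))

  Δ-zero-fun : ∀ j h → Δ (λ _ → ι 0) j h ≡ ι 0
  Δ-zero-fun zero h = refl
  Δ-zero-fun (suc j) h = trans (cong₂ _-_ (Δ-zero-fun j (suc h)) (Δ-zero-fun j h)) (+-inverseʳ _)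

  Δ-binom-diag : ∀ k → Δ (binom k) k 0 ≡ ι 1
  Δ-binom-diag zero = binom-zero 0
  Δ-binom-diag (suc k) = trans (Δ-inner (binom (suc k)) k 0) (trans (Δ-cong (pascal k) k 0) (Δ-binom-diag k))

  Δ-binom-off : ∀ k j → j ≢ k → Δ (binom k) j 0 ≡ ι 0
  Δ-binom-off zero zero h = ⊥-elim (h refl)
  Δ-binom-off (suc k) zero h = binom-0 k
  Δ-binom-off zero (suc j) h = trans (Δ-inner (binom 0) j 0) (trans (Δ-cong (λ n → trans (cong₂ _-_ (binom-zero (suc n)) (binom-zero n)) (+-inverseʳ _)) j 0) (Δ-zero-fun j 0))
  Δ-binom-off (suc k) (suc j) h = trans (Δ-inner (binom (suc k)) j 0) (trans (Δ-cong (pascal k) j 0) (Δ-binom-off k j (λ e → h (cong suc e))))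

  -- The hypothesis passes to the shifted sequence, as its differences at 0 are sums of two
  -- consecutive differences of `t` at 0.
  Δ-determines : ∀ (t : ℕ → R) → (∀ j → Δ t j 0 ≡ ι 0) → ∀ n → t n ≡ ι 0
  Δ-determines t h zero = h 0
  Δ-determines t h (suc n) = Δ-determines (λ n → t (suc n)) (λ j → trans (Δ-shift t j 0)
    (≤-antisym (lin (Δ t j 1 ∷ Δ t j 0 ∷ []) (λ a b → (a :- b ≼ con 0) ∷ (b ≼ con 0) ∷ [] ⊢ (a ≼ con 0) by (0 , (1 , 0 ∷ []) ∷ (1 , 1 ∷ []) ∷ [])) (≤-reflexive (h (suc j))) (≤-reflexive (h j))) (lin (Δ t j 1 ∷ Δ t j 0 ∷ []) (λ a b → (con 0 ≼ a :- b) ∷ (con 0 ≼ b) ∷ [] ⊢ (con 0 ≼ a) by (0 , (1 , 0 ∷ []) ∷ (1 , 1 ∷ []) ∷ [])) (≤-reflexive (sym (h (suc j)))) (≤-reflexive (sym (h j)))))) n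

  newtonPoly : (ℕ → R) → ℕ → List R
  newtonPoly s zero = []
  newtonPoly s (suc K) = addL (newtonPoly s K) (map (Δ s K 0 *_) (binomial K))

  newton-eval : ∀ s K n → evalR (newtonPoly s (suc K)) (ι n) ≡ evalR (newtonPoly s K) (ι n) + Δ s K 0 * binom K n
  newton-eval s K n = trans (evalR-add (newtonPoly s K) _ (ι n)) (cong (evalR (newtonPoly s K) (ι n) +_) (evalR-scale _ (binomial K) (ι n)))

  Δ-newton : ∀ s K j → Δ (λ n → evalR (newtonPoly s (suc K)) (ι n)) j 0 ≡ Δ (λ n → evalR (newtonPoly s K) (ι n)) j 0 + Δ s K 0 * Δ (binom K) j 0
  Δ-newton s K j = trans (Δ-cong (newton-eval s K) j 0) (Δ-linear _ (binom K) (Δ s K 0) j 0)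

  Δ-newton-≥ : ∀ s K j → K ℕ.≤ j → Δ (λ n → evalR (newtonPoly s K) (ι n)) j 0 ≡ ι 0
  Δ-newton-≥ s zero j p = Δ-zero-fun j 0
  Δ-newton-≥ s (suc K) j p = trans (Δ-newton s K j) (trans (cong₂ (λ a b → a + Δ s K 0 * b) (Δ-newton-≥ s K j (ℕₚ.<⇒≤ p)) (Δ-binom-off K j (λ e → ℕₚ.<⇒≢ p (sym e))))
    (ring (Δ s K 0 ∷ []) (λ a → con 0 :+ a :* con 0 ≈ con 0)))

  Δ-newton-< : ∀ s K j → j ℕ.< K → Δ (λ n → evalR (newtonPoly s K) (ι n)) j 0 ≡ Δ s j 0
  Δ-newton-< s (suc K) j p with ℕₚ.m≤n⇒m<n∨m≡n (ℕₚ.≤-pred p)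
  ... | inj₁ q = trans (Δ-newton s K j) (trans (cong₂ (λ a b → a + Δ s K 0 * b) (Δ-newton-< s K j q) (Δ-binom-off K j (ℕₚ.<⇒≢ q))) (ring (Δ s j 0 ∷ Δ s K 0 ∷ []) (λ a b → a :+ b :* con 0 ≈ a)))
  ... | inj₂ refl = trans (Δ-newton s K K) (trans (cong₂ (λ a b → a + Δ s K 0 * b) (Δ-newton-≥ s K K ℕₚ.≤-refl) (Δ-binom-diag K)) (ring (Δ s K 0 ∷ []) (λ a → con 0 :+ a :* con 1 ≈ a)))

  newton : ∀ s K → (∀ j → K ℕ.≤ j → Δ s j 0 ≡ ι 0) → ∀ n → s n ≡ evalR (newtonPoly s K) (ι n)
  newton s K h n = (≤-antisym (lin (s n ∷ p n ∷ []) (λ a b → (a :+ (con 0 :- con 1) :* b ≼ con 0) ∷ [] ⊢ (a ≼ b) by (0 , (1 , 0 ∷ []) ∷ [])) (≤-reflexive (Δ-determines (λ n → s n + (ι 0 - ι 1) * p n) zeros n))) (lin (s n ∷ p n ∷ []) (λ a b → (con 0 ≼ a :+ (con 0 :- con 1) :* b) ∷ [] ⊢ (b ≼ a) by (0 , (1 , 0 ∷ []) ∷ [])) (≤-reflexive (sym (Δ-determines (λ n → s n + (ι 0 - ι 1) * p n) zeros n)))))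
    where
    p : ℕ → R
    p n = evalR (newtonPoly s K) (ι n)
    same : ∀ j → Δ p j 0 ≡ Δ s j 0
    same j with ℕₚ.≤-<-connex K j
    ... | inj₁ q = trans (Δ-newton-≥ s K j q) (sym (h j q))
    ... | inj₂ q = Δ-newton-< s K j q
    zeros : ∀ j → Δ (λ n → s n + (ι 0 - ι 1) * p n) j 0 ≡ ι 0
    zeros j = trans (Δ-linear s p (ι 0 - ι 1) j 0) (trans (cong (λ t → Δ s j 0 + (ι 0 - ι 1) * t) (same j)) (ring (Δ s j 0 ∷ []) (λ a → a :+ (con 0 :- con 1) :* a ≈ con 0)))

-- Truncated exponentials and the vanishing of the high differences

module VanishingDifferences where
  open SealedRationals
  open LinearArithmetic
  open FiniteSums
  open ArithmeticFunctions
  open MangoldtIdentities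
  open LogarithmicSums
  open ChebyshevBound
  open ApproximateLogarithm
  open DividedDifferences
  open NewtonInterpolation
  import Data.Integer.Properties as ℤₚ
  open import Data.Integer.Base using (-[1+_]) renaming (+_ to pos)
  open import Data.List.Base using (length)

  1≤! : ∀ n → 1 ℕ.≤ n !
  1≤! n = ℕₚ.1≤n! n

  expR : R → ℕ → R
  expR x zero = ι 1
  expR x (suc N) = expR x N + pw x (suc N) * u (suc N !)

  expR-mono : ∀ {x y} → ι 0 ≤ x → x ≤ y → ∀ N → expR x N ≤ expR y N
  expR-mono p q zero = ≤-refl
  expR-mono p q (suc N) = +-mono-≤ (expR-mono p q N) (*-mono-≤ (0≤pw p (suc N)) (0≤u (1≤! (suc N))) (pw-mono p q (suc N)) ≤-refl)

  1≤expR : ∀ {x} → ι 0 ≤ x → ∀ N → ι 1 ≤ expR x N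
  1≤expR p zero = ≤-refl
  1≤expR {x} p (suc N) = (lin (expR x N ∷ pw x (suc N) ∷ u (suc N !) ∷ []) (λ a b c → (con 1 ≼ a) ∷ (con 0 ≼ b :* c) ∷ [] ⊢ (con 1 ≼ a :+ b :* c) by (0 , (1 , 0 ∷ []) ∷ (1 , 1 ∷ []) ∷ [])) (1≤expR p N) (*-nonneg (0≤pw p (suc N)) (0≤u (1≤! (suc N)))))

  expR-zero : ∀ N → expR (ι 0) N ≡ ι 1
  expR-zero zero = refl
  expR-zero (suc N) = trans (cong₂ (λ s t → s + t * u (suc N !)) (expR-zero N) (*-zeroˡ _)) (ring (u (suc N !) ∷ []) (λ a → con 1 :+ con 0 :* a ≈ con 1))

  pw-≤1 : ∀ {c} → ι 0 ≤ c → c ≤ ι 1 → ∀ {i j} → i ℕ.≤ j → pw c j ≤ pw c i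
  pw-≤1 p q {zero} {zero} z≤n = ≤-refl
  pw-≤1 {c} p q {zero} {suc j} z≤n = (lin (pw c j ∷ c ∷ []) (λ a c → (a ≼ con 1) ∷ (con 0 ≼ a) ∷ (c ≼ con 1) ∷ [] ⊢ (c :* a ≼ con 1) by (0 , (1 , 0 ∷ []) ∷ (1 , 1 ∷ 2 ∷ []) ∷ [])) (pw-≤1 p q {zero} {j} z≤n) (0≤pw p j) q)
  pw-≤1 p q (s≤s r) = *-monoʳ-≤ p (pw-≤1 p q r)

  -- In every term of the truncated series the power of `c` is at most `N′`, and `c ≤ 1`. The lemma
  -- trades a slightly smaller exponent for a factor close to 1, a quantitative continuity from the
  -- left.
  expR-scale : ∀ {c x} → ι 0 ≤ c → c ≤ ι 1 → ι 0 ≤ x → ∀ {N N′} → N ℕ.≤ N′ → pw c N′ * expR x N ≤ expR (c * x) N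
  expR-scale {c} {x} p q r {zero} {N′} s = (lin (pw c N′ ∷ []) (λ a → (a ≼ con 1) ∷ [] ⊢ (a :* con 1 ≼ con 1) by (0 , (1 , 0 ∷ []) ∷ [])) (pw-≤1 p q {zero} {N′} s))
  expR-scale {c} {x} p q r {suc N} {N′} s = ≤-trans (≤-reflexive (*-distribˡ-+ (pw c N′) _ _)) (+-mono-≤ (expR-scale p q r (ℕₚ.<⇒≤ s)) term)
    where
    t : R
    t = pw x (suc N) * u (suc N !)
    0≤t : ι 0 ≤ t
    0≤t = *-nonneg (0≤pw r (suc N)) (0≤u (1≤! (suc N)))
    term : pw c N′ * t ≤ pw (c * x) (suc N) * u (suc N !)
    term = ≤-trans (*-mono-≤ (0≤pw p N′) 0≤t (pw-≤1 p q s) ≤-refl) (≤-reflexive (trans (sym (*-assoc _ _ _)) (cong (_* u (suc N !)) (sym (pw-* c x (suc N))))))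

  bernoulli-minus : ∀ {y} → ι 0 ≤ y → y ≤ ι 1 → ∀ n → ι 1 - ι n * y ≤ pw (ι 1 - y) n
  bernoulli-minus {y} p q zero = (lin (y ∷ []) (λ y → [] ⊢ (con 1 :- con 0 :* y ≼ con 1) by (0 , [])))
  bernoulli-minus {y} p q (suc n) = (lin (y ∷ ι n ∷ pw (ι 1 - y) n ∷ ι (suc n) ∷ []) (λ y a b c → ((con 1 :- y) :* (con 1 :- a :* y) ≼ (con 1 :- y) :* b) ∷ ((con 1 :+ a) :* y ≼ c :* y) ∷ (con 0 ≼ a :* (y :* y)) ∷ [] ⊢ (con 1 :- c :* y ≼ (con 1 :- y) :* b) by (0 , (1 , 0 ∷ []) ∷ (1 , 1 ∷ []) ∷ (1 , 2 ∷ []) ∷ [])) (*-monoʳ-≤ 0≤1-y (bernoulli-minus p q n)) (≤-reflexive (sym (cong (_* y) (ι-suc n)))) (*-nonneg (0≤ι n) (*-nonneg p p)))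
    where
    0≤1-y : ι 0 ≤ ι 1 - y
    0≤1-y = (lin (y ∷ []) (λ y → (y ≼ con 1) ∷ [] ⊢ (con 0 ≼ con 1 :- y) by (0 , (1 , 0 ∷ []) ∷ [])) q)

  pw-increment : ∀ {z v} → ι 0 ≤ z → ι 0 ≤ v → ∀ i → pw (z + v) (suc i) - pw z (suc i) ≤ ι (suc i) * (v * pw (z + v) i)
  pw-increment {z} {v} p q zero = (lin (z ∷ v ∷ []) (λ z v → [] ⊢ ((z :+ v) :* con 1 :- z :* con 1 ≼ con 1 :* (v :* con 1)) by (0 , [])))
  pw-increment {z} {v} p q (suc i) = (lin (z ∷ v ∷ pw (z + v) (suc i) ∷ pw z (suc i) ∷ ι (suc i) ∷ pw (z + v) i ∷ ι (suc (suc i)) ∷ []) (λ z v a b c d e → ((z :+ v) :* (a :- b) ≼ (z :+ v) :* (c :* (v :* d))) ∷ (v :* b ≼ v :* a) ∷ ((z :+ v) :* (c :* (v :* d)) ≼ c :* (v :* a)) ∷ ((con 1 :+ c) :* (v :* a) ≼ e :* (v :* a)) ∷ [] ⊢ ((z :+ v) :* a :- z :* b ≼ e :* (v :* a)) by (0 , (1 , 0 ∷ []) ∷ (1 , 1 ∷ []) ∷ (1 , 2 ∷ []) ∷ (1 , 3 ∷ []) ∷ [])) (*-monoʳ-≤ 0≤z+v (pw-increment p q i)) (*-monoʳ-≤ q (pw-mono p z≤z+v (suc i))) (≤-reflexive e) (≤-reflexive (sym (cong (_* (v * pw (z + v) (suc i))) (ι-suc (suc i))))))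
    where
    z≤z+v : z ≤ z + v
    z≤z+v = (lin (v ∷ z ∷ []) (λ v z → (con 0 ≼ v) ∷ [] ⊢ (z ≼ z :+ v) by (0 , (1 , 0 ∷ []) ∷ [])) q)
    0≤z+v : ι 0 ≤ z + v
    0≤z+v = ≤-trans p z≤z+v
    e : (z + v) * (ι (suc i) * (v * pw (z + v) i)) ≡ ι (suc i) * (v * pw (z + v) (suc i))
    e = (ring (z ∷ v ∷ ι (suc i) ∷ pw (z + v) i ∷ []) (λ z v a b → (z :+ v) :* (a :* (v :* b)) ≈ a :* (v :* ((z :+ v) :* b))))

  u-! : ∀ i → ι (suc i) * u (suc i !) ≡ u (i !)
  u-! i = trans (cong (ι (suc i) *_) (u-* {suc i} (s≤s z≤n) (1≤! i))) (trans (sym (*-assoc _ _ _)) (trans (cong (_* u (i !)) (ι*u (s≤s z≤n))) (*-identityˡ _)))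

  -- A mean value inequality: the derivative of the truncation at N + 1 is the truncation at N,
  -- which is increasing.
  expR-increment : ∀ {z v} → ι 0 ≤ z → ι 0 ≤ v → ∀ N → expR (z + v) (suc N) - expR z (suc N) ≤ v * expR (z + v) N
  expR-increment {z} {v} p q zero = (lin (z ∷ v ∷ u 1 ∷ []) (λ z v a → ((z :+ v) :* con 1 :* a ≼ (z :+ v) :* con 1 :* con 1) ∷ (z :* con 1 :* con 1 ≼ z :* con 1 :* a) ∷ [] ⊢ (con 1 :+ (z :+ v) :* con 1 :* a :- (con 1 :+ z :* con 1 :* a) ≼ v :* con 1) by (0 , (1 , 0 ∷ []) ∷ (1 , 1 ∷ []) ∷ [])) (≤-reflexive (cong ((z + v) * ι 1 *_) u-1)) (≤-reflexive (sym (cong (z * ι 1 *_) u-1))))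
  expR-increment {z} {v} p q (suc N) = (lin (expR (z + v) (suc N) ∷ expR z (suc N) ∷ v ∷ expR (z + v) N ∷ a ∷ c ∷ w ∷ d ∷ u (suc N !) ∷ []) (λ b e v f a c w d g → (b :- e ≼ v :* f) ∷ ((a :- c) :* w ≼ v :* (d :* g)) ∷ [] ⊢ (b :+ a :* w :- (e :+ c :* w) ≼ v :* (f :+ d :* g)) by (0 , (1 , 0 ∷ []) ∷ (1 , 1 ∷ []) ∷ [])) (expR-increment p q N) term)
    where
    a c d w : R
    a = pw (z + v) (suc (suc N))
    c = pw z (suc (suc N))
    d = pw (z + v) (suc N)
    w = u (suc (suc N) !)
    0≤w : ι 0 ≤ w
    0≤w = 0≤u (1≤! (suc (suc N)))
    term : (a - c) * w ≤ v * (d * u (suc N !))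
    term = ≤-trans (lin (a ∷ c ∷ ι (suc (suc N)) ∷ v ∷ d ∷ w ∷ []) (λ a c b v d w → (a :- c ≼ b :* (v :* d)) ∷ (con 0 ≼ w) ∷ [] ⊢ ((a :- c) :* w ≼ b :* (v :* d) :* w) by (0 , (1 , 0 ∷ 1 ∷ []) ∷ [])) (pw-increment p q (suc N)) 0≤w)
      (≤-reflexive (trans (ring (ι (suc (suc N)) ∷ v ∷ d ∷ w ∷ []) (λ a v d w → a :* (v :* d) :* w ≈ v :* (d :* (a :* w)))) (cong (λ t → v * (d * t)) (u-! (suc N)))))

  expR-step : ∀ {z v} → ι 0 ≤ z → ι 0 ≤ v → ∀ N → expR (z + v) N * (ι 1 - v) ≤ expR z N
  expR-step {z} {v} p q zero = (lin (v ∷ []) (λ v → (con 0 ≼ v) ∷ [] ⊢ (con 1 :* (con 1 :- v) ≼ con 1) by (0 , (1 , 0 ∷ []) ∷ [])) q)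
  expR-step {z} {v} p q (suc N) = (lin (E ∷ t ∷ expR z (suc N) ∷ v ∷ []) (λ E t a v → (E :+ t :- a ≼ v :* E) ∷ (con 0 ≼ v :* t) ∷ [] ⊢ ((E :+ t) :* (con 1 :- v) ≼ a) by (0 , (1 , 0 ∷ []) ∷ (1 , 1 ∷ []) ∷ [])) (expR-increment p q N) (*-nonneg q 0≤t))
    where
    E t : R
    E = expR (z + v) N
    t = pw (z + v) (suc N) * u (suc N !)
    0≤t : ι 0 ≤ t
    0≤t = *-nonneg (0≤pw (lin (z ∷ v ∷ []) (λ z v → (con 0 ≼ z) ∷ (con 0 ≼ v) ∷ [] ⊢ (con 0 ≼ z :+ v) by (0 , (1 , 0 ∷ []) ∷ (1 , 1 ∷ []) ∷ [])) p q) (suc N)) (0≤u (1≤! (suc N)))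

  -- The truncated exponential at j/(M+1) lies below (1 + 1/M)^j, since 1 − 1/(M+1) is the inverse of 1 + 1/M.
  expR≤pw : ∀ M → 1 ℕ.≤ M → ∀ N j → expR (ι j * u (suc M)) N ≤ pw (ι 1 + u M) j
  expR≤pw M 1≤M N zero = ≤-reflexive (trans (cong (λ t → expR t N) (*-zeroˡ _)) (expR-zero N))
  expR≤pw M 1≤M N (suc j) = ≤-trans (≤-reflexive (trans (cong (λ t → expR t N) e₁) e₂)) (*-monoʳ-≤ 0≤b (≤-trans (expR-step (*-nonneg (0≤ι j) 0≤v) 0≤v N) (expR≤pw M 1≤M N j)))
    where
    v b z : R
    v = u (suc M)
    b = ι 1 + u M
    z = ι j * v
    0≤v : ι 0 ≤ v
    0≤v = 0≤u (s≤s z≤n)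
    0≤b : ι 0 ≤ b
    0≤b = (lin (u M ∷ []) (λ a → (con 0 ≼ a) ∷ [] ⊢ (con 0 ≼ con 1 :+ a) by (0 , (1 , []) ∷ (1 , 0 ∷ []) ∷ [])) (0≤u 1≤M))
    e₁ : ι (suc j) * v ≡ z + v
    e₁ = trans (cong (_* v) (ι-suc j)) (ring (ι j ∷ v ∷ []) (λ a v → (con 1 :+ a) :* v ≈ a :* v :+ v))
    e₂ : expR (z + v) N ≡ b * (expR (z + v) N * (ι 1 - v))
    e₂ = (≤-antisym (lin (expR (z + v) N ∷ u M ∷ v ∷ []) (λ a b v → (a :* (b :* v) ≼ a :* (b :- v)) ∷ [] ⊢ (a ≼ (con 1 :+ b) :* (a :* (con 1 :- v))) by (0 , (1 , 0 ∷ []) ∷ [])) (≤-reflexive (sym (cong (expR (z + v) N *_) (u-step 1≤M))))) (lin (expR (z + v) N ∷ u M ∷ v ∷ []) (λ a b v → (a :* (b :- v) ≼ a :* (b :* v)) ∷ [] ⊢ ((con 1 :+ b) :* (a :* (con 1 :- v)) ≼ a) by (0 , (1 , 0 ∷ []) ∷ [])) (≤-reflexive (cong (expR (z + v) N *_) (u-step 1≤M)))))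

  positive⇒u : ∀ {x} → ι 0 < x → ∃ λ p → 1 ℕ.≤ p × u p ≤ x
  positive⇒u {x} 0<x with archimedean (inv x)
  ... | p , h = suc p , s≤s z≤n , *-cancel-≤ (1≤ι {suc p} (s≤s z≤n))
      (lin (ι (suc p) ∷ u (suc p) ∷ ι p ∷ x ∷ inv x ∷ []) (λ a b c x d → (a :* b ≼ con 1) ∷ (x :* d ≼ x :* c) ∷ (con 0 ≼ x) ∷ (con 1 ≼ x :* d) ∷ ((con 1 :+ c) :* x ≼ a :* x) ∷ [] ⊢ (a :* b ≼ a :* x) by (0 , (1 , 0 ∷ []) ∷ (1 , 1 ∷ []) ∷ (1 , 2 ∷ []) ∷ (1 , 3 ∷ []) ∷ (1 , 4 ∷ []) ∷ [])) (≤-reflexive (ι*u {suc p} (s≤s z≤n))) hx (<⇒≤ 0<x) (≤-reflexive (sym (*-inverseʳ x≢0))) (≤-reflexive (sym (cong (_* x) (ι-suc p)))))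
    where
    x≢0 : x ≢ ι 0
    x≢0 e = 0<x (≤-reflexive e)
    hx : x * inv x ≤ x * ι p
    hx = *-monoʳ-≤ (<⇒≤ 0<x) h

  module LogFactorial {V : ℕ} {L : ℕ → R} (ls : LogSys V L) where
    open LogSys ls

    L-! : ∀ k → L (k !) ≡ T k
    L-! zero = L-1
    L-! (suc k) = trans (L-* {suc k} (s≤s z≤n) (1≤! k)) (trans (cong (L (suc k) +_) (L-! k)) (+-comm _ _))

    T≡∑ψ : ∀ k → T k ≡ ∑ k (λ r → ψ (k ÷ r))
    T≡∑ψ k = trans (T≡∑Λ k) (trans (∑-cong k (λ n _ _ → trans (*-comm _ _) (sym (∑-const (k ÷ n) (Λ n))))) (hyperbola-swap k (λ n r → Λ n)))

    L-denominator : ∀ s m base k j → L (Integrality.denominator s m base k j) ≡ ∑ (m ℕ.+ j) (λ r → ψ (k ÷ r)) - ∑ m (λ r → ψ (k ÷ r))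
    L-denominator s m base k zero = trans L-1 (sym (trans (cong (λ t → ∑ t (λ r → ψ (k ÷ r)) - ∑ m (λ r → ψ (k ÷ r))) (ℕₚ.+-identityʳ m)) (+-inverseʳ _)))
    L-denominator s m base k (suc j) = begin
      L (D j ℕ.* lcmTo (k ÷ suc (m ℕ.+ j)))
        ≡⟨ L-* (Integrality.1≤denominator s m base k j) (1≤lcmTo (k ÷ suc (m ℕ.+ j))) ⟩
      L (D j) + L (lcmTo (k ÷ suc (m ℕ.+ j)))
        ≡⟨ cong₂ _+_ (L-denominator s m base k j) (sym (ψ≡L-lcmTo (k ÷ suc (m ℕ.+ j)))) ⟩
      (F (m ℕ.+ j) - F m) + ψ (k ÷ suc (m ℕ.+ j))
        ≡⟨ (ring (F (m ℕ.+ j) ∷ F m ∷ ψ (k ÷ suc (m ℕ.+ j)) ∷ []) (λ a b c → a :- b :+ c ≈ a :+ c :- b)) ⟩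
      F (suc (m ℕ.+ j)) - F m
        ≡⟨ cong (λ t → F t - F m) (sym (ℕₚ.+-suc m j)) ⟩
      F (m ℕ.+ suc j) - F m ∎
      where
      open ≡-Reasoning
      D : ℕ → ℕ
      D = Integrality.denominator s m base k
      F : ℕ → R
      F n = ∑ n (λ r → ψ (k ÷ r))

  int-small : ∀ {x} → IsInt x → abs x < ι 1 → x ≡ ι 0
  int-small (pos zero , e) h = trans e (ιℤ-pos 0)
  int-small {x} (pos (suc n) , e) h = ⊥-elim (h (≤-trans (ι-mono (s≤s z≤n)) (≤-trans (≤-reflexive (sym (trans e (ιℤ-pos (suc n))))) (x≤abs x))))
  int-small {x} (-[1+ n ] , e) h = ⊥-elim (h (≤-trans (ι-mono (s≤s z≤n)) (≤-trans (≤-reflexive (sym x≡)) (-x≤abs x))))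
    where
    x≡ : ι 0 - x ≡ ι (suc n)
    x≡ = (≤-antisym (lin (x ∷ ι (suc n) ∷ []) (λ x a → (con 0 ≼ x :+ a) ∷ [] ⊢ (con 0 :- x ≼ a) by (0 , (1 , 0 ∷ []) ∷ [])) (≤-reflexive (sym (trans (cong (_+ ι (suc n)) e) (trans (cong (ιℤ -[1+ n ] +_) (sym (ιℤ-pos (suc n)))) (trans (sym (ιℤ-+ -[1+ n ] (pos (suc n)))) (trans (cong ιℤ (ℤₚ.+-inverseˡ (pos (suc n)))) (ιℤ-pos 0)))))))) (lin (x ∷ ι (suc n) ∷ []) (λ x a → (x :+ a ≼ con 0) ∷ [] ⊢ (a ≼ con 0 :- x) by (0 , (1 , 0 ∷ []) ∷ [])) (≤-reflexive (trans (cong (_+ ι (suc n)) e) (trans (cong (ιℤ -[1+ n ] +_) (sym (ιℤ-pos (suc n)))) (trans (sym (ιℤ-+ -[1+ n ] (pos (suc n)))) (trans (cong ιℤ (ℤₚ.+-inverseˡ (pos (suc n)))) (ιℤ-pos 0))))))))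

  module Main (m : ℕ) (1≤m : 1 ℕ.≤ m) (s : ℕ → R) (base : ∀ l → Sorted l → length l ≡ suc m → IsInt (dd s l))
    (C θ : R) (0≤C : ι 0 ≤ C) (0≤θ : ι 0 ≤ θ) (growth : ∀ n → abs (s n) ≤ C * pw θ n) (N : ℕ) (θ<exp : θ + ι 1 < expR (H m) N) where
    open PNT logs using (ψ-lower-bound)

    τ h E δ : R
    τ = θ + ι 1
    h = H m
    E = expR h N
    δ = E - τ
    1≤τ : ι 1 ≤ τ
    1≤τ = (lin (θ ∷ []) (λ a → (con 0 ≼ a) ∷ [] ⊢ (con 1 ≼ a :+ con 1) by (0 , (1 , 0 ∷ []) ∷ [])) 0≤θ)
    0≤τ : ι 0 ≤ τ
    0≤τ = ≤-trans (0≤ι 1) 1≤τ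
    1≤h : ι 1 ≤ h
    1≤h = ≤-trans (≤-reflexive (sym H-1)) (∑-upper u 1≤m (λ i p _ → 0≤u p))
    0≤h : ι 0 ≤ h
    0≤h = ≤-trans (0≤ι 1) 1≤h
    0<δ : ι 0 < δ
    0<δ q = θ<exp (lin (E ∷ τ ∷ []) (λ E a → (E :- a ≼ con 0) ∷ [] ⊢ (E ≼ a) by (0 , (1 , 0 ∷ []) ∷ [])) q)

    Δ-bound : ∀ k i → abs (Δ s k i) ≤ C * pw θ i * pw τ k
    Δ-bound zero i = ≤-trans (growth i) (≤-reflexive (sym (*-identityʳ _)))
    Δ-bound (suc k) i = ≤-trans (≤-trans (≤-reflexive (cong abs (ring (Δ s k (suc i) ∷ Δ s k i ∷ []) (λ a b → a :- b ≈ a :+ (con 0 :- b))))) (abs-+ _ _))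
      (lin (abs (Δ s k (suc i)) ∷ C ∷ θ ∷ pw θ i ∷ pw τ k ∷ abs (ι 0 - Δ s k i) ∷ []) (λ a C b c d e → (a ≼ C :* (b :* c) :* d) ∷ (e ≼ C :* c :* d) ∷ [] ⊢ (a :+ e ≼ C :* c :* ((b :+ con 1) :* d)) by (0 , (1 , 0 ∷ []) ∷ (1 , 1 ∷ []) ∷ [])) (Δ-bound k (suc i)) (within-abs (within-neg (abs-within (Δ-bound k i)))))

    private
      p : ℕ
      p = proj₁ (positive⇒u 0<δ)
      1≤p : 1 ℕ.≤ p
      1≤p = proj₁ (proj₂ (positive⇒u 0<δ))
      u≤δ : u p ≤ δ
      u≤δ = proj₂ (proj₂ (positive⇒u 0<δ))
      E′ τ′ C′ : ℕ
      E′ = proj₁ (archimedean E)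
      τ′ = suc (proj₁ (archimedean τ))
      C′ = proj₁ (archimedean C)
      E≤ : E ≤ ι E′
      E≤ = proj₂ (archimedean E)
      τ≤ : τ ≤ ι τ′
      τ≤ = ≤-trans (proj₂ (archimedean τ)) (ι-mono (ℕₚ.n≤1+n _))
      C≤ : C ≤ ι C′
      C≤ = proj₂ (archimedean C)
      opaque
        q : ℕ
        -- With ε = 1/q, lowering the exponent by the share 3 ε costs at most 3 N E ε, which must be
        -- at most 1/(2 p) and so at most δ/2. The added 4 in all gives 4 ε ≤ 1.
        q = suc (6 ℕ.* (N ℕ.* E′) ℕ.* p ℕ.+ 3)
        1≤q : 1 ℕ.≤ q
        1≤q = s≤s z≤n
        ι-q : ι q ≡ ι 6 * (ι N * ι E′) * ι p + ι 4
        ι-q = trans (ι-suc _) (trans (cong (ι 1 +_) (trans (ι-+ (6 ℕ.* (N ℕ.* E′) ℕ.* p) 3) (cong (_+ ι 3) (trans (ι-* (6 ℕ.* (N ℕ.* E′)) p) (cong (_* ι p) (trans (ι-* 6 (N ℕ.* E′)) (cong (ι 6 *_) (ι-* N E′))))))))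
          (ring (ι N ∷ ι E′ ∷ ι p ∷ []) (λ a b c → con 1 :+ (con 6 :* (a :* b) :* c :+ con 3) ≈ con 6 :* (a :* b) :* c :+ con 4)))
      opaque
        K₁ : ℕ
        K₁ = proj₁ (ψ-lower-bound q 1≤q)
        ψ-lower : ∀ {V L} (ls : LogSys V L) {x} → 1 ℕ.≤ x → 2 ℕ.* x ℕ.≤ V → ι x ≤ LogSys.ψ ls x + u q * ι x + ι K₁
        ψ-lower = proj₂ (ψ-lower-bound q 1≤q)
      K₂ W : ℕ
      -- Total of the bounded errors: for each r ≤ m the constant of the prime number theorem and 1
      -- for the rounding of k/r, and finally 1 for the rounding at the prime factors of the
      -- denominator.
      K₂ = m ℕ.* (K₁ ℕ.+ 1) ℕ.+ 1
      W = 2 ℕ.* p ℕ.* τ′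
      ε y ρ : R
      ε = u q
      -- Enlarging τ to ρ = τ (1 + y) uses at most 1/(2 p), the other half of the margin; the powers
      -- of 1 + y will outgrow `C`.
      y = u (2 ℕ.* p ℕ.* τ′)
      ρ = τ * (ι 1 + y)
      0≤ε : ι 0 ≤ ε
      0≤ε = 0≤u 1≤q
      qε : ι q * ε ≡ ι 1
      qε = ι*u 1≤q
      0≤NE : ι 0 ≤ ι N * ι E′ * ι p
      0≤NE = *-nonneg (*-nonneg (0≤ι N) (0≤ι E′)) (0≤ι p)
      4ε≤1 : ι 4 * ε ≤ ι 1
      4ε≤1 = (lin (ι q ∷ ε ∷ ι N ∷ ι E′ ∷ ι p ∷ []) (λ a b c d e → (a :* b ≼ con 1) ∷ ((con 6 :* (c :* d) :* e :+ con 4) :* b ≼ a :* b) ∷ (con 0 ≼ c :* d :* e :* b) ∷ [] ⊢ (con 4 :* b ≼ con 1) by (0 , (1 , 0 ∷ []) ∷ (1 , 1 ∷ []) ∷ (6 , 2 ∷ []) ∷ [])) (≤-reflexive qε) (≤-reflexive (sym (cong (_* ε) ι-q))) (*-nonneg 0≤NE 0≤ε))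
      small : ι 6 * (ι N * E * ε) ≤ u p
      small = (lin (ι p ∷ u p ∷ ι N ∷ ι E′ ∷ ε ∷ E ∷ []) (λ a b c d e E → (b :* (con 6 :* (c :* d) :* a :* e) ≼ b :* con 1) ∷ (c :* d :* e :* con 1 ≼ c :* d :* e :* (a :* b)) ∷ (c :* e :* E ≼ c :* e :* d) ∷ [] ⊢ (con 6 :* (c :* E :* e) ≼ b) by (0 , (1 , 0 ∷ []) ∷ (6 , 1 ∷ []) ∷ (6 , 2 ∷ []) ∷ [])) (*-monoʳ-≤ (0≤u 1≤p) bound) (≤-reflexive (sym (cong (ι N * ι E′ * ε *_) pu))) (*-monoʳ-≤ (*-nonneg (0≤ι N) 0≤ε) E≤))
        where
        pu : ι p * u p ≡ ι 1
        pu = ι*u 1≤p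
        bound : ι 6 * (ι N * ι E′) * ι p * ε ≤ ι 1
        bound = (lin (ι q ∷ ε ∷ ι N ∷ ι E′ ∷ ι p ∷ []) (λ a b c d e → (a :* b ≼ con 1) ∷ ((con 6 :* (c :* d) :* e :+ con 4) :* b ≼ a :* b) ∷ (con 0 ≼ b) ∷ [] ⊢ (con 6 :* (c :* d) :* e :* b ≼ con 1) by (0 , (1 , 0 ∷ []) ∷ (1 , 1 ∷ []) ∷ (4 , 2 ∷ []) ∷ [])) (≤-reflexive qε) (≤-reflexive (sym (cong (_* ε) ι-q))) 0≤ε)
      1≤2pτ : 1 ℕ.≤ 2 ℕ.* p ℕ.* τ′
      1≤2pτ = 1≤-* {2 ℕ.* p} (1≤-* {2} (s≤s z≤n) 1≤p) (s≤s z≤n)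
      0≤y : ι 0 ≤ y
      0≤y = 0≤u 1≤2pτ
      τy : ι 2 * (τ * y) ≤ u p
      τy = (lin (y ∷ τ ∷ ι τ′ ∷ u p ∷ []) (λ y a b c → (y :* a ≼ y :* b) ∷ (con 2 :* b :* y ≼ c) ∷ [] ⊢ (con 2 :* (a :* y) ≼ c) by (0 , (2 , 0 ∷ []) ∷ (1 , 1 ∷ []) ∷ [])) (*-monoʳ-≤ 0≤y τ≤) (≤-reflexive e))
        where
        e : ι 2 * ι τ′ * y ≡ u p
        e = trans (cong (ι 2 * ι τ′ *_) (trans (u-* {2 ℕ.* p} (1≤-* {2} (s≤s z≤n) 1≤p) (s≤s z≤n)) (cong (_* u τ′) (u-* {2} (s≤s z≤n) 1≤p))))
          (trans (ring (ι τ′ ∷ u 2 ∷ u p ∷ u τ′ ∷ []) (λ a b c d → con 2 :* a :* (b :* c :* d) ≈ con 2 :* b :* (a :* d) :* c))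
            (trans (cong₂ (λ a b → a * b * u p) (ι*u {2} (s≤s z≤n)) (ι*u {τ′} (s≤s z≤n))) (ring (u p ∷ []) (λ a → con 1 :* con 1 :* a ≈ a))))

      c : R
      -- Three losses of ε: the prime number theorem, the bounded errors `K₂`, and the rounding of
      -- the exponent `J`.
      c = ι 1 - ι 3 * ε
      0≤c : ι 0 ≤ c
      0≤c = (lin (ε ∷ []) (λ a → (con 4 :* a ≼ con 1) ∷ [] ⊢ (con 0 ≼ con 1 :- con 3 :* a) by (3 , (1 , []) ∷ (3 , 0 ∷ []) ∷ [])) 4ε≤1)
      c≤1 : c ≤ ι 1
      c≤1 = (lin (ε ∷ []) (λ a → (con 0 ≼ a) ∷ [] ⊢ (con 1 :- con 3 :* a ≼ con 1) by (0 , (3 , 0 ∷ []) ∷ [])) 0≤ε)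
      ρ≤ : ρ ≤ expR (c * h) N
      ρ≤ = ≤-trans (lin (τ ∷ y ∷ u p ∷ E ∷ ι N ∷ ε ∷ []) (λ a y b E c d → (con 2 :* (a :* y) ≼ b) ∷ (b ≼ E :- a) ∷ (con 6 :* (c :* E :* d) ≼ b) ∷ [] ⊢ (a :* (con 1 :+ y) ≼ (con 1 :- c :* (con 3 :* d)) :* E) by (1 , (1 , 0 ∷ []) ∷ (2 , 1 ∷ []) ∷ (1 , 2 ∷ []) ∷ [])) τy u≤δ small)
         (≤-trans (lin (ι N ∷ ε ∷ pw c N ∷ E ∷ []) (λ a b c E → (con 1 :- a :* (con 3 :* b) ≼ c) ∷ (con 1 ≼ E) ∷ [] ⊢ ((con 1 :- a :* (con 3 :* b)) :* E ≼ c :* E) by (0 , (1 , 0 ∷ []) ∷ (1 , 0 ∷ 1 ∷ []) ∷ [])) (bernoulli-minus 0≤3ε 3ε≤1 N) (1≤expR 0≤h N))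
           (expR-scale 0≤c c≤1 0≤h {N} {N} ℕₚ.≤-refl))
        where
        0≤3ε : ι 0 ≤ ι 3 * ε
        0≤3ε = (lin (ε ∷ []) (λ a → (con 0 ≼ a) ∷ [] ⊢ (con 0 ≼ con 3 :* a) by (0 , (3 , 0 ∷ []) ∷ [])) 0≤ε)
        3ε≤1 : ι 3 * ε ≤ ι 1
        3ε≤1 = (lin (ε ∷ []) (λ a → (con 0 ≼ con 1 :- con 3 :* a) ∷ [] ⊢ (con 3 :* a ≼ con 1) by (0 , (1 , 0 ∷ []) ∷ [])) 0≤c)
      0≤ρ : ι 0 ≤ ρ
      0≤ρ = *-nonneg 0≤τ (lin (y ∷ []) (λ y → (con 0 ≼ y) ∷ [] ⊢ (con 0 ≼ con 1 :+ y) by (0 , (1 , []) ∷ (1 , 0 ∷ []) ∷ [])) 0≤y)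

    opaque
      K₀ : ℕ
      -- The summands ensure in turn that `k` exceeds `m`, that `K₂` is at most ε k, and that `k y`
      -- is at least `C`.
      K₀ = suc m ℕ.+ K₂ ℕ.* q ℕ.+ C′ ℕ.* W
      m<K₀ : m ℕ.< K₀
      m<K₀ = (linℕ (m ∷ K₂ ∷ q ∷ C′ ∷ W ∷ []) (λ m a q C′ W → (con 0 ≼ a) ∷ (con 0 ≼ q) ∷ (con 0 ≼ C′) ∷ (con 0 ≼ W) ∷ [] ⊢ (con 1 :+ m ≼ con 1 :+ m :+ a :* q :+ C′ :* W) by (0 , (1 , 0 ∷ 1 ∷ []) ∷ (1 , 2 ∷ 3 ∷ []) ∷ [])) ℕ.z≤n ℕ.z≤n ℕ.z≤n ℕ.z≤n)
      K₂q≤K₀ : K₂ ℕ.* q ℕ.≤ K₀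
      K₂q≤K₀ = (linℕ (K₂ ∷ q ∷ m ∷ C′ ∷ W ∷ []) (λ a q m C′ W → (con 0 ≼ m) ∷ (con 0 ≼ C′) ∷ (con 0 ≼ W) ∷ [] ⊢ (a :* q ≼ con 1 :+ m :+ a :* q :+ C′ :* W) by (0 , (1 , []) ∷ (1 , 0 ∷ []) ∷ (1 , 1 ∷ 2 ∷ []) ∷ [])) ℕ.z≤n ℕ.z≤n ℕ.z≤n)
      C′W≤K₀ : C′ ℕ.* W ℕ.≤ K₀
      C′W≤K₀ = (linℕ (C′ ∷ W ∷ m ∷ K₂ ∷ q ∷ []) (λ C′ W m a q → (con 0 ≼ m) ∷ (con 0 ≼ a) ∷ (con 0 ≼ q) ∷ [] ⊢ (C′ :* W ≼ con 1 :+ m :+ a :* q :+ C′ :* W) by (0 , (1 , []) ∷ (1 , 0 ∷ []) ∷ (1 , 1 ∷ 2 ∷ []) ∷ [])) ℕ.z≤n ℕ.z≤n ℕ.z≤n)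

    module Vanish (k j : ℕ) (m+j : m ℕ.+ j ≡ k) (K₀≤k : K₀ ℕ.≤ k) where
      open Integrality s m base k using (denominator; 1≤denominator; range-integral)
      P V B : ℕ
      P = denominator j
      V = 2 ℕ.* k
      -- The base 1 + 1/B is fine enough for three purposes: V³ ≤ B makes `L` an approximate
      -- logarithm up to `V`, P ≤ B keeps the rounding at the primes of `P` below 1, and 2 q ≤ B
      -- gives 2/B ≤ ε.
      B = suc (V ℕ.* (V ℕ.* V) ℕ.+ P ℕ.+ 2 ℕ.* q)
      1≤B : 1 ℕ.≤ B
      1≤B = s≤s z≤n
      open ApproximateLogarithm.LogBase B 1≤B
      V³≤B : V ℕ.* (V ℕ.* V) ℕ.≤ B
      V³≤B = (linℕ (V ∷ P ∷ q ∷ []) (λ V P q → (con 0 ≼ P) ∷ (con 0 ≼ q) ∷ [] ⊢ (V :* (V :* V) ≼ con 1 :+ (V :* (V :* V) :+ P :+ con 2 :* q)) by (0 , (1 , []) ∷ (1 , 0 ∷ []) ∷ (2 , 1 ∷ []) ∷ [])) ℕ.z≤n ℕ.z≤n)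
      P≤B : P ℕ.≤ B
      P≤B = (linℕ (P ∷ V ∷ q ∷ []) (λ P V q → (con 0 ≼ V) ∷ (con 0 ≼ q) ∷ [] ⊢ (P ≼ con 1 :+ (V :* (V :* V) :+ P :+ con 2 :* q)) by (0 , (1 , []) ∷ (2 , 1 ∷ []) ∷ (1 , 0 ∷ 0 ∷ 0 ∷ []) ∷ [])) ℕ.z≤n ℕ.z≤n)
      2q≤B : 2 ℕ.* q ℕ.≤ B
      2q≤B = (linℕ (q ∷ V ∷ P ∷ []) (λ q V P → (con 0 ≼ V) ∷ (con 0 ≼ P) ∷ [] ⊢ (con 2 :* q ≼ con 1 :+ (V :* (V :* V) :+ P :+ con 2 :* q)) by (0 , (1 , []) ∷ (1 , 1 ∷ []) ∷ (1 , 0 ∷ 0 ∷ 0 ∷ []) ∷ [])) ℕ.z≤n ℕ.z≤n)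
      ls : LogSys V L
      ls = logSys {V} V³≤B
      open LogSys ls using (ψ)
      open LogFactorial ls
      1≤k : 1 ℕ.≤ k
      1≤k = ℕₚ.≤-trans (s≤s z≤n) (ℕₚ.≤-trans m<K₀ K₀≤k)
      m≤k : m ℕ.≤ k
      m≤k = ℕₚ.≤-trans (ℕₚ.m≤m+n m j) (ℕₚ.≤-reflexive m+j)
      1≤P : 1 ℕ.≤ P
      1≤P = 1≤denominator j
      κ : R
      κ = ι k

      each : ∀ r → 1 ℕ.≤ r → r ℕ.≤ m → (ι 1 - ε) * (κ * u r) - (ι K₁ + ι 1) ≤ ψ (k ÷ r)
      each r a b = (lin (ι x ∷ ψ x ∷ ε ∷ ι K₁ ∷ κ ∷ u r ∷ []) (λ a b c d e f → (a ≼ b :+ c :* a :+ d) ∷ (e :* f ≼ a :+ con 1) ∷ (a ≼ e :* f) ∷ (con 0 ≼ c) ∷ [] ⊢ ((con 1 :- c) :* (e :* f) :- (d :+ con 1) ≼ b) by (0 , (1 , 0 ∷ []) ∷ (1 , 1 ∷ []) ∷ (1 , 2 ∷ 3 ∷ []) ∷ [])) (ψ-lower ls {x} (1≤÷ a (ℕₚ.≤-trans b m≤k)) (ℕₚ.*-monoʳ-≤ 2 (÷-≤ k r))) (ι-÷-> k a) (ι-÷-≤ k a) 0≤ε)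
        where
        x : ℕ
        x = k ÷ r

      ∑ψ-lower : (ι 1 - ε) * (κ * h) - ι m * (ι K₁ + ι 1) ≤ ∑ m (λ r → ψ (k ÷ r))
      ∑ψ-lower = ≤-trans (≤-reflexive (sym (trans (∑-- m _ _) (cong₂ _-_ (trans (∑-*ˡ m (ι 1 - ε) _) (cong ((ι 1 - ε) *_) (∑-*ˡ m κ u))) (∑-const m (ι K₁ + ι 1)))))) (∑-mono m each)

      log-difference : ι (A (k !)) * u B ≡ ι (A P) * u B + ∑ m (λ r → ψ (k ÷ r))
      log-difference = (≤-antisym (lin (ι (A (k !)) ∷ u B ∷ ∑ (m ℕ.+ j) (λ r → ψ (k ÷ r)) ∷ ι (A P) ∷ ∑ m (λ r → ψ (k ÷ r)) ∷ []) (λ a b c d e → (a :* b ≼ c) ∷ (c :- e ≼ d :* b) ∷ [] ⊢ (a :* b ≼ d :* b :+ e) by (0 , (1 , 0 ∷ []) ∷ (1 , 1 ∷ []) ∷ [])) (≤-reflexive (trans (L-! k) (trans (T≡∑ψ k) (cong (λ t → ∑ t (λ r → ψ (k ÷ r))) (sym m+j))))) (≤-reflexive (sym (L-denominator s m base k j)))) (lin (ι (A (k !)) ∷ u B ∷ ∑ (m ℕ.+ j) (λ r → ψ (k ÷ r)) ∷ ι (A P) ∷ ∑ m (λ r → ψ (k ÷ r)) ∷ []) (λ a b c d e → (c ≼ a :* b) ∷ (d :* b ≼ c :- e) ∷ [] ⊢ (d :* b :+ e ≼ a :* b) by (0 , (1 , 0 ∷ []) ∷ (1 , 1 ∷ [])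 ∷ [])) (≤-reflexive (sym (trans (L-! k) (trans (T≡∑ψ k) (cong (λ t → ∑ t (λ r → ψ (k ÷ r))) (sym m+j)))))) (≤-reflexive (L-denominator s m base k j))))

      A₁ A₂ : ℕ
      -- As exponents of `b`, `A₁` is a lower bound for k! and `A₂` an upper bound for `P`, so b to
      -- the power A₁ - A₂ bounds k!/P from below.
      A₁ = A (k !)
      A₂ = A P ℕ.+ Ω P

      gap : ι A₂ * u B + (ι 1 - ι 2 * ε) * (κ * h) ≤ ι A₁ * u B
      gap = (lin (ι A₁ ∷ u B ∷ ι (A P) ∷ ∑ m (λ r → ψ (k ÷ r)) ∷ ε ∷ κ ∷ h ∷ ι m ∷ ι K₁ ∷ ι A₂ ∷ ι (Ω P) ∷ ι K₂ ∷ []) (λ a b c d e f h g i j k l → (c :* b :+ d ≼ a :* b) ∷ ((con 1 :- e) :* (f :* h) :- g :* (i :+ con 1) ≼ d) ∷ (j :* b ≼ (c :+ k) :* b) ∷ (k :* b ≼ con 1) ∷ (l ≼ e :* (f :* h)) ∷ (g :* (i :+ con 1) :+ con 1 ≼ l) ∷ [] ⊢ (j :* b :+ (con 1 :- con 2 :* e) :* (f :* h) ≼ a :* b) by (0 , (1 , 0 ∷ []) ∷ (1 , 1 ∷ []) ∷ (1 , 2 ∷ []) ∷ (1 , 3 ∷ []) ∷ (1 , 4 ∷ []) ∷ (1 , 5 ∷ []) ∷ [])) (≤-reflexive (sym log-difference)) ∑ψ-lower (≤-reflexive (cong (_* u B) (ι-+ (A P) (Ω P)))) Ωu large (≤-reflexive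 (sym (trans (ι-+ (m ℕ.* (K₁ ℕ.+ 1)) 1) (cong (_+ ι 1) (trans (ι-* m _) (cong (ι m *_) (ι-+ K₁ 1))))))))
        where
        0≤uB : ι 0 ≤ u B
        0≤uB = 0≤u 1≤B
        Ωu : ι (Ω P) * u B ≤ ι 1
        Ωu = (lin (ι (Ω P) ∷ ι B ∷ u B ∷ []) (λ a b c → (a ≼ b) ∷ (con 0 ≼ c) ∷ (b :* c ≼ con 1) ∷ [] ⊢ (a :* c ≼ con 1) by (0 , (1 , 2 ∷ []) ∷ (1 , 0 ∷ 1 ∷ []) ∷ [])) (ι-mono (ℕₚ.≤-trans (Ω≤ 1≤P) P≤B)) 0≤uB (≤-reflexive (ι*u 1≤B)))
        K₂q≤k : K₂ ℕ.* q ℕ.≤ k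
        K₂q≤k = ℕₚ.≤-trans K₂q≤K₀ K₀≤k
        K₂≤ : ι K₂ ≤ ε * κ
        K₂≤ = (lin (ε ∷ ι K₂ ∷ ι q ∷ κ ∷ []) (λ a b c d → (a :* (b :* c) ≼ a :* d) ∷ (b :* con 1 ≼ b :* (c :* a)) ∷ [] ⊢ (b ≼ a :* d) by (0 , (1 , 0 ∷ []) ∷ (1 , 1 ∷ []) ∷ [])) (*-monoʳ-≤ 0≤ε (≤-trans (≤-reflexive (sym (ι-* K₂ q))) (ι-mono K₂q≤k))) (≤-reflexive (sym (cong (ι K₂ *_) qε))))
        large : ι K₂ ≤ ε * (κ * h)
        large = (lin (ι K₂ ∷ ε ∷ κ ∷ h ∷ []) (λ a b c h → (a ≼ b :* c) ∷ (b :* c :* con 1 ≼ b :* c :* h) ∷ [] ⊢ (a ≼ b :* (c :* h)) by (0 , (1 , 0 ∷ []) ∷ (1 , 1 ∷ []) ∷ [])) K₂≤ (*-monoʳ-≤ (*-nonneg 0≤ε (0≤ι k)) 1≤h))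

      A₂≤A₁ : A₂ ℕ.≤ A₁
      A₂≤A₁ = ι-cancel-≤ (unscale (≤-trans nonneg gap))
        where
        unscale : ∀ {a b} → a * u B ≤ b * u B → a ≤ b
        unscale {a} {b} h = (lin (ι B ∷ a ∷ u B ∷ b ∷ []) (λ c a d b → (c :* (a :* d) ≼ c :* (b :* d)) ∷ (a :* con 1 ≼ a :* (c :* d)) ∷ (b :* (c :* d) ≼ b :* con 1) ∷ [] ⊢ (a ≼ b) by (0 , (1 , 0 ∷ []) ∷ (1 , 1 ∷ []) ∷ (1 , 2 ∷ []) ∷ [])) (*-monoʳ-≤ (0≤ι B) h) (≤-reflexive (sym (cong (a *_) (ι*u 1≤B)))) (≤-reflexive (cong (b *_) (ι*u 1≤B))))
        nonneg : ι A₂ * u B ≤ ι A₂ * u B + (ι 1 - ι 2 * ε) * (κ * h)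
        nonneg = (lin (ε ∷ κ ∷ h ∷ ι A₂ ∷ u B ∷ []) (λ a b h c d → (con 0 ≼ (con 1 :- con 2 :* a) :* (b :* h)) ∷ [] ⊢ (c :* d ≼ c :* d :+ (con 1 :- con 2 :* a) :* (b :* h)) by (0 , (1 , 0 ∷ []) ∷ [])) (*-nonneg 0≤c′ (*-nonneg (0≤ι k) 0≤h)))
          where
          0≤c′ : ι 0 ≤ ι 1 - ι 2 * ε
          0≤c′ = (lin (ε ∷ []) (λ a → (con 0 ≼ con 1 :- con 3 :* a) ∷ [] ⊢ (con 0 ≼ con 1 :- con 2 :* a) by (2 , (1 , []) ∷ (2 , 0 ∷ []) ∷ [])) 0≤c)

      t J : ℕ
      t = A₁ ℕ.∸ A₂
      -- The integer exponent per unit of k: b^t is at least the k-th power of b^J, so the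
      -- comparison with ρ^k reduces to ρ ≤ b^J and no root is taken.
      J = t ÷ k
      A₂+t : A₂ ℕ.+ t ≡ A₁
      A₂+t = ℕₚ.m+[n∸m]≡n A₂≤A₁
      w v : R
      w = u B
      v = u (suc B)
      0≤w : ι 0 ≤ w
      0≤w = 0≤u 1≤B
      0≤v : ι 0 ≤ v
      0≤v = 0≤u (s≤s z≤n)
      v≤w : v ≤ w
      v≤w = u-anti 1≤B (ℕₚ.n≤1+n B)
      v≤1 : v ≤ ι 1
      v≤1 = u≤1 {suc B} (s≤s z≤n)
      2w≤ε : ι 2 * w ≤ ε
      2w≤ε = (lin (ε ∷ w ∷ ι q ∷ ι B ∷ []) (λ a w b c → (a :* w :* (con 2 :* b) ≼ a :* w :* c) ∷ (con 2 :* w :* con 1 ≼ con 2 :* w :* (b :* a)) ∷ (a :* (c :* w) ≼ a :* con 1) ∷ [] ⊢ (con 2 :* w ≼ a) by (0 , (1 , 0 ∷ []) ∷ (1 , 1 ∷ []) ∷ (1 , 2 ∷ []) ∷ [])) (*-monoʳ-≤ (*-nonneg 0≤ε 0≤w) (≤-trans (≤-reflexive (sym (ι-* 2 q))) (ι-mono 2q≤B))) (≤-reflexive (sym (cong (ι 2 * w *_) qε))) (≤-reflexive (cong (ε *_) (ι*u 1≤B))))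
      rate : (ι 1 - ι 2 * ε) * h ≤ (ι J + ι 1) * w
      rate = *-cancel-≤ (1≤ι 1≤k) (lin (ι A₂ ∷ w ∷ ε ∷ κ ∷ h ∷ ι A₁ ∷ ι t ∷ ι J ∷ []) (λ a w b c h d e f → (a :* w :+ (con 1 :- con 2 :* b) :* (c :* h) ≼ d :* w) ∷ (d :* w ≼ (a :+ e) :* w) ∷ (e :* w ≼ c :* (con 1 :+ f) :* w) ∷ [] ⊢ (c :* ((con 1 :- con 2 :* b) :* h) ≼ c :* ((f :+ con 1) :* w)) by (0 , (1 , 0 ∷ []) ∷ (1 , 1 ∷ []) ∷ (1 , 2 ∷ []) ∷ [])) gap (≤-reflexive (cong (_* w) (trans (cong ι (sym A₂+t)) (ι-+ A₂ t)))) tw)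
        where
        tw : ι t * w ≤ κ * (ι 1 + ι J) * w
        tw = (lin (ι t ∷ κ ∷ ι J ∷ w ∷ []) (λ a b c w → (a ≼ b :* (con 1 :+ c)) ∷ (con 0 ≼ w) ∷ [] ⊢ (a :* w ≼ b :* (con 1 :+ c) :* w) by (0 , (1 , 0 ∷ 1 ∷ []) ∷ [])) (≤-trans (ι-mono (ℕₚ.<⇒≤ (÷-upper t 1≤k))) (≤-reflexive (trans (ι-* k (suc J)) (cong (κ *_) (ι-suc J))))) 0≤w)
      -- Rounding `t ÷ k` down and replacing 1/B by 1/(B+1), as `expR≤pw` requires, costs a bounded
      -- multiple of 1/B; the third ε pays for it.
      ch≤Jv : c * h ≤ ι J * v
      ch≤Jv = (lin (ι J ∷ v ∷ w ∷ ε ∷ h ∷ []) (λ a v w b h → (a :* w :* (con 1 :- v) ≼ a :* v) ∷ ((con 1 :- v) :* ((con 1 :- con 2 :* b) :* h :- w) ≼ (con 1 :- v) :* (a :* w)) ∷ (con 0 ≼ v :* b :* h) ∷ (con 0 ≼ v :* w) ∷ (v :* h ≼ w :* h) ∷ (w :* con 1 ≼ w :* h) ∷ (con 2 :* w :* h ≼ b :* h) ∷ [] ⊢ ((con 1 :- con 3 :* b) :* h ≼ a :* v) by (0 , (1 , 0 ∷ []) ∷ (1 , 1 ∷ []) ∷ (2 , 2 ∷ []) ∷ (1 , 3 ∷ []) ∷ (1 , 4 ∷ []) ∷ (1 , 5 ∷ []) ∷ (1 , 6 ∷ []) ∷ [])) (≤-reflexive (sym Jv)) (*-monoʳ-≤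 0≤1-v (rate′)) (*-nonneg (*-nonneg 0≤v 0≤ε) 0≤h) (*-nonneg 0≤v 0≤w) vh wh εh)
        where
        0≤1-v : ι 0 ≤ ι 1 - v
        0≤1-v = (lin (v ∷ []) (λ v → (v ≼ con 1) ∷ [] ⊢ (con 0 ≼ con 1 :- v) by (0 , (1 , 0 ∷ []) ∷ [])) v≤1)
        rate′ : (ι 1 - ι 2 * ε) * h - w ≤ ι J * w
        rate′ = (lin (ε ∷ h ∷ ι J ∷ w ∷ []) (λ a h b w → ((con 1 :- con 2 :* a) :* h ≼ (b :+ con 1) :* w) ∷ [] ⊢ ((con 1 :- con 2 :* a) :* h :- w ≼ b :* w) by (0 , (1 , 0 ∷ []) ∷ [])) rate)
        Jv : ι J * v ≡ ι J * w * (ι 1 - v)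
        Jv = (≤-antisym (lin (ι J ∷ w ∷ v ∷ []) (λ a w v → (a :* (w :* v) ≼ a :* (w :- v)) ∷ [] ⊢ (a :* v ≼ a :* w :* (con 1 :- v)) by (0 , (1 , 0 ∷ []) ∷ [])) (≤-reflexive (sym (cong (ι J *_) (u-step 1≤B))))) (lin (ι J ∷ w ∷ v ∷ []) (λ a w v → (a :* (w :- v) ≼ a :* (w :* v)) ∷ [] ⊢ (a :* w :* (con 1 :- v) ≼ a :* v) by (0 , (1 , 0 ∷ []) ∷ [])) (≤-reflexive (cong (ι J *_) (u-step 1≤B)))))
        vh : v * h ≤ w * h
        vh = (lin (v ∷ w ∷ h ∷ []) (λ v w h → (v ≼ w) ∷ (con 0 ≼ h) ∷ [] ⊢ (v :* h ≼ w :* h) by (0 , (1 , 0 ∷ 1 ∷ []) ∷ [])) v≤w 0≤h)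
        wh : w * ι 1 ≤ w * h
        wh = *-monoʳ-≤ 0≤w 1≤h
        εh : ι 2 * w * h ≤ ε * h
        εh = (lin (w ∷ ε ∷ h ∷ []) (λ w a h → (con 2 :* w ≼ a) ∷ (con 0 ≼ h) ∷ [] ⊢ (con 2 :* w :* h ≼ a :* h) by (0 , (1 , 0 ∷ 1 ∷ []) ∷ [])) 2w≤ε 0≤h)

      -- `ρ` is at most the truncated exponential at `c h`, hence at J/(B+1), hence at most b^J; and
      -- J k ≤ t.
      pwρ≤ : pw ρ k ≤ pw b t
      pwρ≤ = ≤-trans (pw-mono 0≤ρ (≤-trans ρ≤ (≤-trans (expR-mono (*-nonneg 0≤c 0≤h) ch≤Jv N) (expR≤pw B 1≤B N J))) k)
        (≤-trans (≤-reflexive (sym (pw-pw b J k))) (pw-mono-exp 1≤b (ℕₚ.≤-trans (ℕₚ.≤-reflexive (ℕₚ.*-comm J k)) (÷-lower t k))))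

      Θ : R
      Θ = pw τ k
      1≤Θ : ι 1 ≤ Θ
      1≤Θ = 1≤pw 1≤τ k

      -- By Bernoulli's inequality (1 + y)^k is at least 1 + k y, and k y is at least `C`.
      pwρ≥ : Θ * (ι 1 + C) ≤ pw ρ k
      pwρ≥ = ≤-trans (*-monoʳ-≤ (≤-trans (0≤ι 1) 1≤Θ) (≤-trans (lin (C ∷ κ ∷ y ∷ []) (λ C a y → (C ≼ a :* y) ∷ [] ⊢ (con 1 :+ C ≼ con 1 :+ a :* y) by (0 , (1 , 0 ∷ []) ∷ [])) C≤κy) (bernoulli 0≤y k))) (≤-reflexive (sym (pw-* τ (ι 1 + y) k)))
        where
        C≤κy : C ≤ κ * y
        C≤κy = (lin (C ∷ ι C′ ∷ y ∷ ι W ∷ κ ∷ []) (λ C a y b c → (C ≼ a) ∷ (y :* (a :* b) ≼ y :* c) ∷ (a :* con 1 ≼ a :* (b :* y)) ∷ [] ⊢ (C ≼ c :* y) by (0 , (1 , 0 ∷ []) ∷ (1 , 1 ∷ []) ∷ (1 , 2 ∷ []) ∷ [])) C≤ (*-monoʳ-≤ 0≤y (≤-trans (≤-reflexive (sym (ι-* C′ W))) (ι-mono (ℕₚ.≤-trans C′W≤K₀ K₀≤k)))) (≤-reflexive (sym (cong (ι C′ *_) (ι*u {W} 1≤2pτ)))))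

      factorial-large : ι P * (Θ * (ι 1 + C)) ≤ ι (k !)
      factorial-large = ≤-trans (*-mono-≤ (0≤ι P) 0≤x (A-upper 1≤P) (≤-trans pwρ≥ pwρ≤)) (≤-trans (≤-reflexive (trans (sym (pw-+ b A₂ t)) (cong (pw b) A₂+t))) (A-lower (1≤! k)))
        where
        0≤x : ι 0 ≤ Θ * (ι 1 + C)
        0≤x = (lin (Θ ∷ C ∷ []) (λ a C → (con 1 ≼ a) ∷ (con 0 ≼ C) ∷ [] ⊢ (con 0 ≼ a :* (con 1 :+ C)) by (0 , (1 , []) ∷ (1 , 0 ∷ []) ∷ (1 , 1 ∷ []) ∷ (1 , 0 ∷ 1 ∷ []) ∷ [])) 1≤Θ 0≤C)

      D z : R
      D = Δ s k 0
      z = ι P * dd s (range 0 k)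
      PD : ι P * D ≡ ι (k !) * z
      PD = trans (cong (ι P *_) (Δ≡dd s k 0)) (ring (ι P ∷ ι (k !) ∷ dd s (range 0 k) ∷ []) (λ a b c → a :* (b :* c) ≈ b :* (a :* c)))
      D-within : Within (C * Θ) D
      D-within = abs-within (≤-trans (Δ-bound k 0) (≤-reflexive (cong (_* Θ) (*-identityʳ C))))
      1≤PΘ : ι 1 ≤ ι P * Θ
      1≤PΘ = (lin (ι P ∷ Θ ∷ []) (λ a b → (con 1 ≼ a) ∷ (con 1 ≼ b) ∷ [] ⊢ (con 1 ≼ a :* b) by (0 , (1 , 0 ∷ []) ∷ (1 , 1 ∷ []) ∷ (1 , 0 ∷ 1 ∷ []) ∷ [])) (1≤ι 1≤P) 1≤Θ)

      -- By `PD`, |z| ≥ 1 would give k! ≤ P |D| ≤ P C Θ, while `factorial-large` says that k! is at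
      -- least P Θ (1 + C).
      z-small : abs z < ι 1
      z-small h with abs-cases z
      ... | inj₁ e = 1≰0 (lin (ι (k !) ∷ z ∷ ι P ∷ D ∷ C ∷ Θ ∷ []) (λ a z b D C c → (a :* con 1 ≼ a :* z) ∷ (a :* z ≼ b :* D) ∷ (b :* D ≼ b :* (C :* c)) ∷ (b :* (c :* (con 1 :+ C)) ≼ a) ∷ (con 1 ≼ b :* c) ∷ [] ⊢ (con 1 ≼ con 0) by (0 , (1 , 0 ∷ []) ∷ (1 , 1 ∷ []) ∷ (1 , 2 ∷ []) ∷ (1 , 3 ∷ []) ∷ (1 , 4 ∷ []) ∷ [])) (*-monoʳ-≤ (0≤ι (k !)) (≤-trans h (≤-reflexive e))) (≤-reflexive (sym PD)) (*-monoʳ-≤ (0≤ι P) (proj₂ D-within)) factorial-large 1≤PΘ)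
      ... | inj₂ e = 1≰0 (lin (ι (k !) ∷ z ∷ ι P ∷ D ∷ C ∷ Θ ∷ []) (λ a z b D C c → (a :* con 1 ≼ a :* (con 0 :- z)) ∷ (b :* D ≼ a :* z) ∷ (b :* (con 0 :- C :* c) ≼ b :* D) ∷ (b :* (c :* (con 1 :+ C)) ≼ a) ∷ (con 1 ≼ b :* c) ∷ [] ⊢ (con 1 ≼ con 0) by (0 , (1 , 0 ∷ []) ∷ (1 , 1 ∷ []) ∷ (1 , 2 ∷ []) ∷ (1 , 3 ∷ []) ∷ (1 , 4 ∷ []) ∷ [])) (*-monoʳ-≤ (0≤ι (k !)) (≤-trans h (≤-reflexive e))) (≤-reflexive PD) (*-monoʳ-≤ (0≤ι P) (proj₁ D-within)) factorial-large 1≤PΘ)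

      vanish : D ≡ ι 0
      vanish = ≤-antisym (*-cancel-≤ (1≤ι 1≤P) (≤-reflexive PD0)) (*-cancel-≤ (1≤ι 1≤P) (≤-reflexive (sym PD0)))
        where
        PD0 : ι P * D ≡ ι P * ι 0
        PD0 = trans PD (trans (cong (ι (k !) *_) (int-small (range-integral j m+j) z-small)) (trans (*-zeroʳ _) (sym (*-zeroʳ _))))

    polynomial : ∃ λ f → ∀ n → s n ≡ evalR f (ι n)
    polynomial = newtonPoly s K₀ , newton s K₀ (λ k K₀≤k → Vanish.vanish k (k ℕ.∸ m) (ℕₚ.m+[n∸m]≡n (ℕₚ.≤-trans (ℕₚ.<⇒≤ m<K₀) K₀≤k)) K₀≤k)

-- Return to the rationals and the definitions of the statement

module Transfer where
  open SealedRationals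
  open LinearArithmetic
  open FiniteSums
  open LogarithmicSums using (H)
  open ApproximateLogarithm using (pw)
  open DividedDifferences
  open NewtonInterpolation using (evalR; cancel-ι)
  open VanishingDifferences
  import Defs as D
  open import Data.Integer.Base as ℤ using (ℤ; -[1+_]; +[1+_]) renaming (+_ to pos)
  import Data.Integer.Properties as ℤₚ
  open import Data.Rational as ℚ using (ℚ; mkℚ)
  import Data.Rational.Properties as ℚₚ
  import Data.Rational.Unnormalised as ℚᵘ
  import Data.Rational.Unnormalised.Properties as ℚᵘₚ
  open import Data.Fin.Base using (Fin; zero; suc)
  import Data.Fin.Properties as Finₚ
  open import Data.List.Base using (length; lookup; map)
  open import Data.List.Relation.Unary.All as All using (All)
  open import Data.List.Relation.Unary.AllPairs using ([]; _∷_)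
  open import Data.List.Membership.Propositional.Properties using (∈-lookup)
  open import Function.Definitions using (Injective)

  opaque
    unfolding R ι fromℚ u _≤_

    /1≡ιℤ : ∀ z → fromℚ (z ℚ./ 1) ≡ ιℤ z
    /1≡ιℤ z = ℚₚ.↥p/↧p≡p (mkℚ z 0 _)

    from-+ : ∀ x y → fromℚ (x ℚ.+ y) ≡ fromℚ x + fromℚ y
    from-+ x y = refl

    from-* : ∀ x y → fromℚ (x ℚ.* y) ≡ fromℚ x * fromℚ y
    from-* x y = refl

    from-- : ∀ x y → fromℚ (x ℚ.- y) ≡ fromℚ x - fromℚ y
    from-- x y = refl

    from-0 : fromℚ ℚ.0ℚ ≡ ι 0
    from-0 = refl

    from-1 : fromℚ ℚ.1ℚ ≡ ι 1
    from-1 = refl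

    from-≤ : ∀ {x y} → x ℚ.≤ y → fromℚ x ≤ fromℚ y
    from-≤ p = p

    from-< : ∀ {x y} → x ℚ.< y → fromℚ x < fromℚ y
    from-< p q = ℚₚ.<-irrefl refl (ℚₚ.<-≤-trans p q)

    from-injective : ∀ {x y} → fromℚ x ≡ fromℚ y → x ≡ y
    from-injective e = e

    from-to : ∀ x → fromℚ (toℚ x) ≡ x
    from-to x = refl

    from-inv : ∀ x → fromℚ (D.inv x) ≡ inv (fromℚ x)
    from-inv x@(mkℚ (pos zero) _ _) with x ℚ.≟ ℚ.0ℚ
    ... | yes _ = refl
    ... | no x≢0 = ⊥-elim (x≢0 (ℚₚ.↥p≡0⇒p≡0 x refl))
    from-inv x@(mkℚ +[1+ _ ] _ _) with x ℚ.≟ ℚ.0ℚ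
    ... | yes ()
    ... | no _ = refl
    from-inv x@(mkℚ -[1+ _ ] _ _) with x ℚ.≟ ℚ.0ℚ
    ... | yes ()
    ... | no _ = refl

    u≡inv : ∀ n → u n ≡ inv (ι n)
    u≡inv n = refl

    unit-fraction : ∀ n → ι (suc n) * fromℚ (pos 1 ℚ./ suc n) ≡ ι 1
    unit-fraction n = ℚₚ.toℚᵘ-injective (ℚᵘₚ.≃-trans (ℚₚ.toℚᵘ-homo-* (ι (suc n)) (pos 1 ℚ./ suc n))
      (ℚᵘₚ.≃-trans (ℚᵘₚ.*-congˡ {ℚ.toℚᵘ (ι (suc n))} (ℚₚ.toℚᵘ-fromℚᵘ (ℚᵘ.mkℚᵘ (pos 1) n)))
        (ℚᵘ.*≡* (trans (ℤₚ.*-identityʳ (pos (suc n) ℤ.* pos 1)) (trans (ℤₚ.*-identityʳ (pos (suc n))) (sym (trans (ℤₚ.*-identityˡ (pos 1 ℤ.* pos (suc n))) (ℤₚ.*-identityˡ (pos (suc n))))))))))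

  from-ℕ : ∀ n → fromℚ (D.ℕ→ℚ n) ≡ ι n
  from-ℕ n = trans (/1≡ιℤ (pos n)) (ιℤ-pos n)

  from-abs : ∀ x → abs (fromℚ x) ≤ fromℚ (ℚ.∣ x ∣)
  from-abs x = abs-lub (from-≤ (x≤∣x∣ x)) (≤-trans (≤-reflexive (trans (cong (_- fromℚ x) (sym from-0)) (sym (from-- ℚ.0ℚ x))))
    (from-≤ (subst₂ ℚ._≤_ (sym (ℚₚ.+-identityˡ (ℚ.- x))) (ℚₚ.∣-p∣≡∣p∣ x) (x≤∣x∣ (ℚ.- x)))))
    where
    x≤∣x∣ : ∀ x → x ℚ.≤ ℚ.∣ x ∣
    x≤∣x∣ x with ℚₚ.≤-total ℚ.0ℚ x
    ... | inj₁ p = ℚₚ.≤-reflexive (sym (ℚₚ.0≤p⇒∣p∣≡p p))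
    ... | inj₂ p = ℚₚ.≤-trans p (ℚₚ.0≤∣p∣ x)

  from-^ : ∀ x n → fromℚ (x D.^ n) ≡ pw (fromℚ x) n
  from-^ x zero = from-1
  from-^ x (suc n) = trans (from-* x _) (cong (fromℚ x *_) (from-^ x n))

  from-expPartial : ∀ x N → fromℚ (D.expPartial x N) ≡ expR (fromℚ x) N
  from-expPartial x zero = from-1
  from-expPartial x (suc N) = trans (from-+ _ _) (cong₂ _+_ (from-expPartial x N) (trans (from-* _ _)
    (cong₂ _*_ (from-^ x (suc N)) (trans (from-inv _) (trans (cong inv (from-ℕ (suc N !))) (sym (u≡inv (suc N !))))))))

  from-harmonic : ∀ m → fromℚ (D.harmonic m) ≡ H m
  from-harmonic zero = from-0
  from-harmonic (suc m) = trans (from-+ _ _) (cong₂ _+_ (from-harmonic m)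
    (cancel-ι m (trans (unit-fraction m) (sym (ι*u {suc m} (s≤s z≤n))))))

  from-integer : ∀ {x} → D.IsInteger x → IsInt (fromℚ x)
  from-integer (z , refl) = z , /1≡ιℤ z

  from-eval : ∀ f x → fromℚ (D.eval (map toℚ f) x) ≡ evalR f (fromℚ x)
  from-eval [] x = from-0
  from-eval (c ∷ f) x = trans (from-+ _ _) (cong₂ _+_ (from-to c) (trans (from-* x _) (cong (fromℚ x *_) (from-eval f x))))

  ΣFin-cong : ∀ k {f g : Fin k → ℚ} → (∀ i → f i ≡ g i) → D.ΣFin k f ≡ D.ΣFin k g
  ΣFin-cong zero h = refl
  ΣFin-cong (suc k) h = cong₂ ℚ._+_ (h zero) (ΣFin-cong k (λ i → h (suc i)))

  ΠFin-cong : ∀ k {f g : Fin k → ℚ} → (∀ i → f i ≡ g i) → D.ΠFin k f ≡ D.ΠFin k g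
  ΠFin-cong zero h = refl
  ΠFin-cong (suc k) h = cong₂ ℚ._*_ (h zero) (ΠFin-cong k (λ i → h (suc i)))

  from-ΣFin : ∀ l (f : ℕ → ℚ) → fromℚ (D.ΣFin (length l) (λ i → f (lookup l i))) ≡ sumList (λ x → fromℚ (f x)) l
  from-ΣFin [] f = from-0
  from-ΣFin (x ∷ l) f = trans (from-+ _ _) (cong (fromℚ (f x) +_) (from-ΣFin l f))

  lookup-injective : ∀ {l} → Distinct l → ∀ i j → lookup l i ≡ lookup l j → i ≡ j
  lookup-injective (h ∷ d) zero zero e = refl
  lookup-injective (h ∷ d) zero (suc j) e = ⊥-elim (All.lookup h (∈-lookup j) e)
  lookup-injective (h ∷ d) (suc i) zero e = ⊥-elim (All.lookup h (∈-lookup i) (sym e))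
  lookup-injective (h ∷ d) (suc i) (suc j) e = cong suc (lookup-injective d i j e)

  -- The statement compares positions of nodes, the lists of the proof compare their values;
  -- injectivity of the nodes identifies the two.
  facℚ : ℕ → ℕ → ℚ
  facℚ x y with x ℕₚ.≟ y
  ... | yes _ = ℚ.1ℚ
  ... | no _ = D.ℕ→ℚ x ℚ.- D.ℕ→ℚ y

  from-fac : ∀ x y → fromℚ (facℚ x y) ≡ fac x y
  from-fac x y with x ℕₚ.≟ y
  ... | yes _ = from-1
  ... | no _ = trans (from-- _ _) (cong₂ _-_ (from-ℕ x) (from-ℕ y))

  from-ΠFin : ∀ x l → fromℚ (D.ΠFin (length l) (λ j → facℚ x (lookup l j))) ≡ prodFac x l
  from-ΠFin x [] = from-1
  from-ΠFin x (y ∷ l) = trans (from-* _ _) (cong₂ _*_ (from-fac x y) (from-ΠFin x l))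

  -- The local function of divDiff cannot be named, so it is captured by unification;
  -- divDiff unfolds at the index zero, where the factors are already evaluated.
  mutual
    factor : (m : ℕ) (s : ℕ → ℚ) (n : Fin (suc m) → ℕ) → Fin m → Fin m → ℚ
    factor = _

    divDiff≡ : ∀ m s n → D.divDiff m s n ≡
      D.inv (ℚ.1ℚ ℚ.* D.ΠFin m (λ j → D.ℕ→ℚ (n zero) ℚ.- D.ℕ→ℚ (n (suc j)))) ℚ.* s (n zero) ℚ.+
      D.ΣFin m (λ i → D.inv ((D.ℕ→ℚ (n (suc i)) ℚ.- D.ℕ→ℚ (n zero)) ℚ.* D.ΠFin m (factor m s n i)) ℚ.* s (n (suc i)))
    divDiff≡ m s n = refl

  facℚ-≡ : ∀ x → facℚ x x ≡ ℚ.1ℚ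
  facℚ-≡ x with x ℕₚ.≟ x
  ... | yes _ = refl
  ... | no h = ⊥-elim (h refl)

  facℚ-≢ : ∀ {x y} → x ≢ y → facℚ x y ≡ D.ℕ→ℚ x ℚ.- D.ℕ→ℚ y
  facℚ-≢ {x} {y} h with x ℕₚ.≟ y
  ... | yes e = ⊥-elim (h e)
  ... | no _ = refl

  factor≡ : ∀ m s n → Injective _≡_ _≡_ n → ∀ i j → factor m s n i j ≡ facℚ (n (suc i)) (n (suc j))
  factor≡ m s n inj i j with i Finₚ.≟ j
  ... | yes refl = sym (facℚ-≡ (n (suc i)))
  ... | no h = sym (facℚ-≢ (λ e → h (Finₚ.suc-injective (inj e))))

  divDiff-facℚ : ∀ m s n → Injective _≡_ _≡_ n →
    D.divDiff m s n ≡ D.ΣFin (suc m) (λ i → D.inv (D.ΠFin (suc m) (λ j → facℚ (n i) (n j))) ℚ.* s (n i))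
  divDiff-facℚ m s n inj = trans (divDiff≡ m s n) (cong₂ ℚ._+_
    (cong (λ t → D.inv t ℚ.* s (n zero)) (cong₂ ℚ._*_ (sym (facℚ-≡ (n zero))) (ΠFin-cong m (λ j → sym (facℚ-≢ (λ e → Finₚ.0≢1+n (inj e)))))))
    (ΣFin-cong m (λ i → cong (λ t → D.inv t ℚ.* s (n (suc i))) (cong₂ ℚ._*_ (sym (facℚ-≢ (λ e → Finₚ.0≢1+n (sym (inj e))))) (ΠFin-cong m (factor≡ m s n inj i))))))

  from-divDiff : ∀ (s : ℕ → ℚ) x l → Distinct (x ∷ l) → fromℚ (D.divDiff (length l) s (lookup (x ∷ l))) ≡ dd (λ n → fromℚ (s n)) (x ∷ l)
  from-divDiff s x l d = trans (cong fromℚ (divDiff-facℚ (length l) s n inj))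
    (trans (from-ΣFin (x ∷ l) (λ y → D.inv (D.ΠFin (suc (length l)) (λ j → facℚ y (n j))) ℚ.* s y))
      (sumList-cong (All.universal (λ y → trans (from-* _ _) (cong (_* fromℚ (s y)) (trans (from-inv _) (cong inv (from-ΠFin y (x ∷ l)))))) (x ∷ l))))
    where
    n : Fin (suc (length l)) → ℕ
    n = lookup (x ∷ l)
    inj : Injective _≡_ _≡_ n
    inj {i} {j} e = lookup-injective d i j e

  module _ (m : ℕ) (s : ℕ → ℚ) (integral : (n : Fin (suc m) → ℕ) → Injective _≡_ _≡_ n → D.IsInteger (D.divDiff m s n)) where
    base : ∀ l → Sorted l → length l ≡ suc m → IsInt (dd (λ n → fromℚ (s n)) l)
    base (x ∷ l) srt refl = subst IsInt (from-divDiff s x l (sorted⇒distinct srt))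
      (from-integer (integral (lookup (x ∷ l)) (λ {i} {j} e → lookup-injective (sorted⇒distinct srt) i j e)))

  polynomial : (m : ℕ) (s : ℕ → ℚ) → ((n : Fin (suc m) → ℕ) → Injective _≡_ _≡_ n → D.IsInteger (D.divDiff m s n)) →
    (C θ : ℚ) → ℚ.0ℚ ℚ.< C → ℚ.0ℚ ℚ.< θ → ((n : ℕ) → ℚ.∣ s n ∣ ℚ.≤ C ℚ.* (θ D.^ n)) →
    (θ ℚ.+ ℚ.1ℚ) D.<exp (D.harmonic m) → ∃ λ (f : List ℚ) → (n : ℕ) → s n ≡ D.eval f (D.ℕ→ℚ n)
  polynomial m s integral C θ 0<C 0<θ growth (N , θ<exp) = by-degree m integral expR-bound
    where
    C′ θ′ : R
    C′ = fromℚ C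
    θ′ = fromℚ θ
    0≤θ′ : ι 0 ≤ θ′
    0≤θ′ = ≤-trans (≤-reflexive (sym from-0)) (from-≤ (ℚₚ.<⇒≤ 0<θ))
    0≤C′ : ι 0 ≤ C′
    0≤C′ = ≤-trans (≤-reflexive (sym from-0)) (from-≤ (ℚₚ.<⇒≤ 0<C))
    growth′ : ∀ n → abs (fromℚ (s n)) ≤ C′ * pw θ′ n
    growth′ n = ≤-trans (from-abs (s n)) (≤-trans (from-≤ (growth n)) (≤-reflexive (trans (from-* C _) (cong (C′ *_) (from-^ θ n)))))
    expR-bound : θ′ + ι 1 < expR (H m) N
    expR-bound = subst₂ _<_ (trans (from-+ θ ℚ.1ℚ) (cong (θ′ +_) from-1)) (trans (from-expPartial (D.harmonic m) N) (cong (λ t → expR t N) (from-harmonic m))) (from-< θ<exp)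
    by-degree : ∀ m → ((n : Fin (suc m) → ℕ) → Injective _≡_ _≡_ n → D.IsInteger (D.divDiff m s n)) → θ′ + ι 1 < expR (H m) N →
      ∃ λ (f : List ℚ) → (n : ℕ) → s n ≡ D.eval f (D.ℕ→ℚ n)
    -- For m = 0 every truncation of the exponential of 0 equals 1, so the growth hypothesis reads θ
    -- + 1 < 1 and contradicts 0 ≤ θ.
    by-degree zero _ h = ⊥-elim (h (≤-trans (≤-reflexive (expR-zero N)) (lin (θ′ ∷ []) (λ a → (con 0 ≼ a) ∷ [] ⊢ (con 1 ≼ a :+ con 1) by (0 , (1 , 0 ∷ []) ∷ [])) 0≤θ′)))
    by-degree (suc m) int h = from-poly (Main.polynomial (suc m) (s≤s z≤n) (λ n → fromℚ (s n)) (base (suc m) s int) C′ θ′ 0≤C′ 0≤θ′ growth′ N h)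
      where
      from-poly : (∃ λ f → ∀ n → fromℚ (s n) ≡ evalR f (ι n)) → ∃ λ (f : List ℚ) → (n : ℕ) → s n ≡ D.eval f (D.ℕ→ℚ n)
      from-poly (f , h) = map toℚ f , λ n → from-injective (trans (h n) (sym (trans (from-eval f (D.ℕ→ℚ n)) (cong (evalR f) (from-ℕ n)))))

open import Defs
open import Data.Nat using (ℕ; suc)
open import Data.Fin using (Fin)
open import Data.Rational using (ℚ; 0ℚ; 1ℚ; _+_; _*_; _≤_; _<_; ∣_∣)
open import Data.List using (List)
open import Data.Product using (∃)
open import Function.Definitions using (Injective)
open import Relation.Binary.PropositionalEquality using (_≡_)

theorem1p1 : (m : ℕ) (s : ℕ → ℚ) →
    ((n : Fin (suc m) → ℕ) → Injective _≡_ _≡_ n → IsInteger (divDiff m s n)) →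
    (C θ : ℚ) → 0ℚ < C → 0ℚ < θ →
    ((n : ℕ) → ∣ s n ∣ ≤ C * (θ ^ n)) →
    (θ + 1ℚ) <exp (harmonic m) →
    ∃ λ (f : List ℚ) → (n : ℕ) → s n ≡ eval f (ℕ→ℚ n)
theorem1p1 = Transfer.polynomial
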